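{- Let $\mathbb{F}_q$ be the finite field with $q$ elements, $K=\mathbb{F}_q(\theta)$, and $K_\infty=\mathbb{F}_q(\!(\tfrac{1}{\theta})\!)$. Let $\lambda_\theta$ be a $(q-1)$-th root of $-\theta$ in a separable closure of $K$, and let \[ \tilde{\pi}=\lambda_\theta\, \theta \prod_{j\ge 1}\bigl(1-\theta^{1-q^j}\bigr)^{ -1}\in K_\infty(\lambda_\theta) \] be the Carlitz period. Then $\tilde{\pi}$ is hypertranscendental over $K$, i.e. the set $\{\partial_\theta^{(n)}(\tilde{\pi}) \mid n\ge 0\}$ is algebraically independent over $K$.
   Context: The hyperdifferential operators with respect to $\theta$, $(\partial_\theta^{(n)})_{n\ge 0}$, are defined on $K_\infty$ by $\partial_\theta^{(n)}\bigl(\sum_{i\ge i_0} c_i\theta^{ -i}\bigr)=\sum_{i\ge i_0} c_i\binom{ -i}{n}\theta^{ -i-n}$ (with $c_i\in\mathbb{F}_q$); this family is a higher derivation (i.e. $\partial^{(0)}_\theta=\mathrm{id}$, each $\partial^{(n)}_\theta$ is $\mathbb{F}_q$-linear and $\partial_\theta^{(n)}(fg)=\sum_{i+j=n}\partial_\theta^{(i)}(f)\partial_\theta^{(j)}(g)$), and it is extended to the separable algebraic extension $K_\infty(\lambda_\theta)$ as the unique higher derivation extending it. -}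

module Defs where

open import Level using (0ℓ; _⊔_)
open import Algebra.Bundles using (CommutativeRing)
open import Data.Nat as ℕ using (ℕ; zero; suc; _∸_; _^_)
open import Data.Nat.Combinatorics using (_C_)
open import Data.Integer as ℤ using (ℤ; +_; -[1+_])
open import Data.Fin using (Fin)
open import Data.List using (List; []; _∷_; _++_; [_]; reverse; dropWhile; length)
open import Data.List.Relation.Unary.All using (All)
open import Data.Bool using (if_then_else_)
open import Data.Product using (∃; Σ)
open import Relation.Nullary using (¬_; does)
open import Relation.Binary using (Decidable)
open import Relation.Binary.PropositionalEquality using (_≡_)

module RingOps {c ℓ} (R : CommutativeRing c ℓ) where
  open CommutativeRing R

  sumTo : ℕ → (ℕ → Carrier) → Carrier
  sumTo zero    f = 0#
  sumTo (suc n) f = sumTo n f + f n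

  pow : Carrier → ℕ → Carrier
  pow x zero    = 1#
  pow x (suc n) = pow x n * x

  natC : ℕ → Carrier
  natC zero    = 0#
  natC (suc n) = natC n + 1#

  intC : ℤ → Carrier
  intC (+ n)     = natC n
  intC -[1+ n ]  = - natC (suc n)

  getD : List Carrier → ℕ → Carrier
  getD []       _       = 0#
  getD (x ∷ xs) zero    = x
  getD (x ∷ xs) (suc i) = getD xs i

  record IsFieldRing : Set (c ⊔ ℓ) where
    field
      1≉0 : ¬ (1# ≈ 0#)
      inverse : ∀ x → ¬ (x ≈ 0#) → ∃ λ y → x * y ≈ 1#

record FiniteField (q : ℕ) : Set₁ where
  field
    Fring : CommutativeRing 0ℓ 0ℓ
  open CommutativeRing Fring
  field
    _≟F_     : Decidable _≈_
    inv      : Carrier → Carrier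
    inv-r    : ∀ x → ¬ (x ≈ 0#) → x * inv x ≈ 1#
    1≉0      : ¬ (1# ≈ 0#)
    enum     : Fin q → Carrier
    enum-surj : ∀ x → ∃ λ i → enum i ≈ x
    enum-inj : ∀ i j → enum i ≈ enum j → i ≡ j

binomℤ : ℤ → ℕ → ℤ
binomℤ (+ m)    n = + (m C n)
binomℤ -[1+ m ] n = (ℤ.- ℤ.1ℤ) ℤ.^ n ℤ.* + ((m ℕ.+ n) C n)

module Laurent {q : ℕ} (𝔽 : FiniteField q) where
  open FiniteField 𝔽
  open CommutativeRing Fring renaming (Carrier to F)
  open RingOps Fring

  -- the Laurent series  Σ_{j ≥ 0} c j · θ^{-(v + j)}
  record K∞ : Set where
    constructor laurent
    field
      v : ℤ
      c : ℕ → F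
  open K∞ public

  -- coefficient of θ^{-k}
  coefAt : K∞ → ℤ → F
  coefAt f k with k ℤ.- v f
  ... | + j      = c f j
  ... | -[1+ _ ] = 0#

  _≈∞_ : K∞ → K∞ → Set
  f ≈∞ g = ∀ k → coefAt f k ≈ coefAt g k

  0∞ : K∞
  0∞ = laurent (+ 0) (λ _ → 0#)

  1∞ : K∞
  1∞ = laurent (+ 0) (λ { zero → 1# ; (suc _) → 0# })

  -- the element θ = θ^{-(-1)}
  θ∞ : K∞
  θ∞ = laurent (ℤ.- ℤ.1ℤ) (λ { zero → 1# ; (suc _) → 0# })

  const∞ : F → K∞
  const∞ a = laurent (+ 0) (λ { zero → a ; (suc _) → 0# })

  _+∞_ : K∞ → K∞ → K∞
  f +∞ g = laurent w (λ j → coefAt f (w ℤ.+ + j) + coefAt g (w ℤ.+ + j))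
    where w = v f ℤ.⊓ v g

  -∞_ : K∞ → K∞
  -∞ f = laurent (v f) (λ j → - c f j)

  _*∞_ : K∞ → K∞ → K∞
  f *∞ g = laurent (v f ℤ.+ v g) (λ n → sumTo (suc n) (λ i → c f i * c g (n ∸ i)))

  -- inverse of a power series a 0 + a 1 X + ... with a 0 ≠ 0
  invSeries : (ℕ → F) → ℕ → F
  invSeries a n = getD (bs n) n
    where
      u' = inv (a 0)
      bs : ℕ → List F
      bs zero    = u' ∷ []
      bs (suc n) = bs n ++ [ - (u' * sumTo (suc n) (λ i → a (suc i) * getD (bs n) (n ∸ i))) ]

  -- inverse of a Laurent series whose leading coefficient c f 0 is nonzero
  invNorm : K∞ → K∞
  invNorm f = laurent (ℤ.- v f) (invSeries (c f))

  -- a polynomial in θ, given by its coefficient list (constant term first),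
  -- as an element of K∞ (normalised so that the leading coefficient is nonzero)
  poly∞ : List F → K∞
  poly∞ l = laurent (ℤ.- + (length r ∸ 1)) (getD r)
    where r = dropWhile (λ x → x ≟F 0#) (reverse l)

  record K : Set where
    field
      num : List F
      den : List F
      den≢0 : ¬ All (_≈ 0#) den

  K→K∞ : K → K∞
  K→K∞ x = poly∞ (K.num x) *∞ invNorm (poly∞ (K.den x))

  IsZeroK : K → Set
  IsZeroK x = All (_≈ 0#) (K.num x)

  -- hyperdifferential operators:
  -- ∂^(n) (Σ c_i θ^{-i}) = Σ c_i binom(-i, n) θ^{-i-n}
  ∂ : ℕ → K∞ → K∞
  ∂ n f = laurent (v f ℤ.+ + n) (λ j → intC (binomℤ (ℤ.- (v f ℤ.+ + j)) n) * c f j)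

  oneMinus : ℕ → K∞
  oneMinus j = laurent (+ 0) (λ k →
    if does (k ℕ.≟ 0) then 1#
    else if does (k ℕ.≟ (q ^ j ∸ 1)) then - 1# else 0#)

  factor : ℕ → K∞
  factor j = invNorm (oneMinus j)

  prodUpTo : ℕ → K∞
  prodUpTo zero    = 1∞
  prodUpTo (suc J) = prodUpTo J *∞ factor (suc J)

  -- ∏_{j ≥ 1} (1 - θ^{1-q^j})^{-1}: coefficient of θ^{-k} is that of the
  -- partial product up to j = k+1 (later factors are ≡ 1 mod θ^{-(k+1)})
  carlitzProd : K∞
  carlitzProd = laurent (+ 0) (λ k → coefAt (prodUpTo (suc k)) (+ k))

  module Over {a ℓ} (L : CommutativeRing a ℓ) (ι : K∞ → CommutativeRing.Carrier L) where
    open CommutativeRing L renaming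
      (Carrier to Lc; _≈_ to _≈L_; _+_ to _+L_; _*_ to _*L_; -_ to -L_; 0# to 0L; 1# to 1L)
    module RL = RingOps L

    record IsRingEmbedding : Set ℓ where
      field
        cong-ι : ∀ f g → f ≈∞ g → ι f ≈L ι g
        ι-+ : ∀ f g → ι (f +∞ g) ≈L (ι f +L ι g)
        ι-* : ∀ f g → ι (f *∞ g) ≈L (ι f *L ι g)
        ι-1 : ι 1∞ ≈L 1L

    record IsHigherDerivation (D : ℕ → Lc → Lc) : Set (a ⊔ ℓ) where
      field
        D0 : ∀ x → D 0 x ≈L x
        D-cong : ∀ n x y → x ≈L y → D n x ≈L D n y
        D-+ : ∀ n x y → D n (x +L y) ≈L (D n x +L D n y)
        D-lin : ∀ n (α : F) x → D n (ι (const∞ α) *L x) ≈L (ι (const∞ α) *L D n x)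
        D-Leibniz : ∀ n x y →
          D n (x *L y) ≈L RL.sumTo (suc n) (λ i → D i x *L D (n ∸ i) y)

    Extends : (ℕ → Lc → Lc) → Set ℓ
    Extends D = ∀ n f → D n (ι f) ≈L ι (∂ n f)

    carlitzPeriod : Lc → Lc
    carlitzPeriod λθ = λθ *L ι (θ∞ *∞ carlitzProd)

    -- polynomials with coefficients in K in the variables X_0, ..., X_{n-1}
    -- (Poly (suc n) = polynomials in X_n with coefficients in Poly n)
    Poly : ℕ → Set
    Poly zero    = K
    Poly (suc n) = List (Poly n)

    IsZeroPoly : ∀ n → Poly n → Set
    IsZeroPoly zero    p  = IsZeroK p
    IsZeroPoly (suc n) ps = All (IsZeroPoly n) ps

    evalPoly : ∀ n → Poly n → (ℕ → Lc) → Lc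
    evalPoly zero    p  x = ι (K→K∞ p)
    evalPoly (suc n) ps x = go ps 0
      where
        go : List (Poly n) → ℕ → Lc
        go []       k = 0L
        go (p ∷ ps) k = (evalPoly n p x *L RL.pow (x n) k) +L go ps (suc k)

    AlgebraicallyIndependent : (ℕ → Lc) → Set ℓ
    AlgebraicallyIndependent x =
      ∀ n (P : Poly n) → ¬ IsZeroPoly n P → ¬ (evalPoly n P x ≈L 0L)

{-# OPTIONS --safe #-}
-- Put z = 1/θ.  The product in π̃ is the inverse of ∏_{j ≥ 1} (1 - θ z^{q^j}), and λ = λ^{q^m} (-z)^e, where
-- q^m-th powers are constants for the hyperderivatives of order < q^m.  Hence, modulo ε^{q^m} and up to factors
-- with coefficients in 𝔽_q[z, θ], the jet Σ ∂^{(i)}(π̃) ε^i is the inverse of γ = ∏_{j ≥ 1} (1 - (θ + ε) z^{q^j});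
-- since 1, λ, ..., λ^{q-2} are linearly independent over K∞, it suffices that the coefficients of γ are
-- algebraically independent over 𝔽_q(θ).
--
-- This is shown by induction on the number n of coefficients, with Mahler's method applied to the formal jets
-- ∏_{j ≥ 1} (1 - (t + ε) x^{q^j}).  At t = θ^{q^j}, x = z the constant term of one factor vanishes and the
-- remaining coefficients become a Frobenius twist of γ, so independence of n - 1 values gives independence of n
-- formal jets.  Conversely, the Frobenius twists of a relation between n values are relations at t = θ^{q^k}.
-- By Siegel's lemma some nonzero polynomial in the formal jets is proportional to these relations at all k < M,
-- hence tiny at M nodes, hence tiny by a Schwarz lemma.  Sorting exponents of x modulo q^M turns it into
-- approximate formal relations of bounded degree and arbitrarily high order; linear algebra over 𝔽_q[t] then
-- produces an exact one.
module Submission where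

open import Defs
open import Algebra.Bundles using (CommutativeRing)
open import Algebra.Solver.Ring.AlmostCommutativeRing using (AlmostCommutativeRing; fromCommutativeRing; _-Raw-AlmostCommutative⟶_)
open import Algebra.Structures using (IsCommutativeRing)
open import Data.Bool using (true; false; if_then_else_)
open import Data.Empty using (⊥; ⊥-elim)
open import Data.Fin as Fin using (Fin; punchIn; combine; remQuot; toℕ)
open import Data.Integer as ℤ using (ℤ; +_; -[1+_])
open import Data.List using (List; []; _∷_; length; map; drop; _++_; tabulate; dropWhile; reverse)
open import Data.List.Relation.Binary.Permutation.Propositional.Properties using (All-resp-↭; ↭-reverse)
open import Data.List.Relation.Unary.All as All using (All; []; _∷_)
open import Data.Maybe using (Maybe; just; nothing)
open import Data.Nat as ℕ using (ℕ; zero; suc; _∸_; _≤_; _<_; z≤n; s≤s; _^_)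
open import Data.Nat.Combinatorics using (nCn≡1; k>n⇒nCk≡0) renaming (_C_ to _choose_)
open import Data.Product using (_,_; ∃; _×_; proj₁; proj₂)
open import Data.Sum using (inj₁; inj₂; _⊎_)
open import Data.Unit using (⊤; tt)
open import Data.Vec.Functional using (Vector; insertAt; removeAt)
open import Function using (_∘_)
open import Level using (Level; _⊔_; 0ℓ) renaming (suc to lsuc)
open import Relation.Binary.Definitions using (tri<; tri≈; tri>)
open import Relation.Binary.PropositionalEquality as ≡ using (_≡_)
open import Relation.Nullary using (¬_; yes; no; Dec; ¬?; does)
open import Relation.Nullary.Decidable using (decidable-stable)
import Algebra.Solver.Ring
import Algebra.Properties.Ring
import Algebra.Properties.Semiring.Mult.TCOptimised
import Relation.Binary.Reasoning.Setoid
import Data.Nat.Properties as ℕₚ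
import Data.Integer.Properties as ℤₚ
import Algebra.Properties.Semiring.Sum
import Data.Fin.Base
import Data.Fin.Properties as Finₚ
import Data.Vec.Functional.Properties as VFₚ
import Data.List.Properties as Listₚ
import Data.List.Relation.Unary.All.Properties as Allₚ
import Data.Nat.Solver
import Data.Nat.DivMod as DivMod
import Algebra.Properties.Semiring.Exp
import Algebra.Properties.Semiring.Mult
import Algebra.Properties.CommutativeMonoid.Sum
import Algebra.Properties.CommutativeSemiring.Binomial
import Data.Fin.Permutation as Permutation

-- Raising a relation at t = θ, x = z to the power q^k moves both points, to θ^{q^k} and z^{q^k}.
-- The equation relating x to x^q at fixed t brings all k < M back to the common point x = z^{q^M},
-- so that one auxiliary polynomial can serve every twist. Its shape is dictated by counting. For
-- the tail in t to be negligible, the number M of nodes must exceed the bound T on the degree in t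
-- by more than d g, where g is the number of factors of each jet below the chosen slope; but a
-- nonzero polynomial of degree less than T cannot vanish at M > T nodes. Proportionality to the
-- twisted relation leaves one free multiplier per node, and these additional unknowns make the
-- linear system solvable. The degree in x is h q^M with h fixed, whereas the order of vanishing
-- reaches G q^M for every G, because q^g outgrows M, which is linear in g. This gap survives the
-- sorting of exponents. Equality in L is not assumed decidable; it is decided only for coefficients
-- in 𝔽_q, so non-vanishing is argued under double negation, which is removed for elements with an
-- explicit expansion.

module IntegerSolver {c ℓ} (R : CommutativeRing c ℓ) where
  open CommutativeRing R
  open Algebra.Properties.Ring ring using (-‿distribˡ-*; -‿distribʳ-*; -‿+-comm; -‿involutive; -0#≈0#)
  open Algebra.Properties.Semiring.Mult.TCOptimised semiring using (1+×; ×-homo-+; ×1-homo-*) renaming (_×_ to _·_)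
  open Relation.Binary.Reasoning.Setoid setoid

  ⟦_⟧ℤ : ℤ → Carrier
  ⟦ + n ⟧ℤ      = n · 1#
  ⟦ -[1+ n ] ⟧ℤ = - (suc n · 1#)

  private
    cancel-head : ∀ a b → (1# + a) + - (1# + b) ≈ a + - b
    cancel-head a b = begin
      (1# + a) + - (1# + b)      ≈⟨ +-congˡ (-‿+-comm 1# b) ⟨
      (1# + a) + (- 1# + - b)    ≈⟨ +-congʳ (+-comm 1# a) ⟩
      (a + 1#) + (- 1# + - b)    ≈⟨ +-assoc a 1# _ ⟩
      a + (1# + (- 1# + - b))    ≈⟨ +-congˡ (+-assoc 1# (- 1#) (- b)) ⟨
      a + ((1# + - 1#) + - b)    ≈⟨ +-congˡ (+-congʳ (-‿inverseʳ 1#)) ⟩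
      a + (0# + - b)             ≈⟨ +-congˡ (+-identityˡ _) ⟩
      a + - b                    ∎

    ⊖-homo : ∀ m n → ⟦ m ℤ.⊖ n ⟧ℤ ≈ m · 1# + - (n · 1#)
    ⊖-homo zero    zero    = sym (-‿inverseʳ 0#)
    ⊖-homo zero    (suc n) = sym (+-identityˡ _)
    ⊖-homo (suc m) zero    = sym (trans (+-congˡ -0#≈0#) (+-identityʳ _))
    ⊖-homo (suc m) (suc n) = begin
      ⟦ suc m ℤ.⊖ suc n ⟧ℤ       ≡⟨ ≡.cong ⟦_⟧ℤ (ℤₚ.[1+m]⊖[1+n]≡m⊖n m n) ⟩
      ⟦ m ℤ.⊖ n ⟧ℤ               ≈⟨ ⊖-homo m n ⟩
      m · 1# + - (n · 1#)        ≈⟨ cancel-head _ _ ⟨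
      (1# + m · 1#) + - (1# + n · 1#) ≈⟨ +-cong (1+× m 1#) (-‿cong (1+× n 1#)) ⟨
      suc m · 1# + - (suc n · 1#) ∎

    neg-homo : ∀ i → ⟦ ℤ.- i ⟧ℤ ≈ - ⟦ i ⟧ℤ
    neg-homo (+ zero)  = sym -0#≈0#
    neg-homo (+ suc n) = refl
    neg-homo -[1+ n ]  = sym (-‿involutive _)

    +-homo : ∀ i j → ⟦ i ℤ.+ j ⟧ℤ ≈ ⟦ i ⟧ℤ + ⟦ j ⟧ℤ
    +-homo (+ m)    (+ n)    = ×-homo-+ 1# m n
    +-homo (+ m)    -[1+ n ] = ⊖-homo m (suc n)
    +-homo -[1+ m ] (+ n)    = trans (⊖-homo n (suc m)) (+-comm _ _)
    +-homo -[1+ m ] -[1+ n ] = begin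
      - (suc (suc (m ℕ.+ n)) · 1#)            ≡⟨ ≡.cong (λ k → - (suc k · 1#)) (≡.sym (ℕₚ.+-suc m n)) ⟩
      - ((suc m ℕ.+ suc n) · 1#)              ≈⟨ -‿cong (×-homo-+ 1# (suc m) (suc n)) ⟩
      - (suc m · 1# + suc n · 1#)             ≈⟨ -‿+-comm _ _ ⟨
      - (suc m · 1#) + - (suc n · 1#)         ∎

    *-homo⁺ : ∀ m n → ⟦ (+ m) ℤ.* (+ n) ⟧ℤ ≈ (m · 1#) * (n · 1#)
    *-homo⁺ m n = trans (reflexive (≡.cong ⟦_⟧ℤ (≡.sym (ℤₚ.pos-* m n)))) (×1-homo-* m n)

    *-homo : ∀ i j → ⟦ i ℤ.* j ⟧ℤ ≈ ⟦ i ⟧ℤ * ⟦ j ⟧ℤ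
    *-homo (+ m) (+ n) = *-homo⁺ m n
    *-homo (+ m) -[1+ n ] = begin
      ⟦ (+ m) ℤ.* -[1+ n ] ⟧ℤ           ≡⟨ ≡.cong ⟦_⟧ℤ (≡.sym (ℤₚ.neg-distribʳ-* (+ m) (+ suc n))) ⟩
      ⟦ ℤ.- ((+ m) ℤ.* (+ suc n)) ⟧ℤ    ≈⟨ neg-homo ((+ m) ℤ.* (+ suc n)) ⟩
      - ⟦ (+ m) ℤ.* (+ suc n) ⟧ℤ        ≈⟨ -‿cong (*-homo⁺ m (suc n)) ⟩
      - (m · 1# * suc n · 1#)           ≈⟨ -‿distribʳ-* _ _ ⟩
      m · 1# * - (suc n · 1#)           ∎
    *-homo -[1+ m ] (+ n) = begin
      ⟦ -[1+ m ] ℤ.* (+ n) ⟧ℤ           ≡⟨ ≡.cong ⟦_⟧ℤ (≡.sym (ℤₚ.neg-distribˡ-* (+ suc m) (+ n))) ⟩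
      ⟦ ℤ.- ((+ suc m) ℤ.* (+ n)) ⟧ℤ    ≈⟨ neg-homo ((+ suc m) ℤ.* (+ n)) ⟩
      - ⟦ (+ suc m) ℤ.* (+ n) ⟧ℤ        ≈⟨ -‿cong (*-homo⁺ (suc m) n) ⟩
      - (suc m · 1# * n · 1#)           ≈⟨ -‿distribˡ-* _ _ ⟩
      - (suc m · 1#) * n · 1#           ∎
    *-homo -[1+ m ] -[1+ n ] = begin
      ⟦ (+ suc m) ℤ.* (+ suc n) ⟧ℤ      ≈⟨ *-homo⁺ (suc m) (suc n) ⟩
      suc m · 1# * suc n · 1#           ≈⟨ -‿involutive _ ⟨
      - - (suc m · 1# * suc n · 1#)     ≈⟨ -‿cong (-‿distribˡ-* _ _) ⟩
      - (- (suc m · 1#) * suc n · 1#)   ≈⟨ -‿distribʳ-* _ _ ⟩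
      - (suc m · 1#) * - (suc n · 1#)   ∎

    almost : AlmostCommutativeRing c ℓ
    almost = fromCommutativeRing R

    homo : ℤ.+-*-rawRing -Raw-AlmostCommutative⟶ almost
    homo = record
      { ⟦_⟧ = ⟦_⟧ℤ ; +-homo = +-homo ; *-homo = *-homo ; -‿homo = neg-homo
      ; 0-homo = refl ; 1-homo = refl }

    dec : ∀ i j → Maybe (⟦ i ⟧ℤ ≈ ⟦ j ⟧ℤ)
    dec i j with i ℤ.≟ j
    ... | yes eq = just (reflexive (≡.cong ⟦_⟧ℤ eq))
    ... | no _   = nothing

  open Algebra.Solver.Ring ℤ.+-*-rawRing almost homo dec public
    using (solve; _:=_; _:+_; _:*_; _:-_; :-_; con; Polynomial)

  :0 :1 : ∀ {n} → Polynomial n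
  :0 = con (+ 0)
  :1 = con (+ 1)

-- Finite sums and formal power series over a commutative ring.

module Sums {c ℓ} (R : CommutativeRing c ℓ) where
  open CommutativeRing R
  open RingOps R
  open IntegerSolver R
  open Relation.Binary.Reasoning.Setoid setoid

  Σ-cong : ∀ n {f g : ℕ → Carrier} → (∀ i → i < n → f i ≈ g i) → sumTo n f ≈ sumTo n g
  Σ-cong zero    h = refl
  Σ-cong (suc n) h = +-cong (Σ-cong n (λ i i<n → h i (ℕₚ.m<n⇒m<1+n i<n))) (h n ℕₚ.≤-refl)

  Σ-cong′ : ∀ n {f g : ℕ → Carrier} → (∀ i → f i ≈ g i) → sumTo n f ≈ sumTo n g
  Σ-cong′ n h = Σ-cong n (λ i _ → h i)

  Σ-zero : ∀ n {f : ℕ → Carrier} → (∀ i → i < n → f i ≈ 0#) → sumTo n f ≈ 0#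
  Σ-zero zero    h = refl
  Σ-zero (suc n) h = trans (+-cong (Σ-zero n (λ i i<n → h i (ℕₚ.m<n⇒m<1+n i<n))) (h n ℕₚ.≤-refl)) (+-identityˡ 0#)

  Σ-+ : ∀ n (f g : ℕ → Carrier) → sumTo n (λ i → f i + g i) ≈ sumTo n f + sumTo n g
  Σ-+ zero    f g = sym (+-identityˡ 0#)
  Σ-+ (suc n) f g = trans (+-congʳ (Σ-+ n f g))
    (solve 4 (λ a b x y → (a :+ b) :+ (x :+ y) := (a :+ x) :+ (b :+ y)) refl (sumTo n f) (sumTo n g) (f n) (g n))

  Σ-*ˡ : ∀ n x (f : ℕ → Carrier) → x * sumTo n f ≈ sumTo n (λ i → x * f i)
  Σ-*ˡ zero    x f = zeroʳ x
  Σ-*ˡ (suc n) x f = trans (distribˡ x _ _) (+-congʳ (Σ-*ˡ n x f))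

  Σ-*ʳ : ∀ n x (f : ℕ → Carrier) → sumTo n f * x ≈ sumTo n (λ i → f i * x)
  Σ-*ʳ zero    x f = zeroˡ x
  Σ-*ʳ (suc n) x f = trans (distribʳ x _ _) (+-congʳ (Σ-*ʳ n x f))

  Σ-neg : ∀ n (f : ℕ → Carrier) → - sumTo n f ≈ sumTo n (λ i → - f i)
  Σ-neg zero    f = solve 0 (:- :0 := :0) refl
  Σ-neg (suc n) f = trans (solve 2 (λ a b → :- (a :+ b) := :- a :+ :- b) refl (sumTo n f) (f n)) (+-congʳ (Σ-neg n f))

  Σ-swap : ∀ m n (f : ℕ → ℕ → Carrier) →
           sumTo m (λ i → sumTo n (f i)) ≈ sumTo n (λ j → sumTo m (λ i → f i j))
  Σ-swap zero    n f = sym (Σ-zero n (λ _ _ → refl))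
  Σ-swap (suc m) n f = trans (+-congʳ (Σ-swap m n f)) (sym (Σ-+ n _ _))

  Σ-head : ∀ n (f : ℕ → Carrier) → sumTo (suc n) f ≈ f 0 + sumTo n (f ∘ suc)
  Σ-head zero    f = +-comm 0# (f 0)
  Σ-head (suc n) f = trans (+-congʳ (Σ-head n f)) (+-assoc _ _ _)

  Σ-append : ∀ m n (f : ℕ → Carrier) → sumTo (m ℕ.+ n) f ≈ sumTo m f + sumTo n (λ i → f (m ℕ.+ i))
  Σ-append zero    n f = sym (+-identityˡ _)
  Σ-append (suc m) n f = begin
    sumTo (suc (m ℕ.+ n)) f                                        ≈⟨ Σ-head (m ℕ.+ n) f ⟩
    f 0 + sumTo (m ℕ.+ n) (f ∘ suc)                                ≈⟨ +-congˡ (Σ-append m n (f ∘ suc)) ⟩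
    f 0 + (sumTo m (f ∘ suc) + sumTo n (λ i → f (suc m ℕ.+ i)))    ≈⟨ +-assoc _ _ _ ⟨
    (f 0 + sumTo m (f ∘ suc)) + sumTo n (λ i → f (suc m ℕ.+ i))    ≈⟨ +-congʳ (Σ-head m f) ⟨
    sumTo (suc m) f + sumTo n (λ i → f (suc m ℕ.+ i))              ∎

  Σ-extend : ∀ {m n} (f : ℕ → Carrier) → m ≤ n → (∀ i → m ≤ i → f i ≈ 0#) → sumTo n f ≈ sumTo m f
  Σ-extend {m} {n} f m≤n h = begin
    sumTo n f                                        ≡⟨ ≡.cong (λ k → sumTo k f) (≡.sym (ℕₚ.m+[n∸m]≡n m≤n)) ⟩
    sumTo (m ℕ.+ (n ∸ m)) f                          ≈⟨ Σ-append m (n ∸ m) f ⟩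
    sumTo m f + sumTo (n ∸ m) (λ i → f (m ℕ.+ i))    ≈⟨ +-congˡ (Σ-zero (n ∸ m) (λ i _ → h (m ℕ.+ i) (ℕₚ.m≤m+n m i))) ⟩
    sumTo m f + 0#                                   ≈⟨ +-identityʳ _ ⟩
    sumTo m f                                        ∎

  Σ-block : ∀ b Q (f : ℕ → Carrier) → sumTo (b ℕ.* Q) f ≈ sumTo b (λ N → sumTo Q (λ e → f (N ℕ.* Q ℕ.+ e)))
  Σ-block zero    Q f = refl
  Σ-block (suc b) Q f = begin
    sumTo (Q ℕ.+ b ℕ.* Q) f        ≡⟨ ≡.cong (λ k → sumTo k f) (ℕₚ.+-comm Q (b ℕ.* Q)) ⟩
    sumTo (b ℕ.* Q ℕ.+ Q) f        ≈⟨ Σ-append (b ℕ.* Q) Q f ⟩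
    sumTo (b ℕ.* Q) f + sumTo Q (λ e → f (b ℕ.* Q ℕ.+ e)) ≈⟨ +-congʳ (Σ-block b Q f) ⟩
    _ ∎

  Σ-single : ∀ n k (f : ℕ → Carrier) → k < n → (∀ i → i < n → ¬ (i ≡ k) → f i ≈ 0#) → sumTo n f ≈ f k
  Σ-single (suc n) k f k<n h with n ℕ.≟ k
  ... | yes ≡.refl = trans (+-congʳ (Σ-zero n (λ i i<n → h i (ℕₚ.m<n⇒m<1+n i<n) (ℕₚ.<⇒≢ i<n)))) (+-identityˡ _)
  ... | no n≢k     = trans (+-cong (Σ-single n k f (ℕₚ.≤∧≢⇒< (ℕₚ.≤-pred k<n) (n≢k ∘ ≡.sym)) (λ i i<n → h i (ℕₚ.m<n⇒m<1+n i<n))) (h n ℕₚ.≤-refl n≢k)) (+-identityʳ _)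

  pow-cong : ∀ n {x y} → x ≈ y → pow x n ≈ pow y n
  pow-cong zero    e = refl
  pow-cong (suc n) e = *-cong (pow-cong n e) e

  pow-+ : ∀ x m n → pow x (m ℕ.+ n) ≈ pow x m * pow x n
  pow-+ x zero    n = sym (*-identityˡ _)
  pow-+ x (suc m) n = begin
    pow x (m ℕ.+ n) * x       ≈⟨ *-congʳ (pow-+ x m n) ⟩
    (pow x m * pow x n) * x   ≈⟨ solve 3 (λ a b c → (a :* b) :* c := (a :* c) :* b) refl (pow x m) (pow x n) x ⟩
    (pow x m * x) * pow x n   ∎

  pow-* : ∀ x m n → pow x (m ℕ.* n) ≈ pow (pow x n) m
  pow-* x zero    n = refl
  pow-* x (suc m) n = begin
    pow x (n ℕ.+ m ℕ.* n)       ≈⟨ pow-+ x n (m ℕ.* n) ⟩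
    pow x n * pow x (m ℕ.* n)   ≈⟨ *-comm _ _ ⟩
    pow x (m ℕ.* n) * pow x n   ≈⟨ *-congʳ (pow-* x m n) ⟩
    pow (pow x n) m * pow x n   ∎

  pow-distrib : ∀ x y n → pow (x * y) n ≈ pow x n * pow y n
  pow-distrib x y zero    = sym (*-identityˡ _)
  pow-distrib x y (suc n) = begin
    pow (x * y) n * (x * y)       ≈⟨ *-congʳ (pow-distrib x y n) ⟩
    (pow x n * pow y n) * (x * y) ≈⟨ solve 4 (λ a b c d → (a :* b) :* (c :* d) := (a :* c) :* (b :* d)) refl (pow x n) (pow y n) x y ⟩
    (pow x n * x) * (pow y n * y) ∎

  pow-1 : ∀ n → pow 1# n ≈ 1#
  pow-1 zero    = refl
  pow-1 (suc n) = trans (*-identityʳ _) (pow-1 n)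

module PowerSeries {c ℓ} (R : CommutativeRing c ℓ) where
  open CommutativeRing R
  open RingOps R
  open IntegerSolver R
  open Sums R
  open Relation.Binary.Reasoning.Setoid setoid

  Ser : Set c
  Ser = ℕ → Carrier

  infixl 7 _⊛_
  infix 4 _≋_

  _≋_ : Ser → Ser → Set ℓ
  f ≋ g = ∀ n → f n ≈ g n

  const : Carrier → Ser
  const a zero    = a
  const a (suc _) = 0#

  var : Ser
  var zero          = 0#
  var (suc zero)    = 1#
  var (suc (suc _)) = 0#

  opaque
    -- Opaque, so that iterated products of series do not unfold into nested sums; the lemmas of
    -- this block, in particular the recursions at either end of the sum, are the interface.
    _⊛_ : Ser → Ser → Ser
    (f ⊛ g) n = sumTo (suc n) (λ i → f i * g (n ∸ i))

    ⊛-def : ∀ f g n → (f ⊛ g) n ≡ sumTo (suc n) (λ i → f i * g (n ∸ i))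
    ⊛-def f g n = ≡.refl

    ⊛-cong : ∀ {f f′ g g′} → f ≋ f′ → g ≋ g′ → f ⊛ g ≋ f′ ⊛ g′
    ⊛-cong p q n = Σ-cong′ (suc n) (λ i → *-cong (p i) (q (n ∸ i)))

    ⊛-zero : ∀ f g → (f ⊛ g) 0 ≈ f 0 * g 0
    ⊛-zero f g = +-identityˡ _

    ⊛-suc : ∀ f g n → (f ⊛ g) (suc n) ≈ f 0 * g (suc n) + ((f ∘ suc) ⊛ g) n
    ⊛-suc f g n = Σ-head (suc n) _

    ⊛-suc′ : ∀ f g n → (f ⊛ g) (suc n) ≈ (f ⊛ (g ∘ suc)) n + f (suc n) * g 0
    ⊛-suc′ f g n = +-cong
      (Σ-cong (suc n) (λ i i≤n → *-congˡ (reflexive (≡.cong g (ℕₚ.+-∸-assoc 1 (ℕₚ.≤-pred i≤n))))))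
      (*-congˡ (reflexive (≡.cong g (ℕₚ.n∸n≡0 n))))

    ⊛-distribʳ : ∀ h f g → (λ n → f n + g n) ⊛ h ≋ (λ n → (f ⊛ h) n + (g ⊛ h) n)
    ⊛-distribʳ h f g n = trans (Σ-cong′ (suc n) (λ i → distribʳ _ _ _)) (Σ-+ (suc n) _ _)

    ⊛-distribˡ : ∀ h f g → h ⊛ (λ n → f n + g n) ≋ (λ n → (h ⊛ f) n + (h ⊛ g) n)
    ⊛-distribˡ h f g n = trans (Σ-cong′ (suc n) (λ i → distribˡ _ _ _)) (Σ-+ (suc n) _ _)

    scale-⊛ : ∀ a f g n → ((λ i → a * f i) ⊛ g) n ≈ a * (f ⊛ g) n
    scale-⊛ a f g n = trans (Σ-cong′ (suc n) (λ i → *-assoc _ _ _)) (sym (Σ-*ˡ (suc n) a _))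

    zero-⊛ : ∀ f → (λ _ → 0#) ⊛ f ≋ (λ _ → 0#)
    zero-⊛ f n = Σ-zero (suc n) (λ i _ → zeroˡ _)

  -- The sum can be peeled at its front (`⊛-suc`) or at its back (`⊛-suc′`); matching the two
  -- recursions replaces the reversal of a sum.
  ⊛-comm : ∀ f g → f ⊛ g ≋ g ⊛ f
  ⊛-comm f g zero    = trans (⊛-zero f g) (trans (*-comm _ _) (sym (⊛-zero g f)))
  ⊛-comm f g (suc n) = begin
    (f ⊛ g) (suc n)                          ≈⟨ ⊛-suc f g n ⟩
    f 0 * g (suc n) + ((f ∘ suc) ⊛ g) n      ≈⟨ +-cong (*-comm _ _) (⊛-comm (f ∘ suc) g n) ⟩
    g (suc n) * f 0 + (g ⊛ (f ∘ suc)) n      ≈⟨ +-comm _ _ ⟩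
    (g ⊛ (f ∘ suc)) n + g (suc n) * f 0      ≈⟨ ⊛-suc′ g f n ⟨
    (g ⊛ f) (suc n)                          ∎

  -- Induction on the index through the head recursion, which avoids reindexing a triangular double
  -- sum.
  ⊛-assoc : ∀ f g h → (f ⊛ g) ⊛ h ≋ f ⊛ (g ⊛ h)
  ⊛-assoc f g h zero = begin
    ((f ⊛ g) ⊛ h) 0       ≈⟨ ⊛-zero (f ⊛ g) h ⟩
    (f ⊛ g) 0 * h 0       ≈⟨ *-congʳ (⊛-zero f g) ⟩
    f 0 * g 0 * h 0       ≈⟨ *-assoc _ _ _ ⟩
    f 0 * (g 0 * h 0)     ≈⟨ *-congˡ (⊛-zero g h) ⟨
    f 0 * (g ⊛ h) 0       ≈⟨ ⊛-zero f (g ⊛ h) ⟨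
    (f ⊛ (g ⊛ h)) 0       ∎
  ⊛-assoc f g h (suc n) = begin
    ((f ⊛ g) ⊛ h) (suc n)
      ≈⟨ ⊛-suc (f ⊛ g) h n ⟩
    (f ⊛ g) 0 * h (suc n) + (((f ⊛ g) ∘ suc) ⊛ h) n
      ≈⟨ +-cong (*-congʳ (⊛-zero f g)) (⊛-cong (⊛-suc f g) (λ _ → refl) n) ⟩
    f 0 * g 0 * h (suc n) + ((λ k → f 0 * g (suc k) + ((f ∘ suc) ⊛ g) k) ⊛ h) n
      ≈⟨ +-congˡ (⊛-distribʳ h _ _ n) ⟩
    f 0 * g 0 * h (suc n) + (((λ k → f 0 * g (suc k)) ⊛ h) n + (((f ∘ suc) ⊛ g) ⊛ h) n)
      ≈⟨ +-congˡ (+-cong (scale-⊛ (f 0) (g ∘ suc) h n) (⊛-assoc (f ∘ suc) g h n)) ⟩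
    f 0 * g 0 * h (suc n) + (f 0 * ((g ∘ suc) ⊛ h) n + ((f ∘ suc) ⊛ (g ⊛ h)) n)
      ≈⟨ solve 5 (λ a b x y w → a :* b :* x :+ (a :* y :+ w) := a :* (b :* x :+ y) :+ w) refl
           (f 0) (g 0) (h (suc n)) (((g ∘ suc) ⊛ h) n) (((f ∘ suc) ⊛ (g ⊛ h)) n) ⟩
    f 0 * (g 0 * h (suc n) + ((g ∘ suc) ⊛ h) n) + ((f ∘ suc) ⊛ (g ⊛ h)) n
      ≈⟨ +-congʳ (*-congˡ (⊛-suc g h n)) ⟨
    f 0 * (g ⊛ h) (suc n) + ((f ∘ suc) ⊛ (g ⊛ h)) n
      ≈⟨ ⊛-suc f (g ⊛ h) n ⟨
    (f ⊛ (g ⊛ h)) (suc n) ∎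

  const-⊛ : ∀ a f n → (const a ⊛ f) n ≈ a * f n
  const-⊛ a f zero    = ⊛-zero (const a) f
  const-⊛ a f (suc n) = trans (⊛-suc (const a) f n) (trans (+-congˡ (zero-⊛ f n)) (+-identityʳ _))

  one-⊛ : ∀ f → const 1# ⊛ f ≋ f
  one-⊛ f n = trans (const-⊛ 1# f n) (*-identityˡ _)

  var-⊛-zero : ∀ f → (var ⊛ f) 0 ≈ 0#
  var-⊛-zero f = trans (⊛-zero var f) (zeroˡ _)

  var-⊛-suc : ∀ f n → (var ⊛ f) (suc n) ≈ f n
  var-⊛-suc f n = begin
    (var ⊛ f) (suc n)                        ≈⟨ ⊛-suc var f n ⟩
    0# * f (suc n) + ((var ∘ suc) ⊛ f) n     ≈⟨ +-cong (zeroˡ _) (⊛-cong tail-var (λ _ → refl) n) ⟩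
    0# + (const 1# ⊛ f) n                    ≈⟨ trans (+-identityˡ _) (one-⊛ f n) ⟩
    f n                                      ∎
    where
    tail-var : (var ∘ suc) ≋ const 1#
    tail-var zero    = refl
    tail-var (suc _) = refl

  PS-isCommutativeRing : IsCommutativeRing _≋_ (λ f g n → f n + g n) _⊛_ (λ f n → - f n) (λ _ → 0#) (const 1#)
  PS-isCommutativeRing = record
    { isRing = record
      { +-isAbelianGroup = record
        { isGroup = record
          { isMonoid = record
            { isSemigroup = record
              { isMagma = record
                { isEquivalence = record
                  { refl = λ _ → refl ; sym = λ p n → sym (p n) ; trans = λ p q n → trans (p n) (q n) }
                ; ∙-cong = λ p q n → +-cong (p n) (q n) }
              ; assoc = λ f g h n → +-assoc _ _ _ }
            ; identity = (λ f n → +-identityˡ _) , (λ f n → +-identityʳ _) }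
          ; inverse = (λ f n → -‿inverseˡ _) , (λ f n → -‿inverseʳ _)
          ; ⁻¹-cong = λ p n → -‿cong (p n) }
        ; comm = λ f g n → +-comm _ _ }
      ; *-cong = ⊛-cong
      ; *-assoc = ⊛-assoc
      ; *-identity = one-⊛ , (λ f n → trans (⊛-comm f (const 1#) n) (one-⊛ f n))
      ; distrib = ⊛-distribˡ , ⊛-distribʳ }
    ; *-comm = ⊛-comm }

  PS : CommutativeRing c ℓ
  PS = record { isCommutativeRing = PS-isCommutativeRing }

  private module P = RingOps PS

  sumTo-at : ∀ m (f : ℕ → Ser) n → P.sumTo m f n ≡ sumTo m (λ i → f i n)
  sumTo-at zero    f n = ≡.refl
  sumTo-at (suc m) f n = ≡.cong (_+ f m n) (sumTo-at m f n)

  var^-⊛-shift : ∀ m f n → (P.pow var m ⊛ f) (m ℕ.+ n) ≈ f n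
  var^-⊛-shift zero    f n = one-⊛ f n
  var^-⊛-shift (suc m) f n = begin
    ((P.pow var m ⊛ var) ⊛ f) (suc m ℕ.+ n)  ≈⟨ ⊛-cong (⊛-comm (P.pow var m) var) (λ _ → refl) (suc m ℕ.+ n) ⟩
    ((var ⊛ P.pow var m) ⊛ f) (suc m ℕ.+ n)  ≈⟨ ⊛-assoc var (P.pow var m) f (suc m ℕ.+ n) ⟩
    (var ⊛ (P.pow var m ⊛ f)) (suc m ℕ.+ n)  ≈⟨ var-⊛-suc (P.pow var m ⊛ f) (m ℕ.+ n) ⟩
    (P.pow var m ⊛ f) (m ℕ.+ n)              ≈⟨ var^-⊛-shift m f n ⟩
    f n                                      ∎

  var^-⊛-low : ∀ m f n → n < m → (P.pow var m ⊛ f) n ≈ 0#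
  var^-⊛-low (suc m) f n n<m = trans (⊛-cong (⊛-comm (P.pow var m) var) (λ _ → refl) n)
    (trans (⊛-assoc var (P.pow var m) f n) (low n n<m))
    where
    low : ∀ n → n < suc m → (var ⊛ (P.pow var m ⊛ f)) n ≈ 0#
    low zero    _         = var-⊛-zero _
    low (suc n) (s≤s n<m) = trans (var-⊛-suc _ n) (var^-⊛-low m f n n<m)

-- Relations compatible with ring operations, jets and polynomials of bounded degree.

-- Evaluation maps, Frobenius twists, congruences, hyperderivations and degree bounds are instances.
record FilteredRelation {c ℓ c′ ℓ′} (A : CommutativeRing c ℓ) (B : CommutativeRing c′ ℓ′) (r : Level)
       : Set (c ⊔ ℓ ⊔ c′ ⊔ ℓ′ ⊔ lsuc r) where
  private
    module A = CommutativeRing A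
    module B = CommutativeRing B
  field
    T      : ℕ → A.Carrier → B.Carrier → Set r
    T-cong : ∀ {w x x′ y y′} → x A.≈ x′ → y B.≈ y′ → T w x y → T w x′ y′
    T-mono : ∀ {w w′ x y} → w ≤ w′ → T w x y → T w′ x y
    T-0    : T 0 A.0# B.0#
    T-1    : T 0 A.1# B.1#
    T-+    : ∀ {w x x′ y y′} → T w x y → T w x′ y′ → T w (x A.+ x′) (y B.+ y′)
    T-*    : ∀ {w w′ x x′ y y′} → T w x y → T w′ x′ y′ → T (w ℕ.+ w′) (x A.* x′) (y B.* y′)
    T-neg  : ∀ {w x y} → T w x y → T w (A.- x) (B.- y)

sumℕ : ℕ → (ℕ → ℕ) → ℕ
sumℕ zero    f = 0
sumℕ (suc n) f = sumℕ n f ℕ.+ f n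

-- ∏_{i < cnt} (1 - (τ + ε) ζ^{q^{a + 1 + i}}) as a power series in ε
module Jets {c ℓ} (R : CommutativeRing c ℓ) (q : ℕ) where
  open CommutativeRing R
  open RingOps R
  open PowerSeries R
  open Sums R
  private
    module S = CommutativeRing PS

  factorJet : Carrier → Carrier → Ser
  factorJet τ s zero          = 1# - τ * s
  factorJet τ s (suc zero)    = - s
  factorJet τ s (suc (suc _)) = 0#

  jetProd : Carrier → Carrier → ℕ → ℕ → Ser
  jetProd τ ζ a zero      = const 1#
  jetProd τ ζ a (suc cnt) = jetProd τ ζ a cnt ⊛ factorJet τ (pow ζ (q ^ (suc a ℕ.+ cnt)))

  factorJet-cong : ∀ {τ τ′ s s′} → τ ≈ τ′ → s ≈ s′ → factorJet τ s ≋ factorJet τ′ s′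
  factorJet-cong p p′ zero          = +-congˡ (-‿cong (*-cong p p′))
  factorJet-cong p p′ (suc zero)    = -‿cong p′
  factorJet-cong p p′ (suc (suc _)) = refl

  jetProd-+ : ∀ τ ζ a b c → jetProd τ ζ a (b ℕ.+ c) ≋ jetProd τ ζ a b ⊛ jetProd τ ζ (a ℕ.+ b) c
  jetProd-+ τ ζ a b zero rewrite ℕₚ.+-identityʳ b = S.sym (S.*-identityʳ _)
  jetProd-+ τ ζ a b (suc c) rewrite ℕₚ.+-suc b c | ℕₚ.+-assoc a b c =
    S.trans (S.*-congʳ (jetProd-+ τ ζ a b c)) (S.*-assoc (jetProd τ ζ a b) (jetProd τ ζ (a ℕ.+ b) c) _)

  -- The Mahler functional equation in iterated form: replacing x by x^{q^a} at fixed t discards the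
  -- leading factors of the product.
  jetProd-rebase : ∀ τ ζ a b cnt → jetProd τ (pow ζ (q ^ a)) b cnt ≋ jetProd τ ζ (a ℕ.+ b) cnt
  jetProd-rebase τ ζ a b zero      = λ _ → refl
  jetProd-rebase τ ζ a b (suc cnt) = ⊛-cong (jetProd-rebase τ ζ a b cnt) (factorJet-cong refl
    (trans (sym (pow-* ζ (q ^ (suc b ℕ.+ cnt)) (q ^ a))) (reflexive (≡.cong (pow ζ) exponent))))
    where
    open ≡.≡-Reasoning
    exponent : q ^ (suc b ℕ.+ cnt) ℕ.* q ^ a ≡ q ^ (suc (a ℕ.+ b) ℕ.+ cnt)
    exponent = begin
      q ^ (suc b ℕ.+ cnt) ℕ.* q ^ a   ≡⟨ ℕₚ.^-distribˡ-+-* q (suc b ℕ.+ cnt) a ⟨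
      q ^ (suc b ℕ.+ cnt ℕ.+ a)       ≡⟨ ≡.cong (q ^_) (≡.trans (ℕₚ.+-comm (suc b ℕ.+ cnt) a) (≡.trans (ℕₚ.+-suc a (b ℕ.+ cnt)) (≡.cong suc (≡.sym (ℕₚ.+-assoc a b cnt))))) ⟩
      q ^ (suc (a ℕ.+ b) ℕ.+ cnt)     ∎

-- Monomials of total degree at most d in n variables, split according to divisibility by X₀.
Mon : ℕ → ℕ → Set
Mon zero    d       = ⊤
Mon (suc n) zero    = ⊤
Mon (suc n) (suc d) = Mon n (suc d) ⊎ Mon (suc n) d

module Polynomials {c ℓ} (R : CommutativeRing c ℓ) where
  open CommutativeRing R
  open IntegerSolver R
  open Relation.Binary.Reasoning.Setoid setoid

  ev : ∀ n d → (Mon n d → Carrier) → (ℕ → Carrier) → Carrier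
  ev zero    d       c x = c tt
  ev (suc n) zero    c x = c tt
  ev (suc n) (suc d) c x = ev n (suc d) (c ∘ inj₁) (x ∘ suc) + x 0 * ev (suc n) d (c ∘ inj₂) x

  ev-cong : ∀ n d {c c′ x x′} → (∀ μ → c μ ≈ c′ μ) → (∀ i → i < n → x i ≈ x′ i) → ev n d c x ≈ ev n d c′ x′
  ev-cong zero    d       p p′ = p tt
  ev-cong (suc n) zero    p p′ = p tt
  ev-cong (suc n) (suc d) p p′ = +-cong (ev-cong n (suc d) (p ∘ inj₁) (λ i i<n → p′ (suc i) (s≤s i<n)))
                                        (*-cong (p′ 0 (s≤s z≤n)) (ev-cong (suc n) d (p ∘ inj₂) p′))

  ev-scale : ∀ n d a c x → ev n d (λ μ → a * c μ) x ≈ a * ev n d c x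
  ev-scale zero    d       a c x = refl
  ev-scale (suc n) zero    a c x = refl
  ev-scale (suc n) (suc d) a c x = trans
    (+-cong (ev-scale n (suc d) a (c ∘ inj₁) (x ∘ suc)) (*-congˡ (ev-scale (suc n) d a (c ∘ inj₂) x)))
    (solve 4 (λ a u v w → a :* u :+ v :* (a :* w) := a :* (u :+ v :* w)) refl a _ (x 0) _)

  ev-+ : ∀ n d c c′ x → ev n d (λ μ → c μ + c′ μ) x ≈ ev n d c x + ev n d c′ x
  ev-+ zero    d       c c′ x = refl
  ev-+ (suc n) zero    c c′ x = refl
  ev-+ (suc n) (suc d) c c′ x = trans
    (+-cong (ev-+ n (suc d) (c ∘ inj₁) (c′ ∘ inj₁) (x ∘ suc)) (*-congˡ (ev-+ (suc n) d (c ∘ inj₂) (c′ ∘ inj₂) x)))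
    (solve 5 (λ u u′ v w w′ → (u :+ u′) :+ v :* (w :+ w′) := (u :+ v :* w) :+ (u′ :+ v :* w′)) refl _ _ (x 0) _ _)

  ev-zero : ∀ n d {c} x → (∀ μ → c μ ≈ 0#) → ev n d c x ≈ 0#
  ev-zero zero    d       x h = h tt
  ev-zero (suc n) zero    x h = h tt
  ev-zero (suc n) (suc d) x h = begin
    _                ≈⟨ +-cong (ev-zero n (suc d) (x ∘ suc) (h ∘ inj₁)) (*-congˡ (ev-zero (suc n) d x (h ∘ inj₂))) ⟩
    0# + x 0 * 0#    ≈⟨ solve 1 (λ a → :0 :+ a :* :0 := :0) refl (x 0) ⟩
    0#               ∎

  open RingOps R

  ev-Σ : ∀ n d m (c : ℕ → Mon n d → Carrier) x →
         ev n d (λ μ → sumTo m (λ i → c i μ)) x ≈ sumTo m (λ i → ev n d (c i) x)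
  ev-Σ n d zero    c x = ev-zero n d x (λ _ → refl)
  ev-Σ n d (suc m) c x = trans (ev-+ n d _ _ x) (+-congʳ (ev-Σ n d m c x))

-- Each construction of the proof is carried through an arbitrary relation once. Unary properties
-- such as degree or slope bounds are instances that ignore the second argument.
module RelationLemmas {c ℓ c′ ℓ′ r} {A : CommutativeRing c ℓ} {B : CommutativeRing c′ ℓ′}
       (rel : FilteredRelation A B r) where
  open FilteredRelation rel
  private
    module A = CommutativeRing A
    module B = CommutativeRing B
    module OA = RingOps A
    module OB = RingOps B
    module SA = PowerSeries A
    module SB = PowerSeries B
    module PA = Polynomials A
    module PB = Polynomials B

  T-sum : ∀ n {w f g} → (∀ i → i < n → T w (f i) (g i)) → T w (OA.sumTo n f) (OB.sumTo n g)
  T-sum zero    h = T-mono z≤n T-0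
  T-sum (suc n) h = T-+ (T-sum n (λ i i<n → h i (ℕₚ.m<n⇒m<1+n i<n))) (h n ℕₚ.≤-refl)

  T-⊛ : ∀ {w w′ f g f′ g′} n → (∀ i → T w (f i) (f′ i)) → (∀ i → T w′ (g i) (g′ i)) →
        T (w ℕ.+ w′) ((f SA.⊛ g) n) ((f′ SB.⊛ g′) n)
  T-⊛ {w} {w′} {f} {g} {f′} {g′} n h h′ =
    T-cong (A.reflexive (≡.sym (SA.⊛-def f g n))) (B.reflexive (≡.sym (SB.⊛-def f′ g′ n)))
      (T-sum (suc n) (λ i _ → T-* (h i) (h′ (n ∸ i))))

  T-pow : ∀ n {x y} → T 0 x y → T 0 (OA.pow x n) (OB.pow y n)
  T-pow zero    h = T-1
  T-pow (suc n) h = T-* (T-pow n h) h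

  T-const : ∀ {x y} → T 0 x y → ∀ i → T 0 (SA.const x i) (SB.const y i)
  T-const h zero    = h
  T-const h (suc i) = T-0

  -- The weight belongs to a whole factor and not to τ and ζ separately: θ alone is not a polynomial
  -- in z, while its product with a high power of z is; likewise t lies below a slope above which t
  -- x^m lies for large m.
  T-jetProd : ∀ q {τ ζ τ′ ζ′} a cnt (W : ℕ → ℕ) →
    (∀ i → i < cnt → ∀ k → T (W i) (Jets.factorJet A q τ (OA.pow ζ (q ^ (suc a ℕ.+ i))) k)
                                   (Jets.factorJet B q τ′ (OB.pow ζ′ (q ^ (suc a ℕ.+ i))) k)) →
    ∀ k → T (sumℕ cnt W) (Jets.jetProd A q τ ζ a cnt k) (Jets.jetProd B q τ′ ζ′ a cnt k)
  T-jetProd q a zero      W h k = T-const T-1 k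
  T-jetProd q a (suc cnt) W h k =
    T-⊛ k (T-jetProd q a cnt W (λ i i<n → h i (ℕₚ.m<n⇒m<1+n i<n))) (h cnt ℕₚ.≤-refl)

  T-factorJet : ∀ q {τ s τ′ s′} → T 0 τ τ′ → T 0 s s′ →
                ∀ k → T 0 (Jets.factorJet A q τ s k) (Jets.factorJet B q τ′ s′ k)
  T-factorJet q h h′ zero          = T-+ T-1 (T-neg (T-* h h′))
  T-factorJet q h h′ (suc zero)    = T-neg h′
  T-factorJet q h h′ (suc (suc _)) = T-0

  T-jetProd₀ : ∀ q {τ ζ τ′ ζ′} → T 0 τ τ′ → T 0 ζ ζ′ → ∀ a cnt k →
    T 0 (Jets.jetProd A q τ ζ a cnt k) (Jets.jetProd B q τ′ ζ′ a cnt k)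
  T-jetProd₀ q h h′ a zero      k = T-const T-1 k
  T-jetProd₀ q h h′ a (suc cnt) k =
    T-⊛ k (T-jetProd₀ q h h′ a cnt) (T-factorJet q h (T-pow (q ^ (suc a ℕ.+ cnt)) h′))

  T-ev : ∀ n d {w v c c′ x x′} → (∀ μ → T w (c μ) (c′ μ)) → (∀ i → i < n → T v (x i) (x′ i)) →
         T (w ℕ.+ d ℕ.* v) (PA.ev n d c x) (PB.ev n d c′ x′)
  T-ev zero    d       h h′ = T-mono (ℕₚ.m≤m+n _ _) (h tt)
  T-ev (suc n) zero    h h′ = T-mono (ℕₚ.m≤m+n _ _) (h tt)
  T-ev (suc n) (suc d) {w} {v} h h′ = T-+
    (T-ev n (suc d) (h ∘ inj₁) (λ i i<n → h′ (suc i) (s≤s i<n)))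
    (T-mono (ℕₚ.≤-reflexive weight) (T-* (h′ 0 (s≤s z≤n)) (T-ev (suc n) d (h ∘ inj₂) h′)))
    where
    weight : v ℕ.+ (w ℕ.+ d ℕ.* v) ≡ w ℕ.+ (v ℕ.+ d ℕ.* v)
    weight = ≡.trans (≡.sym (ℕₚ.+-assoc v w _)) (≡.trans (≡.cong (ℕ._+ d ℕ.* v) (ℕₚ.+-comm v w)) (ℕₚ.+-assoc w v _))

  T-ev₀ : ∀ n d {c c′ x x′} → (∀ μ → T 0 (c μ) (c′ μ)) → (∀ i → i < n → T 0 (x i) (x′ i)) →
          T 0 (PA.ev n d c x) (PB.ev n d c′ x′)
  T-ev₀ n d h h′ = T-mono (ℕₚ.≤-reflexive (ℕₚ.*-zeroʳ d)) (T-ev n d h h′)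

-- Evaluation of series with finitely many terms.

-- Evaluation at ζ of polynomials over A, as a relation on power series.
module Evaluation {c ℓ} (B : CommutativeRing c ℓ) where
  open CommutativeRing B
  open RingOps B
  open IntegerSolver B
  open Sums B
  open PowerSeries B
  open Relation.Binary.Reasoning.Setoid setoid

  evalTo : ℕ → (ℕ → Carrier) → Carrier → Carrier
  evalTo b e ζ = sumTo b (λ N → e N * pow ζ N)

  evalTo-suc : ∀ b e ζ → evalTo (suc b) e ζ ≈ e 0 + ζ * evalTo b (e ∘ suc) ζ
  evalTo-suc b e ζ = trans (Σ-head b _) (+-cong (*-identityʳ _)
    (trans (Σ-cong′ b (λ N → solve 3 (λ a p z → a :* (p :* z) := z :* (a :* p)) refl (e (suc N)) (pow ζ N) ζ))
           (sym (Σ-*ˡ b ζ _))))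

  evalTo-extend : ∀ {b b′} e ζ → b ≤ b′ → (∀ i → b ≤ i → e i ≈ 0#) → evalTo b′ e ζ ≈ evalTo b e ζ
  evalTo-extend e ζ b≤b′ h = Σ-extend _ b≤b′ (λ i b≤i → trans (*-congʳ (h i b≤i)) (zeroˡ _))

  evalTo-+ : ∀ b e e′ ζ → evalTo b (λ N → e N + e′ N) ζ ≈ evalTo b e ζ + evalTo b e′ ζ
  evalTo-+ b e e′ ζ = trans (Σ-cong′ b (λ N → distribʳ _ _ _)) (Σ-+ b _ _)

  evalTo-scale : ∀ b a e ζ → evalTo b (λ N → a * e N) ζ ≈ a * evalTo b e ζ
  evalTo-scale b a e ζ = trans (Σ-cong′ b (λ N → *-assoc _ _ _)) (sym (Σ-*ˡ b a _))

  -- The range W of the product is any sufficient one: the induction takes one term from e and one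
  -- from W, but none from e′.
  evalTo-⊛ : ∀ b b′ W e e′ ζ → b ℕ.+ b′ ≤ W → (∀ i → b ≤ i → e i ≈ 0#) → (∀ i → b′ ≤ i → e′ i ≈ 0#) →
             evalTo W (e ⊛ e′) ζ ≈ evalTo b e ζ * evalTo b′ e′ ζ
  evalTo-⊛ zero b′ W e e′ ζ _ h h′ = begin
    evalTo W (e ⊛ e′) ζ      ≈⟨ Σ-zero W (λ N _ → trans (*-congʳ (trans (⊛-cong (λ i → h i z≤n) (λ _ → refl) N) (zero-⊛ e′ N))) (zeroˡ _)) ⟩
    0#                       ≈⟨ zeroˡ _ ⟨
    0# * evalTo b′ e′ ζ      ∎
  evalTo-⊛ (suc b) b′ (suc W) e e′ ζ (s≤s le) h h′ = begin
    evalTo (suc W) (e ⊛ e′) ζ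
      ≈⟨ evalTo-suc W _ ζ ⟩
    (e ⊛ e′) 0 + ζ * evalTo W ((e ⊛ e′) ∘ suc) ζ
      ≈⟨ +-cong (⊛-zero e e′) (*-congˡ (Σ-cong′ W (λ N → *-congʳ (⊛-suc e e′ N)))) ⟩
    e 0 * e′ 0 + ζ * evalTo W (λ N → e 0 * e′ (suc N) + ((e ∘ suc) ⊛ e′) N) ζ
      ≈⟨ +-congˡ (*-congˡ (trans (evalTo-+ W _ _ ζ) (+-cong (evalTo-scale W (e 0) _ ζ) (evalTo-⊛ b b′ W (e ∘ suc) e′ ζ le (λ i b≤i → h (suc i) (s≤s b≤i)) h′)))) ⟩
    e 0 * e′ 0 + ζ * (e 0 * evalTo W (e′ ∘ suc) ζ + evalTo b (e ∘ suc) ζ * evalTo b′ e′ ζ)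
      ≈⟨ solve 6 (λ a x z u v w → a :* x :+ z :* (a :* u :+ v :* w) := a :* (x :+ z :* u) :+ z :* v :* w) refl
           (e 0) (e′ 0) ζ (evalTo W (e′ ∘ suc) ζ) (evalTo b (e ∘ suc) ζ) (evalTo b′ e′ ζ) ⟩
    e 0 * (e′ 0 + ζ * evalTo W (e′ ∘ suc) ζ) + ζ * evalTo b (e ∘ suc) ζ * evalTo b′ e′ ζ
      ≈⟨ +-congʳ (*-congˡ (trans (sym (evalTo-suc W e′ ζ)) (evalTo-extend e′ ζ (ℕₚ.≤-trans (ℕₚ.m≤n+m b′ b) (ℕₚ.≤-trans le (ℕₚ.n≤1+n W))) h′))) ⟩
    e 0 * evalTo b′ e′ ζ + ζ * evalTo b (e ∘ suc) ζ * evalTo b′ e′ ζ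
      ≈⟨ distribʳ _ _ _ ⟨
    (e 0 + ζ * evalTo b (e ∘ suc) ζ) * evalTo b′ e′ ζ
      ≈⟨ *-congʳ (evalTo-suc b e ζ) ⟨
    evalTo (suc b) e ζ * evalTo b′ e′ ζ ∎

⊛-bounded : ∀ {c ℓ} (R : CommutativeRing c ℓ) → let open CommutativeRing R ; open PowerSeries R in
  ∀ {b b′ f g} → (∀ i → b ≤ i → f i ≈ 0#) → (∀ i → b′ ≤ i → g i ≈ 0#) → ∀ i → b ℕ.+ b′ ≤ i → (f ⊛ g) i ≈ 0#
⊛-bounded R {b} {b′} {f} {g} h h′ n le = trans (reflexive (⊛-def f g n)) (Σ-zero (suc n) term)
  where
  open CommutativeRing R
  open PowerSeries R
  open Sums R
  term : ∀ i → i < suc n → f i * g (n ∸ i) ≈ 0#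
  term i i≤n with b ℕ.≤? i
  ... | yes b≤i = trans (*-congʳ (h i b≤i)) (zeroˡ _)
  ... | no b≰i  = trans (*-congˡ (h′ (n ∸ i) (ℕₚ.m+n≤o⇒m≤o∸n b′ (ℕₚ.≤-trans (ℕₚ.+-monoʳ-≤ b′ (ℕₚ.<⇒≤ (ℕₚ.≰⇒> b≰i))) (ℕₚ.≤-trans (ℕₚ.≤-reflexive (ℕₚ.+-comm b′ b)) le))))) (zeroʳ _)

module _ {c ℓ c′ ℓ′ r} {R : CommutativeRing c ℓ} {B : CommutativeRing c′ ℓ′} (rel : FilteredRelation R B r) where
  private
    module R = CommutativeRing R
    module B = CommutativeRing B
    module SR = PowerSeries R
    module SB = PowerSeries B
  open FilteredRelation rel
  open RelationLemmas rel
  open Evaluation B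
  open Sums B
  open IntegerSolver B

  -- A power series cannot be evaluated at ζ in general, so evaluation is a relation carrying a
  -- bound on the support. Coefficients pass through `rel` before ζ is inserted; iterating this
  -- evaluates in t and then in x.
  record Evaluates (ζ : B.Carrier) (E : SR.Ser) (y : B.Carrier) : Set (c′ ⊔ ℓ ⊔ ℓ′ ⊔ r) where
    constructor evaluates
    field
      bound    : ℕ
      image    : ℕ → B.Carrier
      related  : ∀ N → T 0 (E N) (image N)
      high     : ∀ N → bound ≤ N → E N R.≈ R.0#
      highᵢ    : ∀ N → bound ≤ N → image N B.≈ B.0#
      value    : y B.≈ evalTo bound image ζ

  evaluation : B.Carrier → FilteredRelation SR.PS B (c′ ⊔ ℓ ⊔ ℓ′ ⊔ r)
  evaluation ζ = record
    { T = λ _ → Evaluates ζ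
    ; T-cong = λ p p′ (evaluates b e t h h′ v) →
        evaluates b e (λ N → T-cong (p N) B.refl (t N)) (λ N le → R.trans (R.sym (p N)) (h N le)) h′ (B.trans (B.sym p′) v)
    ; T-mono = λ _ t → t
    ; T-0 = evaluates 0 (λ _ → B.0#) (λ _ → T-0) (λ _ _ → R.refl) (λ _ _ → B.refl) B.refl
    ; T-1 = evaluates 1 (SB.const B.1#) (T-const T-1) (λ { (suc _) _ → R.refl }) (λ { (suc _) _ → B.refl })
        (B.sym (B.trans (B.+-identityˡ _) (B.*-identityˡ _)))
    ; T-+ = add
    ; T-* = mul
    ; T-neg = λ (evaluates b e t h h′ v) → evaluates b (λ N → B.- e N) (λ N → T-neg (t N))
        (λ N le → R.trans (R.-‿cong (h N le)) (Algebra.Properties.Ring.-0#≈0# R.ring)) (λ N le → B.trans (B.-‿cong (h′ N le)) (Algebra.Properties.Ring.-0#≈0# B.ring))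
        (B.trans (B.-‿cong v) (B.trans (Σ-neg b _) (Σ-cong′ b (λ N → negMul (e N) _))))
    }
    where
    negMul : ∀ a p → B.- (a B.* p) B.≈ (B.- a) B.* p
    negMul a p = solve 2 (λ a p → :- (a :* p) := (:- a) :* p) B.refl a p
    add : ∀ {E E′ y y′} → Evaluates ζ E y → Evaluates ζ E′ y′ → Evaluates ζ (λ N → E N R.+ E′ N) (y B.+ y′)
    add (evaluates b e t h h′ v) (evaluates b₁ e₁ t₁ h₁ h₁′ v₁) = evaluates (b ℕ.⊔ b₁) (λ N → e N B.+ e₁ N)
      (λ N → T-+ (t N) (t₁ N))
      (λ N le → R.trans (R.+-cong (h N (ℕₚ.m⊔n≤o⇒m≤o b b₁ le)) (h₁ N (ℕₚ.m⊔n≤o⇒n≤o b b₁ le))) (R.+-identityˡ _))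
      (λ N le → B.trans (B.+-cong (h′ N (ℕₚ.m⊔n≤o⇒m≤o b b₁ le)) (h₁′ N (ℕₚ.m⊔n≤o⇒n≤o b b₁ le))) (B.+-identityˡ _))
      (B.trans (B.+-cong (B.trans v (B.sym (evalTo-extend e ζ (ℕₚ.m≤m⊔n b b₁) h′))) (B.trans v₁ (B.sym (evalTo-extend e₁ ζ (ℕₚ.m≤n⊔m b b₁) h₁′))))
        (B.sym (evalTo-+ (b ℕ.⊔ b₁) e e₁ ζ)))
    mul : ∀ {E E′ y y′} → Evaluates ζ E y → Evaluates ζ E′ y′ → Evaluates ζ (E SR.⊛ E′) (y B.* y′)
    mul (evaluates b e t h h′ v) (evaluates b₁ e₁ t₁ h₁ h₁′ v₁) = evaluates (b ℕ.+ b₁) (e SB.⊛ e₁)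
      (λ N → T-⊛ N t t₁)
      (⊛-bounded R h h₁)
      (⊛-bounded B h′ h₁′)
      (B.trans (B.*-cong v v₁) (B.sym (evalTo-⊛ b b₁ (b ℕ.+ b₁) e e₁ ζ ℕₚ.≤-refl h′ h₁′)))

  evaluates-const : ∀ {ζ x y} → T 0 x y → Evaluates ζ (SR.const x) y
  evaluates-const {ζ} {x} {y} t = evaluates 1 (SB.const y) (T-const t) (λ { (suc _) _ → R.refl }) (λ { (suc _) _ → B.refl })
    (B.sym (B.trans (B.+-identityˡ _) (B.*-identityʳ _)))

  evaluates-var : ∀ {ζ} → Evaluates ζ SR.var ζ
  evaluates-var {ζ} = evaluates 2 SB.var
    (λ { zero → T-0 ; (suc zero) → T-1 ; (suc (suc _)) → T-0 })
    (λ { (suc zero) (s≤s ()) ; (suc (suc _)) _ → R.refl })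
    (λ { (suc zero) (s≤s ()) ; (suc (suc _)) _ → B.refl })
    (solve 1 (λ z → z := (:0 :+ :0 :* :1) :+ :1 :* (:1 :* z)) B.refl ζ)

-- Synthetic division and linear algebra over domains.

module Roots {c ℓ} (R : CommutativeRing c ℓ) where
  open CommutativeRing R
  open RingOps R
  open IntegerSolver R
  open Relation.Binary.Reasoning.Setoid setoid

  horner : List Carrier → Carrier → Carrier
  horner []       α = 0#
  horner (c ∷ cs) α = c + α * horner cs α

  quotient : Carrier → List Carrier → List Carrier
  quotient α []           = []
  quotient α (c ∷ [])     = []
  quotient α (c ∷ d ∷ ds) = horner (d ∷ ds) α ∷ quotient α (d ∷ ds)

  quotient-law : ∀ cs α β → (β - α) * horner (quotient α cs) β ≈ horner cs β - horner cs α
  quotient-law [] α β = solve 2 (λ a b → (b :- a) :* :0 := :0 :- :0) refl α β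
  quotient-law (c ∷ []) α β = solve 3 (λ a b c → (b :- a) :* :0 := (c :+ b :* :0) :- (c :+ a :* :0)) refl α β c
  quotient-law (c ∷ d ∷ ds) α β = begin
    (β - α) * (hα + β * qβ)             ≈⟨ solve 4 (λ a b h q → (b :- a) :* (h :+ b :* q) := (b :- a) :* h :+ b :* ((b :- a) :* q)) refl α β hα qβ ⟩
    (β - α) * hα + β * ((β - α) * qβ)   ≈⟨ +-congˡ (*-congˡ (quotient-law (d ∷ ds) α β)) ⟩
    (β - α) * hα + β * (hβ - hα)        ≈⟨ solve 5 (λ a b h k c → (b :- a) :* h :+ b :* (k :- h) := (c :+ b :* k) :- (c :+ a :* h)) refl α β hα hβ c ⟩
    (c + β * hβ) - (c + α * hα)         ∎
    where
    hα = horner (d ∷ ds) α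
    hβ = horner (d ∷ ds) β
    qβ = horner (quotient α (d ∷ ds)) β

  -- The coefficients of the quotient are partial Horner values, so bounds for the tail of `cs` pass
  -- to the quotient.
  getD-quotient : ∀ α cs l → getD (quotient α cs) l ≈ horner (drop (suc l) cs) α
  getD-quotient α []           l       = refl
  getD-quotient α (c ∷ [])     zero    = refl
  getD-quotient α (c ∷ [])     (suc l) = refl
  getD-quotient α (c ∷ d ∷ ds) zero    = refl
  getD-quotient α (c ∷ d ∷ ds) (suc l) = getD-quotient α (d ∷ ds) l

  horner-drop : ∀ α cs l → horner (drop l cs) α ≈ getD cs l + α * horner (drop (suc l) cs) α
  horner-drop α []       zero    = solve 1 (λ a → :0 := :0 :+ a :* :0) refl α
  horner-drop α []       (suc l) = solve 1 (λ a → :0 := :0 :+ a :* :0) refl α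
  horner-drop α (c ∷ cs) zero    = refl
  horner-drop α (c ∷ cs) (suc l) = horner-drop α cs l

  coefficient-from-quotient : ∀ α cs l → getD cs (suc l) ≈ getD (quotient α cs) l - α * getD (quotient α cs) (suc l)
  coefficient-from-quotient α cs l = begin
    getD cs (suc l)                                       ≈⟨ solve 2 (λ a b → a := (a :+ b) :- b) refl (getD cs (suc l)) (α * horner (drop (suc (suc l)) cs) α) ⟩
    (getD cs (suc l) + α * horner (drop (suc (suc l)) cs) α) - α * horner (drop (suc (suc l)) cs) α
      ≈⟨ +-cong (trans (sym (horner-drop α cs (suc l))) (sym (getD-quotient α cs l))) (-‿cong (*-congˡ (sym (getD-quotient α cs (suc l))))) ⟩
    getD (quotient α cs) l - α * getD (quotient α cs) (suc l) ∎

  coefficient₀-from-quotient : ∀ α cs → getD cs 0 ≈ horner cs α - α * getD (quotient α cs) 0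
  coefficient₀-from-quotient α cs = begin
    getD cs 0                                       ≈⟨ solve 2 (λ a b → a := (a :+ b) :- b) refl (getD cs 0) (α * horner (drop 1 cs) α) ⟩
    (getD cs 0 + α * horner (drop 1 cs) α) - α * horner (drop 1 cs) α
      ≈⟨ +-cong (sym (horner-drop α cs 0)) (-‿cong (*-congˡ (sym (getD-quotient α cs 0)))) ⟩
    horner cs α - α * getD (quotient α cs) 0        ∎

  length-quotient : ∀ α cs k → length cs ≤ suc k → length (quotient α cs) ≤ k
  length-quotient α []           k       le = z≤n
  length-quotient α (c ∷ [])     k       le = z≤n
  length-quotient α (c ∷ d ∷ ds) (suc k) (s≤s le) = s≤s (length-quotient α (d ∷ ds) k le)
  length-quotient α (c ∷ d ∷ ds) zero    (s≤s ())

  module _ (no-zero-divisors : ∀ x y → x * y ≈ 0# → ¬ (x ≈ 0#) → y ≈ 0#) where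

    -- A comparison of degrees would need decidable equality. Instead one root is divided out, the
    -- quotient vanishes by induction, and the coefficients are read back from it.
    roots⇒zero : ∀ k (root : ℕ → Carrier) → (∀ i j → i < j → j < k → ¬ (root i - root j ≈ 0#)) →
      ∀ cs → length cs ≤ k → (∀ i → i < k → horner cs (root i) ≈ 0#) → ∀ l → getD cs l ≈ 0#
    roots⇒zero zero    root distinct []  le h l = refl
    roots⇒zero (suc k) root distinct cs le h l = conclude l
      where
      α = root k
      quotient-root : ∀ i → i < k → horner (quotient α cs) (root i) ≈ 0#
      quotient-root i i<k = no-zero-divisors (root i - α) _
        (trans (quotient-law cs α (root i)) (trans (+-cong (h i (ℕₚ.m<n⇒m<1+n i<k)) (-‿cong (h k ℕₚ.≤-refl))) (-‿inverseʳ 0#)))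
        (distinct i k i<k ℕₚ.≤-refl)
      quotient-zero : ∀ l → getD (quotient α cs) l ≈ 0#
      quotient-zero = roots⇒zero k root (λ i j i<j j<k → distinct i j i<j (ℕₚ.m<n⇒m<1+n j<k)) (quotient α cs)
        (length-quotient α cs k le) quotient-root
      conclude : ∀ l → getD cs l ≈ 0#
      conclude zero    = trans (coefficient₀-from-quotient α cs)
        (trans (+-cong (h k ℕₚ.≤-refl) (-‿cong (*-congˡ (quotient-zero 0)))) (solve 1 (λ a → :0 :- a :* :0 := :0) refl α))
      conclude (suc l) = trans (coefficient-from-quotient α cs l)
        (trans (+-cong (quotient-zero l) (-‿cong (*-congˡ (quotient-zero (suc l))))) (solve 1 (λ a → :0 :- a :* :0 := :0) refl α))

module LinearMaps {c ℓ c′ ℓ′} (R : CommutativeRing c ℓ) (M : CommutativeRing c′ ℓ′)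
       (h : CommutativeRing.Carrier R → CommutativeRing.Carrier M) where
  open Data.Fin.Base using (zero; suc)
  private
    module R = CommutativeRing R
    module M = CommutativeRing M
  open Algebra.Properties.Semiring.Sum M.semiring using (sum; sum-cong-≋)

  record IsLinear {N} (f : Vector R.Carrier N → M.Carrier) : Set (c ⊔ ℓ ⊔ ℓ′) where
    field
      cong-f  : ∀ {x y} → (∀ i → x i R.≈ y i) → f x M.≈ f y
      add-f   : ∀ x y → f (λ i → x i R.+ y i) M.≈ f x M.+ f y
      scale-f : ∀ a x → f (λ i → a R.* x i) M.≈ h a M.* f x

  infixr 5 _◂_
  _◂_ : ∀ {N} → R.Carrier → Vector R.Carrier N → Vector R.Carrier (suc N)
  (a ◂ x) zero    = a
  (a ◂ x) (suc i) = x i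

  basis : ∀ {N} → Fin N → Vector R.Carrier N
  basis zero    = R.1# ◂ (λ _ → R.0#)
  basis (suc i) = R.0# ◂ basis i

  linear-tail : ∀ {N} {f : Vector R.Carrier (suc N) → M.Carrier} → IsLinear f → IsLinear (λ x → f (R.0# ◂ x))
  linear-tail {f = f} lin = record
    { cong-f  = λ p → cong-f λ { zero → R.refl ; (suc i) → p i }
    ; add-f   = λ x y → M.trans (cong-f λ { zero → R.sym (R.+-identityˡ _) ; (suc i) → R.refl }) (add-f _ _)
    ; scale-f = λ a x → M.trans (cong-f λ { zero → R.sym (R.zeroʳ a) ; (suc i) → R.refl }) (scale-f a _) }
    where open IsLinear lin

  linear-expand : (h0 : h R.0# M.≈ M.0#) → ∀ {N} {f : Vector R.Carrier N → M.Carrier} → IsLinear f →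
                  ∀ x → f x M.≈ sum (λ i → h (x i) M.* f (basis i))
  linear-expand h0 {zero}  {f} lin x = M.trans (cong-f (λ ())) (M.trans (scale-f R.0# x) (M.trans (M.*-congʳ h0) (M.zeroˡ _)))
    where open IsLinear lin
  linear-expand h0 {suc N} {f} lin x = M.trans
    (cong-f {y = λ i → x 0F R.* basis zero i R.+ (R.0# ◂ (x ∘ suc)) i}
      λ { zero → R.sym (R.trans (R.+-identityʳ _) (R.*-identityʳ _)) ; (suc i) → R.sym (R.trans (R.+-congʳ (R.zeroʳ _)) (R.+-identityˡ _)) })
    (M.trans (add-f _ _) (M.+-cong (scale-f (x 0F) _) (linear-expand h0 (linear-tail lin) (x ∘ suc))))
    where
    open IsLinear lin
    0F : Fin (suc N)
    0F = zero

module LinearSystems {c ℓ} (R : CommutativeRing c ℓ) where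
  open Data.Fin.Base using (zero; suc)
  open CommutativeRing R hiding (zero)
  open IntegerSolver R
  open Algebra.Properties.Semiring.Sum semiring using (sum; sum-cong-≋; sum-remove; *-distribˡ-sum; ∑-distrib-+; sum-replicate-zero)
  open Relation.Binary.Reasoning.Setoid setoid

  dot : ∀ {N} → Vector Carrier N → Vector Carrier N → Carrier
  dot r x = sum (λ i → r i * x i)

  dot-zeroˡ : ∀ {N} {r : Vector Carrier N} x → (∀ i → r i ≈ 0#) → dot r x ≈ 0#
  dot-zeroˡ {N} x h = trans (sum-cong-≋ (λ i → trans (*-congʳ (h i)) (zeroˡ _))) (sum-replicate-zero N)

  dot-zeroʳ : ∀ {N} (r : Vector Carrier N) {x} → (∀ i → x i ≈ 0#) → dot r x ≈ 0#
  dot-zeroʳ {N} r h = trans (sum-cong-≋ (λ i → trans (*-congˡ (h i)) (zeroʳ _))) (sum-replicate-zero N)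

  dot-eliminate : ∀ {N} a b (m r x : Vector Carrier N) →
                  dot (λ i → a * m i - b * r i) x ≈ a * dot m x - b * dot r x
  dot-eliminate a b m r x = begin
    dot (λ i → a * m i - b * r i) x
      ≈⟨ sum-cong-≋ (λ i → solve 5 (λ a b m r x → (a :* m :- b :* r) :* x := a :* (m :* x) :+ (:- b) :* (r :* x)) refl a b (m i) (r i) (x i)) ⟩
    sum (λ i → a * (m i * x i) + (- b) * (r i * x i))
      ≈⟨ ∑-distrib-+ (λ i → a * (m i * x i)) (λ i → (- b) * (r i * x i)) ⟩
    sum (λ i → a * (m i * x i)) + sum (λ i → (- b) * (r i * x i))
      ≈⟨ +-cong (*-distribˡ-sum a (λ i → m i * x i)) (*-distribˡ-sum (- b) (λ i → r i * x i)) ⟨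
    a * dot m x + (- b) * dot r x
      ≈⟨ solve 4 (λ a b u v → a :* u :+ (:- b) :* v := a :* u :- b :* v) refl a b (dot m x) (dot r x) ⟩
    a * dot m x - b * dot r x ∎

  dot-scaleʳ : ∀ {N} a (m x : Vector Carrier N) → dot m (λ i → a * x i) ≈ a * dot m x
  dot-scaleʳ a m x = trans (sum-cong-≋ (λ i → solve 3 (λ a m x → m :* (a :* x) := a :* (m :* x)) refl a (m i) (x i)))
    (sym (*-distribˡ-sum a (λ i → m i * x i)))

  module Domain (1≉0 : ¬ (1# ≈ 0#)) (no-zero-divisors : ∀ x y → x * y ≈ 0# → ¬ (x ≈ 0#) → y ≈ 0#) where

    module Finite (_≟_ : ∀ x y → Dec (x ≈ y)) where

      NontrivialSolution : ∀ N → List (Vector Carrier N) → Set (c ⊔ ℓ)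
      NontrivialSolution N rows = ∃ λ x → (∃ λ i → ¬ (x i ≈ 0#)) × All (λ r → dot r x ≈ 0#) rows

      -- Fraction-free elimination: a row without pivot is dropped, and otherwise the remaining rows
      -- are cross-multiplied with the pivot row, so that no division occurs.
      fewer-equations-than-unknowns : ∀ k N (rows : List (Vector Carrier N)) → length rows ≤ k → k < N → NontrivialSolution N rows
      fewer-equations-than-unknowns k (suc N) [] _ _ = (λ _ → 1#) , (zero , 1≉0) , []
      fewer-equations-than-unknowns (suc k) (suc N) (r ∷ rs) (s≤s le) lt with Finₚ.any? (λ i → ¬? (r i ≟ 0#))
      ... | no none = x , nz , dot-zeroˡ x (λ i → decidable-stable (r i ≟ 0#) (λ ne → none (i , ne))) ∷ solves
        where
        rec = fewer-equations-than-unknowns k (suc N) rs le (ℕₚ.<-trans (ℕₚ.n<1+n k) lt)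
        x = proj₁ rec
        nz = proj₁ (proj₂ rec)
        solves = proj₂ (proj₂ rec)
      ... | yes (i₀ , r≉0) = x , (punchIn i₀ (proj₁ nz′) , nz) , head-solved ∷ All.map (λ {m} → lift m) (Allₚ.map⁻ solves′)
        where
        a = r i₀
        reduce : Vector Carrier (suc N) → Vector Carrier N
        reduce m j = a * removeAt m i₀ j - m i₀ * removeAt r i₀ j
        rec = fewer-equations-than-unknowns k N (map reduce rs) (ℕₚ.≤-trans (ℕₚ.≤-reflexive (Listₚ.length-map reduce rs)) le) (ℕₚ.≤-pred lt)
        x′ = proj₁ rec
        nz′ = proj₁ (proj₂ rec)
        solves′ = proj₂ (proj₂ rec)
        x₀ = - dot (removeAt r i₀) x′
        x : Vector Carrier (suc N)
        x = insertAt (λ j → a * x′ j) i₀ x₀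
        nz : ¬ (x (punchIn i₀ (proj₁ nz′)) ≈ 0#)
        nz e = proj₂ nz′ (no-zero-divisors a _ (trans (sym (reflexive (VFₚ.insertAt-punchIn (λ j → a * x′ j) i₀ x₀ (proj₁ nz′)))) e) r≉0)
        dot-x : ∀ m → dot m x ≈ m i₀ * x₀ + a * dot (removeAt m i₀) x′
        dot-x m = begin
          dot m x ≈⟨ sum-remove {i = i₀} (λ i → m i * x i) ⟩
          m i₀ * x i₀ + sum (removeAt (λ i → m i * x i) i₀)
            ≈⟨ +-cong (*-congˡ (reflexive (VFₚ.insertAt-lookup (λ j → a * x′ j) i₀ x₀)))
                      (sum-cong-≋ (λ j → *-congˡ (reflexive (VFₚ.insertAt-punchIn (λ j → a * x′ j) i₀ x₀ j)))) ⟩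
          m i₀ * x₀ + dot (removeAt m i₀) (λ j → a * x′ j) ≈⟨ +-congˡ (dot-scaleʳ a (removeAt m i₀) x′) ⟩
          m i₀ * x₀ + a * dot (removeAt m i₀) x′ ∎
        head-solved : dot r x ≈ 0#
        head-solved = trans (dot-x r) (solve 2 (λ a u → a :* (:- u) :+ a :* u := :0) refl a (dot (removeAt r i₀) x′))
        lift : ∀ m → dot (reduce m) x′ ≈ 0# → dot m x ≈ 0#
        lift m e = begin
          dot m x ≈⟨ dot-x m ⟩
          m i₀ * x₀ + a * dot (removeAt m i₀) x′
            ≈⟨ solve 4 (λ b u a v → b :* (:- u) :+ a :* v := a :* v :- b :* u) refl (m i₀) (dot (removeAt r i₀) x′) a (dot (removeAt m i₀) x′) ⟩
          a * dot (removeAt m i₀) x′ - m i₀ * dot (removeAt r i₀) x′ ≈⟨ dot-eliminate a (m i₀) (removeAt m i₀) (removeAt r i₀) x′ ⟨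
          dot (reduce m) x′ ≈⟨ e ⟩
          0# ∎

    module Infinite {s} (S : Carrier → Set s) (S-0 : S 0#) (S-1 : S 1#)
           (S-+ : ∀ {x y} → S x → S y → S (x + y)) (S-* : ∀ {x y} → S x → S y → S (x * y)) (S-neg : ∀ {x} → S x → S (- x))
           (stable : ∀ x → ¬ ¬ (x ≈ 0#) → x ≈ 0#) where

      private
        S-dot : ∀ {N} (r x : Vector Carrier N) → (∀ i → S (r i)) → (∀ i → S (x i)) → S (dot r x)
        S-dot {zero}  r x h h′ = S-0
        S-dot {suc N} r x h h′ = S-+ (S-* (h zero) (h′ zero)) (S-dot (r ∘ suc) (x ∘ suc) (h ∘ suc) (h′ ∘ suc))

      Solution : ∀ N → (ℕ → Set) → (ℕ → Vector Carrier N) → Set (c ⊔ ℓ ⊔ s)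
      Solution N I m = ∃ λ x → (∀ i → S (x i)) × ¬ (∀ i → x i ≈ 0#) × (∀ e → I e → dot (m e) x ≈ 0#)

      -- Induction on the number of unknowns. If some row has a nonzero entry in the first column,
      -- that unknown is eliminated; if no row has one, the first unit vector solves the whole
      -- system. Which case holds cannot be decided for infinitely many rows, hence the double
      -- negations. Fraction-free elimination keeps the solution inside S.
      compactness : ∀ N (m : ℕ → Vector Carrier N) → (∀ e i → S (m e i)) →
        (∀ G → ¬ ¬ Solution N (_< G) m) → ¬ ¬ Solution N (λ _ → ⊤) m
      compactness zero    m Sm finite k = finite 0 (λ (x , _ , nz , _) → nz (λ ()))
      compactness (suc N) m Sm finite k = k ((λ { zero → 1# ; (suc _) → 0# }) , (λ { zero → S-1 ; (suc _) → S-0 }) ,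
          (λ h → 1≉0 (h zero)) , (λ e _ → trans (+-cong (trans (*-identityʳ _) (column-zero e)) (dot-zeroʳ (m e ∘ suc) (λ _ → refl))) (+-identityˡ 0#)))
        where
        pivot : ∀ e₀ → ¬ ¬ (m e₀ zero ≈ 0#)
        pivot e₀ a≉0 = compactness N m′ (λ e i → S-+ (S-* (Sm e₀ zero) (Sm e (suc i))) (S-neg (S-* (Sm e zero) (Sm e₀ (suc i)))))
            finite′ (λ (x , Sx , nz , solves) → k
              ( (λ { zero → - dot (r ∘ suc) x ; (suc i) → a * x i })
              , (λ { zero → S-neg (S-dot (r ∘ suc) x (Sm e₀ ∘ suc) Sx) ; (suc i) → S-* (Sm e₀ zero) (Sx i) })
              , (λ h → nz (λ i → no-zero-divisors a (x i) (h (suc i)) a≉0))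
              , (λ e _ → begin
                  m e zero * - dot (r ∘ suc) x + dot (m e ∘ suc) (λ i → a * x i) ≈⟨ +-congˡ (dot-scaleʳ a (m e ∘ suc) x) ⟩
                  m e zero * - dot (r ∘ suc) x + a * dot (m e ∘ suc) x
                    ≈⟨ solve 4 (λ b u a v → b :* (:- u) :+ a :* v := a :* v :- b :* u) refl (m e zero) (dot (r ∘ suc) x) a (dot (m e ∘ suc) x) ⟩
                  a * dot (m e ∘ suc) x - m e zero * dot (r ∘ suc) x ≈⟨ dot-eliminate a (m e zero) (m e ∘ suc) (r ∘ suc) x ⟨
                  dot (m′ e) x ≈⟨ solves e tt ⟩
                  0# ∎)))
          where
          r = m e₀
          a = m e₀ zero
          m′ : ℕ → Vector Carrier N
          m′ e i = a * m e (suc i) - m e zero * r (suc i)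
          finite′ : ∀ G → ¬ ¬ Solution N (_< G) m′
          -- The initial segment is enlarged so as to contain the pivot row: its equation expresses
          -- the eliminated unknown, and if the other unknowns vanished it would force this one to
          -- vanish as well.
          finite′ G k′ = finite (G ℕ.⊔ suc e₀) λ (x , Sx , nz , solves) →
            let e₀-solved : a * x zero + dot (r ∘ suc) (x ∘ suc) ≈ 0#
                e₀-solved = solves e₀ (ℕₚ.m≤n⊔m G (suc e₀))
            in k′ (x ∘ suc , Sx ∘ suc
              , (λ h → nz λ { zero → no-zero-divisors a (x zero) (trans (sym (trans (+-congˡ (dot-zeroʳ (r ∘ suc) h)) (+-identityʳ _))) e₀-solved) a≉0
                            ; (suc i) → h i })
              , (λ e e<G → let u = dot (m e ∘ suc) (x ∘ suc) ; v = dot (r ∘ suc) (x ∘ suc) in begin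
                  dot (m′ e) (x ∘ suc) ≈⟨ dot-eliminate a (m e zero) (m e ∘ suc) (r ∘ suc) (x ∘ suc) ⟩
                  a * u - m e zero * v
                    ≈⟨ solve 5 (λ a b u v x₀ → a :* u :- b :* v := a :* (b :* x₀ :+ u) :- b :* (a :* x₀ :+ v)) refl a (m e zero) u v (x zero) ⟩
                  a * (m e zero * x zero + u) - m e zero * (a * x zero + v)
                    ≈⟨ +-cong (*-congˡ (solves e (ℕₚ.≤-trans e<G (ℕₚ.m≤m⊔n G (suc e₀))))) (-‿cong (*-congˡ e₀-solved)) ⟩
                  a * 0# - m e zero * 0# ≈⟨ solve 2 (λ a b → a :* :0 :- b :* :0 := :0) refl a (m e zero) ⟩
                  0# ∎))
        column-zero : ∀ e → m e zero ≈ 0#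
        column-zero e = stable _ (pivot e)

-- Enumeration of monomials and representation of polynomial functions.

monCount : ℕ → ℕ → ℕ
monCount zero    d       = 1
monCount (suc n) zero    = 1
monCount (suc n) (suc d) = monCount n (suc d) ℕ.+ monCount (suc n) d

toFin : ∀ n d → Mon n d → Fin (monCount n d)
toFin zero    d       _        = Fin.zero
toFin (suc n) zero    _        = Fin.zero
toFin (suc n) (suc d) (inj₁ μ) = toFin n (suc d) μ Fin.↑ˡ monCount (suc n) d
toFin (suc n) (suc d) (inj₂ μ) = monCount n (suc d) Fin.↑ʳ toFin (suc n) d μ

fromFin : ∀ n d → Fin (monCount n d) → Mon n d
fromFin zero    d       _ = tt
fromFin (suc n) zero    _ = tt
fromFin (suc n) (suc d) i with Fin.splitAt (monCount n (suc d)) i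
... | inj₁ j = inj₁ (fromFin n (suc d) j)
... | inj₂ j = inj₂ (fromFin (suc n) d j)

toFin-fromFin : ∀ n d i → toFin n d (fromFin n d i) ≡ i
toFin-fromFin zero    d       Fin.zero = ≡.refl
toFin-fromFin (suc n) zero    Fin.zero = ≡.refl
toFin-fromFin (suc n) (suc d) i with Fin.splitAt (monCount n (suc d)) i in eq
... | inj₁ j = ≡.trans (≡.cong (Fin._↑ˡ monCount (suc n) d) (toFin-fromFin n (suc d) j)) (Finₚ.splitAt⁻¹-↑ˡ eq)
... | inj₂ j = ≡.trans (≡.cong (monCount n (suc d) Fin.↑ʳ_) (toFin-fromFin (suc n) d j)) (Finₚ.splitAt⁻¹-↑ʳ eq)

module Representation {c ℓ} (R : CommutativeRing c ℓ) where
  open CommutativeRing R hiding (zero)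
  open IntegerSolver R
  open Polynomials R
  open RingOps R
  open Relation.Binary.Reasoning.Setoid setoid

  Fun : Set c
  Fun = (ℕ → Carrier) → Carrier

  -- A polynomial is handled as a function together with a witnessing family of coefficients:
  -- identities are then checked pointwise, while S records an integrality or degree condition on
  -- the coefficients.
  record Rep {s} (S : Carrier → Set s) (n d : ℕ) (f : Fun) : Set (c ⊔ ℓ ⊔ s) where
    constructor rep
    field
      coef   : Mon n d → Carrier
      coef-S : ∀ μ → S (coef μ)
      agrees : ∀ x → f x ≈ ev n d coef x
  open Rep public

  Rep-cong : ∀ {s} {S : Carrier → Set s} {n d f g} → (∀ x → f x ≈ g x) → Rep S n d f → Rep S n d g
  Rep-cong h (rep c Sc e) = rep c Sc (λ x → trans (sym (h x)) (e x))

  Rep-map : ∀ {s s′} {S : Carrier → Set s} {S′ : Carrier → Set s′} {n d f} a →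
            (∀ {x} → S x → S′ (a * x)) → Rep S n d f → Rep S′ n d (λ x → a * f x)
  Rep-map a h (rep c Sc e) = rep (λ μ → a * c μ) (h ∘ Sc) (λ x → trans (*-congˡ (e x)) (sym (ev-scale _ _ a c x)))

  Rep-weaken : ∀ {s s′} {S : Carrier → Set s} {S′ : Carrier → Set s′} {n d f} → (∀ {x} → S x → S′ x) → Rep S n d f → Rep S′ n d f
  Rep-weaken h (rep c Sc e) = rep c (h ∘ Sc) e

  module Closed {s} (S : Carrier → Set s) (S-0 : S 0#) (S-+ : ∀ {x y} → S x → S y → S (x + y)) where

    Rep-+ : ∀ {n d f g} → Rep S n d f → Rep S n d g → Rep S n d (λ x → f x + g x)
    Rep-+ (rep c Sc e) (rep c′ Sc′ e′) = rep (λ μ → c μ + c′ μ) (λ μ → S-+ (Sc μ) (Sc′ μ))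
      (λ x → trans (+-cong (e x) (e′ x)) (sym (ev-+ _ _ c c′ x)))

    Rep-0 : ∀ n d → Rep S n d (λ _ → 0#)
    Rep-0 n d = rep (λ _ → 0#) (λ _ → S-0) (λ x → sym (ev-zero n d x (λ _ → refl)))

    private
      join : ∀ {n d f g} → Rep S n (suc d) f → Rep S (suc n) d g → Rep S (suc n) (suc d) (λ x → f (x ∘ suc) + x 0 * g x)
      join (rep c Sc e) (rep c′ Sc′ e′) = rep (λ { (inj₁ μ) → c μ ; (inj₂ μ) → c′ μ }) (λ { (inj₁ μ) → Sc μ ; (inj₂ μ) → Sc′ μ })
        (λ x → +-cong (e (x ∘ suc)) (*-congˡ (e′ x)))

      lower : ∀ {n d f} (r : Rep S (suc n) (suc d) f) → Rep S n (suc d) (ev n (suc d) (coef r ∘ inj₁))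
      lower (rep c Sc e) = rep (c ∘ inj₁) (Sc ∘ inj₁) (λ _ → refl)

      upper : ∀ {n d f} (r : Rep S (suc n) (suc d) f) → Rep S (suc n) d (ev (suc n) d (coef r ∘ inj₂))
      upper (rep c Sc e) = rep (c ∘ inj₂) (Sc ∘ inj₂) (λ _ → refl)

      drop-zero : ∀ x y → x + y * 0# ≈ x
      drop-zero = solve 2 (λ x y → x :+ y :* :0 := x) refl

    Rep-const : ∀ n d {a} → S a → Rep S n d (λ _ → a)
    Rep-const zero    d       Sa = rep _ (λ _ → Sa) (λ _ → refl)
    Rep-const (suc n) zero    Sa = rep _ (λ _ → Sa) (λ _ → refl)
    Rep-const (suc n) (suc d) Sa = Rep-cong (λ x → drop-zero _ _) (join (Rep-const n (suc d) Sa) (Rep-0 (suc n) d))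

    Rep-lift : ∀ n d {f} → Rep S n d f → Rep S n (suc d) f
    Rep-lift zero    d       (rep c Sc e) = rep c Sc e
    Rep-lift (suc n) zero    (rep c Sc e) = Rep-cong (λ x → sym (e x)) (Rep-const (suc n) 1 (Sc tt))
    Rep-lift (suc n) (suc d) r = Rep-cong (λ x → sym (agrees r x))
      (join (Rep-lift n (suc d) (lower r)) (Rep-lift (suc n) d (upper r)))

    Rep-lift+ : ∀ n d k {f} → Rep S n d f → Rep S n (k ℕ.+ d) f
    Rep-lift+ n d zero    r = r
    Rep-lift+ n d (suc k) r = Rep-lift n (k ℕ.+ d) (Rep-lift+ n d k r)

    Rep-≤ : ∀ n {d d′ f} → d ≤ d′ → Rep S n d f → Rep S n d′ f
    Rep-≤ n {d} {d′} {f} le r = ≡.subst (λ k → Rep S n k f) (ℕₚ.m∸n+n≡m le) (Rep-lift+ n d (d′ ∸ d) r)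

    Rep-var : ∀ n d i {f} → i < n → Rep S n d f → Rep S n (suc d) (λ x → x i * f x)
    Rep-var (suc n) d zero _ r = Rep-cong (λ x → +-identityˡ _)
      (join (Rep-0 n (suc d)) (Rep-cong (λ x → refl) r))
    Rep-var (suc n) zero (suc i) (s≤s i<n) r@(rep c Sc e) = Rep-cong (λ x → trans (drop-zero _ _) (*-congˡ (sym (e x))))
      (join (Rep-var n zero i i<n (Rep-const n 0 (Sc tt))) (Rep-0 (suc n) 0))
    Rep-var (suc n) (suc d) (suc i) (s≤s i<n) r = Rep-cong
      (λ x → trans (solve 4 (λ y u v w → y :* u :+ v :* (y :* w) := y :* (u :+ v :* w)) refl (x (suc i)) _ (x 0) _) (*-congˡ (sym (agrees r x))))
      (join (Rep-var n (suc d) i i<n (lower r)) (Rep-var (suc n) d (suc i) (s≤s i<n) (upper r)))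

    Rep-Σ : ∀ {n d} m {f : ℕ → Fun} → (∀ i → i < m → Rep S n d (f i)) → Rep S n d (λ x → sumTo m (λ i → f i x))
    Rep-Σ zero    h = Rep-0 _ _
    Rep-Σ (suc m) h = Rep-+ (Rep-Σ m (λ i i<m → h i (ℕₚ.m<n⇒m<1+n i<m))) (h m ℕₚ.≤-refl)

  -- Substitution into a polynomial, for any notion G of (graded) function stable under
  -- multiplication by the substituted functions.
  substitute : ∀ {g g′} (G : ℕ → Fun → Set g) (G′ : ℕ → Fun → Set g′) →
    (∀ {e f f′} → (∀ x → f x ≈ f′ x) → G′ e f → G′ e f′) →
    (∀ {e f} → G′ e f → G′ (suc e) f) →
    (∀ {e f f′} → G′ e f → G′ e f′ → G′ e (λ x → f x + f′ x)) →
    ∀ n d (c : Mon n d → Carrier) (y : ℕ → Fun) →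
    (∀ μ {e f} → G e f → G′ e (λ x → c μ * f x)) →
    (∀ i {e f} → i < n → G e f → G (suc e) (λ x → y i x * f x)) →
    ∀ {e f} → G e f → G′ (d ℕ.+ e) (λ x → ev n d c (λ i → y i x) * f x)
  substitute {g} {g′} G G′ G′-cong G′-lift G′-+ = go
    where
    liftBy : ∀ k {e f} → G′ e f → G′ (k ℕ.+ e) f
    liftBy zero    h = h
    liftBy (suc k) h = G′-lift (liftBy k h)
    go : ∀ n d (c : Mon n d → Carrier) (y : ℕ → Fun) →
      (∀ μ {e f} → G e f → G′ e (λ x → c μ * f x)) →
      (∀ i {e f} → i < n → G e f → G (suc e) (λ x → y i x * f x)) →
      ∀ {e f} → G e f → G′ (d ℕ.+ e) (λ x → ev n d c (λ i → y i x) * f x)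
    go zero    d       c y hc hy h = liftBy d (hc tt h)
    go (suc n) zero    c y hc hy h = hc tt h
    go (suc n) (suc d) c y hc hy {e} {f} h = G′-cong
      (λ x → solve 4 (λ u f y₀ w → u :* f :+ w :* (y₀ :* f) := (u :+ y₀ :* w) :* f) refl _ (f x) (y 0 x) _)
      (G′-+ (go n (suc d) (c ∘ inj₁) (y ∘ suc) (hc ∘ inj₁) (λ i i<n → hy (suc i) (s≤s i<n)) h)
            (≡.subst (λ k → G′ k (λ x → ev (suc n) d (c ∘ inj₂) (λ i → y i x) * (y 0 x * f x))) (ℕₚ.+-suc d e)
              (go (suc n) d (c ∘ inj₂) y (hc ∘ inj₂) hy (hy 0 (s≤s z≤n) h))))

  module Subring {s} (S : Carrier → Set s) (S-cong : ∀ {x y} → x ≈ y → S x → S y) (S-0 : S 0#) (S-1 : S 1#)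
         (S-+ : ∀ {x y} → S x → S y → S (x + y)) (S-* : ∀ {x y} → S x → S y → S (x * y)) where
    open Closed S S-0 S-+

    PolyFun : ℕ → Fun → Set (c ⊔ ℓ ⊔ s)
    PolyFun n f = ∃ λ d → Rep S n d f

    PolyFun-cong : ∀ {n f g} → (∀ x → f x ≈ g x) → PolyFun n f → PolyFun n g
    PolyFun-cong h (d , r) = d , Rep-cong h r

    PolyFun-const : ∀ {n a} → S a → PolyFun n (λ _ → a)
    PolyFun-const {n} Sa = 0 , Rep-const n 0 Sa

    PolyFun-+ : ∀ {n f g} → PolyFun n f → PolyFun n g → PolyFun n (λ x → f x + g x)
    PolyFun-+ {n} (d , r) (d′ , r′) = d ℕ.⊔ d′ , Rep-+ (Rep-≤ n (ℕₚ.m≤m⊔n d d′) r) (Rep-≤ n (ℕₚ.m≤n⊔m d d′) r′)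

    PolyFun-scale : ∀ {n f a} → S a → PolyFun n f → PolyFun n (λ x → a * f x)
    PolyFun-scale Sa (d , r) = d , Rep-map _ (S-* Sa) r

    PolyFun-var : ∀ {n i} → i < n → PolyFun n (λ x → x i)
    PolyFun-var {n} {i} i<n = 1 , Rep-cong (λ x → *-identityʳ _) (Rep-var n 0 i i<n (Rep-const n 0 S-1))

    PolyFun-* : ∀ {n f g} → PolyFun n f → PolyFun n g → PolyFun n (λ x → f x * g x)
    PolyFun-* {n} (d , rep c Sc e) h = PolyFun-cong (λ x → *-congʳ (sym (e x)))
      (substitute (λ _ → PolyFun n) (λ _ → PolyFun n) PolyFun-cong (λ h → h) PolyFun-+ n d c (λ i x → x i)
        (λ μ → PolyFun-scale (Sc μ)) (λ { i i<n (d′ , r) → suc d′ , Rep-var n d′ i i<n r }) {e = 0} h)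

    PolyFun-subst : ∀ {n m f} (y : ℕ → Fun) → (∀ i → i < n → PolyFun m (y i)) → PolyFun n f → PolyFun m (λ x → f (λ i → y i x))
    PolyFun-subst {n} {m} y hy (d , rep c Sc e) = PolyFun-cong (λ x → trans (*-identityʳ _) (sym (e _)))
      (substitute (λ _ → PolyFun m) (λ _ → PolyFun m) PolyFun-cong (λ h → h) PolyFun-+ n d c y
        (λ μ → PolyFun-scale (Sc μ)) (λ i i<n → PolyFun-* (hy i i<n)) {e = 0} (PolyFun-const S-1))

    PolyFun-pow : ∀ {n f} k → PolyFun n f → PolyFun n (λ x → pow (f x) k)
    PolyFun-pow zero    h = PolyFun-const S-1
    PolyFun-pow (suc k) h = PolyFun-* (PolyFun-pow k h) h

    PolyFun-Σ : ∀ {n} m {f : ℕ → Fun} → (∀ i → i < m → PolyFun n (f i)) → PolyFun n (λ x → sumTo m (λ i → f i x))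
    PolyFun-Σ zero    h = PolyFun-const S-0
    PolyFun-Σ (suc m) h = PolyFun-+ (PolyFun-Σ m (λ i i<m → h i (ℕₚ.m<n⇒m<1+n i<m))) (h m ℕₚ.≤-refl)

module Vanishing {c ℓ} (R : CommutativeRing c ℓ)
       (no-zero-divisors : ∀ x y → CommutativeRing._≈_ R (CommutativeRing._*_ R x y) (CommutativeRing.0# R) →
         ¬ CommutativeRing._≈_ R x (CommutativeRing.0# R) → CommutativeRing._≈_ R y (CommutativeRing.0# R)) where
  open CommutativeRing R hiding (zero)
  open Polynomials R
  open RingOps R
  open Roots R

  _◃_ : Carrier → (ℕ → Carrier) → ℕ → Carrier
  (a ◃ x) zero    = a
  (a ◃ x) (suc i) = x i

  X₀-coefficients : ∀ n d → (Mon (suc n) d → Carrier) → (ℕ → Carrier) → List Carrier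
  X₀-coefficients n zero    c x = c tt ∷ []
  X₀-coefficients n (suc d) c x = ev n (suc d) (c ∘ inj₁) x ∷ X₀-coefficients n d (c ∘ inj₂) x

  length-X₀ : ∀ n d c x → length (X₀-coefficients n d c x) ≡ suc d
  length-X₀ n zero    c x = ≡.refl
  length-X₀ n (suc d) c x = ≡.cong suc (length-X₀ n d (c ∘ inj₂) x)

  horner-X₀ : ∀ n d c a x → ev (suc n) d c (a ◃ x) ≈ horner (X₀-coefficients n d c x) a
  horner-X₀ n zero    c a x = sym (trans (+-congˡ (zeroʳ _)) (+-identityʳ _))
  horner-X₀ n (suc d) c a x = +-congˡ (*-congˡ (horner-X₀ n d (c ∘ inj₂) a x))

  -- Testing on a grid is all that is needed, and this freedom is used: a grid of Q-th powers allows
  -- Frobenius to be undone.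
  vanishing⇒zero : (node : ℕ → Carrier) → (∀ i j → i < j → ¬ (node i - node j ≈ 0#)) →
    ∀ n d c → (∀ (a : ℕ → ℕ) → ev n d c (node ∘ a) ≈ 0#) → ∀ μ → c μ ≈ 0#
  vanishing⇒zero node distinct zero    d c h tt = h (λ _ → 0)
  vanishing⇒zero node distinct (suc n) d c h = lists d c all-zero
    where
    all-zero : ∀ (a : ℕ → ℕ) l → getD (X₀-coefficients n d c (node ∘ a)) l ≈ 0#
    all-zero a = roots⇒zero no-zero-divisors (suc d) node (λ i j i<j _ → distinct i j i<j) (X₀-coefficients n d c (node ∘ a))
      (ℕₚ.≤-reflexive (length-X₀ n d c (node ∘ a)))
      (λ i _ → trans (sym (horner-X₀ n d c (node i) (node ∘ a)))
                (trans (ev-cong (suc n) d (λ _ → refl) (λ { zero _ → refl ; (suc j) _ → refl })) (h (λ { zero → i ; (suc j) → a j }))))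
    lists : ∀ d c → (∀ (a : ℕ → ℕ) l → getD (X₀-coefficients n d c (node ∘ a)) l ≈ 0#) → ∀ μ → c μ ≈ 0#
    lists zero    c h tt       = h (λ _ → 0) 0
    lists (suc d) c h (inj₁ μ) = vanishing⇒zero node distinct n (suc d) (c ∘ inj₁) (λ a → h a 0) μ
    lists (suc d) c h (inj₂ μ) = lists d (c ∘ inj₂) (λ a l → h a (suc l)) μ

-- The valued field: size, height and a Schwarz lemma.

-- The structure of a field L containing 𝔽_q((z)) that the transcendence argument uses:
-- 𝒪 is the image of 𝔽_q[[z]], and θ = 1/z.
record ValuedExtension {q : ℕ} (𝔽 : FiniteField q) {a ℓ} (L : CommutativeRing a ℓ) (p : Level) : Set (a ⊔ ℓ ⊔ lsuc p) where
  open FiniteField 𝔽 using (Fring)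
  private module F = CommutativeRing Fring
  open CommutativeRing L
  open RingOps L
  field
    isField      : IsFieldRing
    2≤q          : 2 ≤ q
    [_]          : F.Carrier → Carrier
    []-cong      : ∀ {x y} → x F.≈ y → [ x ] ≈ [ y ]
    []-+         : ∀ x y → [ x F.+ y ] ≈ [ x ] + [ y ]
    []-*         : ∀ x y → [ x F.* y ] ≈ [ x ] * [ y ]
    []-1         : [ F.1# ] ≈ 1#
    z θ          : Carrier
    zθ≈1         : z * θ ≈ 1#
    𝒪            : Carrier → Set p
    𝒪-cong       : ∀ {x y} → x ≈ y → 𝒪 x → 𝒪 y
    𝒪-+          : ∀ {x y} → 𝒪 x → 𝒪 y → 𝒪 (x + y)
    𝒪-*          : ∀ {x y} → 𝒪 x → 𝒪 y → 𝒪 (x * y)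
    𝒪-[]         : ∀ x → 𝒪 [ x ]
    𝒪-z          : 𝒪 z
    𝒪-geometric  : ∀ e → ∃ λ u → 𝒪 u × (1# - pow z (suc e)) * u ≈ 1#
    separation   : ∀ W (e : ℕ → F.Carrier) B {y} → 𝒪 y → sumTo W (λ N → [ e N ] * pow z N) ≈ pow z B * y →
                   ∀ N → N < W → N < B → e N F.≈ F.0#
    frobenius    : ∀ x y → pow (x + y) q ≈ pow x q + pow y q

module ValuedLemmas {q : ℕ} {𝔽 : FiniteField q} {a ℓ} {L : CommutativeRing a ℓ} {p} (V : ValuedExtension 𝔽 L p) where
  open ValuedExtension V public
  open FiniteField 𝔽 using (Fring; _≟F_) renaming (1≉0 to F-1≉0)
  private module F = CommutativeRing Fring
  open CommutativeRing L hiding (zero)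
  open RingOps L
  open IsFieldRing isField public
  open IntegerSolver L
  open Sums L
  open PowerSeries L using (_⊛_; const; ⊛-cong)
  open Evaluation L
  open Roots L
  open Algebra.Properties.Ring ring using (-0#≈0#)
  open Relation.Binary.Reasoning.Setoid setoid

  no-zero-divisors : ∀ x y → x * y ≈ 0# → ¬ (x ≈ 0#) → y ≈ 0#
  no-zero-divisors x y xy≈0 x≉0 = begin
    y              ≈⟨ *-identityˡ y ⟨
    1# * y         ≈⟨ *-congʳ x*x⁻¹≈1 ⟨
    x * x⁻¹ * y    ≈⟨ solve 3 (λ x i y → x :* i :* y := i :* (x :* y)) refl x x⁻¹ y ⟩
    x⁻¹ * (x * y)  ≈⟨ *-congˡ xy≈0 ⟩
    x⁻¹ * 0#       ≈⟨ zeroʳ _ ⟩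
    0#             ∎
    where
    x⁻¹ = proj₁ (inverse x x≉0)
    x*x⁻¹≈1 = proj₂ (inverse x x≉0)

  pow-nonzero : ∀ {x} n → ¬ (x ≈ 0#) → ¬ (pow x n ≈ 0#)
  pow-nonzero zero    x≉0 = 1≉0
  pow-nonzero (suc n) x≉0 e = pow-nonzero n x≉0 (no-zero-divisors _ _ (trans (*-comm _ _) e) x≉0)

  *-nonzero : ∀ {x y} → ¬ (x ≈ 0#) → ¬ (y ≈ 0#) → ¬ (x * y ≈ 0#)
  *-nonzero x≉0 y≉0 e = y≉0 (no-zero-divisors _ _ e x≉0)

  []-0 : [ F.0# ] ≈ 0#
  []-0 = begin
    [ F.0# ]                          ≈⟨ solve 1 (λ u → u := (u :+ u) :- u) refl [ F.0# ] ⟩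
    ([ F.0# ] + [ F.0# ]) - [ F.0# ]  ≈⟨ +-congʳ (trans (sym ([]-+ F.0# F.0#)) ([]-cong (F.+-identityˡ F.0#))) ⟩
    [ F.0# ] - [ F.0# ]               ≈⟨ -‿inverseʳ _ ⟩
    0#                                ∎

  []-neg : ∀ x → [ F.- x ] ≈ - [ x ]
  []-neg x = begin
    [ F.- x ]                      ≈⟨ solve 2 (λ u v → u := (u :+ v) :- v) refl [ F.- x ] [ x ] ⟩
    ([ F.- x ] + [ x ]) - [ x ]    ≈⟨ +-congʳ (trans (sym ([]-+ (F.- x) x)) (trans ([]-cong (F.-‿inverseˡ x)) []-0)) ⟩
    0# - [ x ]                     ≈⟨ +-identityˡ _ ⟩
    - [ x ]                        ∎

  z≉0 : ¬ (z ≈ 0#)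
  z≉0 e = 1≉0 (trans (sym zθ≈1) (trans (*-congʳ e) (zeroˡ θ)))

  θ^z^ : ∀ n → pow θ n * pow z n ≈ 1#
  θ^z^ n = trans (sym (pow-distrib θ z n)) (trans (pow-cong n (trans (*-comm θ z) zθ≈1)) (pow-1 n))

  θ≉0 : ¬ (θ ≈ 0#)
  θ≉0 e = 1≉0 (trans (sym zθ≈1) (trans (*-congˡ e) (zeroʳ z)))

  θ^z^+ : ∀ m n → pow θ m * pow z (m ℕ.+ n) ≈ pow z n
  θ^z^+ m n = begin
    pow θ m * pow z (m ℕ.+ n)        ≈⟨ *-congˡ (pow-+ z m n) ⟩
    pow θ m * (pow z m * pow z n)    ≈⟨ *-assoc _ _ _ ⟨
    pow θ m * pow z m * pow z n      ≈⟨ *-congʳ (θ^z^ m) ⟩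
    1# * pow z n                     ≈⟨ *-identityˡ _ ⟩
    pow z n                          ∎

  θ^z^∸ : ∀ {m n} → m ≤ n → pow θ m * pow z n ≈ pow z (n ∸ m)
  θ^z^∸ {m} {n} m≤n = trans (*-congˡ (reflexive (≡.cong (pow z) (≡.sym (ℕₚ.m+[n∸m]≡n m≤n))))) (θ^z^+ m (n ∸ m))

  𝒪-0 : 𝒪 0#
  𝒪-0 = 𝒪-cong []-0 (𝒪-[] F.0#)

  𝒪-1 : 𝒪 1#
  𝒪-1 = 𝒪-cong []-1 (𝒪-[] F.1#)

  𝒪-neg : ∀ {x} → 𝒪 x → 𝒪 (- x)
  𝒪-neg {x} h = 𝒪-cong (trans (*-congʳ (trans ([]-neg F.1#) (-‿cong []-1))) (solve 1 (λ x → :- :1 :* x := :- x) refl x)) (𝒪-* (𝒪-[] (F.- F.1#)) h)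

  𝒪-pow : ∀ {x} n → 𝒪 x → 𝒪 (pow x n)
  𝒪-pow zero    h = 𝒪-1
  𝒪-pow (suc n) h = 𝒪-* (𝒪-pow n h) h

  record O (B : ℕ) (x : Carrier) : Set (a ⊔ ℓ ⊔ p) where
    constructor small
    field
      cofactor   : Carrier
      cofactor-𝒪 : 𝒪 cofactor
      factors    : x ≈ pow z B * cofactor

  O-cong : ∀ {B x y} → x ≈ y → O B x → O B y
  O-cong e (small w h v) = small w h (trans (sym e) v)

  O-+ : ∀ {B x y} → O B x → O B y → O B (x + y)
  O-+ (small u h e) (small u′ h′ e′) = small (u + u′) (𝒪-+ h h′) (trans (+-cong e e′) (sym (distribˡ _ _ _)))

  O-neg : ∀ {B x} → O B x → O B (- x)
  O-neg {B} (small u h e) = small (- u) (𝒪-neg h) (trans (-‿cong e) (solve 2 (λ p u → :- (p :* u) := p :* (:- u)) refl (pow z B) u))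

  O-* : ∀ {B B′ x y} → O B x → O B′ y → O (B ℕ.+ B′) (x * y)
  O-* {B} {B′} (small u h e) (small u′ h′ e′) = small (u * u′) (𝒪-* h h′)
    (trans (*-cong e e′) (trans (solve 4 (λ p u p′ u′ → (p :* u) :* (p′ :* u′) := (p :* p′) :* (u :* u′)) refl (pow z B) u (pow z B′) u′) (*-congʳ (sym (pow-+ z B B′)))))

  O-≤ : ∀ {B B′ x} → B′ ≤ B → O B x → O B′ x
  O-≤ {B} {B′} le (small u h e) = small (pow z (B ∸ B′) * u) (𝒪-* (𝒪-pow (B ∸ B′) 𝒪-z) h)
    (trans e (trans (*-congʳ (trans (reflexive (≡.cong (pow z) (≡.sym (ℕₚ.m+[n∸m]≡n le)))) (pow-+ z B′ (B ∸ B′)))) (*-assoc _ _ _)))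

  O-0 : ∀ {B} → O B 0#
  O-0 = small 0# 𝒪-0 (sym (zeroʳ _))

  O-z^ : ∀ B → O B (pow z B)
  O-z^ B = small 1# 𝒪-1 (sym (*-identityʳ _))

  𝒪⇒O : ∀ {x} → 𝒪 x → O 0 x
  𝒪⇒O h = small _ h (sym (*-identityˡ _))

  O⇒𝒪 : ∀ {B x} → O B x → 𝒪 x
  O⇒𝒪 {B} (small u h e) = 𝒪-cong (sym e) (𝒪-* (𝒪-pow B 𝒪-z) h)

  O-scale : ∀ {B x y} → 𝒪 y → O B x → O B (y * x)
  O-scale h h′ = O-* (𝒪⇒O h) h′

  O-θ^ : ∀ {B x} k → k ≤ B → O B x → O (B ∸ k) (pow θ k * x)
  O-θ^ k k≤B (small u h e) = small u h (trans (*-congˡ e) (trans (sym (*-assoc _ _ _)) (*-congʳ (θ^z^∸ k≤B))))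

  O-Σ : ∀ n {B f} → (∀ i → i < n → O B (f i)) → O B (sumTo n f)
  O-Σ zero    h = O-0
  O-Σ (suc n) h = O-+ (O-Σ n (λ i i<n → h i (ℕₚ.m<n⇒m<1+n i<n))) (h n ℕₚ.≤-refl)

  -- Convergence to 0 in the z-adic topology. Limits are never formed for the values: a relation
  -- between infinite products is stated as a null sequence of its values at partial products.
  Null : (ℕ → Carrier) → Set (a ⊔ ℓ ⊔ p)
  Null x = ∀ B → ∃ λ J₀ → ∀ J → J₀ ≤ J → O B (x J)

  Null-cong : ∀ {x y} → (∀ J → x J ≈ y J) → Null x → Null y
  Null-cong {x} {y} e h B = proj₁ (h B) , λ J le → O-cong (e J) (proj₂ (h B) J le)

  Null-scale : ∀ {x} (y : ℕ → Carrier) → (∀ J → 𝒪 (y J)) → Null x → Null (λ J → y J * x J)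
  Null-scale y hy h B = proj₁ (h B) , λ J le → O-scale (hy J) (proj₂ (h B) J le)

  Null-θ^ : ∀ {x} k → Null x → Null (λ J → pow θ k * x J)
  Null-θ^ {x} k h B = proj₁ (h (k ℕ.+ B)) , λ J le →
    ≡.subst (λ m → O m (pow θ k * x J)) (ℕₚ.m+n∸m≡n k B) (O-θ^ k (ℕₚ.m≤m+n k B) (proj₂ (h (k ℕ.+ B)) J le))

  Null-shift : ∀ {x} k → Null x → Null (λ J → x (k ℕ.+ J))
  Null-shift k h B = proj₁ (h B) , λ J le → proj₂ (h B) (k ℕ.+ J) (ℕₚ.≤-trans le (ℕₚ.m≤n+m J k))

  Null-pow : ∀ {x} n → Null x → Null (λ J → pow (x J) (suc n))
  Null-pow n h B = proj₁ (h B) , λ J le → O-scale (𝒪-pow n (O⇒𝒪 (proj₂ (h B) J le))) (proj₂ (h B) J le)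

  frobenius^ : ∀ k x y → pow (x + y) (q ^ k) ≈ pow x (q ^ k) + pow y (q ^ k)
  frobenius^ zero    x y = trans (*-identityˡ _) (+-cong (sym (*-identityˡ _)) (sym (*-identityˡ _)))
  frobenius^ (suc k) x y = begin
    pow (x + y) (q ℕ.* q ^ k)                          ≈⟨ pow-* (x + y) q (q ^ k) ⟩
    pow (pow (x + y) (q ^ k)) q                        ≈⟨ pow-cong q (frobenius^ k x y) ⟩
    pow (pow x (q ^ k) + pow y (q ^ k)) q              ≈⟨ frobenius _ _ ⟩
    pow (pow x (q ^ k)) q + pow (pow y (q ^ k)) q      ≈⟨ +-cong (pow-* x q (q ^ k)) (pow-* y q (q ^ k)) ⟨
    pow x (q ℕ.* q ^ k) + pow y (q ℕ.* q ^ k)          ∎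

  1≤q : 1 ≤ q
  1≤q = ℕₚ.≤-trans (s≤s z≤n) 2≤q

  q^≥1 : ∀ k → 1 ≤ q ^ k
  q^≥1 k = ℕₚ.m^n>0 q {{ℕ.>-nonZero 1≤q}} k

  pow-zero : ∀ {n} → 1 ≤ n → pow 0# n ≈ 0#
  pow-zero {suc n} _ = zeroʳ _

  frobRel : ℕ → FilteredRelation L L ℓ
  frobRel k = record
    { T = λ _ x y → y ≈ pow x (q ^ k)
    ; T-cong = λ p p′ t → trans (sym p′) (trans t (pow-cong (q ^ k) p))
    ; T-mono = λ _ t → t
    ; T-0 = sym (pow-zero (q^≥1 k))
    ; T-1 = sym (pow-1 (q ^ k))
    ; T-+ = λ t t′ → trans (+-cong t t′) (sym (frobenius^ k _ _))
    ; T-* = λ t t′ → trans (*-cong t t′) (sym (pow-distrib _ _ (q ^ k)))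
    -- The sign is obtained from additivity at x + (- x) = 0, which treats even and odd q alike.
    ; T-neg = λ {_} {x} {y} t → begin
        - y                                              ≈⟨ -‿cong t ⟩
        - pow x (q ^ k)                                  ≈⟨ +-identityʳ _ ⟨
        - pow x (q ^ k) + 0#                             ≈⟨ +-congˡ (trans (pow-cong (q ^ k) (-‿inverseʳ x)) (pow-zero (q^≥1 k))) ⟨
        - pow x (q ^ k) + pow (x - x) (q ^ k)            ≈⟨ +-congˡ (frobenius^ k x (- x)) ⟩
        - pow x (q ^ k) + (pow x (q ^ k) + pow (- x) (q ^ k)) ≈⟨ solve 2 (λ u v → :- u :+ (u :+ v) := v) refl _ _ ⟩
        pow (- x) (q ^ k)                                ∎ }

  -- Elements of 𝔽_q[z] of degree at most w. The degree in z plays the role of a height.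
  record Bounded (w : ℕ) (x : Carrier) : Set ℓ where
    constructor bounded
    field
      digits : ℕ → F.Carrier
      digits-high : ∀ N → w < N → digits N F.≈ F.0#
      expansion : x ≈ evalTo (suc w) ([_] ∘ digits) z

  constRel : FilteredRelation Fring L ℓ
  constRel = record
    { T = λ _ x y → y ≈ [ x ]
    ; T-cong = λ p p′ t → trans (sym p′) (trans t ([]-cong p))
    ; T-mono = λ _ t → t
    ; T-0 = sym []-0
    ; T-1 = sym []-1
    ; T-+ = λ t t′ → trans (+-cong t t′) (sym ([]-+ _ _))
    ; T-* = λ t t′ → trans (*-cong t t′) (sym ([]-* _ _))
    ; T-neg = λ t → trans (-‿cong t) (sym ([]-neg _)) }

  private module PF = PowerSeries Fring

  []-⊛ : ∀ e e′ N → [ (e PF.⊛ e′) N ] ≈ (([_] ∘ e) ⊛ ([_] ∘ e′)) N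
  []-⊛ e e′ N = sym (RelationLemmas.T-⊛ constRel {0} {0} N (λ _ → refl) (λ _ → refl))

  private
    high-zero : ∀ {w} {e : ℕ → F.Carrier} → (∀ N → w < N → e N F.≈ F.0#) → ∀ i → suc w ≤ i → [ e i ] ≈ 0#
    high-zero h i le = trans ([]-cong (h i le)) []-0

  Bounded-cong : ∀ {w x y} → x ≈ y → Bounded w x → Bounded w y
  Bounded-cong p (bounded e h v) = bounded e h (trans (sym p) v)

  Bounded-≤ : ∀ {w w′ x} → w ≤ w′ → Bounded w x → Bounded w′ x
  Bounded-≤ le (bounded e h v) = bounded e (λ N lt → h N (ℕₚ.≤-<-trans le lt)) (trans v (sym (evalTo-extend ([_] ∘ e) z (s≤s le) (high-zero h))))

  Bounded-0 : ∀ {w} → Bounded w 0#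
  Bounded-0 {w} = bounded (λ _ → F.0#) (λ _ _ → F.refl) (sym (Σ-zero (suc w) (λ i _ → trans (*-congʳ []-0) (zeroˡ _))))

  Bounded-[] : ∀ {w} x → Bounded w [ x ]
  Bounded-[] {w} x = Bounded-≤ z≤n (bounded (PF.const x) (λ { (suc N) _ → F.refl }) (sym (trans (+-identityˡ _) (*-identityʳ _))))

  Bounded-+ : ∀ {w x y} → Bounded w x → Bounded w y → Bounded w (x + y)
  Bounded-+ {w} (bounded e h v) (bounded e′ h′ v′) = bounded (λ N → e N F.+ e′ N) (λ N lt → F.trans (F.+-cong (h N lt) (h′ N lt)) (F.+-identityˡ _))
    (trans (+-cong v v′) (trans (sym (evalTo-+ (suc w) _ _ z)) (Σ-cong′ (suc w) (λ N → *-congʳ (sym ([]-+ _ _))))))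

  Bounded-* : ∀ {w w′ x y} → Bounded w x → Bounded w′ y → Bounded (w ℕ.+ w′) (x * y)
  Bounded-* {w} {w′} (bounded e h v) (bounded e′ h′ v′) = bounded (e PF.⊛ e′) top
    (trans (*-cong v v′) (trans (sym (evalTo-⊛ (suc w) (suc w′) (suc w ℕ.+ suc w′) _ _ z ℕₚ.≤-refl (high-zero h) (high-zero h′)))
      (trans (Σ-cong′ (suc w ℕ.+ suc w′) (λ N → *-congʳ (sym ([]-⊛ e e′ N))))
        (evalTo-extend ([_] ∘ (e PF.⊛ e′)) z (s≤s (ℕₚ.+-monoʳ-≤ w (ℕₚ.n≤1+n w′))) (high-zero top)))))
    where
    top : ∀ N → w ℕ.+ w′ < N → (e PF.⊛ e′) N F.≈ F.0#
    top N lt = F.trans (F.reflexive (PF.⊛-def e e′ N)) (Sums.Σ-zero Fring (suc N) term)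
      where
      term : ∀ i → i < suc N → e i F.* e′ (N ∸ i) F.≈ F.0#
      term i i≤N with w ℕ.<? i
      ... | yes w<i = F.trans (F.*-congʳ (h i w<i)) (F.zeroˡ _)
      ... | no w≮i  = F.trans (F.*-congˡ (h′ (N ∸ i) (ℕₚ.m+n≤o⇒m≤o∸n (suc w′)
          (ℕₚ.≤-trans (ℕₚ.≤-trans (ℕₚ.+-monoʳ-≤ (suc w′) (ℕₚ.≮⇒≥ w≮i)) (s≤s (ℕₚ.≤-reflexive (ℕₚ.+-comm w′ w)))) lt)))) (F.zeroʳ _)

  Bounded-neg : ∀ {w x} → Bounded w x → Bounded w (- x)
  Bounded-neg {w} {x} h = Bounded-cong (trans (*-congʳ (trans ([]-neg F.1#) (-‿cong []-1))) (solve 1 (λ x → :- :1 :* x := :- x) refl x)) (Bounded-* {0} (Bounded-[] (F.- F.1#)) h)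

  Bounded-z^ : ∀ k → Bounded k (pow z k)
  Bounded-z^ zero    = Bounded-cong []-1 (Bounded-[] F.1#)
  Bounded-z^ (suc k) = ≡.subst (λ m → Bounded m (pow z k * z)) (ℕₚ.+-comm k 1)
    (Bounded-* (Bounded-z^ k) (bounded PF.var (λ { (suc (suc N)) _ → F.refl ; (suc zero) (s≤s ()) })
      (sym (trans (+-cong (trans (+-identityˡ _) (trans (*-congʳ []-0) (zeroˡ _))) (*-cong []-1 (*-identityˡ z))) (trans (+-identityˡ _) (*-identityˡ z))))))

  boundedRel : FilteredRelation L L ℓ
  boundedRel = record
    { T = λ w x _ → Bounded w x
    ; T-cong = λ p _ → Bounded-cong p
    ; T-mono = Bounded-≤
    ; T-0 = Bounded-0
    ; T-1 = Bounded-z^ 0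
    ; T-+ = Bounded-+
    ; T-* = Bounded-*
    ; T-neg = Bounded-neg }

  Bounded⇒𝒪 : ∀ {w x} → Bounded w x → 𝒪 x
  Bounded⇒𝒪 {w} (bounded e h v) = 𝒪-cong (sym v) (O⇒𝒪 (O-Σ (suc w) {0} (λ i _ → 𝒪⇒O (𝒪-* (𝒪-[] (e i)) (𝒪-pow i 𝒪-z)))))

  -- The Liouville inequality of this setting: a nonzero polynomial in z of degree at most w is not
  -- divisible by z^{w+1} in 𝒪.
  Bounded-small⇒≈0 : ∀ {w x} → Bounded w x → O (suc w) x → x ≈ 0#
  Bounded-small⇒≈0 {w} (bounded e h v) (small y 𝒪y x≈) = trans v (Σ-zero (suc w) (λ N N<W →
    trans (*-congʳ (trans ([]-cong (separation (suc w) e (suc w) 𝒪y (trans (sym v) x≈) N N<W N<W)) []-0)) (zeroˡ _)))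

  evaluation-injective : ∀ W (e : ℕ → F.Carrier) → evalTo W ([_] ∘ e) z ≈ 0# → ∀ N → N < W → e N F.≈ F.0#
  evaluation-injective W e v N N<W = separation W e W 𝒪-0 (trans v (sym (zeroʳ _))) N N<W N<W

  -- An element with an explicit expansion vanishes exactly when its digits do, and those have
  -- decidable equality.
  Bounded-stable : ∀ {w x} → Bounded w x → ¬ ¬ (x ≈ 0#) → x ≈ 0#
  Bounded-stable {w} (bounded e h v) nn = trans v (Σ-zero (suc w) (λ N N<W → trans (*-congʳ (trans ([]-cong
    (decidable-stable (e N ≟F F.0#) (λ ne → nn (λ x≈0 → ne (evaluation-injective (suc w) e (trans (sym v) x≈0) N N<W))))) []-0)) (zeroˡ _)))

  -- The spacing s is a parameter because the s-th powers of the points `node 1` are the points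
  -- `node s`.
  node : ℕ → ℕ → Carrier
  node s i = pow z (i ℕ.* s)

  node-distinct : ∀ s → 1 ≤ s → ∀ i j → i < j → ¬ (node s i - node s j ≈ 0#)
  node-distinct s 1≤s i j i<j e = F-1≉0 (F.trans (F.sym δ-diag) δ-zero)
    where
    I = i ℕ.* s
    -- The digit sequence of z^I. If z^I were equal to the higher power z^{j s}, separation would
    -- force its digit 1 to be 0.
    δ : ℕ → F.Carrier
    δ N with N ℕ.≟ I
    ... | yes _ = F.1#
    ... | no _  = F.0#
    δ-diag : δ I F.≈ F.1#
    δ-diag with I ℕ.≟ I
    ... | yes _ = F.refl
    ... | no ne = ⊥-elim (ne ≡.refl)
    δ-off : ∀ N → ¬ (N ≡ I) → δ N F.≈ F.0#
    δ-off N ne with N ℕ.≟ I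
    ... | yes eq = ⊥-elim (ne eq)
    ... | no _   = F.refl
    value : evalTo (suc I) ([_] ∘ δ) z ≈ pow z (j ℕ.* s) * 1#
    value = begin
      evalTo (suc I) ([_] ∘ δ) z ≈⟨ Σ-single (suc I) I _ ℕₚ.≤-refl (λ N _ ne → trans (*-congʳ (trans ([]-cong (δ-off N ne)) []-0)) (zeroˡ _)) ⟩
      [ δ I ] * pow z I          ≈⟨ *-congʳ (trans ([]-cong δ-diag) []-1) ⟩
      1# * pow z I               ≈⟨ solve 2 (λ u v → :1 :* u := (u :- v) :+ v :* :1) refl (pow z I) (pow z (j ℕ.* s)) ⟩
      (node s i - node s j) + pow z (j ℕ.* s) * 1# ≈⟨ trans (+-congʳ e) (+-identityˡ _) ⟩
      pow z (j ℕ.* s) * 1#       ∎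
    δ-zero : δ I F.≈ F.0#
    δ-zero = separation (suc I) δ (j ℕ.* s) 𝒪-1 value I ℕₚ.≤-refl (ℕₚ.*-monoˡ-< s {{ℕ.>-nonZero 1≤s}} i<j)

  listOf : ℕ → (ℕ → Carrier) → List Carrier
  listOf zero    c = []
  listOf (suc n) c = c 0 ∷ listOf n (c ∘ suc)

  getD-listOf : ∀ n c l → l < n → getD (listOf n c) l ≈ c l
  getD-listOf (suc n) c zero    _         = refl
  getD-listOf (suc n) c (suc l) (s≤s l<n) = getD-listOf n (c ∘ suc) l l<n

  getD-listOf-O : ∀ n c l {B} → (l < n → O B (c l)) → O B (getD (listOf n c) l)
  getD-listOf-O zero    c l       h = O-0
  getD-listOf-O (suc n) c zero    h = h (s≤s z≤n)
  getD-listOf-O (suc n) c (suc l) h = getD-listOf-O n (c ∘ suc) l (h ∘ s≤s)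

  horner-listOf : ∀ n c α → horner (listOf n c) α ≈ evalTo n c α
  horner-listOf zero    c α = refl
  horner-listOf (suc n) c α = trans (+-congˡ (*-congˡ (horner-listOf n (c ∘ suc) α))) (sym (evalTo-suc n c α))

  -- A Schwarz lemma, by repeated synthetic division at the nodes θ^{q^k}.
  schwarz : ∀ M A w cs → (∀ k → k < M → q ^ k ≤ A) →
    (∀ l → M ≤ l → O (w ℕ.+ l ℕ.* A) (getD cs l)) →
    (∀ k → k < M → O w (horner cs (pow θ (q ^ k)))) →
    M ℕ.* A ≤ w → ∀ l → O (w ∸ M ℕ.* A) (getD cs l)
  schwarz zero    A w cs _ tail values _ l = O-≤ (ℕₚ.m≤m+n w _) (tail l z≤n)
  schwarz (suc M) A w cs nodes tail values le = conclude
    where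
    Q = q ^ M
    α = pow θ Q
    Q≤A : Q ≤ A
    Q≤A = nodes M ℕₚ.≤-refl
    quot = quotient α cs
    -- Every Horner step multiplies by α, whose size costs Q ≤ A; the surplus A per index in the
    -- tail bound pays for it.
    horner-small : ∀ n ds l → length ds ≤ n → (∀ j → O (w ℕ.+ (suc l ℕ.+ j) ℕ.* A) (getD ds j)) → O (w ℕ.+ suc l ℕ.* A) (horner ds α)
    horner-small n       []       l len h = O-0
    horner-small (suc n) (d ∷ ds) l (s≤s len) h = O-+
      (≡.subst (λ k → O (w ℕ.+ k ℕ.* A) d) (ℕₚ.+-identityʳ (suc l)) (h 0))
      (O-≤ bound (O-θ^ Q Q≤ (horner-small n ds (suc l) len (λ j → ≡.subst (λ k → O (w ℕ.+ k ℕ.* A) (getD ds j)) (ℕₚ.+-suc (suc l) j) (h (suc j))))))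
      where
      Q≤ : Q ≤ w ℕ.+ suc (suc l) ℕ.* A
      Q≤ = ℕₚ.≤-trans Q≤A (ℕₚ.≤-trans (ℕₚ.m≤m+n A _) (ℕₚ.m≤n+m _ w))
      bound : w ℕ.+ suc l ℕ.* A ≤ w ℕ.+ suc (suc l) ℕ.* A ∸ Q
      bound = ℕₚ.m+n≤o⇒m≤o∸n _ (ℕₚ.≤-trans (ℕₚ.+-monoʳ-≤ _ Q≤A) (ℕₚ.≤-reflexive (≡.trans (ℕₚ.+-assoc w _ A) (≡.cong (w ℕ.+_) (ℕₚ.+-comm _ A)))))
    getD-drop : ∀ cs l j → getD (Data.List.drop l cs) j ≡ getD cs (l ℕ.+ j)
    getD-drop cs       zero    j = ≡.refl
    getD-drop []       (suc l) j = ≡.refl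
    getD-drop (c ∷ cs) (suc l) j = getD-drop cs l j
    quot-tail : ∀ l → M ≤ l → O (w ℕ.+ l ℕ.* A) (getD quot l)
    quot-tail l M≤l = O-≤ (ℕₚ.+-monoʳ-≤ w (ℕₚ.m≤n+m _ A)) (O-cong (sym (getD-quotient α cs l))
      (horner-small _ (Data.List.drop (suc l) cs) l ℕₚ.≤-refl
        (λ j → ≡.subst (O _) (≡.sym (getD-drop cs (suc l) j)) (tail (suc l ℕ.+ j) (s≤s (ℕₚ.≤-trans M≤l (ℕₚ.m≤m+n l j)))))))
    -- Division by β - α loses nothing: for exponents q^k < Q one has z^Q (β - α) = -(1 - z^{e+1}),
    -- a unit of 𝒪, so β - α has the large absolute value of θ^Q.
    quot-values : ∀ k → k < M → O w (horner quot (pow θ (q ^ k)))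
    quot-values k k<M = O-cong recover (O-scale (𝒪-* (𝒪-neg 𝒪-1) (𝒪-* 𝒪u (𝒪-pow Q 𝒪-z))) difference)
      where
      β = pow θ (q ^ k)
      y = horner quot β
      q^k<Q : q ^ k < Q
      q^k<Q = ℕₚ.^-monoʳ-< q 2≤q k<M
      e = Q ∸ suc (q ^ k)
      Q≡ : q ^ k ℕ.+ suc e ≡ Q
      Q≡ = ≡.trans (ℕₚ.+-suc (q ^ k) e) (ℕₚ.m+[n∸m]≡n q^k<Q)
      u = proj₁ (𝒪-geometric e)
      𝒪u = proj₁ (proj₂ (𝒪-geometric e))
      geo = proj₂ (proj₂ (𝒪-geometric e))
      difference : O w ((β - α) * y)
      difference = O-cong (sym (quotient-law cs α β)) (O-+ (values k (ℕₚ.m<n⇒m<1+n k<M)) (O-neg (values M ℕₚ.≤-refl)))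
      scaled : pow z Q * (β - α) ≈ - (1# - pow z (suc e))
      scaled = begin
        pow z Q * (β - α)               ≈⟨ solve 3 (λ p b a → p :* (b :- a) := b :* p :- a :* p) refl (pow z Q) β α ⟩
        β * pow z Q - α * pow z Q       ≈⟨ +-cong (trans (*-congˡ (reflexive (≡.cong (pow z) (≡.sym Q≡)))) (θ^z^+ (q ^ k) (suc e))) (-‿cong (θ^z^ Q)) ⟩
        pow z (suc e) - 1#              ≈⟨ solve 2 (λ p o → p :- o := :- (o :- p)) refl (pow z (suc e)) 1# ⟩
        - (1# - pow z (suc e))          ∎
      recover : - 1# * (u * pow z Q) * ((β - α) * y) ≈ y
      recover = begin
        - 1# * (u * pow z Q) * ((β - α) * y)      ≈⟨ solve 4 (λ u p d y → (:- :1) :* (u :* p) :* (d :* y) := (:- (u :* (p :* d))) :* y) refl u (pow z Q) (β - α) y ⟩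
        - (u * (pow z Q * (β - α))) * y           ≈⟨ *-congʳ (-‿cong (*-congˡ scaled)) ⟩
        - (u * - (1# - pow z (suc e))) * y        ≈⟨ solve 3 (λ u g y → (:- (u :* (:- g))) :* y := (g :* u) :* y) refl u (1# - pow z (suc e)) y ⟩
        (1# - pow z (suc e)) * u * y              ≈⟨ trans (*-congʳ geo) (*-identityˡ y) ⟩
        y                                         ∎
    MA≤w : M ℕ.* A ≤ w
    MA≤w = ℕₚ.≤-trans (ℕₚ.m≤n+m _ A) le
    quot-small : ∀ l → O (w ∸ M ℕ.* A) (getD quot l)
    quot-small = schwarz M A w quot (λ k k<M → nodes k (ℕₚ.m<n⇒m<1+n k<M)) quot-tail quot-values MA≤w
    new : ℕ
    new = w ∸ suc M ℕ.* A
    new≡ : new ≡ w ∸ M ℕ.* A ∸ A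
    new≡ = ≡.trans (≡.cong (w ∸_) (ℕₚ.+-comm A (M ℕ.* A))) (≡.sym (ℕₚ.∸-+-assoc w (M ℕ.* A) A))
    A≤ : A ≤ w ∸ M ℕ.* A
    A≤ = ℕₚ.m+n≤o⇒m≤o∸n A le
    -- Undoing the division multiplies by α once. This is the only loss, at most A per node, whence
    -- the total M A.
    α-small : ∀ l → O new (α * getD quot l)
    α-small l = ≡.subst (λ m → O m (α * getD quot l)) (≡.sym new≡)
      (O-≤ (ℕₚ.∸-monoʳ-≤ (w ∸ M ℕ.* A) Q≤A) (O-θ^ Q (ℕₚ.≤-trans Q≤A A≤) (quot-small l)))
    conclude : ∀ l → O new (getD cs l)
    conclude zero    = O-cong (sym (coefficient₀-from-quotient α cs)) (O-+ (O-≤ (ℕₚ.m∸n≤m w (suc M ℕ.* A)) (values M ℕₚ.≤-refl)) (O-neg (α-small 0)))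
    conclude (suc l) = O-cong (sym (coefficient-from-quotient α cs l))
      (O-+ (≡.subst (λ m → O m (getD quot l)) (≡.sym new≡) (O-≤ (ℕₚ.m∸n≤m _ A) (quot-small l)) ) (O-neg (α-small (suc l))))

-- Formal series in t and x over 𝔽_q.

module FormalSeries {q : ℕ} (𝔽 : FiniteField q) where
  open FiniteField 𝔽 using (Fring; _≟F_; inv; inv-r) renaming (1≉0 to F-1≉0)
  module F = CommutativeRing Fring
  module PF = PowerSeries Fring
  𝔽[[t]] = PF.PS
  module P = CommutativeRing 𝔽[[t]]
  module PP = PowerSeries 𝔽[[t]]
  𝔽[[t]][[x]] = PP.PS
  module B = CommutativeRing 𝔽[[t]][[x]]
  private
    module BO = RingOps 𝔽[[t]][[x]]
    module BS = PowerSeries 𝔽[[t]][[x]]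
    module PO = RingOps 𝔽[[t]]

  t x : B.Carrier
  t = PP.const PF.var
  x = PP.var

  F-no-zero-divisors : ∀ u v → u F.* v F.≈ F.0# → ¬ (u F.≈ F.0#) → v F.≈ F.0#
  F-no-zero-divisors u v e u≉0 = F.trans (F.sym (F.*-identityˡ v)) (F.trans (F.*-congʳ (F.sym (F.trans (F.*-comm (inv u) u) (inv-r u u≉0))))
    (F.trans (F.*-assoc _ _ _) (F.trans (F.*-congˡ e) (F.zeroʳ _))))

  private
    least-nonzero : ∀ (g : ℕ → F.Carrier) k → (∀ i → i < k → g i F.≈ F.0#) ⊎ (∃ λ n → ¬ (g n F.≈ F.0#) × (∀ i → i < n → g i F.≈ F.0#))
    least-nonzero g zero    = inj₁ (λ _ ())
    least-nonzero g (suc k) with least-nonzero g k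
    ... | inj₂ found = inj₂ found
    ... | inj₁ below with g k ≟F F.0#
    ...   | no ne  = inj₂ (k , ne , below)
    ...   | yes eq = inj₁ (λ i i<1+k → case i i<1+k)
      where
      case : ∀ i → i < suc k → g i F.≈ F.0#
      case i i<1+k with i ℕ.≟ k
      ... | yes ≡.refl = eq
      ... | no i≢k     = below i (ℕₚ.≤∧≢⇒< (ℕₚ.≤-pred i<1+k) i≢k)

  least-index : ∀ (g : ℕ → F.Carrier) k → ¬ (g k F.≈ F.0#) → ∃ λ n → ¬ (g n F.≈ F.0#) × (∀ i → i < n → g i F.≈ F.0#)
  least-index g k ne with least-nonzero g (suc k)
  ... | inj₂ found = found
  ... | inj₁ below = ⊥-elim (ne (below k ℕₚ.≤-refl))

  P-1≉0 : ¬ (P.1# P.≈ P.0#)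
  P-1≉0 h = F-1≉0 (h 0)

  P-stable : ∀ f → ¬ ¬ (f P.≈ P.0#) → f P.≈ P.0#
  P-stable f nn n = decidable-stable (f n ≟F F.0#) (λ ne → nn (λ h → ne (h n)))

  -- The negative hypothesis on f yields no index of a nonzero coefficient. So the argument runs
  -- backwards: a nonzero coefficient of g, taken at least index, would make every coefficient of f
  -- vanish.
  P-no-zero-divisors : ∀ f g → f P.* g P.≈ P.0# → ¬ (f P.≈ P.0#) → g P.≈ P.0#
  P-no-zero-divisors f g fg≈0 f≉0 n = decidable-stable (g n ≟F F.0#) λ ne → f≉0 (f-zero (least-index g n ne))
    where
    f-zero : (∃ λ n₀ → ¬ (g n₀ F.≈ F.0#) × (∀ i → i < n₀ → g i F.≈ F.0#)) → f P.≈ P.0#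
    f-zero (n₀ , ne , below) m = all-below (suc m) m ℕₚ.≤-refl
      where
      all-below : ∀ k i → i < k → f i F.≈ F.0#
      all-below (suc k) i i<1+k with i ℕ.≟ k
      ... | no i≢k     = all-below k i (ℕₚ.≤∧≢⇒< (ℕₚ.≤-pred i<1+k) i≢k)
      ... | yes ≡.refl = F-no-zero-divisors (g n₀) (f i) (F.trans (F.*-comm _ _) (F.trans (F.sym at-i) (fg≈0 (i ℕ.+ n₀)))) ne
        where
        at-i : (f P.* g) (i ℕ.+ n₀) F.≈ f i F.* g n₀
        at-i = F.trans (F.reflexive (PF.⊛-def f g (i ℕ.+ n₀))) (F.trans
          (Sums.Σ-single Fring (suc (i ℕ.+ n₀)) i _ (s≤s (ℕₚ.m≤m+n i n₀)) off)
          (F.*-congˡ (F.reflexive (≡.cong g (ℕₚ.m+n∸m≡n i n₀)))))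
          where
          off : ∀ j → j < suc (i ℕ.+ n₀) → ¬ (j ≡ i) → f j F.* g (i ℕ.+ n₀ ∸ j) F.≈ F.0#
          off j j≤ j≢i with j ℕ.<? i
          ... | yes j<i = F.trans (F.*-congʳ (all-below i j j<i)) (F.zeroˡ _)
          ... | no j≮i  = F.trans (F.*-congˡ (below _ lt)) (F.zeroʳ _)
            where
            lt : i ℕ.+ n₀ ∸ j < n₀
            lt = ℕₚ.+-cancelˡ-< j _ _ (ℕₚ.≤-<-trans (ℕₚ.≤-reflexive (ℕₚ.m+[n∸m]≡n (ℕₚ.≤-pred j≤)))
              (ℕₚ.+-monoˡ-< n₀ (ℕₚ.≤∧≢⇒< (ℕₚ.≮⇒≥ j≮i) (j≢i ∘ ≡.sym))))

  FiniteP : P.Carrier → Set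
  FiniteP f = ∃ λ b → ∀ i → b ≤ i → f i F.≈ F.0#

  FiniteP-cong : ∀ {f g} → f P.≈ g → FiniteP f → FiniteP g
  FiniteP-cong e (b , h) = b , λ i le → F.trans (F.sym (e i)) (h i le)

  FiniteP-0 : FiniteP P.0#
  FiniteP-0 = 0 , λ _ _ → F.refl

  FiniteP-1 : FiniteP P.1#
  FiniteP-1 = 1 , λ { (suc _) _ → F.refl }

  FiniteP-+ : ∀ {f g} → FiniteP f → FiniteP g → FiniteP (f P.+ g)
  FiniteP-+ (b , h) (b′ , h′) = b ℕ.⊔ b′ , λ i le → F.trans (F.+-cong (h i (ℕₚ.m⊔n≤o⇒m≤o b b′ le)) (h′ i (ℕₚ.m⊔n≤o⇒n≤o b b′ le))) (F.+-identityˡ _)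

  FiniteP-* : ∀ {f g} → FiniteP f → FiniteP g → FiniteP (f P.* g)
  FiniteP-* (b , h) (b′ , h′) = b ℕ.+ b′ , ⊛-bounded Fring h h′

  FiniteP-neg : ∀ {f} → FiniteP f → FiniteP (P.- f)
  FiniteP-neg (b , h) = b , λ i le → F.trans (F.-‿cong (h i le)) (Algebra.Properties.Ring.-0#≈0# F.ring)

  FiniteP-Σ : ∀ n {f : ℕ → P.Carrier} → (∀ i → i < n → FiniteP (f i)) → FiniteP (PO.sumTo n f)
  FiniteP-Σ zero    h = FiniteP-0
  FiniteP-Σ (suc n) h = FiniteP-+ (FiniteP-Σ n (λ i i<n → h i (ℕₚ.m<n⇒m<1+n i<n))) (h n ℕₚ.≤-refl)

  finiteRel : FilteredRelation 𝔽[[t]][[x]] 𝔽[[t]][[x]] 0ℓ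
  finiteRel = record
    { T = λ _ E _ → ∀ N → FiniteP (E N)
    ; T-cong = λ p _ h N → FiniteP-cong (p N) (h N)
    ; T-mono = λ _ h → h
    ; T-0 = λ _ → FiniteP-0
    ; T-1 = λ { zero → FiniteP-1 ; (suc _) → FiniteP-0 }
    ; T-+ = λ h h′ N → FiniteP-+ (h N) (h′ N)
    ; T-* = λ {_} {_} {E} {E′} h h′ N → FiniteP-cong (P.reflexive (≡.sym (PP.⊛-def E E′ N)))
        (FiniteP-Σ (suc N) (λ i _ → FiniteP-* (h i) (h′ (N ∸ i))))
    ; T-neg = λ h N → FiniteP-neg (h N) }

  modRel : ℕ → FilteredRelation 𝔽[[t]][[x]] 𝔽[[t]][[x]] 0ℓ
  modRel b = record
    { T = λ _ E E′ → ∀ N → N < b → E N P.≈ E′ N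
    ; T-cong = λ p p′ h N lt → P.trans (P.sym (p N)) (P.trans (h N lt) (p′ N))
    ; T-mono = λ _ h → h
    ; T-0 = λ _ _ → P.refl
    ; T-1 = λ _ _ → P.refl
    ; T-+ = λ h h′ N lt → P.+-cong (h N lt) (h′ N lt)
    ; T-* = λ {_} {_} {E} {E′} {G} {G′} h h′ N lt → P.trans (P.reflexive (PP.⊛-def E E′ N))
        (P.trans (Sums.Σ-cong 𝔽[[t]] (suc N) (λ i i≤N → P.*-cong (h i (ℕₚ.≤-<-trans (ℕₚ.≤-pred i≤N) lt)) (h′ (N ∸ i) (ℕₚ.≤-<-trans (ℕₚ.m∸n≤m N i) lt))))
          (P.reflexive (≡.sym (PP.⊛-def G G′ N))))
    ; T-neg = λ h N lt → P.-‿cong (h N lt) }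

  -- the Newton polygon lies above slope S: monomials x^N t^l with N + w < l S do not occur
  slopeRel : ℕ → FilteredRelation 𝔽[[t]][[x]] 𝔽[[t]][[x]] 0ℓ
  slopeRel S = record
    { T = λ w E _ → Slope w E
    ; T-cong = λ p _ h N l lt → F.trans (F.sym (p N l)) (h N l lt)
    ; T-mono = λ le h N l lt → h N l (ℕₚ.≤-<-trans (ℕₚ.+-monoʳ-≤ N le) lt)
    ; T-0 = λ _ _ _ → F.refl
    ; T-1 = λ { zero zero () ; zero (suc _) _ → F.refl ; (suc _) _ _ → F.refl }
    ; T-+ = λ h h′ N l lt → F.trans (F.+-cong (h N l lt) (h′ N l lt)) (F.+-identityˡ _)
    ; T-* = λ {w} {w′} {E} {E′} → slope-* w w′ E E′
    ; T-neg = λ h N l lt → F.trans (F.-‿cong (h N l lt)) (Algebra.Properties.Ring.-0#≈0# F.ring) }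
    where
    Slope : ℕ → B.Carrier → Set
    Slope w E = ∀ N l → N ℕ.+ w < l ℕ.* S → E N l F.≈ F.0#
    slope-* : ∀ w w′ E E′ → Slope w E → Slope w′ E′ → Slope (w ℕ.+ w′) (E B.* E′)
    slope-* w w′ E E′ h h′ N l lt = F.trans (P.reflexive (PP.⊛-def E E′ N) l)
      (F.trans (F.reflexive (PF.sumTo-at (suc N) (λ i → E i P.* E′ (N ∸ i)) l)) (Sums.Σ-zero Fring (suc N) outer))
      where
      outer : ∀ i → i < suc N → (E i P.* E′ (N ∸ i)) l F.≈ F.0#
      outer i i≤N = F.trans (F.reflexive (PF.⊛-def (E i) (E′ (N ∸ i)) l)) (Sums.Σ-zero Fring (suc l) inner)
        where
        inner : ∀ k → k < suc l → E i k F.* E′ (N ∸ i) (l ∸ k) F.≈ F.0#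
        inner k k≤l with (i ℕ.+ w) ℕ.<? (k ℕ.* S)
        ... | yes lt₁ = F.trans (F.*-congʳ (h i k lt₁)) (F.zeroˡ _)
        ... | no ge₁ with (N ∸ i ℕ.+ w′) ℕ.<? ((l ∸ k) ℕ.* S)
        ...   | yes lt₂ = F.trans (F.*-congˡ (h′ (N ∸ i) (l ∸ k) lt₂)) (F.zeroʳ _)
        -- If neither factor were known to vanish, adding the two inequalities would place the
        -- monomial on or above the slope, contrary to `lt`.
        ...   | no ge₂  = ⊥-elim (ℕₚ.<⇒≱ lt total)
          where
          open ℕₚ.≤-Reasoning
          total : l ℕ.* S ≤ N ℕ.+ (w ℕ.+ w′)
          total = begin
            l ℕ.* S                              ≡⟨ ≡.cong (ℕ._* S) (ℕₚ.m+[n∸m]≡n (ℕₚ.≤-pred k≤l)) ⟨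
            (k ℕ.+ (l ∸ k)) ℕ.* S                ≡⟨ ℕₚ.*-distribʳ-+ S k (l ∸ k) ⟩
            k ℕ.* S ℕ.+ (l ∸ k) ℕ.* S            ≤⟨ ℕₚ.+-mono-≤ (ℕₚ.≮⇒≥ ge₁) (ℕₚ.≮⇒≥ ge₂) ⟩
            (i ℕ.+ w) ℕ.+ (N ∸ i ℕ.+ w′)         ≡⟨ ℕₚ.+-assoc i w _ ⟩
            i ℕ.+ (w ℕ.+ (N ∸ i ℕ.+ w′))         ≡⟨ ≡.cong (i ℕ.+_) (≡.trans (≡.sym (ℕₚ.+-assoc w (N ∸ i) w′)) (≡.trans (≡.cong (ℕ._+ w′) (ℕₚ.+-comm w (N ∸ i))) (ℕₚ.+-assoc (N ∸ i) w w′))) ⟩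
            i ℕ.+ (N ∸ i ℕ.+ (w ℕ.+ w′))         ≡⟨ ℕₚ.+-assoc i (N ∸ i) _ ⟨
            (i ℕ.+ (N ∸ i)) ℕ.+ (w ℕ.+ w′)       ≡⟨ ≡.cong (ℕ._+ (w ℕ.+ w′)) (ℕₚ.m+[n∸m]≡n (ℕₚ.≤-pred i≤N)) ⟩
            N ℕ.+ (w ℕ.+ w′)                     ∎

  formalJet : ℕ → ℕ → ℕ → B.Carrier
  formalJet a J = Jets.jetProd 𝔽[[t]][[x]] q t x a J

  x^-low : ∀ m N → N < m → BO.pow x m N P.≈ P.0#
  x^-low m N lt = P.trans (P.sym (B.*-identityʳ (BO.pow x m) N)) (PP.var^-⊛-low m B.1# N lt)

  x^-at : ∀ m E N → (BO.pow x m B.* E) (m ℕ.+ N) P.≈ E N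
  x^-at m E N = PP.var^-⊛-shift m E N

monMax : ∀ n d (f : Mon n d → ℕ) → ∃ λ b → ∀ μ → f μ ≤ b
monMax zero    d       f = f tt , λ _ → ℕₚ.≤-refl
monMax (suc n) zero    f = f tt , λ _ → ℕₚ.≤-refl
monMax (suc n) (suc d) f = let (b , h) = monMax n (suc d) (f ∘ inj₁) ; (b′ , h′) = monMax (suc n) d (f ∘ inj₂) in
  b ℕ.⊔ b′ , λ { (inj₁ μ) → ℕₚ.≤-trans (h μ) (ℕₚ.m≤m⊔n b b′) ; (inj₂ μ) → ℕₚ.≤-trans (h′ μ) (ℕₚ.m≤n⊔m b b′) }

maxBelow : ∀ m (f : ℕ → ℕ) → ∃ λ b → ∀ i → i < m → f i ≤ b
maxBelow zero    f = 0 , λ _ ()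
maxBelow (suc m) f = let (b , h) = maxBelow m f in b ℕ.⊔ f m , λ i i<1+m → case i i<1+m
  where
  case : ∀ i → i < suc m → f i ≤ proj₁ (maxBelow m f) ℕ.⊔ f m
  case i i<1+m with i ℕ.≟ m
  ... | yes ≡.refl = ℕₚ.m≤n⊔m (proj₁ (maxBelow m f)) (f i)
  ... | no i≢m     = ℕₚ.≤-trans (proj₂ (maxBelow m f) i (ℕₚ.≤∧≢⇒< (ℕₚ.≤-pred i<1+m) i≢m)) (ℕₚ.m≤m⊔n _ (f m))

-- At t = θ^Q, x = z the monomial x^N t^l has valuation N - l Q. A slope of 2 Q, twice what is
-- spent, leaves at least half of N - β.
half-slope : ∀ b l Q N β → l ℕ.* (2 ℕ.* Q) ≤ N ℕ.+ β → β ℕ.+ 2 ℕ.* b ≤ N → b ℕ.+ l ℕ.* Q ≤ N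
half-slope b l Q N β h h′ = ℕₚ.*-cancelˡ-≤ 2 (begin
  2 ℕ.* (b ℕ.+ l ℕ.* Q)                    ≡⟨ ℕₚ.*-distribˡ-+ 2 b (l ℕ.* Q) ⟩
  2 ℕ.* b ℕ.+ 2 ℕ.* (l ℕ.* Q)              ≡⟨ ≡.cong (2 ℕ.* b ℕ.+_) (≡.trans (≡.sym (ℕₚ.*-assoc 2 l Q)) (≡.trans (≡.cong (ℕ._* Q) (ℕₚ.*-comm 2 l)) (ℕₚ.*-assoc l 2 Q))) ⟩
  2 ℕ.* b ℕ.+ l ℕ.* (2 ℕ.* Q)              ≤⟨ ℕₚ.+-monoʳ-≤ (2 ℕ.* b) h ⟩
  2 ℕ.* b ℕ.+ (N ℕ.+ β)                    ≡⟨ ≡.trans (ℕₚ.+-comm (2 ℕ.* b) (N ℕ.+ β)) (ℕₚ.+-assoc N β (2 ℕ.* b)) ⟩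
  N ℕ.+ (β ℕ.+ 2 ℕ.* b)                    ≤⟨ ℕₚ.+-monoʳ-≤ N h′ ⟩
  N ℕ.+ N                                  ≡⟨ ≡.cong (N ℕ.+_) (ℕₚ.+-identityʳ N) ⟨
  2 ℕ.* N                                  ∎)
  where open ℕₚ.≤-Reasoning

-- Independence of values: statement, specialisation of t, and slopes of the formal jets.

module FunctionalIndependence {q : ℕ} {𝔽 : FiniteField q} {a ℓ} {L : CommutativeRing a ℓ} {p} (V : ValuedExtension 𝔽 L p) where
  open ValuedLemmas V
  open FormalSeries 𝔽
  open FiniteField 𝔽 using (Fring; _≟F_)
  open CommutativeRing L hiding (zero)
  open RingOps L
  open IntegerSolver L
  open Sums L
  open Evaluation L
  open PowerSeries L using (Ser; _≋_; _⊛_; ⊛-cong; ⊛-def; ⊛-zero; const; const-⊛; var; var-⊛-zero; var-⊛-suc; var^-⊛-low; var^-⊛-shift; ⊛-distribˡ; PS)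
  open Polynomials L
  open Jets L q
  open Representation L
  open Vanishing L no-zero-divisors
  open Relation.Binary.Reasoning.Setoid setoid
  private
    module S = CommutativeRing PS
    module BP = Polynomials 𝔽[[t]][[x]]
    module BO = RingOps 𝔽[[t]][[x]]
    module BS = PowerSeries 𝔽[[t]][[x]]
    module BJ = Jets 𝔽[[t]][[x]] q
    module SS = IntegerSolver PS

  n<q^n : ∀ n → n < q ^ n
  n<q^n zero    = s≤s z≤n
  n<q^n (suc n) = ℕₚ.≤-trans (ℕₚ.≤-trans (s≤s (n<q^n n)) (ℕₚ.≤-trans (ℕₚ.+-monoˡ-≤ (q ^ n) (q^≥1 n)) (ℕₚ.≤-reflexive (≡.cong (q ^ n ℕ.+_) (≡.sym (ℕₚ.+-identityʳ (q ^ n)))))))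
    (ℕₚ.*-monoˡ-≤ (q ^ n) 2≤q)

  -- γ J = ∏_{j ≤ J} (1 - (θ + ε) θ^{-q^j})
  γ : ℕ → ℕ → Carrier
  γ J = jetProd θ z 0 J

  -- Coefficients in 𝔽_q[z] of a common degree suffice, since θ = 1/z and denominators can be
  -- cleared. The null sequence expresses that the relation holds in the limit.
  ValueIndependence : ℕ → Set (a ⊔ ℓ ⊔ p)
  ValueIndependence n = ∀ d (c : Mon n d → Carrier) w → (∀ μ → Bounded w (c μ)) → Null (λ J → ev n d c (γ J)) → ∀ μ → c μ ≈ 0#

  biEval : Carrier → Carrier → FilteredRelation 𝔽[[t]][[x]] L (a ⊔ ℓ)
  biEval τ ζ = evaluation (evaluation constRel τ) ζ

  record BiBounded (h T : ℕ) (E : B.Carrier) : Set where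
    constructor biBounded
    field
      x-high : ∀ N l → h ≤ N → E N l F.≈ F.0#
      t-high : ∀ N l → T ≤ l → E N l F.≈ F.0#

  column : ℕ → B.Carrier → ℕ → Carrier
  column h E l = evalTo h (λ N → [ E N l ]) z

  biValue : ℕ → ℕ → B.Carrier → Carrier → Carrier
  biValue h T E τ = evalTo T (column h E) τ

  biValue-rows : ∀ h T E τ → biValue h T E τ ≈ evalTo h (λ N → evalTo T (λ l → [ E N l ]) τ) z
  biValue-rows h T E τ = begin
    sumTo T (λ l → sumTo h (λ N → [ E N l ] * pow z N) * pow τ l)    ≈⟨ Σ-cong′ T (λ l → Σ-*ʳ h _ _) ⟩
    sumTo T (λ l → sumTo h (λ N → [ E N l ] * pow z N * pow τ l))    ≈⟨ Σ-swap T h _ ⟩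
    sumTo h (λ N → sumTo T (λ l → [ E N l ] * pow z N * pow τ l))
      ≈⟨ Σ-cong′ h (λ N → Σ-cong′ T (λ l → solve 3 (λ e u v → e :* u :* v := e :* v :* u) refl [ E N l ] (pow z N) (pow τ l))) ⟩
    sumTo h (λ N → sumTo T (λ l → [ E N l ] * pow τ l * pow z N))    ≈⟨ Σ-cong′ h (λ N → Σ-*ʳ T _ _) ⟨
    sumTo h (λ N → sumTo T (λ l → [ E N l ] * pow τ l) * pow z N)    ∎

  []-zero : ∀ {e} → e F.≈ F.0# → [ e ] ≈ 0#
  []-zero h = trans ([]-cong h) []-0

  biBounded⇒evaluates : ∀ {h T E} τ → BiBounded h T E → FilteredRelation.T (biEval τ z) 0 E (biValue h T E τ)
  biBounded⇒evaluates {h} {T} {E} τ (biBounded xh th) = evaluates h (λ N → evalTo T (λ l → [ E N l ]) τ)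
    (λ N → evaluates T (λ l → [ E N l ]) (λ _ → refl) (λ l le → th N l le) (λ l le → []-zero (th N l le)) refl)
    (λ N le l → xh N l le)
    (λ N le → Σ-zero T (λ l _ → trans (*-congʳ ([]-zero (xh N l le))) (zeroˡ _)))
    (biValue-rows h T E τ)

  -- Degrees of composite expressions such as a polynomial in formal jets are never computed; they
  -- are read off from the evaluation witness.
  evaluates⇒biBounded : ∀ {E y} τ → FilteredRelation.T (biEval τ z) 0 E y → ∃ λ h → ∃ λ T → BiBounded h T E × y ≈ biValue h T E τ
  evaluates⇒biBounded {E} {y} τ (evaluates b e rel hi hiᵢ v) = b , T , biBounded (λ N l le → hi N le l) t-hi ,
      trans v (trans (Σ-cong′ b (λ N → *-congʳ (row N))) (sym (biValue-rows b T E τ)))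
    where
    T = proj₁ (maxBelow b (λ N → Evaluates.bound (rel N)))
    T-max = proj₂ (maxBelow b (λ N → Evaluates.bound (rel N)))
    t-hi : ∀ N l → T ≤ l → E N l F.≈ F.0#
    t-hi N l le with N ℕ.<? b
    ... | yes N<b = Evaluates.high (rel N) l (ℕₚ.≤-trans (T-max N N<b) le)
    ... | no N≮b  = hi N (ℕₚ.≮⇒≥ N≮b) l
    row : ∀ N → e N ≈ evalTo T (λ l → [ E N l ]) τ
    row N with N ℕ.<? b
    ... | yes N<b = trans (Evaluates.value (rel N)) (trans
        (Σ-cong′ (Evaluates.bound (rel N)) (λ l → *-congʳ (Evaluates.related (rel N) l)))
        (sym (evalTo-extend (λ l → [ E N l ]) τ (T-max N N<b) (λ l le → []-zero (Evaluates.high (rel N) l le)))))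
    ... | no N≮b  = trans (hiᵢ N (ℕₚ.≮⇒≥ N≮b)) (sym (Σ-zero T (λ l _ → trans (*-congʳ ([]-zero (hi N (ℕₚ.≮⇒≥ N≮b) l))) (zeroˡ _))))

  biEval-t : ∀ τ → FilteredRelation.T (biEval τ z) 0 t τ
  biEval-t τ = evaluates-const (evaluation constRel τ) (evaluates-var constRel)

  biEval-x : ∀ τ → FilteredRelation.T (biEval τ z) 0 x z
  biEval-x τ = evaluates-var (evaluation constRel τ)

  -- The subring 𝔽_q[z, θ] of L, that is, Laurent polynomials in z.
  Laurent : Carrier → Set ℓ
  Laurent y = ∃ λ k → ∃ λ w → Bounded w (pow z k * y)

  Laurent-cong : ∀ {y y′} → y ≈ y′ → Laurent y → Laurent y′
  Laurent-cong e (k , w , h) = k , w , Bounded-cong (*-congˡ e) h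

  Laurent-raise : ∀ {y k w} k′ → Bounded w (pow z k * y) → Bounded (k′ ℕ.+ w) (pow z (k′ ℕ.+ k) * y)
  Laurent-raise {y} {k} k′ h = Bounded-cong (trans (sym (*-assoc _ _ _)) (*-congʳ (sym (pow-+ z k′ k)))) (Bounded-* (Bounded-z^ k′) h)

  Laurent-+ : ∀ {y y′} → Laurent y → Laurent y′ → Laurent (y + y′)
  Laurent-+ {y} {y′} (k , w , h) (k′ , w′ , h′) = k′ ℕ.+ k , (k′ ℕ.+ w) ℕ.⊔ (k ℕ.+ w′) , Bounded-cong (sym (distribˡ _ _ _))
    (Bounded-+ (Bounded-≤ (ℕₚ.m≤m⊔n _ _) (Laurent-raise k′ h))
      (Bounded-≤ (ℕₚ.m≤n⊔m _ _) (≡.subst (λ m → Bounded (k ℕ.+ w′) (pow z m * y′)) (ℕₚ.+-comm k k′) (Laurent-raise k h′))))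

  Laurent-* : ∀ {y y′} → Laurent y → Laurent y′ → Laurent (y * y′)
  Laurent-* {y} {y′} (k , w , h) (k′ , w′ , h′) = k ℕ.+ k′ , w ℕ.+ w′ , Bounded-cong
    (trans (solve 4 (λ p y p′ y′ → (p :* y) :* (p′ :* y′) := (p :* p′) :* (y :* y′)) refl (pow z k) y (pow z k′) y′) (*-congʳ (sym (pow-+ z k k′))))
    (Bounded-* h h′)

  Bounded⇒Laurent : ∀ {w y} → Bounded w y → Laurent y
  Bounded⇒Laurent h = 0 , _ , Bounded-cong (sym (*-identityˡ _)) h

  Laurent-0 : Laurent 0#
  Laurent-0 = Bounded⇒Laurent (Bounded-0 {0})

  Laurent-1 : Laurent 1#
  Laurent-1 = Bounded⇒Laurent (Bounded-z^ 0)

  Laurent-neg : ∀ {y} → Laurent y → Laurent (- y)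
  Laurent-neg {y} h = Laurent-cong (solve 1 (λ y → :- :1 :* y := :- y) refl y) (Laurent-* (Bounded⇒Laurent (Bounded-neg (Bounded-z^ 0))) h)

  Laurent-z : Laurent z
  Laurent-z = Bounded⇒Laurent (Bounded-cong (*-identityˡ z) (Bounded-z^ 1))

  Laurent-θ : Laurent θ
  Laurent-θ = 1 , 0 , Bounded-cong (trans (sym zθ≈1) (*-congʳ (sym (*-identityˡ z)))) (Bounded-z^ 0)

  Laurent-pow : ∀ {y} n → Laurent y → Laurent (pow y n)
  Laurent-pow zero    h = Laurent-1
  Laurent-pow (suc n) h = Laurent-* (Laurent-pow n h) h

  laurentRel : FilteredRelation L L ℓ
  laurentRel = record
    { T = λ _ y _ → Laurent y ; T-cong = λ e _ → Laurent-cong e ; T-mono = λ _ h → h ; T-0 = Laurent-0 ; T-1 = Laurent-1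
    ; T-+ = Laurent-+ ; T-* = Laurent-* ; T-neg = Laurent-neg }

  open Subring Laurent Laurent-cong Laurent-0 Laurent-1 Laurent-+ Laurent-* public

  clear-denominators : ∀ n d (c : Mon n d → Carrier) → (∀ μ → Laurent (c μ)) → ∃ λ k → ∃ λ w → ∀ μ → Bounded w (pow z k * c μ)
  clear-denominators n d c h = K , K ℕ.+ W , λ μ → Bounded-≤ (ℕₚ.+-mono-≤ (ℕₚ.m∸n≤m K (proj₁ (h μ))) (W-max μ))
      (≡.subst (λ m → Bounded (K ∸ proj₁ (h μ) ℕ.+ proj₁ (proj₂ (h μ))) (pow z m * c μ)) (ℕₚ.m∸n+n≡m (K-max μ)) (Laurent-raise (K ∸ proj₁ (h μ)) (proj₂ (proj₂ (h μ)))))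
    where
    K = proj₁ (monMax n d (λ μ → proj₁ (h μ)))
    K-max = proj₂ (monMax n d (λ μ → proj₁ (h μ)))
    W = proj₁ (monMax n d (λ μ → proj₁ (proj₂ (h μ))))
    W-max = proj₂ (monMax n d (λ μ → proj₁ (proj₂ (h μ))))

  polyFun-vanishes : ∀ {n} → ValueIndependence n → ∀ {f} → PolyFun n f → Null (λ J → f (γ J)) → ∀ y → f y ≈ 0#
  polyFun-vanishes {n} ind {f} (d , rep c Lc agree) null y = trans (agree y) (ev-zero n d y
      (λ μ → no-zero-divisors (pow z k) (c μ) (scaled-zero μ) (pow-nonzero k z≉0)))
    where
    cleared = clear-denominators n d c Lc
    k = proj₁ cleared
    scaled-zero : ∀ μ → pow z k * c μ ≈ 0#
    scaled-zero = ind d (λ μ → pow z k * c μ) (proj₁ (proj₂ cleared)) (proj₂ (proj₂ cleared))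
      (Null-cong (λ J → trans (*-congˡ (agree (γ J))) (sym (ev-scale n d (pow z k) c (γ J)))) (Null-scale (λ _ → pow z k) (λ _ → 𝒪-pow k 𝒪-z) null))

  -- Multiplication by a jet with nonzero constant term is triangular, so it can be inverted to any
  -- finite order; each step corrects one coefficient. This shows that linear changes of variables
  -- by jets are surjective.
  solve-⊛ : ∀ (b : Ser) → ¬ (b 0 ≈ 0#) → ∀ n (w : ℕ → Carrier) → ∃ λ y → ∀ i → i < n → (b ⊛ y) i ≈ w i
  solve-⊛ b b≉0 zero    w = (λ _ → 0#) , λ _ ()
  solve-⊛ b b≉0 (suc n) w with solve-⊛ b b≉0 n w
  ... | y , solved = y′ , solved′
    where
    u = proj₁ (inverse (b 0) b≉0)
    bu≈1 = proj₂ (inverse (b 0) b≉0)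
    r = u * (w n - (b ⊛ y) n)
    X = RingOps.pow PS var n
    y′ : Ser
    y′ i = y i + (X ⊛ const r) i
    expand : ∀ i → (b ⊛ y′) i ≈ (b ⊛ y) i + (X ⊛ (b ⊛ const r)) i
    expand i = trans (⊛-distribˡ b y (X ⊛ const r) i)
      (+-congˡ (SS.solve 3 (λ b X r → b SS.:* (X SS.:* r) SS.:= X SS.:* (b SS.:* r)) S.refl b X (const r) i))
    solved′ : ∀ i → i < suc n → (b ⊛ y′) i ≈ w i
    solved′ i i≤n with i ℕ.≟ n
    ... | no i≢n = trans (expand i) (trans (+-cong (solved i i<n) (var^-⊛-low n (b ⊛ const r) i i<n)) (+-identityʳ _))
      where i<n = ℕₚ.≤∧≢⇒< (ℕₚ.≤-pred i≤n) i≢n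
    ... | yes ≡.refl = begin
      (b ⊛ y′) n                              ≈⟨ expand n ⟩
      (b ⊛ y) n + (X ⊛ (b ⊛ const r)) n       ≈⟨ +-congˡ (trans (reflexive (≡.cong (X ⊛ (b ⊛ const r)) (≡.sym (ℕₚ.+-identityʳ n)))) (trans (var^-⊛-shift n (b ⊛ const r) 0) (⊛-zero b (const r)))) ⟩
      (b ⊛ y) n + b 0 * (u * (w n - (b ⊛ y) n)) ≈⟨ solve 4 (λ e b u w → e :+ b :* (u :* (w :- e)) := e :+ (b :* u) :* (w :- e)) refl ((b ⊛ y) n) (b 0) u (w n) ⟩
      (b ⊛ y) n + (b 0 * u) * (w n - (b ⊛ y) n) ≈⟨ +-congˡ (trans (*-congʳ bu≈1) (*-identityˡ _)) ⟩
      (b ⊛ y) n + (w n - (b ⊛ y) n)             ≈⟨ solve 2 (λ e w → e :+ (w :- e) := w) refl ((b ⊛ y) n) (w n) ⟩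
      w n ∎

  jetProd₀≉0 : ∀ τ a cnt → (∀ i → i < cnt → ¬ (1# - τ * pow z (q ^ (suc a ℕ.+ i)) ≈ 0#)) → ¬ (jetProd τ z a cnt 0 ≈ 0#)
  jetProd₀≉0 τ a zero      h = 1≉0
  jetProd₀≉0 τ a (suc cnt) h e = *-nonzero (jetProd₀≉0 τ a cnt (λ i i<n → h i (ℕₚ.m<n⇒m<1+n i<n))) (h cnt ℕₚ.≤-refl)
    (trans (sym (⊛-zero (jetProd τ z a cnt) _)) e)

  1-z^≉0 : ∀ m → 1 ≤ m → ¬ (1# - pow z m ≈ 0#)
  1-z^≉0 m 1≤m e = node-distinct 1 (s≤s z≤n) 0 m 1≤m (trans (+-congˡ (-‿cong (reflexive (≡.cong (pow z) (ℕₚ.*-identityʳ m))))) e)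

  1-θ^≉0 : ∀ m → 1 ≤ m → ¬ (1# - pow θ m ≈ 0#)
  1-θ^≉0 m 1≤m e = 1-z^≉0 m 1≤m (trans (solve 2 (λ u v → :1 :- u := (:- u) :* (:1 :- v) :+ (:1 :- v :* u)) refl (pow z m) (pow θ m))
    (trans (+-cong (trans (*-congˡ e) (zeroʳ _)) (+-congˡ (-‿cong (θ^z^ m)))) (trans (+-identityˡ _) (-‿inverseʳ 1#))))

  -- Coefficients of degree below Q in z do not overlap when θ^Q is inserted: after multiplication
  -- by z^{T Q} all lower terms are divisible by z^Q, so the top coefficient, of degree at most w <
  -- Q, must vanish.
  digits-zero : ∀ T w Q (c : ℕ → Carrier) → w < Q → (∀ l → Bounded w (c l)) → evalTo T c (pow θ Q) ≈ 0# → ∀ l → l < T → c l ≈ 0#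
  digits-zero (suc T) w Q c w<Q bd e = all
    where
    low : ∀ l → l < T → O Q (pow z (T ℕ.* Q) * (c l * pow (pow θ Q) l))
    low l l<T = O-cong rearrange (O-* (𝒪⇒O (Bounded⇒𝒪 (bd l))) (O-≤ Q≤ (O-z^ ((T ∸ l) ℕ.* Q))))
      where
      Q≤ : Q ≤ (T ∸ l) ℕ.* Q
      Q≤ = ℕₚ.≤-trans (ℕₚ.≤-reflexive (≡.sym (ℕₚ.+-identityʳ Q))) (ℕₚ.*-monoˡ-≤ Q (ℕₚ.m<n⇒0<n∸m l<T))
      rearrange : c l * pow z ((T ∸ l) ℕ.* Q) ≈ pow z (T ℕ.* Q) * (c l * pow (pow θ Q) l)
      rearrange = begin
        c l * pow z ((T ∸ l) ℕ.* Q)                          ≈⟨ *-congˡ (reflexive (≡.cong (pow z) (ℕₚ.*-distribʳ-∸ Q T l))) ⟩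
        c l * pow z (T ℕ.* Q ∸ l ℕ.* Q)                      ≈⟨ *-congˡ (θ^z^∸ (ℕₚ.*-monoˡ-≤ Q (ℕₚ.<⇒≤ l<T))) ⟨
        c l * (pow θ (l ℕ.* Q) * pow z (T ℕ.* Q))            ≈⟨ *-congˡ (*-congʳ (pow-* θ l Q)) ⟩
        c l * (pow (pow θ Q) l * pow z (T ℕ.* Q))            ≈⟨ solve 3 (λ c u v → c :* (u :* v) := v :* (c :* u)) refl (c l) (pow (pow θ Q) l) (pow z (T ℕ.* Q)) ⟩
        pow z (T ℕ.* Q) * (c l * pow (pow θ Q) l)            ∎
    top : c T ≈ - (pow z (T ℕ.* Q) * evalTo T c (pow θ Q))
    top = begin
      c T ≈⟨ *-identityˡ _ ⟨
      1# * c T ≈⟨ *-congʳ (trans (*-comm _ _) (trans (*-congʳ (sym (pow-* θ T Q))) (θ^z^ (T ℕ.* Q)))) ⟨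
      (pow z (T ℕ.* Q) * pow (pow θ Q) T) * c T
        ≈⟨ solve 4 (λ u v c r → (u :* v) :* c := u :* (r :+ c :* v) :- u :* r) refl (pow z (T ℕ.* Q)) (pow (pow θ Q) T) (c T) (evalTo T c (pow θ Q)) ⟩
      pow z (T ℕ.* Q) * evalTo (suc T) c (pow θ Q) - pow z (T ℕ.* Q) * evalTo T c (pow θ Q)
        ≈⟨ trans (+-congʳ (trans (*-congˡ e) (zeroʳ _))) (+-identityˡ _) ⟩
      - (pow z (T ℕ.* Q) * evalTo T c (pow θ Q)) ∎
    top-zero : c T ≈ 0#
    top-zero = Bounded-small⇒≈0 (bd T) (O-≤ w<Q (O-cong (sym top) (O-neg (O-cong (sym (Σ-*ˡ T _ _)) (O-Σ T low)))))
    rest : evalTo T c (pow θ Q) ≈ 0#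
    rest = trans (sym (trans (+-congˡ (trans (*-congʳ top-zero) (zeroˡ _))) (+-identityʳ _))) e
    all : ∀ l → l < suc T → c l ≈ 0#
    all l l≤T with l ℕ.≟ T
    ... | yes ≡.refl = top-zero
    ... | no l≢T     = digits-zero T w Q c w<Q bd rest l (ℕₚ.≤∧≢⇒< (ℕₚ.≤-pred l≤T) l≢T)

  -- Every omitted factor is 1 modulo a power x^{q^{1+J+k}}, and this exponent exceeds J.
  formalJet-stable : ∀ J k i → FilteredRelation.T (modRel (suc J)) 0 (formalJet 0 (J ℕ.+ k) i) (formalJet 0 J i)
  formalJet-stable J zero    i N lt = P.reflexive (≡.cong (λ m → formalJet 0 m i N) (ℕₚ.+-identityʳ J))
  formalJet-stable J (suc k) i N lt = P.trans (P.reflexive (≡.cong (λ m → formalJet 0 m i N) (ℕₚ.+-suc J k)))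
    (P.trans (RelationLemmas.T-⊛ (modRel (suc J)) {0} {0} i (formalJet-stable J k) factor-trivial N lt)
      (P.trans (BS.⊛-comm (formalJet 0 J) (BS.const B.1#) i N) (BS.one-⊛ (formalJet 0 J) i N)))
    where
    s = BO.pow x (q ^ (1 ℕ.+ (J ℕ.+ k)))
    s-low : ∀ N → N < suc J → s N P.≈ P.0#
    s-low N lt = x^-low _ N (ℕₚ.≤-trans lt (ℕₚ.≤-trans (s≤s (ℕₚ.m≤m+n J k)) (ℕₚ.<⇒≤ (n<q^n (suc (J ℕ.+ k))))))
    factor-trivial : ∀ m → FilteredRelation.T (modRel (suc J)) 0 (BJ.factorJet t s m) (BS.const B.1# m)
    factor-trivial zero N lt = P.trans (P.+-congˡ (P.-‿cong (P.trans (PP.const-⊛ PF.var s N) (P.trans (P.*-congˡ (s-low N lt)) (P.zeroʳ PF.var)))))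
      (P.trans (P.+-congˡ (Algebra.Properties.Ring.-0#≈0# P.ring)) (P.+-identityʳ _))
    factor-trivial (suc zero)    N lt = P.trans (P.-‿cong (s-low N lt)) (Algebra.Properties.Ring.-0#≈0# P.ring)
    factor-trivial (suc (suc m)) N lt = P.refl

  private
    module Slopes (S : ℕ) where
      open FilteredRelation (slopeRel S) public
      open RelationLemmas (slopeRel S) public

  slope-x^ : ∀ S m → FilteredRelation.T (slopeRel S) 0 (BO.pow x m) B.0#
  slope-x^ S m N zero    ()
  slope-x^ S m N (suc l) lt with N ℕ.<? m
  ... | yes N<m = x^-low m N N<m (suc l)
  ... | no N≮m  = F.trans (P.sym (B.*-identityʳ (BO.pow x m) N) (suc l)) (F.trans
      (P.reflexive (≡.cong (BO.pow x m B.* B.1#) (≡.sym (ℕₚ.m+[n∸m]≡n (ℕₚ.≮⇒≥ N≮m)))) (suc l))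
      (F.trans (x^-at m B.1# (N ∸ m) (suc l)) (one-high (N ∸ m))))
    where
    one-high : ∀ N → B.1# N (suc l) F.≈ F.0#
    one-high zero    = F.refl
    one-high (suc _) = F.refl

  slope-t : ∀ S → FilteredRelation.T (slopeRel S) S t B.0#
  slope-t S zero    zero          ()
  slope-t S zero    (suc zero)    lt = ⊥-elim (ℕₚ.<⇒≢ lt (≡.sym (ℕₚ.+-identityʳ S)))
  slope-t S zero    (suc (suc _)) lt = F.refl
  slope-t S (suc N) l             lt = F.refl

  slope-tx^ : ∀ S m → S ≤ m → FilteredRelation.T (slopeRel S) 0 (t B.* BO.pow x m) B.0#
  slope-tx^ S m S≤m N l lt with N ℕ.<? m
  ... | yes N<m = F.trans (B.*-comm t (BO.pow x m) N l) (PP.var^-⊛-low m t N N<m l)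
  ... | no N≮m  = F.trans (B.*-comm t (BO.pow x m) N l) (F.trans
      (P.reflexive (≡.cong (BO.pow x m B.* t) (≡.sym (ℕₚ.m+[n∸m]≡n (ℕₚ.≮⇒≥ N≮m)))) l)
      (F.trans (x^-at m t (N ∸ m) l) (t-high (N ∸ m) l l≥2)))
    where
    l≥2 : 2 ≤ l
    l≥2 = ℕₚ.≰⇒> λ l≤1 → ℕₚ.<⇒≱ lt (ℕₚ.≤-trans (ℕₚ.*-monoˡ-≤ S l≤1) (ℕₚ.≤-trans (ℕₚ.≤-reflexive (ℕₚ.+-identityʳ S))
      (ℕₚ.≤-trans S≤m (ℕₚ.≤-trans (ℕₚ.≮⇒≥ N≮m) (ℕₚ.m≤m+n N 0)))))
    t-high : ∀ N l → 2 ≤ l → t N l F.≈ F.0#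
    t-high zero    (suc (suc l)) _ = F.refl
    t-high zero    (suc zero) (s≤s ())
    t-high (suc N) l             _ = F.refl

  -- Only the first g factors can contain t x^m with m < S and cost S each; all others lie above the
  -- slope. The weight is therefore independent of the length J.
  slope-formalJet : ∀ S a g → (∀ i → g ≤ i → S ≤ q ^ (suc a ℕ.+ i)) → ∀ J k → FilteredRelation.T (slopeRel S) (g ℕ.* S) (formalJet a J k) B.0#
  slope-formalJet S a g big J k = T-mono {y = B.0#} total (T-jetProd q {τ′ = B.0#} {ζ′ = B.0#} a J W factor-slope k)
    where
    open Slopes S
    W : ℕ → ℕ
    W i with i ℕ.<? g
    ... | yes _ = S
    ... | no _  = 0
    factor-slope : ∀ i → i < J → ∀ k → T (W i) (BJ.factorJet t (BO.pow x (q ^ (suc a ℕ.+ i))) k) (BJ.factorJet B.0# (BO.pow B.0# (q ^ (suc a ℕ.+ i))) k)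
    factor-slope i _ zero with i ℕ.<? g
    ... | yes _ = T-+ {y = B.1#} {y′ = B.0#} (T-mono {y = B.1#} z≤n T-1) (T-neg {y = B.0#} (T-mono {y = B.0#} (ℕₚ.≤-reflexive (ℕₚ.+-identityʳ S))
        (T-* {w′ = 0} {y = B.0#} {y′ = B.0#} (slope-t S) (slope-x^ S (q ^ (suc a ℕ.+ i))))))
    ... | no ge = T-+ {y = B.1#} {y′ = B.0#} T-1 (T-neg {y = B.0#} (slope-tx^ S _ (big i (ℕₚ.≮⇒≥ ge))))
    factor-slope i _ (suc zero)    = T-mono {y = B.0#} z≤n (T-neg {y = B.0#} (slope-x^ S (q ^ (suc a ℕ.+ i))))
    factor-slope i _ (suc (suc _)) = T-mono {y = B.0#} z≤n T-0
    weights : ∀ J → sumℕ J W ≤ (J ℕ.⊓ g) ℕ.* S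
    weights zero = z≤n
    weights (suc J) with J ℕ.<? g
    ... | yes J<g = ℕₚ.≤-trans (ℕₚ.+-monoˡ-≤ S (weights J)) (ℕₚ.≤-reflexive (≡.trans
        (≡.cong (λ m → m ℕ.* S ℕ.+ S) (ℕₚ.m≤n⇒m⊓n≡m (ℕₚ.<⇒≤ J<g))) (≡.trans (ℕₚ.+-comm (J ℕ.* S) S) (≡.cong (ℕ._* S) (≡.sym (ℕₚ.m≤n⇒m⊓n≡m J<g))))))
    ... | no J≮g  = ℕₚ.≤-trans (ℕₚ.≤-reflexive (ℕₚ.+-identityʳ _)) (ℕₚ.≤-trans (weights J)
        (ℕₚ.*-monoˡ-≤ S (ℕₚ.≤-reflexive (≡.trans (ℕₚ.m≥n⇒m⊓n≡n (ℕₚ.≮⇒≥ J≮g)) (≡.sym (ℕₚ.m≥n⇒m⊓n≡n (ℕₚ.m≤n⇒m≤1+n (ℕₚ.≮⇒≥ J≮g))))))))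
    total : sumℕ J W ≤ g ℕ.* S
    total = ℕₚ.≤-trans (weights J) (ℕₚ.*-monoˡ-≤ S (ℕₚ.m⊓n≤n J g))

  BiBounded-slope : ∀ S {h T E} → BiBounded h T E → FilteredRelation.T (slopeRel S) (T ℕ.* S) E B.0#
  BiBounded-slope S {h} {T} (biBounded _ th) N l lt = th N l (ℕₚ.≮⇒≥ λ l<T → ℕₚ.<⇒≱ lt (ℕₚ.≤-trans (ℕₚ.*-monoˡ-≤ S (ℕₚ.<⇒≤ l<T)) (ℕₚ.m≤n+m _ N)))

  -- Vanishing to high order in x gives a small value although t = θ^Q is large: along slope 2 Q a
  -- high power of t comes with a much higher power of x.
  value-small : ∀ Q β J b E y → FilteredRelation.T (biEval (pow θ Q) z) 0 E y →
    FilteredRelation.T (slopeRel (2 ℕ.* Q)) β E B.0# → (∀ N → N < J → E N P.≈ P.0#) → β ℕ.+ 2 ℕ.* b ≤ J → O b y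
  value-small Q β J b E y ev-E slope order le with evaluates⇒biBounded (pow θ Q) ev-E
  ... | h , T , _ , y≈ = O-cong (sym y≈) (O-Σ T (λ l _ → O-cong (Σ-*ʳ′ l) (O-Σ h (λ N _ → term N l))))
    where
    Σ-*ʳ′ : ∀ l → sumTo h (λ N → [ E N l ] * pow z N * pow (pow θ Q) l) ≈ column h E l * pow (pow θ Q) l
    Σ-*ʳ′ l = sym (Σ-*ʳ h _ _)
    vanish : ∀ {N l} → E N l F.≈ F.0# → O b ([ E N l ] * pow z N * pow (pow θ Q) l)
    vanish e = O-cong (sym (trans (*-congʳ (trans (*-congʳ ([]-zero e)) (zeroˡ _))) (zeroˡ _))) O-0
    term : ∀ N l → O b ([ E N l ] * pow z N * pow (pow θ Q) l)
    term N l with N ℕ.<? J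
    ... | yes N<J = vanish (order N N<J l)
    ... | no N≮J with (N ℕ.+ β) ℕ.<? (l ℕ.* (2 ℕ.* Q))
    ...   | yes lt = vanish (slope N l lt)
    ...   | no ge  = O-cong rearrange (O-scale (𝒪-[] (E N l)) (O-≤ b≤ (O-θ^ (l ℕ.* Q) lQ≤N (O-z^ N))))
      where
      b+lQ≤N : b ℕ.+ l ℕ.* Q ≤ N
      b+lQ≤N = half-slope b l Q N β (ℕₚ.≮⇒≥ ge) (ℕₚ.≤-trans le (ℕₚ.≮⇒≥ N≮J))
      lQ≤N : l ℕ.* Q ≤ N
      lQ≤N = ℕₚ.≤-trans (ℕₚ.m≤n+m _ b) b+lQ≤N
      b≤ : b ≤ N ∸ l ℕ.* Q
      b≤ = ℕₚ.m+n≤o⇒m≤o∸n b b+lQ≤N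
      rearrange : [ E N l ] * (pow θ (l ℕ.* Q) * pow z N) ≈ [ E N l ] * pow z N * pow (pow θ Q) l
      rearrange = trans (*-congˡ (*-congʳ (pow-* θ l Q))) (solve 3 (λ e u v → e :* (u :* v) := e :* v :* u) refl [ E N l ] (pow (pow θ Q) l) (pow z N))

-- From independence of n values to independence of n + 1 formal jets.

module FunctionalStep {q : ℕ} {𝔽 : FiniteField q} {a ℓ} {L : CommutativeRing a ℓ} {p} (V : ValuedExtension 𝔽 L p) where
  open ValuedLemmas V
  open FunctionalIndependence V
  open FormalSeries 𝔽
  open FiniteField 𝔽 using (Fring; _≟F_)
  open CommutativeRing L hiding (zero)
  open RingOps L
  open IntegerSolver L
  open Sums L
  open Evaluation L
  open PowerSeries L using (Ser; _≋_; _⊛_; ⊛-cong; ⊛-def; ⊛-zero; const; const-⊛; var; var-⊛-zero; var-⊛-suc; PS)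
  open Polynomials L
  open Jets L q
  open Representation L
  open Vanishing L no-zero-divisors
  open Relation.Binary.Reasoning.Setoid setoid
  private
    module S = CommutativeRing PS
    module BP = Polynomials 𝔽[[t]][[x]]
    module SS = IntegerSolver PS

  -- Below x^J the partial product already has the coefficients of the infinite one, so this is the
  -- relation between the infinite jets.
  RelationOfJets : ∀ n d → (Mon n d → B.Carrier) → Set
  RelationOfJets n d R = ∀ J N → N < J → BP.ev n d R (formalJet 0 J) N P.≈ P.0#

  FormalIndependence : ℕ → Set
  FormalIndependence n = ∀ d (R : Mon n d → B.Carrier) h T → (∀ μ → BiBounded h T (R μ)) → RelationOfJets n d R → ∀ μ → R μ B.≈ B.0#

  -- The value of the formal jets at t = θ^{q^j} has vanishing constant term, and its
  -- remaining terms are a multiple of the j-th Frobenius twist of γ.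
  module AtZero (j : ℕ) where
    Q = q ^ suc j
    α = pow θ Q
    s = pow z Q
    b = jetProd α z 0 j

    αs≈1 : α * s ≈ 1#
    αs≈1 = θ^z^ Q

    -- The constant terms of the earlier factors are 1 - θ^{Q - Q′} with Q′ < Q, hence nonzero; this
    -- makes `tail` invertible.
    b₀≉0 : ¬ (b 0 ≈ 0#)
    b₀≉0 = jetProd₀≉0 α 0 j λ i i<j e → let Q′ = q ^ suc i ; Q′<Q = ℕₚ.^-monoʳ-< q 2≤q (s≤s i<j) in
      1-θ^≉0 (Q ∸ Q′) (ℕₚ.m<n⇒0<n∸m Q′<Q) (trans (+-congˡ (-‿cong (begin
        pow θ (Q ∸ Q′)                              ≈⟨ *-identityʳ _ ⟨
        pow θ (Q ∸ Q′) * 1#                         ≈⟨ *-congˡ (θ^z^ Q′) ⟨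
        pow θ (Q ∸ Q′) * (pow θ Q′ * pow z Q′)      ≈⟨ *-assoc _ _ _ ⟨
        pow θ (Q ∸ Q′) * pow θ Q′ * pow z Q′        ≈⟨ *-congʳ (trans (sym (pow-+ θ (Q ∸ Q′) Q′)) (reflexive (≡.cong (pow θ) (ℕₚ.m∸n+n≡m (ℕₚ.<⇒≤ Q′<Q))))) ⟩
        α * pow z Q′                                ∎))) e)

    -- Frobenius sends the jets at (θ, z) to those at (θ^Q, z^Q), and the functional equation
    -- identifies these with the part of the product at (θ^Q, z) after the vanishing factor.
    frobenius-γ : ∀ J → (λ k → pow (γ J k) Q) ≋ jetProd α z (suc j) J
    frobenius-γ J k = trans (sym (RelationLemmas.T-jetProd₀ (frobRel (suc j)) q {τ′ = α} {ζ′ = s} refl refl 0 J k))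
      (trans (jetProd-rebase α z (suc j) 0 J k) (reflexive (≡.cong (λ m → jetProd α z m J k) (ℕₚ.+-identityʳ (suc j)))))

    tail : (ℕ → Carrier) → ℕ → Carrier
    tail y i = - s * (b ⊛ y) i

    split : ∀ J → jetProd α z 0 (suc j ℕ.+ J) ≋ const (- s) ⊛ (var ⊛ (b ⊛ (λ k → pow (γ J k) Q)))
    split J = S.trans (jetProd-+ α z 0 (suc j) J) (S.trans (S.*-cong (S.*-congˡ {b} factor≋) (S.sym (frobenius-γ J)))
      (SS.solve 4 (λ b s v f → (b SS.:* (s SS.:* v)) SS.:* f SS.:= s SS.:* (v SS.:* (b SS.:* f))) S.refl b (const (- s)) var (λ k → pow (γ J k) Q)))
      where
      factor≋ : factorJet α s ≋ const (- s) ⊛ var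
      factor≋ zero          = trans (trans (+-congˡ (-‿cong αs≈1)) (-‿inverseʳ 1#)) (sym (trans (const-⊛ (- s) var 0) (zeroʳ _)))
      factor≋ (suc zero)    = sym (trans (const-⊛ (- s) var 1) (*-identityʳ _))
      factor≋ (suc (suc k)) = sym (trans (const-⊛ (- s) var (suc (suc k))) (zeroʳ _))

    head-zero : ∀ J → jetProd α z 0 (suc j ℕ.+ J) 0 ≈ 0#
    head-zero J = trans (split J 0) (trans (const-⊛ (- s) _ 0) (trans (*-congˡ (var-⊛-zero _)) (zeroʳ _)))

    tail-γ : ∀ J i → jetProd α z 0 (suc j ℕ.+ J) (suc i) ≈ tail (λ k → pow (γ J k) Q) i
    tail-γ J i = trans (split J (suc i)) (trans (const-⊛ (- s) _ (suc i)) (*-congˡ (var-⊛-suc _ i)))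

    Laurent-b : ∀ k → Laurent (b k)
    Laurent-b = RelationLemmas.T-jetProd₀ laurentRel q {τ′ = α} {ζ′ = z} (Laurent-pow Q Laurent-θ) Laurent-z 0 j

    tail-cong : ∀ {y y′} n → (∀ i → i < n → y i ≈ y′ i) → ∀ i → i < n → tail y i ≈ tail y′ i
    tail-cong {y} {y′} n h i i<n = *-congˡ (trans (reflexive (⊛-def b y i)) (trans
      (Σ-cong (suc i) (λ k _ → *-congˡ (h (i ∸ k) (ℕₚ.≤-<-trans (ℕₚ.m∸n≤m i k) i<n)))) (reflexive (≡.sym (⊛-def b y′ i)))))

    tail-polyFun : ∀ n (y : ℕ → Fun) → (∀ k → k < n → PolyFun n (y k)) → ∀ i → i < n → PolyFun n (λ u → tail (λ k → y k u) i)
    tail-polyFun n y hy i i<n = PolyFun-scale (Laurent-neg (Laurent-pow Q Laurent-z)) (PolyFun-cong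
      (λ u → reflexive (≡.sym (⊛-def b (λ k → y k u) i)))
      (PolyFun-Σ (suc i) (λ k _ → PolyFun-scale (Laurent-b k) (hy (i ∸ k) (ℕₚ.≤-<-trans (ℕₚ.m∸n≤m i k) i<n)))))

    tail-surjective : ∀ n (w : ℕ → Carrier) → ∃ λ y → ∀ i → i < n → tail y i ≈ w i
    tail-surjective n w = let (y , h) = solve-⊛ b b₀≉0 n (λ i → - α * w i) in
      y , λ i i<n → trans (*-congˡ (h i i<n)) (trans (solve 3 (λ s a w → (:- s) :* ((:- a) :* w) := (a :* s) :* w) refl s α (w i)) (trans (*-congʳ αs≈1) (*-identityˡ _)))

    -- The polynomial y ↦ c(tail(y^Q)) tends to 0 along γ, hence vanishes identically by
    -- independence of the values. On the grid of Q-th powers this says that u ↦ c(tail(u))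
    -- vanishes, so it is zero; and `tail` is onto, so c is zero.
    vanishing-lower : ∀ {n} → ValueIndependence n → ∀ d (c : Mon n d → Carrier) → (∀ μ → Laurent (c μ)) →
      Null (λ J → ev n d c (tail (λ k → pow (γ J k) Q))) → ∀ μ → c μ ≈ 0#
    vanishing-lower {n} ind d c Lc null = vanishing⇒zero (node 1) (node-distinct 1 (s≤s z≤n)) n d c
        (λ e → let (y , h) = tail-surjective n (node 1 ∘ e) in trans (ev-cong n d (λ _ → refl) (λ i i<n → sym (h i i<n))) (linear-zero y))
      where
      twisted : PolyFun n (λ u → ev n d c (tail (λ k → pow (u k) Q)))
      twisted = PolyFun-subst (λ i u → tail (λ k → pow (u k) Q) i)
        (tail-polyFun n (λ k u → pow (u k) Q) (λ k k<n → PolyFun-pow Q (PolyFun-var k<n))) (d , rep c Lc (λ _ → refl))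
      linear : PolyFun n (λ u → ev n d c (tail u))
      linear = PolyFun-subst (λ i u → tail u i) (tail-polyFun n (λ k u → u k) (λ k k<n → PolyFun-var k<n)) (d , rep c Lc (λ _ → refl))
      linear-zero : ∀ y → ev n d c (tail y) ≈ 0#
      linear-zero y = trans (agrees (proj₂ linear) y) (ev-zero n _ y (vanishing⇒zero (node Q) (node-distinct Q (q^≥1 (suc j))) n _ _
        (λ e → trans (sym (agrees (proj₂ linear) (node Q ∘ e))) (trans
          (ev-cong n d (λ _ → refl) (tail-cong n (λ i _ → trans (reflexive (≡.cong (pow z) (ℕₚ.*-comm (e i) Q))) (pow-* z Q (e i)))))
          (polyFun-vanishes ind twisted null (λ k → pow z (e k)))))))

  private
    unit-cancel : ∀ J (f g : B.Carrier) → f 0 P.≈ P.1# → (∀ N → N < J → (f B.* g) N P.≈ P.0#) → ∀ N → N < J → g N P.≈ P.0#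
    unit-cancel J f g f₀ h N N<J = below (suc N) N<J N ℕₚ.≤-refl
      where
      below : ∀ k → k ≤ J → ∀ i → i < k → g i P.≈ P.0#
      below (suc k) k<J i i≤k with i ℕ.≟ k
      ... | no i≢k     = below k (ℕₚ.<⇒≤ k<J) i (ℕₚ.≤∧≢⇒< (ℕₚ.≤-pred i≤k) i≢k)
      ... | yes ≡.refl = P.trans (P.sym (P.trans (P.*-congʳ f₀) (P.*-identityˡ (g i)))) (P.trans (P.sym at-i) (h i k<J))
        where
        at-i : (f B.* g) i P.≈ f 0 P.* g i
        at-i = P.trans (P.reflexive (PP.⊛-def f g i)) (Sums.Σ-single 𝔽[[t]] (suc i) 0 _ (s≤s z≤n)
          (λ m m≤i m≢0 → P.trans (P.*-congˡ (below i (ℕₚ.<⇒≤ k<J) (i ∸ m) (ℕₚ.∸-monoʳ-< (ℕₚ.n≢0⇒n>0 m≢0) (ℕₚ.≤-pred m≤i)))) (P.zeroʳ (f m))))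

  -- The relation is specialised where X₀ vanishes: only the monomials free of X₀ survive, and they
  -- involve n values. Once their coefficients are zero, what remains is divisible by X₀, whose
  -- constant term in x is 1, and the degree drops.
  formal-from-values : ∀ n → ValueIndependence n → FormalIndependence (suc n)
  formal-from-values n ind zero R h T bd rel tt N = rel (suc N) N ℕₚ.≤-refl
  formal-from-values n ind (suc d) R h T bd rel (inj₁ μ) N l = coefficient N l
    where
    -- The node is chosen with Q = q^{h+1} larger than the degree in x, so that the coefficients can
    -- be recovered from this single specialisation by `digits-zero`.
    open AtZero h
    c : Mon (suc n) (suc d) → Carrier
    c μ = biValue h T (R μ) α
    h<Q : h < Q
    h<Q = ℕₚ.<-trans (n<q^n h) (ℕₚ.^-monoʳ-< q 2≤q (ℕₚ.n<1+n h))
    Bounded-column : ∀ μ l → Bounded h (column h (R μ) l)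
    Bounded-column μ l = bounded (λ N → R μ N l) (λ N lt → BiBounded.x-high (bd μ) N l (ℕₚ.<⇒≤ lt))
      (sym (evalTo-extend (λ N → [ R μ N l ]) z (ℕₚ.n≤1+n h) (λ N le → []-zero (BiBounded.x-high (bd μ) N l le))))
    Laurent-c : ∀ μ → Laurent (c μ)
    Laurent-c μ = RelationLemmas.T-sum laurentRel T {0} {g = λ _ → 0#} (λ l _ → Laurent-* (Bounded⇒Laurent (Bounded-column μ l)) (Laurent-pow l (Laurent-pow Q Laurent-θ)))
    β : ℕ
    β = T ℕ.* (2 ℕ.* Q) ℕ.+ suc d ℕ.* (suc h ℕ.* (2 ℕ.* Q))
    -- Past the first h + 1 factors the exponents of x are at least q Q ≥ 2 Q; hence the factor
    -- `suc h` in β.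
    2Q≤ : ∀ i → suc h ≤ i → 2 ℕ.* Q ≤ q ^ (1 ℕ.+ i)
    2Q≤ i le = ℕₚ.≤-trans (ℕₚ.*-monoˡ-≤ Q 2≤q) (ℕₚ.^-monoʳ-≤ q {{ℕ.>-nonZero (ℕₚ.<-trans (s≤s z≤n) 2≤q)}} (s≤s le))
    null : Null (λ J → ev (suc n) (suc d) c (jetProd α z 0 J))
    null b = β ℕ.+ 2 ℕ.* b , λ J le → value-small Q β J b (BP.ev (suc n) (suc d) R (formalJet 0 J)) _
      (RelationLemmas.T-ev₀ (biEval α z) (suc n) (suc d) (λ μ → biBounded⇒evaluates α (bd μ))
        (λ i _ → RelationLemmas.T-jetProd₀ (biEval α z) q (biEval-t α) (biEval-x α) 0 J i))
      (RelationLemmas.T-ev (slopeRel (2 ℕ.* Q)) (suc n) (suc d) {c′ = λ _ → B.0#} {x′ = λ _ → B.0#} (λ μ → BiBounded-slope (2 ℕ.* Q) (bd μ))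
        (λ i _ → slope-formalJet (2 ℕ.* Q) 0 (suc h) 2Q≤ J i))
      (rel J) le
    c₁-zero : ∀ μ → c (inj₁ μ) ≈ 0#
    c₁-zero = vanishing-lower ind (suc d) (c ∘ inj₁) (Laurent-c ∘ inj₁)
      (Null-cong (λ J → trans (+-cong (ev-cong n (suc d) (λ _ → refl) (λ i _ → tail-γ J i)) (trans (*-congʳ (head-zero J)) (zeroˡ _))) (+-identityʳ _))
        (Null-shift (suc h) null))
    coefficient : ∀ N l → R (inj₁ μ) N l F.≈ F.0#
    coefficient N l with l ℕ.<? T | N ℕ.<? h
    ... | no l≮T  | _       = BiBounded.t-high (bd (inj₁ μ)) N l (ℕₚ.≮⇒≥ l≮T)
    ... | yes _   | no N≮h  = BiBounded.x-high (bd (inj₁ μ)) N l (ℕₚ.≮⇒≥ N≮h)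
    ... | yes l<T | yes N<h = evaluation-injective h (λ N → R (inj₁ μ) N l)
        (digits-zero T h Q (column h (R (inj₁ μ))) h<Q (Bounded-column (inj₁ μ)) (c₁-zero μ) l l<T) N N<h
  formal-from-values n ind (suc d) R h T bd rel (inj₂ μ) = formal-from-values n ind d (R ∘ inj₂) h T (bd ∘ inj₂) upper μ
    where
    lower-zero : ∀ μ → R (inj₁ μ) B.≈ B.0#
    lower-zero μ = formal-from-values n ind (suc d) R h T bd rel (inj₁ μ)
    upper : RelationOfJets (suc n) d (R ∘ inj₂)
    upper J N N<J = unit-cancel J (formalJet 0 J 0) (BP.ev (suc n) d (R ∘ inj₂) (formalJet 0 J)) (formalJet-stable 0 J 0 0 (s≤s z≤n))
      (λ N N<J → P.trans (P.sym (P.trans (P.+-congʳ (BP.ev-zero n (suc d) (formalJet 0 J ∘ suc) lower-zero N)) (P.+-identityˡ _))) (rel J N N<J)) N N<J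

-- Siegel's lemma over 𝔽_q[z].

fromFin-toFin : ∀ n d μ → fromFin n d (toFin n d μ) ≡ μ
fromFin-toFin zero    d       tt       = ≡.refl
fromFin-toFin (suc n) zero    tt       = ≡.refl
fromFin-toFin (suc n) (suc d) (inj₁ μ) rewrite Finₚ.splitAt-↑ˡ (monCount n (suc d)) (toFin n (suc d) μ) (monCount (suc n) d) = ≡.cong inj₁ (fromFin-toFin n (suc d) μ)
fromFin-toFin (suc n) (suc d) (inj₂ μ) rewrite Finₚ.splitAt-↑ʳ (monCount n (suc d)) (monCount (suc n) d) (toFin (suc n) d μ) = ≡.cong inj₂ (fromFin-toFin (suc n) d μ)

module Extension {c ℓ} (R : CommutativeRing c ℓ) where
  open CommutativeRing R

  extend : ∀ {n} → (Fin n → Carrier) → ℕ → Carrier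
  extend {zero}  f s       = 0#
  extend {suc n} f zero    = f Fin.zero
  extend {suc n} f (suc s) = extend (f ∘ Fin.suc) s

  extend-cong : ∀ {n} {f g : Fin n → Carrier} → (∀ i → f i ≈ g i) → ∀ s → extend f s ≈ extend g s
  extend-cong {zero}  h s       = refl
  extend-cong {suc n} h zero    = h Fin.zero
  extend-cong {suc n} h (suc s) = extend-cong (h ∘ Fin.suc) s

  extend-+ : ∀ {n} (f g : Fin n → Carrier) s → extend (λ i → f i + g i) s ≈ extend f s + extend g s
  extend-+ {zero}  f g s       = sym (+-identityˡ 0#)
  extend-+ {suc n} f g zero    = refl
  extend-+ {suc n} f g (suc s) = extend-+ (f ∘ Fin.suc) (g ∘ Fin.suc) s

  extend-* : ∀ {n} a (f : Fin n → Carrier) s → extend (λ i → a * f i) s ≈ a * extend f s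
  extend-* {zero}  a f s       = sym (zeroʳ a)
  extend-* {suc n} a f zero    = refl
  extend-* {suc n} a f (suc s) = extend-* a (f ∘ Fin.suc) s

  extend-high : ∀ {n} (f : Fin n → Carrier) s → n ≤ s → extend f s ≈ 0#
  extend-high {zero}  f s       _        = refl
  extend-high {suc n} f (suc s) (s≤s le) = extend-high (f ∘ Fin.suc) s le

  extend-toℕ : ∀ {n} (f : Fin n → Carrier) i → extend f (toℕ i) ≈ f i
  extend-toℕ f Fin.zero    = refl
  extend-toℕ f (Fin.suc i) = extend-toℕ (f ∘ Fin.suc) i

  extend-all : ∀ {p} (P : Carrier → Set p) → P 0# → ∀ {n} (f : Fin n → Carrier) → (∀ i → P (f i)) → ∀ s → P (extend f s)
  extend-all P P0 {zero}  f h s       = P0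
  extend-all P P0 {suc n} f h zero    = h Fin.zero
  extend-all P P0 {suc n} f h (suc s) = extend-all P P0 (f ∘ Fin.suc) (h ∘ Fin.suc) s

module SiegelLemma {q : ℕ} {𝔽 : FiniteField q} {a ℓ} {L : CommutativeRing a ℓ} {p} (V : ValuedExtension 𝔽 L p) where
  open ValuedLemmas V
  open FiniteField 𝔽 using (Fring; _≟F_) renaming (1≉0 to F-1≉0)
  open FormalSeries 𝔽 using (F-no-zero-divisors)
  private module F = CommutativeRing Fring
  open CommutativeRing L hiding (zero)
  open RingOps L
  open Sums L
  open Evaluation L
  open LinearMaps Fring L [_]
  open LinearSystems Fring
  open Domain F-1≉0 F-no-zero-divisors
  open Finite _≟F_
  private
    module FS = Algebra.Properties.Semiring.Sum F.semiring
    module LS = Algebra.Properties.Semiring.Sum semiring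

  -- A linear equation over 𝔽_q[z] with unknowns in 𝔽_q. Comparing powers of z splits it into
  -- `suc degree` scalar equations, which is the cost counted by `totalWidth`.
  record Equation (N : ℕ) : Set (a ⊔ ℓ) where
    field
      degree  : ℕ
      form    : Vector F.Carrier N → Carrier
      linear  : IsLinear form
      bound   : ∀ i → Bounded degree (form (basis i))
    row : ℕ → Vector F.Carrier N
    row w i = Bounded.digits (bound i) w
    rowsBelow : ℕ → List (Vector F.Carrier N)
    rowsBelow zero    = []
    rowsBelow (suc k) = row k ∷ rowsBelow k
    length-rowsBelow : ∀ k → length (rowsBelow k) ≡ k
    length-rowsBelow zero    = ≡.refl
    length-rowsBelow (suc k) = ≡.cong suc (length-rowsBelow k)
    rows : List (Vector F.Carrier N)
    rows = rowsBelow (suc degree)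
    rows-solved : ∀ {x} → All (λ r → dot r x F.≈ F.0#) rows → ∀ w → w < suc degree → dot (row w) x F.≈ F.0#
    rows-solved {x} = go (suc degree)
      where
      go : ∀ k → All (λ r → dot r x F.≈ F.0#) (rowsBelow k) → ∀ w → w < k → dot (row w) x F.≈ F.0#
      go (suc k) (h ∷ hs) w w≤k with w ℕ.≟ k
      ... | yes ≡.refl = h
      ... | no w≢k     = go k hs w (ℕₚ.≤∧≢⇒< (ℕₚ.≤-pred w≤k) w≢k)

  private
    expand-digits : ∀ W {N} (x : Vector F.Carrier N) (r : Fin N → ℕ → F.Carrier) →
      LS.sum (λ i → [ x i ] * evalTo W ([_] ∘ r i) z) ≈ evalTo W (λ w → [ FS.sum (λ i → r i w F.* x i) ]) z
    expand-digits W {zero}  x r = sym (Σ-zero W (λ w _ → trans (*-congʳ []-0) (zeroˡ _)))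
    expand-digits W {suc N} x r = trans (+-cong (sym (evalTo-scale W [ x Fin.zero ] _ z)) (expand-digits W (x ∘ Fin.suc) (r ∘ Fin.suc)))
      (trans (sym (evalTo-+ W _ _ z)) (Σ-cong′ W (λ w → *-congʳ (trans (+-congʳ (trans (sym ([]-* _ _)) ([]-cong (F.*-comm _ _)))) (sym ([]-+ _ _))))))

  equation-solved : ∀ {N} (e : Equation N) x → All (λ r → dot r x F.≈ F.0#) (Equation.rows e) → Equation.form e x ≈ 0#
  equation-solved e x solved = trans (linear-expand []-0 linear x)
    (trans (LS.sum-cong-≋ (λ i → *-congˡ (Bounded.expansion (bound i))))
    (trans (expand-digits (suc degree) x (λ i → Bounded.digits (bound i)))
      (Σ-zero (suc degree) (λ w w<W → trans (*-congʳ (trans ([]-cong (rows-solved solved w w<W)) []-0)) (zeroˡ _)))))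
    where open Equation e

  totalWidth : ∀ {N} → List (Equation N) → ℕ
  totalWidth []       = 0
  totalWidth (e ∷ es) = suc (Equation.degree e) ℕ.+ totalWidth es

  totalWidth-++ : ∀ {N} (es es′ : List (Equation N)) → totalWidth (es ++ es′) ≡ totalWidth es ℕ.+ totalWidth es′
  totalWidth-++ []       es′ = ≡.refl
  totalWidth-++ (e ∷ es) es′ = ≡.trans (≡.cong (suc (Equation.degree e) ℕ.+_) (totalWidth-++ es es′)) (≡.sym (ℕₚ.+-assoc (suc (Equation.degree e)) _ _))

  totalWidth-tabulate : ∀ {N m w} (e : Fin m → Equation N) → (∀ i → Equation.degree (e i) ≡ w) → totalWidth (tabulate e) ≡ m ℕ.* suc w
  totalWidth-tabulate {m = zero}  e h = ≡.refl
  totalWidth-tabulate {m = suc m} e h = ≡.cong₂ (λ u v → suc u ℕ.+ v) (h Fin.zero) (totalWidth-tabulate (e ∘ Fin.suc) (h ∘ Fin.suc))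

  siegel : ∀ {N} (es : List (Equation N)) → totalWidth es < N → ∃ λ x → (∃ λ i → ¬ (x i F.≈ F.0#)) × All (λ e → Equation.form e x ≈ 0#) es
  siegel {N} es lt = x , proj₁ (proj₂ solution) , go es (proj₂ (proj₂ solution))
    where
    allRows : List (Equation N) → List (Vector F.Carrier N)
    allRows []       = []
    allRows (e ∷ es) = Equation.rows e ++ allRows es
    length-allRows : ∀ es → length (allRows es) ≡ totalWidth es
    length-allRows []       = ≡.refl
    length-allRows (e ∷ es) = ≡.trans (Listₚ.length-++ (Equation.rows e)) (≡.cong₂ ℕ._+_ (Equation.length-rowsBelow e (suc (Equation.degree e))) (length-allRows es))
    solution = fewer-equations-than-unknowns (totalWidth es) N (allRows es) (ℕₚ.≤-reflexive (length-allRows es)) lt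
    x = proj₁ solution
    go : ∀ es → All (λ r → dot r x F.≈ F.0#) (allRows es) → All (λ e → Equation.form e x ≈ 0#) es
    go []       _ = []
    go (e ∷ es) h = equation-solved e x (Allₚ.++⁻ˡ (Equation.rows e) h) ∷ go es (Allₚ.++⁻ʳ (Equation.rows e) h)

-- Choice of parameters and elementary estimates.

-- The parameters of the auxiliary construction; ℓ is the number of monomials, g → ∞.
module Parameters (ℓ d C g : ℕ) where
  N T M h h′ : ℕ
  -- A polynomial of degree d in jets with g factors below the slope has weight d g in units of the
  -- slope; with N one larger, powers of t from M = T + N on are negligible. T makes M equal to 2 (ℓ
  -- + 1) N.
  N  = suc (d ℕ.* g)
  T  = suc (2 ℕ.* ℓ) ℕ.* N
  M  = T ℕ.+ N
  -- h′ bounds the degree of the multipliers and h that of the auxiliary polynomial, in units of Q.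
  -- They differ by the degree C of the twisted relations; neither depends on g.
  h′ = C ℕ.+ 2 ℕ.* suc ℓ ℕ.+ 2
  h  = h′ ℕ.+ C

  -- In units of Q, the N = M - T nodes in excess cost (ℓ + 1) N h and clearing θ costs (ℓ + 1) T,
  -- while the multipliers contribute M h′ = 2 (ℓ + 1) N h′ unknowns. With h = h′ + C the surplus is
  -- (ℓ + 1) N (h′ - C - 2 ℓ - 1) = 3 (ℓ + 1) N; the factor 2 in M beats the excess cost.
  count : ∀ Q → 1 ≤ Q → suc ℓ ℕ.* (M ℕ.* (h ℕ.* Q) ℕ.+ T ℕ.* Q) < suc ℓ ℕ.* (T ℕ.* (h ℕ.* Q)) ℕ.+ M ℕ.* (h′ ℕ.* Q)
  count Q 1≤Q = ℕₚ.<-≤-trans (ℕₚ.m<m+n _ (ℕₚ.≤-trans 1≤Q (ℕₚ.m≤m+n Q _))) (ℕₚ.≤-reflexive (≡.sym identity))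
    where
    open Data.Nat.Solver.+-*-Solver
    identity : suc ℓ ℕ.* (T ℕ.* (h ℕ.* Q)) ℕ.+ M ℕ.* (h′ ℕ.* Q) ≡
               suc ℓ ℕ.* (M ℕ.* (h ℕ.* Q) ℕ.+ T ℕ.* Q) ℕ.+ (Q ℕ.+ (3 ℕ.* (suc ℓ ℕ.* (N ℕ.* Q)) ∸ Q))
    identity = ≡.trans (solve 4 (λ ℓ n c q →
        let t = (con 1 :+ con 2 :* ℓ) :* n ; m = t :+ n ; h′ = c :+ con 2 :* (con 1 :+ ℓ) :+ con 2 ; h = h′ :+ c in
        (con 1 :+ ℓ) :* (t :* (h :* q)) :+ m :* (h′ :* q) :=
        (con 1 :+ ℓ) :* (m :* (h :* q) :+ t :* q) :+ con 3 :* ((con 1 :+ ℓ) :* (n :* q))) ≡.refl ℓ N C Q)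
      (≡.cong (suc ℓ ℕ.* (M ℕ.* (h ℕ.* Q) ℕ.+ T ℕ.* Q) ℕ.+_) (≡.sym (ℕₚ.m+[n∸m]≡n Q≤)))
      where
      Q≤ : Q ≤ 3 ℕ.* (suc ℓ ℕ.* (N ℕ.* Q))
      Q≤ = ℕₚ.≤-trans (ℕₚ.≤-trans (ℕₚ.m≤m+n Q _) (ℕₚ.m≤m+n (N ℕ.* Q) _)) (ℕₚ.m≤m+n (suc ℓ ℕ.* (N ℕ.* Q)) _)

  -- The power t^l carries valuation at least (l - T - d g) S = (1 + l - M) S. Of this, l A pays for
  -- the size of t at the nodes, and S - M A still remains.
  slope-gain : ∀ l S A → M ≤ l → A ≤ S → M ℕ.* A ≤ S → (S ∸ M ℕ.* A) ℕ.+ l ℕ.* A ℕ.+ (T ℕ.* S ℕ.+ d ℕ.* (g ℕ.* S)) ≤ l ℕ.* S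
  slope-gain l S A M≤l A≤S MA≤S = begin
    (S ∸ M ℕ.* A) ℕ.+ l ℕ.* A ℕ.+ (T ℕ.* S ℕ.+ d ℕ.* (g ℕ.* S))
      ≡⟨ ≡.cong (λ m → (S ∸ M ℕ.* A) ℕ.+ m ℕ.* A ℕ.+ (T ℕ.* S ℕ.+ d ℕ.* (g ℕ.* S))) l≡ ⟩
    (S ∸ M ℕ.* A) ℕ.+ (M ℕ.+ r) ℕ.* A ℕ.+ (T ℕ.* S ℕ.+ d ℕ.* (g ℕ.* S))
      ≡⟨ solve 8 (λ u m r a t s d g → u :+ (m :+ r) :* a :+ (t :* s :+ d :* (g :* s)) := (u :+ m :* a) :+ r :* a :+ (t :+ d :* g) :* s) ≡.refl (S ∸ M ℕ.* A) M r A T S d g ⟩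
    (S ∸ M ℕ.* A ℕ.+ M ℕ.* A) ℕ.+ r ℕ.* A ℕ.+ (T ℕ.+ d ℕ.* g) ℕ.* S
      ≡⟨ ≡.cong (λ m → m ℕ.+ r ℕ.* A ℕ.+ (T ℕ.+ d ℕ.* g) ℕ.* S) (ℕₚ.m∸n+n≡m MA≤S) ⟩
    S ℕ.+ r ℕ.* A ℕ.+ (T ℕ.+ d ℕ.* g) ℕ.* S
      ≤⟨ ℕₚ.+-monoˡ-≤ _ (ℕₚ.+-monoʳ-≤ S (ℕₚ.*-monoʳ-≤ r A≤S)) ⟩
    S ℕ.+ r ℕ.* S ℕ.+ (T ℕ.+ d ℕ.* g) ℕ.* S
      ≡⟨ solve 4 (λ s r t e → s :+ r :* s :+ (t :+ e) :* s := (t :+ (con 1 :+ e) :+ r) :* s) ≡.refl S r T (d ℕ.* g) ⟩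
    (M ℕ.+ r) ℕ.* S
      ≡⟨ ≡.cong (ℕ._* S) l≡ ⟨
    l ℕ.* S ∎
    where
    open ℕₚ.≤-Reasoning
    open Data.Nat.Solver.+-*-Solver
    r = l ∸ M
    l≡ : l ≡ M ℕ.+ r
    l≡ = ≡.sym (ℕₚ.m+[n∸m]≡n M≤l)

n<2^n : ∀ n → n < 2 ^ n
n<2^n zero    = s≤s z≤n
n<2^n (suc n) = ℕₚ.≤-trans (s≤s (n<2^n n)) (ℕₚ.≤-trans (ℕₚ.+-monoˡ-≤ (2 ^ n) (ℕₚ.m^n>0 2 n)) (ℕₚ.≤-reflexive (≡.cong (2 ^ n ℕ.+_) (≡.sym (ℕₚ.+-identityʳ (2 ^ n))))))

exponential-beats-linear : ∀ q → 2 ≤ q → ∀ u v → ∃ λ g → u ℕ.* g ℕ.+ v ≤ q ^ g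
exponential-beats-linear q 2≤q u v = m ℕ.+ m , (begin
  u ℕ.* (m ℕ.+ m) ℕ.+ v        ≡⟨ solve 3 (λ u m v → u :* (m :+ m) :+ v := (con 2 :* u) :* m :+ v) ≡.refl u m v ⟩
  2 ℕ.* u ℕ.* m ℕ.+ v          ≤⟨ ℕₚ.+-mono-≤ (ℕₚ.*-monoˡ-≤ m (ℕₚ.m≤m+n (2 ℕ.* u) v)) (ℕₚ.m≤n+m v (2 ℕ.* u)) ⟩
  m ℕ.* m ℕ.+ m                ≡⟨ ℕₚ.+-comm (m ℕ.* m) m ⟩
  suc m ℕ.* m                  ≤⟨ ℕₚ.*-mono-≤ (n<2^n m) (ℕₚ.<⇒≤ (n<2^n m)) ⟩
  2 ^ m ℕ.* 2 ^ m              ≡⟨ ℕₚ.^-distribˡ-+-* 2 m m ⟨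
  2 ^ (m ℕ.+ m)                ≤⟨ ℕₚ.^-monoˡ-≤ (m ℕ.+ m) 2≤q ⟩
  q ^ (m ℕ.+ m)                ∎)
  where
  open ℕₚ.≤-Reasoning
  open Data.Nat.Solver.+-*-Solver
  -- With the even exponent g = 2 m it is enough that m (m + 1) is at most 2^m 2^m.
  m = 2 ℕ.* u ℕ.+ v

-- Bounds the degree in z of a partial jet: the last factor dominates, up to a factor 2.
geometric-sum : ∀ q → 2 ≤ q → ∀ k m → sumℕ m (λ i → q ^ (suc k ℕ.+ i)) ≤ 2 ℕ.* q ^ (k ℕ.+ m)
geometric-sum q 2≤q k zero    = z≤n
geometric-sum q 2≤q k (suc m) = begin
  sumℕ m (λ i → q ^ (suc k ℕ.+ i)) ℕ.+ q ^ (suc k ℕ.+ m)   ≤⟨ ℕₚ.+-monoˡ-≤ _ (ℕₚ.≤-trans (geometric-sum q 2≤q k m) (ℕₚ.*-monoˡ-≤ (q ^ (k ℕ.+ m)) 2≤q)) ⟩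
  q ^ (suc k ℕ.+ m) ℕ.+ q ^ (suc k ℕ.+ m)                  ≡⟨ ≡.cong (q ^ (suc k ℕ.+ m) ℕ.+_) (ℕₚ.+-identityʳ _) ⟨
  2 ℕ.* q ^ (suc k ℕ.+ m)                                  ≡⟨ ≡.cong (λ e → 2 ℕ.* q ^ e) (ℕₚ.+-suc k m) ⟨
  2 ℕ.* q ^ (k ℕ.+ suc m)                                  ∎
  where open ℕₚ.≤-Reasoning

below-suc : ∀ {p} {P : ℕ → Set p} m → P m → (∀ k → k < m → P k) → ∀ k → k < suc m → P k
below-suc m top below k k≤m with k ℕ.≟ m
... | yes ≡.refl = top
... | no k≢m     = below k (ℕₚ.≤∧≢⇒< (ℕₚ.≤-pred k≤m) k≢m)

-- Frobenius twists of a relation between the values.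

module TwistedRelations {q : ℕ} {𝔽 : FiniteField q} {a ℓ} {L : CommutativeRing a ℓ} {p} (V : ValuedExtension 𝔽 L p) where
  open ValuedLemmas V
  open FunctionalIndependence V
  open CommutativeRing L hiding (zero)
  open RingOps L
  open IntegerSolver L
  open Sums L
  open Evaluation L
  open PowerSeries L using (Ser; _≋_; _⊛_; ⊛-cong; ⊛-def; ⊛-zero; const)
  open Polynomials L
  open Jets L q
  open Representation L
  open Vanishing L no-zero-divisors
  open Relation.Binary.Reasoning.Setoid setoid

  q^-mono : ∀ {i j} → i ≤ j → q ^ i ≤ q ^ j
  q^-mono = ℕₚ.^-monoʳ-≤ q {{ℕ.>-nonZero (ℕₚ.<-trans (s≤s z≤n) 2≤q)}}

  Bounded-pow : ∀ m {w x} → Bounded w x → Bounded (m ℕ.* w) (pow x m)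
  Bounded-pow zero    h = Bounded-z^ 0
  Bounded-pow (suc m) {w} {x} h = ≡.subst (λ k → Bounded k (pow x m * x)) (ℕₚ.+-comm (m ℕ.* w) w) (Bounded-* (Bounded-pow m h) h)

  αz : ∀ k i → pow θ (q ^ k) * pow z (q ^ (suc k ℕ.+ i)) ≈ pow z (q ^ (suc k ℕ.+ i) ∸ q ^ k)
  αz k i = θ^z^∸ (q^-mono (ℕₚ.≤-trans (ℕₚ.n≤1+n k) (ℕₚ.m≤m+n (suc k) i)))

  partialJet : ℕ → ℕ → Ser
  partialJet k m = jetProd (pow θ (q ^ k)) z k m

  partialJet₀≉0 : ∀ k m → ¬ (partialJet k m 0 ≈ 0#)
  partialJet₀≉0 k m = jetProd₀≉0 _ k m (λ i _ e → 1-z^≉0 _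
    (ℕₚ.m<n⇒0<n∸m (ℕₚ.^-monoʳ-< q 2≤q (s≤s (ℕₚ.m≤m+n k i)))) (trans (+-congˡ (-‿cong (sym (αz k i)))) e))

  Bounded-partialJet : ∀ k m i → Bounded (2 ℕ.* q ^ (k ℕ.+ m)) (partialJet k m i)
  Bounded-partialJet k m i = Bounded-≤ (geometric-sum q 2≤q k m)
    (RelationLemmas.T-jetProd boundedRel q {τ′ = 0#} {ζ′ = 0#} k m (λ i → q ^ (suc k ℕ.+ i)) factor i)
    where
    factor : ∀ i → i < m → ∀ e → Bounded (q ^ (suc k ℕ.+ i)) (factorJet (pow θ (q ^ k)) (pow z (q ^ (suc k ℕ.+ i))) e)
    factor i _ zero          = Bounded-+ (Bounded-≤ z≤n (Bounded-z^ 0)) (Bounded-neg (Bounded-cong (sym (αz k i)) (Bounded-≤ (ℕₚ.m∸n≤m _ (q ^ k)) (Bounded-z^ _))))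
    factor i _ (suc zero)    = Bounded-neg (Bounded-z^ _)
    factor i _ (suc (suc e)) = Bounded-0

  -- The q^k-th power of γ is a jet product at t = θ^{q^k} that begins after exponent q^k. Splitting
  -- off m factors moves the beginning to k + m, and m = M - k makes it the same for all k.
  partialJet-γ : ∀ k m J → partialJet k m ⊛ jetProd (pow θ (q ^ k)) z (k ℕ.+ m) J ≋ (λ i → pow (γ (m ℕ.+ J) i) (q ^ k))
  partialJet-γ k m J i = trans (sym (jetProd-+ (pow θ (q ^ k)) z k m J i)) (sym
    (trans (sym (RelationLemmas.T-jetProd₀ (frobRel k) q {τ′ = pow θ (q ^ k)} {ζ′ = pow z (q ^ k)} refl refl 0 (m ℕ.+ J) i))
      (trans (jetProd-rebase _ z k 0 (m ℕ.+ J) i) (reflexive (≡.cong (λ e → jetProd (pow θ (q ^ k)) z e (m ℕ.+ J) i) (ℕₚ.+-identityʳ k))))))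

  module _ (n d : ℕ) (c : Mon n d → Carrier) (w₀ : ℕ) (bd : ∀ μ → Bounded w₀ (c μ)) where

    twist : ℕ → Mon n d → Carrier
    twist k μ = pow (c μ) (q ^ k)

    -- the relation c(γ) = 0, raised to the power q^k and rewritten in terms of the jets at θ^{q^k}
    -- of the product starting after exponent q^{k + m}
    private
      twistedRelation′ : ∀ k m → ∃ λ (ρ : Mon n d → Carrier) →
        (∀ μ → Bounded ((w₀ ℕ.+ d ℕ.* 2) ℕ.* q ^ (k ℕ.+ m)) (ρ μ)) × (∀ X → ev n d ρ X ≈ ev n d (twist k) (partialJet k m ⊛ X))
      twistedRelation′ k m = coef r , (λ μ → Bounded-≤ weight (coef-S r μ)) , (λ X → trans (sym (agrees r X)) (*-identityʳ _))
        where
        b = 2 ℕ.* q ^ (k ℕ.+ m)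
        G G′ : ℕ → Fun → Set _
        G e f = Rep (Bounded (e ℕ.* b)) n e f
        G′ e f = Rep (Bounded (q ^ k ℕ.* w₀ ℕ.+ e ℕ.* b)) n e f
        G-shift : ∀ i {e f} → i < n → G e f → G (suc e) (λ X → (partialJet k m ⊛ X) i * f X)
        G-shift i {e} {f} i<n h = Rep-cong
          (λ X → trans (Σ-cong′ (suc i) (λ j → sym (*-assoc _ _ _))) (trans (sym (Σ-*ʳ (suc i) (f X) _)) (*-congʳ (reflexive (≡.sym (⊛-def (partialJet k m) X i))))))
          (Closed.Rep-Σ (Bounded (suc e ℕ.* b)) Bounded-0 Bounded-+ (suc i) (λ j _ →
            Rep-map (partialJet k m j) (Bounded-* (Bounded-partialJet k m j))
              (Closed.Rep-var (Bounded (e ℕ.* b)) Bounded-0 Bounded-+ n e (i ∸ j) (ℕₚ.≤-<-trans (ℕₚ.m∸n≤m i j) i<n) h)))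
        r : Rep (Bounded (q ^ k ℕ.* w₀ ℕ.+ d ℕ.* b)) n d (λ X → ev n d (twist k) (partialJet k m ⊛ X) * 1#)
        r = ≡.subst (λ e → G′ e (λ X → ev n d (twist k) (partialJet k m ⊛ X) * 1#)) (ℕₚ.+-identityʳ d)
          (substitute G G′ Rep-cong
            (λ {e} h → Rep-weaken (Bounded-≤ (ℕₚ.+-monoʳ-≤ (q ^ k ℕ.* w₀) (ℕₚ.m≤n+m (e ℕ.* b) b))) (Closed.Rep-lift _ Bounded-0 Bounded-+ n e h))
            (λ {e} → Closed.Rep-+ _ Bounded-0 Bounded-+)
            n d (twist k) (λ i X → (partialJet k m ⊛ X) i)
            (λ μ h → Rep-map (twist k μ) (Bounded-* (Bounded-pow (q ^ k) (bd μ))) h)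
            G-shift
            (Closed.Rep-const _ Bounded-0 Bounded-+ n 0 (Bounded-z^ 0)))
        -- The twisted coefficients have degree q^k w₀, and each of at most d substitutions of a
        -- partial jet adds 2 q^{k+m}. This is the origin of the constant C = w₀ + 2 d.
        weight : q ^ k ℕ.* w₀ ℕ.+ d ℕ.* b ≤ (w₀ ℕ.+ d ℕ.* 2) ℕ.* q ^ (k ℕ.+ m)
        weight = ℕₚ.≤-trans (ℕₚ.+-mono-≤ (ℕₚ.≤-trans (ℕₚ.*-monoˡ-≤ w₀ (q^-mono (ℕₚ.m≤m+n k m))) (ℕₚ.≤-reflexive (ℕₚ.*-comm (q ^ (k ℕ.+ m)) w₀)))
            (ℕₚ.≤-reflexive (≡.sym (ℕₚ.*-assoc d 2 (q ^ (k ℕ.+ m))))))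
          (ℕₚ.≤-reflexive (≡.sym (ℕₚ.*-distribʳ-+ (q ^ (k ℕ.+ m)) w₀ (d ℕ.* 2))))

    -- From here on only the degree bound and the defining identity of the twisted coefficients
    -- matter, so their construction is hidden.
    opaque
      twistedRelation : ∀ k m → ∃ λ (ρ : Mon n d → Carrier) →
        (∀ μ → Bounded ((w₀ ℕ.+ d ℕ.* 2) ℕ.* q ^ (k ℕ.+ m)) (ρ μ)) × (∀ X → ev n d ρ X ≈ ev n d (twist k) (partialJet k m ⊛ X))
      twistedRelation = twistedRelation′

    -- Multiplication by the partial jet is invertible to order n, so a vanishing ρ forces the twist
    -- of c to vanish on a grid, hence c itself.
    twistedRelation-nonzero : ∀ k m → (∀ μ → proj₁ (twistedRelation k m) μ ≈ 0#) → ∀ μ → c μ ≈ 0#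
    twistedRelation-nonzero k m zero-ρ μ = Bounded-stable (bd μ) (λ c≉0 → pow-nonzero (q ^ k) c≉0 (twist-zero μ))
      where
      ρ = proj₁ (twistedRelation k m)
      twist-zero : ∀ μ → twist k μ ≈ 0#
      twist-zero = vanishing⇒zero (node 1) (node-distinct 1 (s≤s z≤n)) n d (twist k) (λ e →
        let (y , h) = solve-⊛ (partialJet k m) (partialJet₀≉0 k m) n (node 1 ∘ e) in
        trans (ev-cong n d (λ _ → refl) (λ i i<n → sym (h i i<n))) (trans (sym (proj₂ (proj₂ (twistedRelation k m)) y)) (ev-zero n d y zero-ρ)))

    twistedRelation-value : ∀ k m J → ev n d (proj₁ (twistedRelation k m)) (jetProd (pow θ (q ^ k)) z (k ℕ.+ m) J) ≈ pow (ev n d c (γ (m ℕ.+ J))) (q ^ k)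
    twistedRelation-value k m J = trans (proj₂ (proj₂ (twistedRelation k m)) _) (trans
      (ev-cong n d (λ _ → refl) (λ i _ → partialJet-γ k m J i))
      (RelationLemmas.T-ev₀ (frobRel k) n d (λ _ → refl) (λ _ _ → refl)))

monCount-positive : ∀ n d → ∃ λ ℓ → monCount n d ≡ suc ℓ
monCount-positive zero    d       = 0 , ≡.refl
monCount-positive (suc n) zero    = 0 , ≡.refl
monCount-positive (suc n) (suc d) = let (ℓ , e) = monCount-positive n (suc d) in ℓ ℕ.+ monCount (suc n) d , ≡.cong (ℕ._+ monCount (suc n) d) e

-- The auxiliary polynomial and its order of vanishing.

module AuxiliaryFunction {q : ℕ} {𝔽 : FiniteField q} {a ℓ} {L : CommutativeRing a ℓ} {p} (V : ValuedExtension 𝔽 L p) where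
  open ValuedLemmas V
  open FunctionalIndependence V
  open TwistedRelations V
  open SiegelLemma V
  open FormalSeries 𝔽
  open FiniteField 𝔽 using (Fring; _≟F_)
  open CommutativeRing L hiding (zero)
  open RingOps L
  open IntegerSolver L
  open Sums L
  open Evaluation L
  open Roots L using (horner)
  open Polynomials L
  open Jets L q
  open LinearMaps Fring L [_]
  open Extension Fring
  open Relation.Binary.Reasoning.Setoid setoid
  private
    module BP = Polynomials 𝔽[[t]][[x]]

  Linear-Σ : ∀ {N} m {f : ℕ → Vector F.Carrier N → Carrier} → (∀ i → IsLinear (f i)) → IsLinear (λ y → sumTo m (λ i → f i y))
  Linear-Σ m {f} lin = record
    { cong-f  = λ h → Σ-cong′ m (λ i → IsLinear.cong-f (lin i) h)
    ; add-f   = λ y y′ → trans (Σ-cong′ m (λ i → IsLinear.add-f (lin i) y y′)) (Σ-+ m _ _)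
    ; scale-f = λ b y → trans (Σ-cong′ m (λ i → IsLinear.scale-f (lin i) b y)) (sym (Σ-*ˡ m [ b ] _)) }

  Linear-* : ∀ {N} {f : Vector F.Carrier N → Carrier} u → IsLinear f → IsLinear (λ y → f y * u)
  Linear-* u lin = record
    { cong-f  = λ h → *-congʳ (cong-f h)
    ; add-f   = λ y y′ → trans (*-congʳ (add-f y y′)) (distribʳ u _ _)
    ; scale-f = λ b y → trans (*-congʳ (scale-f b y)) (*-assoc _ _ _) }
    where open IsLinear lin

  Linear-- : ∀ {N} {f f′ : Vector F.Carrier N → Carrier} → IsLinear f → IsLinear f′ → IsLinear (λ y → f y - f′ y)
  Linear-- {f = f} {f′} lin lin′ = record
    { cong-f  = λ h → +-cong (IsLinear.cong-f lin h) (-‿cong (IsLinear.cong-f lin′ h))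
    ; add-f   = λ y y′ → trans (+-cong (IsLinear.add-f lin y y′) (-‿cong (IsLinear.add-f lin′ y y′)))
        (solve 4 (λ a b c d → (a :+ b) :- (c :+ d) := (a :- c) :+ (b :- d)) refl (f y) (f y′) (f′ y) (f′ y′))
    ; scale-f = λ b y → trans (+-cong (IsLinear.scale-f lin b y) (-‿cong (IsLinear.scale-f lin′ b y)))
        (solve 3 (λ b u v → b :* u :- b :* v := b :* (u :- v)) refl [ b ] (f y) (f′ y)) }

  Linear-coordinate : ∀ {N} (coordinate : Vector F.Carrier N → F.Carrier) →
    (∀ {y y′} → (∀ i → y i F.≈ y′ i) → coordinate y F.≈ coordinate y′) →
    (∀ y y′ → coordinate (λ i → y i F.+ y′ i) F.≈ coordinate y F.+ coordinate y′) →
    (∀ b y → coordinate (λ i → b F.* y i) F.≈ b F.* coordinate y) → IsLinear (λ y → [ coordinate y ])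
  Linear-coordinate f c p s = record
    { cong-f = λ h → []-cong (c h) ; add-f = λ y y′ → trans ([]-cong (p y y′)) ([]-+ _ _) ; scale-f = λ b y → trans ([]-cong (s b y)) ([]-* _ _) }

  array : ∀ {m k} → (Fin m → Fin k → F.Carrier) → ℕ → ℕ → F.Carrier
  array f s e = extend (λ i → extend (f i) e) s

  array-at : ∀ {m k} (f : Fin m → Fin k → F.Carrier) i j → array f (toℕ i) (toℕ j) F.≈ f i j
  array-at f i j = F.trans (extend-toℕ (λ i → extend (f i) (toℕ j)) i) (extend-toℕ (f i) j)

  array-high₁ : ∀ {m k} (f : Fin m → Fin k → F.Carrier) s e → m ≤ s → array f s e F.≈ F.0#
  array-high₁ f s e = extend-high _ s

  array-high₂ : ∀ {m k} (f : Fin m → Fin k → F.Carrier) s e → k ≤ e → array f s e F.≈ F.0#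
  array-high₂ f s e le = extend-all (F._≈ F.0#) F.refl (λ i → extend (f i) e) (λ i → extend-high (f i) e le) s

  Linear-array : ∀ {N m k} (f : Fin m → Fin k → Fin N) s e → IsLinear (λ y → [ array (λ i j → y (f i j)) s e ])
  Linear-array f s e = Linear-coordinate (λ y → array (λ i j → y (f i j)) s e)
    (λ h → extend-cong (λ i → extend-cong (λ j → h (f i j)) e) s)
    (λ y y′ → F.trans (extend-cong (λ i → extend-+ (λ j → y (f i j)) (λ j → y′ (f i j)) e) s) (extend-+ (λ i → extend (λ j → y (f i j)) e) (λ i → extend (λ j → y′ (f i j)) e) s))
    (λ b y → F.trans (extend-cong (λ i → extend-* b (λ j → y (f i j)) e) s) (extend-* b (λ i → extend (λ j → y (f i j)) e) s))

  -- Degree bounds extracted at different nodes may differ; the values must not depend on them.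
  biValue-unique : ∀ {h T h′ T′ E} τ → BiBounded h T E → BiBounded h′ T′ E → biValue h T E τ ≈ biValue h′ T′ E τ
  biValue-unique {h} {T} {h′} {T′} {E} τ bd bd′ = trans (raise bd (ℕₚ.m≤m⊔n h h′) (ℕₚ.m≤m⊔n T T′)) (sym (raise bd′ (ℕₚ.m≤n⊔m h h′) (ℕₚ.m≤n⊔m T T′)))
    where
    raise : ∀ {h T h′ T′} → BiBounded h T E → h ≤ h′ → T ≤ T′ → biValue h T E τ ≈ biValue h′ T′ E τ
    raise {h} {T} {h′} {T′} (biBounded xh th) hh TT = sym (trans
      (evalTo-extend (column h′ E) τ TT (λ l le → Σ-zero h′ (λ N _ → trans (*-congʳ ([]-zero (th N l le))) (zeroˡ _))))
      (Σ-cong′ T (λ l → *-congʳ (evalTo-extend (λ N → [ E N l ]) z hh (λ N le → []-zero (xh N l le))))))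

  Null-uniform : ∀ M (u : ℕ → ℕ → Carrier) → (∀ k → k < M → Null (u k)) → ∀ b → ∃ λ J₀ → ∀ J → J₀ ≤ J → ∀ k → k < M → O b (u k J)
  Null-uniform zero    u h b = 0 , λ _ _ _ ()
  Null-uniform (suc M) u h b = J₀ ℕ.⊔ J₁ , λ J le → below-suc M (proj₂ (h M ℕₚ.≤-refl b) J (ℕₚ.m⊔n≤o⇒n≤o J₀ J₁ le)) (proj₂ rest J (ℕₚ.m⊔n≤o⇒m≤o J₀ J₁ le))
    where
    rest = Null-uniform M u (λ k k<M → h k (ℕₚ.m<n⇒m<1+n k<M)) b
    J₀ = proj₁ rest
    J₁ = proj₁ (h M ℕₚ.≤-refl b)

  slope-term : ∀ S β E w → FilteredRelation.T (slopeRel S) β E B.0# → ∀ N l → w ℕ.+ β ≤ l ℕ.* S → O w ([ E N l ] * pow z N)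
  slope-term S β E w slope N l le with (N ℕ.+ β) ℕ.<? (l ℕ.* S)
  ... | yes lt = O-cong (sym (trans (*-congʳ ([]-zero (slope N l lt))) (zeroˡ _))) O-0
  ... | no ge  = O-scale (𝒪-[] _) (O-≤ (ℕₚ.+-cancelʳ-≤ β _ _ (ℕₚ.≤-trans le (ℕₚ.≮⇒≥ ge))) (O-z^ N))

  small-columns⇒zero : ∀ {h T E} b → BiBounded h T E → (∀ l → l < T → O b (column h E l)) → ∀ N l → N < b → E N l F.≈ F.0#
  small-columns⇒zero {h} {T} {E} b bd columns N l N<b with l ℕ.<? T | N ℕ.<? h
  ... | no l≮T  | _       = BiBounded.t-high bd N l (ℕₚ.≮⇒≥ l≮T)
  ... | yes _   | no N≮h  = BiBounded.x-high bd N l (ℕₚ.≮⇒≥ N≮h)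
  ... | yes l<T | yes N<h = separation h (λ N → E N l) b (O.cofactor-𝒪 (columns l l<T)) (O.factors (columns l l<T)) N N<h N<b

  -- Inserting x = z turns E into a polynomial in t over 𝔽_q[z], to which the Schwarz lemma applies.
  -- Since z is transcendental over 𝔽_q, smallness of a coefficient means that its low powers of x
  -- are absent.
  small-coefficients : ∀ M A S β w b → (∀ k → k < M → q ^ k ≤ A) → M ℕ.* A ≤ w → b ≤ w ∸ M ℕ.* A →
    (∀ l → M ≤ l → w ℕ.+ l ℕ.* A ℕ.+ β ≤ l ℕ.* S) →
    ∀ E (u : ℕ → Carrier) → (∀ k → FilteredRelation.T (biEval (pow θ (q ^ k)) z) 0 E (u k)) →
    FilteredRelation.T (slopeRel S) β E B.0# → (∀ k → k < M → O w (u k)) → ∀ N l → N < b → E N l F.≈ F.0#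
  small-coefficients M A S β w b q^≤A MA≤w b≤ gain E u evaluated slope values-small = from-bounds (evaluates⇒biBounded (pow θ (q ^ 0)) (evaluated 0))
    where
    from-bounds : (∃ λ h → ∃ λ T → BiBounded h T E × u 0 ≈ biValue h T E (pow θ (q ^ 0))) → ∀ N l → N < b → E N l F.≈ F.0#
    from-bounds (h , T , bd , _) = small-columns⇒zero b bd (λ l l<T → O-cong (getD-listOf T (column h E) l l<T) (O-≤ b≤ (all-small l)))
      where
      cs = listOf T (column h E)
      values : ∀ k → k < M → O w (horner cs (pow θ (q ^ k)))
      values k k<M = let (_ , _ , bd′ , v) = evaluates⇒biBounded (pow θ (q ^ k)) (evaluated k) in
        O-cong (trans v (trans (biValue-unique (pow θ (q ^ k)) bd′ bd) (sym (horner-listOf T (column h E) (pow θ (q ^ k)))))) (values-small k k<M)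
      all-small : ∀ l → O (w ∸ M ℕ.* A) (getD cs l)
      all-small = schwarz M A w cs q^≤A
        (λ l M≤l → getD-listOf-O T (column h E) l (λ _ → O-Σ h (λ N _ → slope-term S β E (w ℕ.+ l ℕ.* A) slope N l (gain l M≤l)))) values MA≤w

  module _ (n d : ℕ) (c : Mon n d → Carrier) (w₀ : ℕ) (bd : ∀ μ → Bounded w₀ (c μ))
           (null : Null (λ J → ev n d c (γ J))) (nonzero : ¬ (∀ μ → c μ ≈ 0#)) where

    cnt ℓ′ C : ℕ
    cnt = monCount n d
    ℓ′  = proj₁ (monCount-positive n d)
    C   = w₀ ℕ.+ d ℕ.* 2

    module Construction (T M Q H H′ H₁ : ℕ) (Q≡ : Q ≡ q ^ M) (H≡1+H₁ : H ≡ suc H₁) (H₁≡ : H₁ ≡ (H′ ∸ 1) ℕ.+ C ℕ.* Q)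
           (enough : cnt ℕ.* (M ℕ.* H ℕ.+ T ℕ.* Q) < cnt ℕ.* (T ℕ.* H) ℕ.+ M ℕ.* H′) where
      unknowns : ℕ
      unknowns = cnt ℕ.* (T ℕ.* H) ℕ.+ M ℕ.* H′
      α : ℕ → Carrier
      α k = pow θ (q ^ k)
      ρ : ℕ → Mon n d → Carrier
      ρ k = proj₁ (twistedRelation n d c w₀ bd k (M ∸ k))

      indexQ : Mon n d → Fin T → Fin H → Fin unknowns
      indexQ μ s e = combine (toFin n d μ) (combine s e) Fin.↑ˡ (M ℕ.* H′)
      indexΛ : Fin M → Fin H′ → Fin unknowns
      indexΛ k e = (cnt ℕ.* (T ℕ.* H)) Fin.↑ʳ combine k e

      Qc : Vector F.Carrier unknowns → Mon n d → ℕ → ℕ → F.Carrier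
      Qc y μ = array (λ s e → y (indexQ μ s e))
      Λc : Vector F.Carrier unknowns → ℕ → ℕ → F.Carrier
      Λc y = array (λ k e → y (indexΛ k e))

      Λ : Vector F.Carrier unknowns → ℕ → Carrier
      Λ y k = evalTo H′ (λ e → [ Λc y k e ]) z

      -- The difference between the coefficient of the auxiliary polynomial at t = θ^{q^k} and the
      -- multiple Λ_k ρ_k of the twisted relation, multiplied by z^{T q^k} to remove θ.
      form : ℕ → Mon n d → Vector F.Carrier unknowns → Carrier
      form k μ y = sumTo T (λ s → sumTo H (λ e → [ Qc y μ s e ] * pow z (e ℕ.+ (T ∸ s) ℕ.* q ^ k))) - Λ y k * (ρ k μ * pow z (T ℕ.* q ^ k))

      form-linear : ∀ k μ → IsLinear (form k μ)
      form-linear k μ = Linear--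
        (Linear-Σ T (λ s → Linear-Σ H (λ e → Linear-* (pow z (e ℕ.+ (T ∸ s) ℕ.* q ^ k)) (Linear-array (indexQ μ) s e))))
        (Linear-* (ρ k μ * pow z (T ℕ.* q ^ k)) (Linear-Σ H′ (λ e → Linear-* (pow z e) (Linear-array indexΛ k e))))

      module BL = RelationLemmas boundedRel

      -- The digits behind this bound are the entries of the linear system; only their existence is
      -- used.
      opaque
        form-bounded : ∀ k μ → k ≤ M → ∀ y → Bounded (H₁ ℕ.+ T ℕ.* q ^ k) (form k μ y)
        form-bounded k μ k≤M y = Bounded-+
          (BL.T-sum T {g = λ _ → 0#} (λ s _ → BL.T-sum H {g = λ _ → 0#} (λ e e<H → Bounded-* {0} (Bounded-[] _) (Bounded-≤
            (ℕₚ.+-mono-≤ (ℕₚ.≤-pred (ℕₚ.≤-trans e<H (ℕₚ.≤-reflexive H≡1+H₁))) (ℕₚ.*-monoˡ-≤ (q ^ k) (ℕₚ.m∸n≤m T s))) (Bounded-z^ _)))))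
          -- Here H = H′ + C Q is used: a multiplier of degree below H′ times ρ of degree C Q stays
          -- within the degree H₁ of the first summand.
          (Bounded-neg (Bounded-≤ (ℕₚ.≤-reflexive (≡.trans (≡.sym (ℕₚ.+-assoc (H′ ∸ 1) (C ℕ.* Q) (T ℕ.* q ^ k))) (≡.cong (ℕ._+ T ℕ.* q ^ k) (≡.sym H₁≡))))
            (Bounded-* {H′ ∸ 1} (BL.T-sum H′ {g = λ _ → 0#} (λ e e<H′ → Bounded-* {0} (Bounded-[] _) (Bounded-≤ (ℕₚ.<⇒≤pred e<H′) (Bounded-z^ e))))
              (Bounded-* (≡.subst (λ m → Bounded (C ℕ.* m) (ρ k μ)) (≡.trans (≡.cong (q ^_) (ℕₚ.m+[n∸m]≡n k≤M)) (≡.sym Q≡)) (proj₁ (proj₂ (twistedRelation n d c w₀ bd k (M ∸ k))) μ)) (Bounded-z^ _)))))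

      equation : ∀ k → k ≤ M → Mon n d → Equation unknowns
      equation k k≤M μ = record { degree = H₁ ℕ.+ T ℕ.* q ^ k ; form = form k μ ; linear = form-linear k μ ; bound = λ i → form-bounded k μ k≤M (basis i) }

      equations : ∀ k → k ≤ M → List (Equation unknowns)
      equations zero    _   = []
      equations (suc k) k<M = tabulate (λ i → equation k (ℕₚ.<⇒≤ k<M) (fromFin n d i)) ++ equations k (ℕₚ.<⇒≤ k<M)

      -- The costs T q^{k′} of clearing θ at the nodes k′ < k add up to at most T q^k because q ≥ 2,
      -- so in total they amount to T Q and not to M T Q.
      width : ∀ k k≤M → totalWidth (equations k k≤M) ≤ cnt ℕ.* (k ℕ.* H ℕ.+ T ℕ.* q ^ k)
      width zero    _   = z≤n
      width (suc k) k<M = ℕₚ.≤-trans (ℕₚ.≤-reflexive (totalWidth-++ (tabulate (λ i → equation k (ℕₚ.<⇒≤ k<M) (fromFin n d i))) (equations k (ℕₚ.<⇒≤ k<M))))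
        (ℕₚ.≤-trans (ℕₚ.+-mono-≤ (ℕₚ.≤-reflexive (totalWidth-tabulate (λ i → equation k (ℕₚ.<⇒≤ k<M) (fromFin n d i)) (λ _ → ≡.refl))) (width k (ℕₚ.<⇒≤ k<M)))
        (ℕₚ.≤-trans (ℕₚ.≤-reflexive (≡.trans (≡.cong (λ u → cnt ℕ.* (u ℕ.+ T ℕ.* q ^ k) ℕ.+ cnt ℕ.* (k ℕ.* H ℕ.+ T ℕ.* q ^ k)) (≡.sym H≡1+H₁)) (rearrange cnt H T (q ^ k) k)))
          (ℕₚ.*-monoʳ-≤ cnt (ℕₚ.+-monoʳ-≤ (suc k ℕ.* H) (ℕₚ.*-monoʳ-≤ T (ℕₚ.*-monoˡ-≤ (q ^ k) 2≤q))))))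
        where
        rearrange : ∀ cnt H T r k → cnt ℕ.* (H ℕ.+ T ℕ.* r) ℕ.+ cnt ℕ.* (k ℕ.* H ℕ.+ T ℕ.* r) ≡ cnt ℕ.* (suc k ℕ.* H ℕ.+ T ℕ.* (2 ℕ.* r))
        rearrange = solveℕ 5 (λ c h t r k → c :*ℕ (h :+ℕ t :*ℕ r) :+ℕ c :*ℕ (k :*ℕ h :+ℕ t :*ℕ r) :=ℕ c :*ℕ ((conℕ 1 :+ℕ k) :*ℕ h :+ℕ t :*ℕ (conℕ 2 :*ℕ r))) ≡.refl
          where open Data.Nat.Solver.+-*-Solver renaming (solve to solveℕ; _:*_ to _:*ℕ_; _:+_ to _:+ℕ_; _:=_ to _:=ℕ_; con to conℕ)

      enough-unknowns : totalWidth (equations M ℕₚ.≤-refl) < unknowns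
      enough-unknowns = ℕₚ.≤-<-trans (ℕₚ.≤-trans (width M ℕₚ.≤-refl) (ℕₚ.≤-reflexive (≡.cong (λ r → cnt ℕ.* (M ℕ.* H ℕ.+ T ℕ.* r)) (≡.sym Q≡)))) enough

      solved-forms : ∀ y m m≤M → All (λ e → Equation.form e y ≈ 0#) (equations m m≤M) → ∀ k → k < m → ∀ μ → form k μ y ≈ 0#
      solved-forms y (suc m) m<M h = below-suc m
        (λ μ → ≡.subst (λ ν → form m ν y ≈ 0#) (fromFin-toFin n d μ)
          (Allₚ.tabulate⁻ {f = λ i → equation m (ℕₚ.<⇒≤ m<M) (fromFin n d i)} (Allₚ.++⁻ˡ (tabulate (λ i → equation m (ℕₚ.<⇒≤ m<M) (fromFin n d i))) h) (toFin n d μ)))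
        (solved-forms y m (ℕₚ.<⇒≤ m<M) (Allₚ.++⁻ʳ (tabulate (λ i → equation m (ℕₚ.<⇒≤ m<M) (fromFin n d i))) h))

      solution : ∃ λ y → (∃ λ i → ¬ (y i F.≈ F.0#)) × (∀ k → k < M → ∀ μ → form k μ y ≈ 0#)
      solution = let (y , nz , solved) = siegel (equations M ℕₚ.≤-refl) enough-unknowns in y , nz , solved-forms y M ℕₚ.≤-refl solved

      module Solved (y : Vector F.Carrier unknowns) (i₀ : Fin unknowns) (y≉0 : ¬ (y i₀ F.≈ F.0#)) (form-zero : ∀ k → k < M → ∀ μ → form k μ y ≈ 0#) where

        auxiliary : Mon n d → B.Carrier
        auxiliary μ N l = Qc y μ l N

        auxiliary-bounded : ∀ μ → BiBounded H T (auxiliary μ)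
        auxiliary-bounded μ = biBounded (λ N l → array-high₂ (λ s e → y (indexQ μ s e)) l N) (λ N l → array-high₁ (λ s e → y (indexQ μ s e)) l N)

        auxiliary-at-node : ∀ k → k < M → ∀ μ → biValue H T (auxiliary μ) (α k) ≈ Λ y k * ρ k μ
        auxiliary-at-node k k<M μ = begin
          v                              ≈⟨ solve 2 (λ v w → v := (v :- w) :+ w) refl v (Λ y k * ρ k μ) ⟩
          (v - Λ y k * ρ k μ) + Λ y k * ρ k μ ≈⟨ +-congʳ (no-zero-divisors Z _ scaled (pow-nonzero (T ℕ.* q ^ k) z≉0)) ⟩
          0# + Λ y k * ρ k μ             ≈⟨ +-identityˡ _ ⟩
          Λ y k * ρ k μ                  ∎
          where
          v = biValue H T (auxiliary μ) (α k)
          Z = pow z (T ℕ.* q ^ k)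
          term : ∀ s → s < T → sumTo H (λ e → [ Qc y μ s e ] * pow z (e ℕ.+ (T ∸ s) ℕ.* q ^ k)) ≈ Z * (column H (auxiliary μ) s * pow (α k) s)
          term s s<T = begin
            sumTo H (λ e → [ Qc y μ s e ] * pow z (e ℕ.+ (T ∸ s) ℕ.* q ^ k))
              ≈⟨ Σ-cong′ H (λ e → trans (*-congˡ (pow-+ z e _)) (sym (*-assoc _ _ _))) ⟩
            sumTo H (λ e → [ Qc y μ s e ] * pow z e * pow z ((T ∸ s) ℕ.* q ^ k)) ≈⟨ Σ-*ʳ H _ _ ⟨
            column H (auxiliary μ) s * pow z ((T ∸ s) ℕ.* q ^ k)
              ≈⟨ *-congˡ (trans (reflexive (≡.cong (pow z) (ℕₚ.*-distribʳ-∸ (q ^ k) T s))) (sym (θ^z^∸ (ℕₚ.*-monoˡ-≤ (q ^ k) (ℕₚ.<⇒≤ s<T))))) ⟩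
            column H (auxiliary μ) s * (pow θ (s ℕ.* q ^ k) * Z) ≈⟨ *-congˡ (*-congʳ (pow-* θ s (q ^ k))) ⟩
            column H (auxiliary μ) s * (pow (α k) s * Z) ≈⟨ solve 3 (λ u v w → u :* (v :* w) := w :* (u :* v)) refl _ _ Z ⟩
            Z * (column H (auxiliary μ) s * pow (α k) s) ∎
          scaled : Z * (v - Λ y k * ρ k μ) ≈ 0#
          scaled = begin
            Z * (v - Λ y k * ρ k μ)          ≈⟨ solve 4 (λ Z v l r → Z :* (v :- l :* r) := Z :* v :- l :* (r :* Z)) refl Z v (Λ y k) (ρ k μ) ⟩
            Z * v - Λ y k * (ρ k μ * Z)      ≈⟨ +-congʳ (trans (Σ-*ˡ T Z _) (sym (Σ-cong T term))) ⟩
            form k μ y                       ≈⟨ form-zero k k<M μ ⟩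
            0#                               ∎

        -- Siegel's lemma might produce a solution supported on the multipliers. But if the
        -- auxiliary polynomial were zero, then Λ_k ρ_k = 0 with Λ_k nonzero for some k, and ρ_k = 0
        -- would make the given relation trivial.
        auxiliary-nonzero : ¬ (∀ μ → auxiliary μ B.≈ B.0#)
        auxiliary-nonzero all-zero = case (Fin.splitAt (cnt ℕ.* (T ℕ.* H)) i₀) ≡.refl
          where
          case : ∀ r → Fin.splitAt (cnt ℕ.* (T ℕ.* H)) i₀ ≡ r → ⊥
          case (inj₁ i) eq = y≉0 (F.trans (F.reflexive (≡.cong y (≡.sym index≡)))
              (F.trans (F.sym (array-at (λ s e → y (indexQ μ s e)) s e)) (all-zero μ (toℕ e) (toℕ s))))
            where
            outer = remQuot {cnt} (T ℕ.* H) i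
            inner = remQuot {T} H (proj₂ outer)
            μ = fromFin n d (proj₁ outer)
            s = proj₁ inner
            e = proj₂ inner
            index≡ : indexQ μ s e ≡ i₀
            index≡ = ≡.trans (≡.cong (Fin._↑ˡ (M ℕ.* H′)) (≡.trans (≡.cong₂ combine (toFin-fromFin n d (proj₁ outer)) (Finₚ.combine-remQuot {T} H (proj₂ outer))) (Finₚ.combine-remQuot {cnt} (T ℕ.* H) i)))
              (Finₚ.splitAt⁻¹-↑ˡ eq)
          case (inj₂ i) eq = nonzero (twistedRelation-nonzero n d c w₀ bd (toℕ k) (M ∸ toℕ k) (λ μ → no-zero-divisors (Λ y (toℕ k)) (ρ (toℕ k) μ)
              (trans (sym (auxiliary-at-node (toℕ k) (Finₚ.toℕ<n k) μ)) (Σ-zero T (λ l _ → trans (*-congʳ (Σ-zero H (λ N _ → trans (*-congʳ ([]-zero (all-zero μ N l))) (zeroˡ _)))) (zeroˡ _)))) Λ≉0))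
            where
            k = proj₁ (remQuot {M} H′ i)
            e = proj₂ (remQuot {M} H′ i)
            index≡ : indexΛ k e ≡ i₀
            index≡ = ≡.trans (≡.cong ((cnt ℕ.* (T ℕ.* H)) Fin.↑ʳ_) (Finₚ.combine-remQuot {M} H′ i)) (Finₚ.splitAt⁻¹-↑ʳ eq)
            Λ≉0 : ¬ (Λ y (toℕ k) ≈ 0#)
            Λ≉0 Λ≈0 = y≉0 (F.trans (F.reflexive (≡.cong y (≡.sym index≡))) (F.trans (F.sym (array-at (λ k e → y (indexΛ k e)) k e))
              (evaluation-injective H′ (Λc y (toℕ k)) Λ≈0 (toℕ e) (Finₚ.toℕ<n e))))

        formalValue : ℕ → B.Carrier
        formalValue J = BP.ev n d auxiliary (formalJet M J)

        nodeValue : ℕ → ℕ → Carrier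
        nodeValue k J = ev n d (λ μ → biValue H T (auxiliary μ) (α k)) (jetProd (α k) z M J)

        nodeValue-evaluates : ∀ k J → FilteredRelation.T (biEval (α k) z) 0 (formalValue J) (nodeValue k J)
        nodeValue-evaluates k J = RelationLemmas.T-ev₀ (biEval (α k) z) n d (λ μ → biBounded⇒evaluates (α k) (auxiliary-bounded μ))
          (λ i _ → RelationLemmas.T-jetProd₀ (biEval (α k) z) q (biEval-t (α k)) (biEval-x (α k)) M J i)

        -- Proportionality pays off here: at the node θ^{q^k} the auxiliary function is a multiple
        -- of the q^k-th power of the original relation, and so tends to 0.
        nodeValue≈ : ∀ k → k < M → ∀ J → nodeValue k J ≈ Λ y k * pow (ev n d c (γ (M ∸ k ℕ.+ J))) (q ^ k)
        nodeValue≈ k k<M J = trans (ev-cong n d (auxiliary-at-node k k<M) (λ _ _ → refl)) (trans (ev-scale n d (Λ y k) (ρ k) _)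
          (*-congˡ (trans (ev-cong n d (λ _ → refl) (λ i _ → reflexive (≡.cong (λ m → jetProd (α k) z m J i) (≡.sym (ℕₚ.m+[n∸m]≡n (ℕₚ.<⇒≤ k<M))))))
            (twistedRelation-value n d c w₀ bd k (M ∸ k) J))))

        𝒪-Λ : ∀ k → 𝒪 (Λ y k)
        𝒪-Λ k = O⇒𝒪 {0} (O-Σ H′ (λ e _ → 𝒪⇒O (𝒪-* (𝒪-[] _) (𝒪-pow e 𝒪-z))))

        nodeValue-null : ∀ k → k < M → Null (nodeValue k)
        nodeValue-null k k<M = Null-cong (λ J → sym (nodeValue≈ k k<M J)) (Null-scale (λ _ → Λ y k) (λ _ → 𝒪-Λ k)
          (≡.subst (λ m → Null (λ J → pow (ev n d c (γ (M ∸ k ℕ.+ J))) m)) (ℕₚ.m+[n∸m]≡n (q^≥1 k)) (Null-pow (q ^ k ∸ 1) (Null-shift (M ∸ k) null))))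

        -- Beyond the first g factors of `formalJet M` the exponents are at least S = q^{M+g}. Out
        -- of S, one M Q is spent on the tail in t and another on the Schwarz lemma; the rest is the
        -- order of vanishing in x, uniformly for large J.
        auxiliary-small : ∀ g S G → S ≡ q ^ (M ℕ.+ g) →
          (∀ l → M ≤ l → (S ∸ M ℕ.* Q) ℕ.+ l ℕ.* Q ℕ.+ (T ℕ.* S ℕ.+ d ℕ.* (g ℕ.* S)) ≤ l ℕ.* S) →
          M ℕ.* Q ≤ S ∸ M ℕ.* Q → G ℕ.* Q ≤ S ∸ M ℕ.* Q ∸ M ℕ.* Q →
          ∃ λ J₀ → ∀ J → J₀ ≤ J → ∀ N → N < G ℕ.* Q → formalValue J N P.≈ P.0#
        auxiliary-small g S G S≡ gain MQ≤w GQ≤ =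
          let (J₀ , values-small) = Null-uniform M nodeValue nodeValue-null (S ∸ M ℕ.* Q) in
          J₀ , λ J le N N<GQ l → small-coefficients M Q S (T ℕ.* S ℕ.+ d ℕ.* (g ℕ.* S)) (S ∸ M ℕ.* Q) (G ℕ.* Q)
            (λ k k<M → ℕₚ.≤-trans (q^-mono (ℕₚ.<⇒≤ k<M)) (ℕₚ.≤-reflexive (≡.sym Q≡))) MQ≤w GQ≤ gain
            (formalValue J) (λ k → nodeValue k J) (λ k → nodeValue-evaluates k J) (slope J) (values-small J le) N l N<GQ
          where
          slope : ∀ J → FilteredRelation.T (slopeRel S) (T ℕ.* S ℕ.+ d ℕ.* (g ℕ.* S)) (formalValue J) B.0#
          slope J = RelationLemmas.T-ev (slopeRel S) n d {c′ = λ _ → B.0#} {x′ = λ _ → B.0#} (λ μ → BiBounded-slope S (auxiliary-bounded μ))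
            (λ i _ → slope-formalJet S M g (λ i le → ℕₚ.≤-trans (ℕₚ.≤-reflexive S≡) (q^-mono (ℕₚ.≤-trans (ℕₚ.+-monoʳ-≤ M le) (ℕₚ.n≤1+n _)))) J i)

-- Sorting the exponents of x modulo q^M.

digit-unique : ∀ Q N N′ {e e′} → e < Q → e′ < Q → e ℕ.+ N ℕ.* Q ≡ N′ ℕ.* Q ℕ.+ e′ → N ≡ N′ × e ≡ e′
digit-unique (suc Q) N N′ {e} {e′} e<Q e′<Q eq = ℕₚ.*-cancelʳ-≡ N N′ (suc Q) (ℕₚ.+-cancelˡ-≡ e _ _ (≡.trans eq (≡.trans (ℕₚ.+-comm (N′ ℕ.* suc Q) e′) (≡.cong (ℕ._+ N′ ℕ.* suc Q) (≡.sym e≡e′))))) , e≡e′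
  where
  e≡e′ : e ≡ e′
  e≡e′ = begin
    e                                    ≡⟨ DivMod.m<n⇒m%n≡m e<Q ⟨
    e DivMod.% suc Q                     ≡⟨ DivMod.[m+kn]%n≡m%n e N (suc Q) ⟨
    (e ℕ.+ N ℕ.* suc Q) DivMod.% suc Q   ≡⟨ ≡.cong (DivMod._% suc Q) (≡.trans eq (ℕₚ.+-comm (N′ ℕ.* suc Q) e′)) ⟩
    (e′ ℕ.+ N′ ℕ.* suc Q) DivMod.% suc Q ≡⟨ DivMod.[m+kn]%n≡m%n e′ N′ (suc Q) ⟩
    e′ DivMod.% suc Q                    ≡⟨ DivMod.m<n⇒m%n≡m e′<Q ⟩
    e′                                   ∎
    where open ≡.≡-Reasoning

module Decimation {q : ℕ} (𝔽 : FiniteField q) where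
  open FormalSeries 𝔽
  private
    module BO = RingOps 𝔽[[t]][[x]]
    module BP = Polynomials 𝔽[[t]][[x]]
    module BJ = Jets 𝔽[[t]][[x]] q
    module BE = Evaluation 𝔽[[t]][[x]]
    module BΣ = Sums 𝔽[[t]][[x]]
    module PΣ = Sums 𝔽[[t]]
    module PO = RingOps 𝔽[[t]]

  constPRel : FilteredRelation 𝔽[[t]] 𝔽[[t]][[x]] 0ℓ
  constPRel = record
    { T = λ _ f E → E B.≈ PP.const f
    ; T-cong = λ p p′ h → B.trans (B.sym p′) (B.trans h (const-cong p))
    ; T-mono = λ _ h → h
    ; T-0 = λ { zero → P.refl ; (suc _) → P.refl }
    ; T-1 = B.refl
    ; T-+ = λ h h′ → B.trans (B.+-cong h h′) λ { zero → P.refl ; (suc _) → P.+-identityˡ P.0# }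
    ; T-* = λ {_} {_} {f} {f′} h h′ → B.trans (B.*-cong h h′) λ { zero → PP.const-⊛ f (PP.const f′) 0 ; (suc N) → P.trans (PP.const-⊛ f (PP.const f′) (suc N)) (P.zeroʳ f) }
    ; T-neg = λ h → B.trans (B.-‿cong h) λ { zero → P.refl ; (suc _) → Algebra.Properties.Ring.-0#≈0# P.ring } }
    where
    const-cong : ∀ {f f′} → f P.≈ f′ → PP.const f B.≈ PP.const f′
    const-cong p zero    = p
    const-cong p (suc _) = P.refl

  monomial-at : ∀ f m → (PP.const f B.* BO.pow x m) m P.≈ f
  monomial-at f m = P.trans (B.*-comm (PP.const f) (BO.pow x m) m) (P.trans
    (P.reflexive (≡.cong (BO.pow x m B.* PP.const f) (≡.sym (ℕₚ.+-identityʳ m)))) (x^-at m (PP.const f) 0))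

  monomial-off : ∀ f m k → ¬ (m ≡ k) → (PP.const f B.* BO.pow x m) k P.≈ P.0#
  monomial-off f m k m≢k with ℕₚ.<-cmp k m
  ... | tri< k<m _ _ = P.trans (B.*-comm (PP.const f) (BO.pow x m) k) (PP.var^-⊛-low m (PP.const f) k k<m)
  ... | tri≈ _ k≡m _ = ⊥-elim (m≢k (≡.sym k≡m))
  ... | tri> _ _ m<k = P.trans (B.*-comm (PP.const f) (BO.pow x m) k) (P.trans
      (P.reflexive (≡.cong (BO.pow x m B.* PP.const f) (≡.sym (≡.trans (ℕₚ.+-suc m (k ∸ suc m)) (ℕₚ.m+[n∸m]≡n m<k))))) (x^-at m (PP.const f) (suc (k ∸ suc m))))

  module _ (Q : ℕ) (b : ℕ) (Y : ℕ → P.Carrier) where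
    -- The truncated series Y at x^Q, written as an evaluation at x^Q of constants so that the
    -- evaluation relation applies to it.
    spread : B.Carrier
    spread = BE.evalTo b (λ N → PP.const (Y N)) (BO.pow x Q)

    private
      expand : ∀ e K → (BO.pow x e B.* spread) K P.≈ PO.sumTo b (λ N → (PP.const (Y N) B.* BO.pow x (e ℕ.+ N ℕ.* Q)) K)
      expand e K = P.trans (BΣ.Σ-*ˡ b (BO.pow x e) _ K) (P.trans (P.reflexive (PP.sumTo-at b _ K)) (PΣ.Σ-cong′ b (λ N → term N K)))
        where
        module S = IntegerSolver 𝔽[[t]][[x]]
        term : ∀ N → BO.pow x e B.* (PP.const (Y N) B.* BO.pow (BO.pow x Q) N) B.≈ PP.const (Y N) B.* BO.pow x (e ℕ.+ N ℕ.* Q)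
        term N = B.trans (S.solve 3 (λ u v w → u S.:* (v S.:* w) S.:= v S.:* (u S.:* w)) B.refl (BO.pow x e) (PP.const (Y N)) (BO.pow (BO.pow x Q) N))
          (B.*-congˡ {PP.const (Y N)} (B.trans (B.*-congˡ {BO.pow x e} (B.sym (BΣ.pow-* x N Q))) (B.sym (BΣ.pow-+ x e (N ℕ.* Q)))))

    spread-off : ∀ {e e′} N → e < Q → e′ < Q → ¬ (e ≡ e′) → (BO.pow x e B.* spread) (N ℕ.* Q ℕ.+ e′) P.≈ P.0#
    spread-off {e} {e′} N e<Q e′<Q e≢e′ = P.trans (expand e _) (PΣ.Σ-zero b (λ N′ _ → monomial-off (Y N′) _ _ (λ eq → e≢e′ (proj₂ (digit-unique Q N′ N e<Q e′<Q eq)))))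

    spread-at : (∀ N → b ≤ N → Y N P.≈ P.0#) → ∀ {e} N → e < Q → (BO.pow x e B.* spread) (N ℕ.* Q ℕ.+ e) P.≈ Y N
    spread-at high {e} N e<Q = P.trans (expand e _) (case (N ℕ.<? b))
      where
      off : ∀ N′ → ¬ (N′ ≡ N) → (PP.const (Y N′) B.* BO.pow x (e ℕ.+ N′ ℕ.* Q)) (N ℕ.* Q ℕ.+ e) P.≈ P.0#
      off N′ ne = monomial-off (Y N′) _ _ (λ eq → ne (proj₁ (digit-unique Q N′ N e<Q e<Q eq)))
      case : Dec (N < b) → PO.sumTo b (λ N′ → (PP.const (Y N′) B.* BO.pow x (e ℕ.+ N′ ℕ.* Q)) (N ℕ.* Q ℕ.+ e)) P.≈ Y N
      case (yes N<b) = P.trans (PΣ.Σ-single b N _ N<b (λ N′ _ → off N′)) (P.trans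
        (P.reflexive (≡.cong (PP.const (Y N) B.* BO.pow x (e ℕ.+ N ℕ.* Q)) (ℕₚ.+-comm (N ℕ.* Q) e))) (monomial-at (Y N) (e ℕ.+ N ℕ.* Q)))
      case (no N≮b)  = P.trans (PΣ.Σ-zero b (λ N′ N′<b → off N′ (λ { ≡.refl → N≮b N′<b }))) (P.sym (high N (ℕₚ.≮⇒≥ N≮b)))

  module _ (M : ℕ) (1≤Q : 1 ≤ q ^ M) (h n d : ℕ) (A : Mon n d → B.Carrier) (A-high : ∀ μ N → h ℕ.* q ^ M ≤ N → A μ N P.≈ P.0#) where
    private
      Q = q ^ M
      instance
        Q-nonZero : ℕ.NonZero (q ^ M)
        Q-nonZero = ℕ.>-nonZero 1≤Q

    part : ℕ → Mon n d → B.Carrier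
    part e μ N = A μ (N ℕ.* q ^ M ℕ.+ e)

    part-high : ∀ e μ N → h ≤ N → part e μ N P.≈ P.0#
    part-high e μ N le = A-high μ _ (ℕₚ.≤-trans (ℕₚ.*-monoˡ-≤ (q ^ M) le) (ℕₚ.m≤m+n _ e))

    private
      A-split : ∀ μ → A μ B.≈ BO.sumTo Q (λ e → BO.pow x e B.* spread Q h (part e μ))
      A-split μ K = P.sym (P.trans (P.reflexive (PP.sumTo-at Q _ K)) (P.trans
        (PΣ.Σ-cong′ Q (λ e → P.reflexive (≡.cong (BO.pow x e B.* spread Q h (part e μ)) K≡)))
        (P.trans (PΣ.Σ-single Q (K DivMod.% Q) _ e₀<Q (λ e e<Q ne → spread-off Q h (part e μ) (K DivMod./ Q) e<Q e₀<Q ne))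
          (P.trans (spread-at Q h (part (K DivMod.% Q) μ) (part-high (K DivMod.% Q) μ) (K DivMod./ Q) e₀<Q) (P.reflexive (≡.cong (A μ) (≡.sym K≡)))))))
        where
        e₀<Q : K DivMod.% Q < Q
        e₀<Q = DivMod.m%n<n K Q
        K≡ : K ≡ K DivMod./ Q ℕ.* Q ℕ.+ K DivMod.% Q
        K≡ = ≡.trans (DivMod.m≡m%n+[m/n]*n K Q) (ℕₚ.+-comm (K DivMod.% Q) _)

    -- By the functional equation `formalJet M J` is `formalJet 0 J` with x^Q in place of x. It
    -- contains only exponents divisible by Q, so the residue class e of the value comes from the
    -- same class of the coefficients A.
    decimation : ∀ J {e} N → e < q ^ M → BP.ev n d A (formalJet M J) (N ℕ.* q ^ M ℕ.+ e) P.≈ BP.ev n d (part e) (formalJet 0 J) N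
    decimation J {e₀} N e₀<Q = P.trans (B.trans split-value (BΣ.Σ-cong′ Q (λ e → B.*-congˡ {BO.pow x e} (spread-value e))) K) (P.trans
        (P.reflexive (PP.sumTo-at Q _ K)) (P.trans (PΣ.Σ-single Q e₀ _ e₀<Q (λ e e<Q ne → spread-off Q (bnd e) (Y e) N e<Q e₀<Q ne))
          (spread-at Q (bnd e₀) (Y e₀) (high e₀) N e₀<Q)))
      where
      K = N ℕ.* Q ℕ.+ e₀
      Y : ℕ → B.Carrier
      Y e = BP.ev n d (part e) (formalJet 0 J)
      W : ℕ → B.Carrier
      W e = BP.ev n d (λ μ → spread Q h (part e μ)) (formalJet M J)
      split-value : BP.ev n d A (formalJet M J) B.≈ BO.sumTo Q (λ e → BO.pow x e B.* W e)
      split-value = B.trans (BP.ev-cong n d A-split (λ _ _ → B.refl)) (B.trans (BP.ev-Σ n d Q _ (formalJet M J))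
        (BΣ.Σ-cong′ Q (λ e → BP.ev-scale n d (BO.pow x e) (λ μ → spread Q h (part e μ)) (formalJet M J))))
      σ = evaluation constPRel (BO.pow x Q)
      related : ∀ e → FilteredRelation.T σ 0 (Y e) (W e)
      related e = FilteredRelation.T-cong σ {0} B.refl (BP.ev-cong n d (λ _ → B.refl) (λ i _ → B.trans (BJ.jetProd-rebase t x M 0 J i) (B.reflexive (≡.cong (λ m → formalJet m J i) (ℕₚ.+-identityʳ M)))))
        (RelationLemmas.T-ev₀ σ n d
          (λ μ → evaluates h (λ N → PP.const (part e μ N)) (λ _ → B.refl) (part-high e μ) (λ N le → λ { zero → part-high e μ N le ; (suc _) → P.refl }) B.refl)
          (λ i _ → RelationLemmas.T-jetProd₀ σ q (evaluates-const constPRel {x = PF.var} B.refl) (evaluates-var constPRel) 0 J i))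
      bnd : ℕ → ℕ
      bnd e = Evaluates.bound (related e)
      high : ∀ e N → bnd e ≤ N → Y e N P.≈ P.0#
      high e = Evaluates.high (related e)
      spread-value : ∀ e → W e B.≈ spread Q (bnd e) (Y e)
      spread-value e = B.trans (Evaluates.value (related e)) (BΣ.Σ-cong′ (bnd e) (λ N → B.*-congʳ {BO.pow (BO.pow x Q) N} (Evaluates.related (related e) N)))

-- From independence of formal jets to independence of values.

module ValueStep {q : ℕ} {𝔽 : FiniteField q} {a ℓ} {L : CommutativeRing a ℓ} {p} (V : ValuedExtension 𝔽 L p) where
  open ValuedLemmas V
  open FunctionalIndependence V
  open FunctionalStep V
  open TwistedRelations V
  open AuxiliaryFunction V
  open FormalSeries 𝔽
  open Decimation 𝔽
  open FiniteField 𝔽 using (Fring; _≟F_)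
  open CommutativeRing L hiding (zero)
  open RingOps L
  open Polynomials L
  private
    module BP = Polynomials 𝔽[[t]][[x]]
    module PX = Extension 𝔽[[t]]
    module PL = LinearMaps 𝔽[[t]] 𝔽[[t]] (λ f → f)
    module PSys = LinearSystems 𝔽[[t]]
    module PSum = Algebra.Properties.Semiring.Sum P.semiring
  open PSys.Domain.Infinite P-1≉0 P-no-zero-divisors FiniteP FiniteP-0 FiniteP-1 FiniteP-+ FiniteP-* FiniteP-neg P-stable

  module _ (n d : ℕ) where
    cntₙ : ℕ
    cntₙ = monCount n d

    module Assemble (h : ℕ) where
      assemble : Vector P.Carrier (cntₙ ℕ.* h) → Mon n d → B.Carrier
      assemble X μ = PX.extend (λ e → X (combine (toFin n d μ) e))

      -- A formal relation of degree below h in x amounts to the vanishing of these forms for all e.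
      -- The length `suc e` is enough, because later factors do not affect the coefficient of x^e.
      coefficientForm : ℕ → Vector P.Carrier (cntₙ ℕ.* h) → P.Carrier
      coefficientForm e X = BP.ev n d (assemble X) (formalJet 0 (suc e)) e

      coefficientForm-linear : ∀ e → PL.IsLinear (coefficientForm e)
      coefficientForm-linear e = record
        { cong-f = λ p → BP.ev-cong n d (λ μ → PX.extend-cong (λ i → p (combine (toFin n d μ) i))) (λ _ _ → B.refl) e
        ; add-f = λ X Y → P.trans (BP.ev-cong n d (λ μ → PX.extend-+ (λ i → X (combine (toFin n d μ) i)) (λ i → Y (combine (toFin n d μ) i))) (λ _ _ → B.refl) e)
            (BP.ev-+ n d (assemble X) (assemble Y) (formalJet 0 (suc e)) e)
        ; scale-f = λ b X → P.trans (BP.ev-cong n d (λ μ N → P.trans (PX.extend-* b (λ i → X (combine (toFin n d μ) i)) N) (P.sym (PP.const-⊛ b (assemble X μ) N))) (λ _ _ → B.refl) e)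
            (P.trans (BP.ev-scale n d (PP.const b) (assemble X) (formalJet 0 (suc e)) e) (PP.const-⊛ b _ e)) }

      matrix : ℕ → Vector P.Carrier (cntₙ ℕ.* h)
      matrix e i = coefficientForm e (PL.basis i)

      matrix-dot : ∀ e X → PSys.dot (matrix e) X P.≈ coefficientForm e X
      matrix-dot e X = P.sym (P.trans (PL.linear-expand P.refl (coefficientForm-linear e) X) (PSum.sum-cong-≋ (λ i → P.*-comm (X i) (matrix e i))))

      basis-finite : ∀ {m} (i j : Fin m) → FiniteP (PL.basis i j)
      basis-finite Fin.zero    Fin.zero    = FiniteP-1
      basis-finite Fin.zero    (Fin.suc j) = FiniteP-0
      basis-finite (Fin.suc i) Fin.zero    = FiniteP-0
      basis-finite (Fin.suc i) (Fin.suc j) = basis-finite i j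

      matrix-finite : ∀ e i → FiniteP (matrix e i)
      matrix-finite e i = RelationLemmas.T-ev₀ finiteRel n d {c′ = λ _ → B.0#} {x′ = formalJet 0 (suc e)}
        (λ μ → PX.extend-all FiniteP FiniteP-0 _ (λ j → basis-finite i (combine (toFin n d μ) j)))
        (λ i _ → RelationLemmas.T-jetProd₀ finiteRel q {τ′ = t} {ζ′ = x} t-finite x-finite 0 (suc e) i) e
        where
        t-finite : ∀ N → FiniteP (t N)
        t-finite zero    = 2 , λ { (suc (suc _)) _ → F.refl ; (suc zero) (s≤s ()) }
        t-finite (suc _) = FiniteP-0
        x-finite : ∀ N → FiniteP (x N)
        x-finite zero          = FiniteP-0
        x-finite (suc zero)    = FiniteP-1
        x-finite (suc (suc _)) = FiniteP-0

      stable-coefficient : ∀ R N J → suc N ≤ J → BP.ev n d R (formalJet 0 J) N P.≈ BP.ev n d R (formalJet 0 (suc N)) N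
      stable-coefficient R N J le = RelationLemmas.T-ev₀ (modRel (suc (suc N))) n d (λ _ _ _ → P.refl)
        (λ i _ → ≡.subst (λ m → FilteredRelation.T (modRel (suc (suc N))) 0 (formalJet 0 m i) (formalJet 0 (suc N) i)) (ℕₚ.m+[n∸m]≡n le) (formalJet-stable (suc N) (J ∸ suc N) i))
        N (ℕₚ.m<n⇒m<1+n ℕₚ.≤-refl)

      no-exact-solution : FormalIndependence n → ¬ Solution (cntₙ ℕ.* h) (λ _ → ⊤) matrix
      no-exact-solution ind (X , finite , nz , solves) = nz λ i →
          let (i₁ , e) = remQuot {cntₙ} h i in
          P.trans (P.reflexive (≡.cong X (≡.sym (≡.trans (≡.cong (λ j → combine j e) (toFin-fromFin n d i₁)) (Finₚ.combine-remQuot {cntₙ} h i)))))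
            (P.trans (P.sym (PX.extend-toℕ (λ e → X (combine (toFin n d (fromFin n d i₁)) e)) e)) (all-zero (fromFin n d i₁) (toℕ e)))
        where
        finMax : ∀ {m} (f : Fin m → ℕ) → ∃ λ b → ∀ i → f i ≤ b
        finMax {zero}  f = 0 , λ ()
        finMax {suc m} f = let (b , hb) = finMax (f ∘ Fin.suc) in f Fin.zero ℕ.⊔ b , λ { Fin.zero → ℕₚ.m≤m⊔n _ b ; (Fin.suc i) → ℕₚ.≤-trans (hb i) (ℕₚ.m≤n⊔m _ b) }
        T = proj₁ (finMax (λ i → proj₁ (finite i)))
        all-zero : ∀ μ → assemble X μ B.≈ B.0#
        all-zero = ind d (assemble X) h T
          (λ μ → biBounded (λ N l le → PX.extend-high (λ e → X (combine (toFin n d μ) e)) N le l)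
            (λ N l le → PX.extend-all (λ f → f l F.≈ F.0#) F.refl _ (λ e → proj₂ (finite (combine (toFin n d μ) e)) l (ℕₚ.≤-trans (proj₂ (finMax (λ i → proj₁ (finite i))) _) le)) N))
          (λ J N N<J → P.trans (stable-coefficient (assemble X) N J N<J) (P.trans (P.sym (matrix-dot N X)) (solves N tt)))

      -- A nonzero coefficient at x^K selects the residue class K mod Q, whose part is nonzero.
      -- Dividing exponents by Q turns degree h Q into h and order G Q into G, so M disappears from
      -- the dimensions and all G concern the same number of unknowns.
      finite-solution : ∀ M G T (A : Mon n d → B.Carrier) → (∀ μ → BiBounded (h ℕ.* q ^ M) T (A μ)) → ¬ (∀ μ → A μ B.≈ B.0#) →
        (∃ λ J₀ → ∀ J → J₀ ≤ J → ∀ N → N < G ℕ.* q ^ M → BP.ev n d A (formalJet M J) N P.≈ P.0#) →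
        ¬ ¬ Solution (cntₙ ℕ.* h) (_< G) matrix
      finite-solution M G T A bd nz (J₀ , small-order) none = nz (λ μ K → P-stable _ (λ ne → none (solution μ K ne)))
        where
        Q = q ^ M
        instance
          Q-nonZero : ℕ.NonZero (q ^ M)
          Q-nonZero = ℕ.>-nonZero (q^≥1 M)
        A-high : ∀ μ N → h ℕ.* q ^ M ≤ N → A μ N P.≈ P.0#
        A-high μ N le l = BiBounded.x-high (bd μ) N l le
        piece = part M (q^≥1 M) h n d A A-high
        solution : ∀ μ K → ¬ (A μ K P.≈ P.0#) → Solution (cntₙ ℕ.* h) (_< G) matrix
        solution μ K ne = X , X-finite , X-nonzero , λ e e<G → P.trans (matrix-dot e X) (P.trans
            (BP.ev-cong n d assemble≈ (λ _ _ → B.refl) e)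
            (P.trans (P.sym (stable-coefficient (piece e₀) e (J₀ ℕ.⊔ suc e) (ℕₚ.m≤n⊔m J₀ (suc e))))
              (P.trans (P.sym (decimation M (q^≥1 M) h n d A A-high (J₀ ℕ.⊔ suc e) e e₀<Q)) (small-order (J₀ ℕ.⊔ suc e) (ℕₚ.m≤m⊔n J₀ (suc e)) _ (index< e e<G)))))
          where
          e₀ = K DivMod.% Q
          e₀<Q : e₀ < q ^ M
          e₀<Q = DivMod.m%n<n K Q
          X : Vector P.Carrier (cntₙ ℕ.* h)
          X i = piece e₀ (fromFin n d (proj₁ (remQuot {cntₙ} h i))) (toℕ (proj₂ (remQuot {cntₙ} h i)))
          X-at : ∀ ν e → X (combine (toFin n d ν) e) P.≈ piece e₀ ν (toℕ e)
          X-at ν e = P.reflexive (≡.trans (≡.cong (λ r → piece e₀ (fromFin n d (proj₁ r)) (toℕ (proj₂ r))) (Finₚ.remQuot-combine {cntₙ} {h} (toFin n d ν) e))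
            (≡.cong (λ ξ → piece e₀ ξ (toℕ e)) (fromFin-toFin n d ν)))
          extend-piece : ∀ {m} (f : Fin m → P.Carrier) (g : ℕ → P.Carrier) → (∀ i → f i P.≈ g (toℕ i)) → (∀ N → m ≤ N → g N P.≈ P.0#) → ∀ N → PX.extend f N P.≈ g N
          extend-piece {zero}  f g hf hg N       = P.sym (hg N z≤n)
          extend-piece {suc m} f g hf hg zero    = hf Fin.zero
          extend-piece {suc m} f g hf hg (suc N) = extend-piece (f ∘ Fin.suc) (g ∘ suc) (hf ∘ Fin.suc) (λ N le → hg (suc N) (s≤s le)) N
          assemble≈ : ∀ ν → assemble X ν B.≈ piece e₀ ν
          assemble≈ ν = extend-piece _ (piece e₀ ν) (X-at ν) (part-high M (q^≥1 M) h n d A A-high e₀ ν)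
          X-finite : ∀ i → FiniteP (X i)
          X-finite i = T , λ l le → BiBounded.t-high (bd _) _ l le
          K≡ : K ≡ K DivMod./ Q ℕ.* Q ℕ.+ e₀
          K≡ = ≡.trans (DivMod.m≡m%n+[m/n]*n K Q) (ℕₚ.+-comm e₀ _)
          X-nonzero : ¬ (∀ i → X i P.≈ P.0#)
          X-nonzero all = ne (P.trans (P.reflexive (≡.cong (A μ) K≡)) (P.trans (P.sym (assemble≈ μ (K DivMod./ Q)))
            (PX.extend-all (λ f → f P.≈ P.0#) P.refl _ (λ e → all (combine (toFin n d μ) e)) (K DivMod./ Q))))
          index< : ∀ e → e < G → e ℕ.* q ^ M ℕ.+ e₀ < G ℕ.* q ^ M
          index< e e<G = ℕₚ.<-≤-trans (ℕₚ.+-monoʳ-< (e ℕ.* q ^ M) e₀<Q) (ℕₚ.≤-trans (ℕₚ.≤-reflexive (ℕₚ.+-comm (e ℕ.* q ^ M) (q ^ M))) (ℕₚ.*-monoˡ-≤ (q ^ M) e<G))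

  HighOrder : ℕ → ℕ → ℕ → ℕ → Set
  HighOrder n d h G = ∃ λ M → ∃ λ T → ∃ λ (A : Mon n d → B.Carrier) → (∀ μ → BiBounded (h ℕ.* q ^ M) T (A μ)) × (¬ (∀ μ → A μ B.≈ B.0#)) ×
    (∃ λ J₀ → ∀ J → J₀ ≤ J → ∀ N → N < G ℕ.* q ^ M → BP.ev n d A (formalJet M J) N P.≈ P.0#)

  auxiliary-exists : ∀ n d (c : Mon n d → Carrier) w₀ (bd : ∀ μ → Bounded w₀ (c μ)) (null : Null (λ J → ev n d c (γ J))) (nonzero : ¬ (∀ μ → c μ ≈ 0#)) →
    ∃ λ h → ∀ G → HighOrder n d h G
  auxiliary-exists n d c w₀ bd null nonzero = Parameters.h ℓ₀ d C′ 0 , λ G → construct G (exponential-beats-linear q 2≤q (u G) (v G))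
    where
    ℓ₀ = proj₁ (monCount-positive n d)
    C′ = w₀ ℕ.+ d ℕ.* 2
    -- u g + v equals 2 M + G: the losses M Q + M Q and the desired order G Q must fit into S = Q
    -- q^g.
    u v : ℕ → ℕ
    u G = 2 ℕ.* (suc (2 ℕ.* ℓ₀) ℕ.+ 1) ℕ.* d
    v G = 2 ℕ.* (suc (2 ℕ.* ℓ₀) ℕ.+ 1) ℕ.+ G
    construct : ∀ G → (∃ λ g → u G ℕ.* g ℕ.+ v G ≤ q ^ g) → HighOrder n d (Parameters.h ℓ₀ d C′ 0) G
    construct G (g , room) = build (T ℕ.+ N) ≡.refl
      where
      open Parameters ℓ₀ d C′ g
      2M+G≡ : u G ℕ.* g ℕ.+ v G ≡ 2 ℕ.* M ℕ.+ G
      2M+G≡ = solveℕ 4 (λ l d g G → con 2 :* (con 1 :+ con 2 :* l :+ con 1) :* d :* g :+ (con 2 :* (con 1 :+ con 2 :* l :+ con 1) :+ G)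
          := con 2 :* ((con 1 :+ con 2 :* l) :* (con 1 :+ d :* g) :+ (con 1 :+ d :* g)) :+ G) ≡.refl ℓ₀ d g G
        where open Data.Nat.Solver.+-*-Solver renaming (solve to solveℕ)
      -- M is replaced by a variable equal to it, so that the defining expression does not unfold in
      -- the types.
      build : ∀ M′ → M′ ≡ M → HighOrder n d (Parameters.h ℓ₀ d C′ 0) G
      build M′ M′≡ = M′ , T , auxiliary , auxiliary-bounded , auxiliary-nonzero , auxiliary-small g (Q ℕ.* q ^ g) G (≡.sym (ℕₚ.^-distribˡ-+-* q M′ g)) gain MQ≤ GQ≤
        where
        Q = q ^ M′
        1≤H′ : 1 ≤ h′ ℕ.* Q
        1≤H′ = ℕₚ.*-mono-≤ (ℕₚ.≤-trans (s≤s z≤n) (ℕₚ.m≤n+m 2 (C′ ℕ.+ 2 ℕ.* suc ℓ₀))) (q^≥1 M′)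
        enough : monCount n d ℕ.* (M′ ℕ.* (h ℕ.* Q) ℕ.+ T ℕ.* Q) < monCount n d ℕ.* (T ℕ.* (h ℕ.* Q)) ℕ.+ M′ ℕ.* (h′ ℕ.* Q)
        enough = ≡.subst₂ (λ m k → m ℕ.* (k ℕ.* (h ℕ.* Q) ℕ.+ T ℕ.* Q) < m ℕ.* (T ℕ.* (h ℕ.* Q)) ℕ.+ k ℕ.* (h′ ℕ.* Q))
          (≡.sym (proj₂ (monCount-positive n d))) (≡.sym M′≡) (count Q (q^≥1 M′))
        open Construction n d c w₀ bd null nonzero T M′ Q (h ℕ.* Q) (h′ ℕ.* Q) ((h′ ℕ.* Q ∸ 1) ℕ.+ C′ ℕ.* Q) ≡.refl
          (≡.trans (ℕₚ.*-distribʳ-+ Q h′ C′) (≡.cong (ℕ._+ C′ ℕ.* Q) (≡.sym (ℕₚ.m+[n∸m]≡n 1≤H′)))) ≡.refl enough using (solution; module Solved)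
        open Solved (proj₁ solution) (proj₁ (proj₁ (proj₂ solution))) (proj₂ (proj₁ (proj₂ solution))) (proj₂ (proj₂ solution))
        room′ : M′ ℕ.+ M′ ℕ.+ G ≤ q ^ g
        room′ = ℕₚ.≤-trans (ℕₚ.≤-reflexive (≡.trans (≡.cong (λ m → m ℕ.+ m ℕ.+ G) M′≡) (≡.trans (≡.cong (λ k → M ℕ.+ k ℕ.+ G) (≡.sym (ℕₚ.+-identityʳ M))) (≡.sym 2M+G≡)))) room
        total : M′ ℕ.* Q ℕ.+ M′ ℕ.* Q ℕ.+ G ℕ.* Q ≤ Q ℕ.* q ^ g
        total = ℕₚ.≤-trans (ℕₚ.≤-reflexive (≡.sym (≡.trans (ℕₚ.*-distribʳ-+ Q (M′ ℕ.+ M′) G) (≡.cong (ℕ._+ G ℕ.* Q) (ℕₚ.*-distribʳ-+ Q M′ M′)))))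
          (ℕₚ.≤-trans (ℕₚ.*-monoˡ-≤ Q room′) (ℕₚ.≤-reflexive (ℕₚ.*-comm (q ^ g) Q)))
        two : M′ ℕ.* Q ℕ.+ M′ ℕ.* Q ≤ Q ℕ.* q ^ g
        two = ℕₚ.≤-trans (ℕₚ.m≤m+n _ (G ℕ.* Q)) total
        MQ≤ : M′ ℕ.* Q ≤ Q ℕ.* q ^ g ∸ M′ ℕ.* Q
        MQ≤ = ℕₚ.m+n≤o⇒m≤o∸n (M′ ℕ.* Q) two
        GQ≤ : G ℕ.* Q ≤ Q ℕ.* q ^ g ∸ M′ ℕ.* Q ∸ M′ ℕ.* Q
        GQ≤ = ℕₚ.≤-trans (ℕₚ.m+n≤o⇒m≤o∸n (G ℕ.* Q) (ℕₚ.≤-trans (ℕₚ.≤-reflexive (ℕₚ.+-comm (G ℕ.* Q) _)) total)) (ℕₚ.≤-reflexive (≡.sym (ℕₚ.∸-+-assoc (Q ℕ.* q ^ g) (M′ ℕ.* Q) (M′ ℕ.* Q))))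
        Q≤S : Q ≤ Q ℕ.* q ^ g
        Q≤S = ℕₚ.m≤m*n Q (q ^ g) {{ℕ.>-nonZero (q^≥1 g)}}
        gain : ∀ l → M′ ≤ l → (Q ℕ.* q ^ g ∸ M′ ℕ.* Q) ℕ.+ l ℕ.* Q ℕ.+ (T ℕ.* (Q ℕ.* q ^ g) ℕ.+ d ℕ.* (g ℕ.* (Q ℕ.* q ^ g))) ≤ l ℕ.* (Q ℕ.* q ^ g)
        gain l M≤l = ≡.subst (λ m → (Q ℕ.* q ^ g ∸ m ℕ.* Q) ℕ.+ l ℕ.* Q ℕ.+ (T ℕ.* (Q ℕ.* q ^ g) ℕ.+ d ℕ.* (g ℕ.* (Q ℕ.* q ^ g))) ≤ l ℕ.* (Q ℕ.* q ^ g)) (≡.sym M′≡)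
          (slope-gain l (Q ℕ.* q ^ g) Q (≡.subst (_≤ l) M′≡ M≤l) Q≤S (≡.subst (λ m → m ℕ.* Q ≤ Q ℕ.* q ^ g) M′≡ (ℕₚ.≤-trans (ℕₚ.m≤m+n _ _) two)))

  -- A nontrivial relation gives approximate formal relations of every order in a fixed
  -- finite-dimensional space. Compactness makes one of them exact, against the formal independence.
  values-from-formal : ∀ n → FormalIndependence n → ValueIndependence n
  values-from-formal n ind d c w₀ bd null μ = Bounded-stable (bd μ) λ c≉0 →
    let (h , aux) = auxiliary-exists n d c w₀ bd null (λ all → c≉0 (all μ)) in
    compactness (monCount n d ℕ.* h) (Assemble.matrix n d h) (Assemble.matrix-finite n d h)
      (λ G → let (M , T , A , bdA , nzA , small-order) = aux G in Assemble.finite-solution n d h M G T A bdA nzA small-order)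
      (Assemble.no-exact-solution n d h ind)

  formal-independence₀ : FormalIndependence 0
  formal-independence₀ d R h T bd rel tt N = rel (suc N) N ℕₚ.≤-refl

  value-independence : ∀ n → ValueIndependence n
  value-independence zero    = values-from-formal 0 formal-independence₀
  value-independence (suc n) = values-from-formal (suc n) (formal-from-values n (value-independence n))

-- Inversion of power series over 𝔽_q.

module SeriesInverse {q : ℕ} (𝔽 : FiniteField q) where
  open FiniteField 𝔽
  open CommutativeRing Fring hiding (zero)
  open RingOps Fring
  open IntegerSolver Fring
  open Sums Fring
  open PowerSeries Fring
  open Laurent 𝔽 using (invSeries)
  open Relation.Binary.Reasoning.Setoid setoid

  -- The list of coefficients through which invSeries computes is local to its definition.  Abstracting
  -- from getD, _++_ and the index makes the position of that list rigid, so that unification finds it.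
  mutual
    prefix : (ℕ → Carrier) → ℕ → ℕ → List Carrier
    prefix u = _

    prefix-found : ∀ u n → ∃ λ rest → invSeries u (suc n) ≡ getD (prefix u (suc n) n ++ rest) (suc n)
    prefix-found u n with getD | _++_ {A = Carrier} | suc n
    ... | _ | _ | _ = _ , ≡.refl

  private
    length-prefix : ∀ u m n → length (prefix u m n) ≡ suc n
    length-prefix u m zero    = ≡.refl
    length-prefix u m (suc n) = ≡.trans (Listₚ.length-++ (prefix u m n)) (≡.trans (ℕₚ.+-comm (length (prefix u m n)) 1) (≡.cong suc (length-prefix u m n)))

    getD-++ˡ : ∀ l l′ i → i < length l → getD (l ++ l′) i ≡ getD l i
    getD-++ˡ (c ∷ l) l′ zero    _         = ≡.refl
    getD-++ˡ (c ∷ l) l′ (suc i) (s≤s lt) = getD-++ˡ l l′ i lt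

    getD-last : ∀ l c k → length l ≡ k → getD (l ++ (c ∷ [])) k ≡ c
    getD-last []      c zero    _  = ≡.refl
    getD-last (b ∷ l) c (suc k) eq = getD-last l c k (ℕₚ.suc-injective eq)

    prefix-invSeries : ∀ u n m i → i ≤ n → getD (prefix u m n) i ≈ invSeries u i
    prefix-invSeries u zero    m zero z≤n = refl
    prefix-invSeries u (suc n) m i i≤1+n with i ℕ.≟ suc n
    ... | no i≢1+n = trans (reflexive (getD-++ˡ (prefix u m n) _ i (ℕₚ.≤-trans (ℕₚ.≤∧≢⇒< i≤1+n i≢1+n) (ℕₚ.≤-reflexive (≡.sym (length-prefix u m n))))))
        (prefix-invSeries u n m i (ℕₚ.≤-pred (ℕₚ.≤∧≢⇒< i≤1+n i≢1+n)))
    ... | yes ≡.refl = trans (reflexive (getD-last (prefix u m n) _ (suc n) (length-prefix u m n)))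
        (trans (-‿cong (*-congˡ (Σ-cong′ (suc n) (λ i → *-congˡ (trans (prefix-invSeries u n m (n ∸ i) (ℕₚ.m∸n≤m n i)) (sym (prefix-invSeries u n (suc n) (n ∸ i) (ℕₚ.m∸n≤m n i))))))))
          (sym (reflexive (getD-last (prefix u (suc n) n) _ (suc n) (length-prefix u (suc n) n)))))

  invSeries-suc : ∀ u n → invSeries u (suc n) ≈ - (inv (u 0) * ((u ∘ suc) ⊛ invSeries u) n)
  invSeries-suc u n = trans (reflexive (getD-last (prefix u (suc n) n) _ (suc n) (length-prefix u (suc n) n)))
    (-‿cong (*-congˡ (trans (Σ-cong′ (suc n) (λ i → *-congˡ (prefix-invSeries u n (suc n) (n ∸ i) (ℕₚ.m∸n≤m n i)))) (reflexive (≡.sym (⊛-def (u ∘ suc) (invSeries u) n))))))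

  invSeries-inverse : ∀ u → ¬ (u 0 ≈ 0#) → u ⊛ invSeries u ≋ const 1#
  invSeries-inverse u u≉0 zero    = trans (⊛-zero u (invSeries u)) (inv-r (u 0) u≉0)
  invSeries-inverse u u≉0 (suc n) = begin
    (u ⊛ invSeries u) (suc n)                              ≈⟨ ⊛-suc u (invSeries u) n ⟩
    u 0 * invSeries u (suc n) + r                          ≈⟨ +-congʳ (*-congˡ (invSeries-suc u n)) ⟩
    u 0 * - (inv (u 0) * r) + r                            ≈⟨ solve 3 (λ a i r → a :* (:- (i :* r)) :+ r := (:- (a :* i)) :* r :+ r) refl (u 0) (inv (u 0)) r ⟩
    - (u 0 * inv (u 0)) * r + r                            ≈⟨ +-congʳ (*-congʳ (-‿cong (inv-r (u 0) u≉0))) ⟩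
    - 1# * r + r                                           ≈⟨ solve 1 (λ r → (:- :1) :* r :+ r := :0) refl r ⟩
    0#                                                     ∎
    where r = ((u ∘ suc) ⊛ invSeries u) n

-- Binomial theorem, Fermat's theorem and additivity of Frobenius.

module BinomialSums {c ℓ} (R : CommutativeRing c ℓ) where
  open CommutativeRing R hiding (zero)
  open RingOps R
  open Sums R
  private
    module Bin = Algebra.Properties.CommutativeSemiring.Binomial commutativeSemiring
    module Exp = Algebra.Properties.Semiring.Exp semiring
    module Mult = Algebra.Properties.Semiring.Mult semiring
    module FinSum = Algebra.Properties.Semiring.Sum semiring

  finSum : ∀ n (f : ℕ → Carrier) → FinSum.sum {n} (f ∘ toℕ) ≈ sumTo n f
  finSum zero    f = refl
  finSum (suc n) f = trans (+-congˡ (finSum n (f ∘ suc))) (sym (Σ-head n f))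

  pow≈^ : ∀ u n → u Exp.^ n ≈ pow u n
  pow≈^ u zero    = refl
  pow≈^ u (suc n) = trans (*-comm u _) (*-congʳ (pow≈^ u n))

  ×≈natC : ∀ n u → n Mult.× u ≈ natC n * u
  ×≈natC zero    u = sym (zeroˡ u)
  ×≈natC (suc n) u = trans (+-congˡ (×≈natC n u)) (trans (+-comm u _) (sym (trans (distribʳ u (natC n) 1#) (+-congˡ (*-identityˡ u)))))

  binomial-sum : ∀ n u v → pow (u + v) n ≈ sumTo (suc n) (λ i → natC (n choose i) * (pow u i * pow v (n ∸ i)))
  binomial-sum n u v = trans (sym (pow≈^ (u + v) n)) (trans (Bin.theorem n u v) (trans
    (FinSum.sum-cong-≋ {suc n} (λ i → trans (×≈natC (n choose toℕ i) _) (*-congˡ (*-cong (pow≈^ u (toℕ i)) (pow≈^ v (n ∸ toℕ i))))))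
    (finSum (suc n) (λ i → natC (n choose i) * (pow u i * pow v (n ∸ i))))))

  -- The vanishing of the inner binomial coefficients is a hypothesis, so that the lemma serves both
  -- L and the power series over L.
  frobenius-additive : ∀ q → (∀ i → 0 < i → i < q → natC (q choose i) ≈ 0#) → 1 ≤ q → ∀ u v → pow (u + v) q ≈ pow u q + pow v q
  frobenius-additive (suc q) h _ u v = trans (binomial-sum (suc q) u v) (trans (+-cong first last) (+-comm _ _))
    where
    first : sumTo (suc q) (λ i → natC (suc q choose i) * (pow u i * pow v (suc q ∸ i))) ≈ pow v (suc q)
    first = trans (Σ-single (suc q) 0 _ (s≤s z≤n) (λ i i<q i≢0 → trans (*-congʳ (h i (ℕₚ.n≢0⇒n>0 i≢0) i<q)) (zeroˡ _)))
      (trans (*-cong (+-identityˡ 1#) (*-identityˡ _)) (*-identityˡ _))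
    last : natC (suc q choose suc q) * (pow u (suc q) * pow v (suc q ∸ suc q)) ≈ pow u (suc q)
    last = trans (*-cong (trans (reflexive (≡.cong natC (nCn≡1 (suc q)))) (+-identityˡ 1#)) (*-congˡ (reflexive (≡.cong (pow v) (ℕₚ.n∸n≡0 (suc q))))))
      (trans (*-identityˡ _) (*-identityʳ _))

module FiniteFieldLemmas {q : ℕ} (𝔽 : FiniteField q) where
  open FiniteField 𝔽
  open CommutativeRing Fring hiding (zero)
  open RingOps Fring
  open Sums Fring
  open IntegerSolver Fring
  open Roots Fring
  open Evaluation Fring
  open BinomialSums Fring
  open FormalSeries 𝔽 using (F-no-zero-divisors)
  open Relation.Binary.Reasoning.Setoid setoid
  private module Π = Algebra.Properties.CommutativeMonoid.Sum *-commutativeMonoid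

  index : Carrier → Fin q
  index u = proj₁ (enum-surj u)

  enum-index : ∀ u → enum (index u) ≈ u
  enum-index u = proj₂ (enum-surj u)

  index-cong : ∀ {u v} → u ≈ v → index u ≡ index v
  index-cong {u} {v} e = enum-inj _ _ (trans (enum-index u) (trans e (sym (enum-index v))))

  index-enum : ∀ i → index (enum i) ≡ i
  index-enum i = enum-inj _ _ (enum-index (enum i))

  q≥2 : 2 ≤ q
  q≥2 = ℕₚ.≰⇒> λ q≤1 → 1≉0 (trans (sym (enum-index 1#)) (trans (reflexive (≡.cong enum (same q≤1 (index 1#) (index 0#)))) (enum-index 0#)))
    where
    same : ∀ {k} → k ≤ 1 → (i j : Fin k) → i ≡ j
    same (s≤s z≤n) Fin.zero Fin.zero = ≡.refl

  module _ (u : Carrier) (u≉0 : ¬ (u ≈ 0#)) where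
    private
      scalePerm : Permutation.Permutation q q
      scalePerm = Permutation.permutation (λ i → index (u * enum i)) (λ i → index (inv u * enum i))
        (cancel (inv-r u u≉0)) (cancel (trans (*-comm _ _) (inv-r u u≉0)))
        where
        cancel : ∀ {b c} → b * c ≈ 1# → ∀ i → index (b * enum (index (c * enum i))) ≡ i
        cancel {b} {c} bc i = ≡.trans (index-cong (trans (*-congˡ (enum-index _)) (trans (sym (*-assoc _ _ _)) (trans (*-congʳ bc) (*-identityˡ _))))) (index-enum i)

      -- Replacing 0 by 1 in the product allows the enumeration of the whole field to be used; the
      -- weight is the factor by which multiplication with u then changes each term.
      unit weight : Carrier → Carrier
      unit v with v ≟F 0#
      ... | yes _ = 1#
      ... | no _  = v
      weight v with v ≟F 0#
      ... | yes _ = 1#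
      ... | no _  = u

      unit≉0 : ∀ v → ¬ (unit v ≈ 0#)
      unit≉0 v with v ≟F 0#
      ... | yes _  = 1≉0
      ... | no v≉0 = v≉0

      unit-scale : ∀ {w} v → w ≈ u * v → unit w ≈ weight v * unit v
      unit-scale {w} v e with w ≟F 0# | v ≟F 0#
      ... | yes _   | yes _   = sym (*-identityˡ 1#)
      ... | no w≉0  | yes v≈0 = ⊥-elim (w≉0 (trans e (trans (*-congˡ v≈0) (zeroʳ u))))
      ... | yes w≈0 | no v≉0  = ⊥-elim (v≉0 (F-no-zero-divisors u v (trans (sym e) w≈0) u≉0))
      ... | no _    | no _    = e

      product-nonzero : ∀ {n} (f : Fin n → Carrier) → (∀ i → ¬ (f i ≈ 0#)) → ¬ (Π.sum f ≈ 0#)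
      product-nonzero {zero}  f h = 1≉0
      product-nonzero {suc n} f h e = product-nonzero (f ∘ Fin.suc) (h ∘ Fin.suc) (F-no-zero-divisors _ _ e (h Fin.zero))

      product-constant : ∀ {n} (f : Fin n → Carrier) → (∀ i → f i ≈ u) → Π.sum f ≈ pow u n
      product-constant {zero}  f h = refl
      product-constant {suc n} f h = trans (*-cong (h Fin.zero) (product-constant (f ∘ Fin.suc) (h ∘ Fin.suc))) (*-comm _ _)

      -- Multiplication by u permutes 𝔽_q, so the product `Pr` of all units equals `W` times itself
      -- and can be cancelled.
      weights≈1 : Π.sum (weight ∘ enum) ≈ 1#
      weights≈1 = begin
        W                  ≈⟨ solve 2 (λ w p → w := (w :- :1) :+ :1) refl W Pr ⟩
        (W - 1#) + 1#      ≈⟨ +-congʳ (F-no-zero-divisors Pr (W - 1#) vanish (product-nonzero (unit ∘ enum) (unit≉0 ∘ enum))) ⟩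
        0# + 1#            ≈⟨ +-identityˡ 1# ⟩
        1#                 ∎
        where
        W = Π.sum (weight ∘ enum)
        Pr = Π.sum (unit ∘ enum)
        permuted : Pr ≈ W * Pr
        permuted = trans (Π.∑-permute (unit ∘ enum) scalePerm) (trans (Π.sum-cong-≋ (λ i → unit-scale (enum i) (enum-index _))) (Π.∑-distrib-+ (weight ∘ enum) (unit ∘ enum)))
        vanish : Pr * (W - 1#) ≈ 0#
        vanish = trans (solve 2 (λ w p → p :* (w :- :1) := w :* p :- p) refl W Pr) (trans (+-congʳ (sym permuted)) (-‿inverseʳ Pr))

      weights≈pow : ∀ {k} (e : Fin k → Carrier) → (∀ i j → e i ≈ e j → i ≡ j) → (i₀ : Fin k) → e i₀ ≈ 0# → Π.sum (weight ∘ e) ≈ pow u (k ∸ 1)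
      weights≈pow {suc k} e e-inj i₀ e≈0 = trans (Π.sum-remove {i = i₀} (weight ∘ e)) (trans (*-cong at-zero (product-constant _ elsewhere)) (*-identityˡ _))
        where
        at-zero : weight (e i₀) ≈ 1#
        at-zero with e i₀ ≟F 0#
        ... | yes _ = refl
        ... | no ne = ⊥-elim (ne e≈0)
        elsewhere : ∀ j → weight (e (Fin.punchIn i₀ j)) ≈ u
        elsewhere j with e (Fin.punchIn i₀ j) ≟F 0#
        ... | yes z = ⊥-elim (Finₚ.punchInᵢ≢i i₀ j (e-inj _ _ (trans z (sym e≈0))))
        ... | no _  = refl

    fermat-unit : pow u (q ∸ 1) ≈ 1#
    fermat-unit = trans (sym (weights≈pow enum enum-inj (index 0#) (enum-index 0#))) weights≈1

  fermat : ∀ u → pow u q ≈ u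
  fermat u with u ≟F 0#
  ... | yes u≈0 = trans (pow-cong q u≈0) (trans (reflexive (≡.cong (pow 0#) (≡.sym (ℕₚ.m+[n∸m]≡n 1≤q)))) (trans (zeroʳ _) (sym u≈0)))
    where 1≤q = ℕₚ.≤-trans (s≤s z≤n) q≥2
  ... | no u≉0  = trans (reflexive (≡.cong (pow u) (≡.sym (ℕₚ.m+[n∸m]≡n (ℕₚ.≤-trans (s≤s z≤n) q≥2))))) (trans (*-congʳ (fermat-unit u u≉0)) (*-identityˡ u))

  -- (X + 1)^q - X^q - 1 has degree < q and vanishes on all of 𝔽_q.
  binomial-zero : ∀ i → 0 < i → i < q → natC (q choose i) ≈ 0#
  binomial-zero (suc i) _ i<q = trans (sym (getD-take q coefficients (suc i) i<q)) (roots⇒zero F-no-zero-divisors q root distinct (take q coefficients)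
      (ℕₚ.≤-reflexive (length-take q coefficients)) (λ j _ → vanishes (root j)) (suc i))
    where
    coefficients : ℕ → Carrier
    coefficients zero    = 0#
    coefficients (suc i) = natC (q choose suc i)
    take : ℕ → (ℕ → Carrier) → List Carrier
    take zero    f = []
    take (suc n) f = f 0 ∷ take n (f ∘ suc)
    length-take : ∀ n f → length (take n f) ≡ n
    length-take zero    f = ≡.refl
    length-take (suc n) f = ≡.cong suc (length-take n (f ∘ suc))
    getD-take : ∀ n f i → i < n → getD (take n f) i ≈ f i
    getD-take (suc n) f zero    _        = refl
    getD-take (suc n) f (suc i) (s≤s lt) = getD-take n (f ∘ suc) i lt
    horner-take : ∀ n f u → horner (take n f) u ≈ evalTo n f u
    horner-take zero    f u = refl
    horner-take (suc n) f u = trans (+-congˡ (*-congˡ (horner-take n (f ∘ suc) u))) (sym (evalTo-suc n f u))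
    root : ℕ → Carrier
    root = Extension.extend Fring enum
    distinct : ∀ i j → i < j → j < q → ¬ (root i - root j ≈ 0#)
    distinct i j i<j j<q e = ℕₚ.<⇒≢ i<j (≡.trans (≡.sym (Finₚ.toℕ-fromℕ< (ℕₚ.<-trans i<j j<q))) (≡.trans (≡.cong toℕ (enum-inj _ _ equal)) (Finₚ.toℕ-fromℕ< j<q)))
      where
      at : ∀ k (k<q : k < q) → root k ≈ enum (Fin.fromℕ< k<q)
      at k k<q = trans (reflexive (≡.cong root (≡.sym (Finₚ.toℕ-fromℕ< k<q)))) (Extension.extend-toℕ Fring enum (Fin.fromℕ< k<q))
      equal : enum (Fin.fromℕ< (ℕₚ.<-trans i<j j<q)) ≈ enum (Fin.fromℕ< j<q)
      equal = trans (sym (at i (ℕₚ.<-trans i<j j<q))) (trans (trans (solve 2 (λ a b → a := (a :- b) :+ b) refl (root i) (root j)) (trans (+-congʳ e) (+-identityˡ _))) (at j j<q))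
    vanishes : ∀ u → horner (take q coefficients) u ≈ 0#
    vanishes u = begin
      horner (take q coefficients) u     ≈⟨ horner-take q coefficients u ⟩
      s                                  ≈⟨ solve 3 (λ s o p → s := ((s :+ o) :+ p) :- p :- o) refl s 1# (pow u q) ⟩
      ((s + 1#) + pow u q) - pow u q - 1# ≈⟨ +-congʳ (+-congʳ (sym expansion)) ⟩
      pow (u + 1#) q - pow u q - 1#      ≈⟨ +-congʳ (+-cong (fermat (u + 1#)) (-‿cong (fermat u))) ⟩
      (u + 1#) - u - 1#                  ≈⟨ solve 1 (λ u → (u :+ :1) :- u :- :1 := :0) refl u ⟩
      0#                                 ∎
      where
      s = evalTo q coefficients u
      1≤q : 1 ≤ q
      1≤q = ℕₚ.≤-trans (s≤s z≤n) q≥2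
      low : ∀ k → 1 ≤ k → (∀ i → i < k → i < q) → sumTo k (λ i → natC (q choose i) * (pow u i * pow 1# (q ∸ i))) ≈ evalTo k coefficients u + 1#
      low (suc k) _ _ = trans (Σ-head k _) (trans (+-cong (trans (*-cong (+-identityˡ 1#) (trans (*-identityˡ _) (pow-1 q))) (*-identityˡ 1#))
          (Σ-cong′ k (λ i → *-congˡ (trans (*-congˡ (pow-1 (q ∸ suc i))) (*-identityʳ _)))))
        (trans (+-comm 1# _) (+-congʳ (sym (trans (Σ-head k _) (trans (+-congʳ (zeroˡ _)) (+-identityˡ _)))))))
      expansion : pow (u + 1#) q ≈ (s + 1#) + pow u q
      expansion = trans (binomial-sum q u 1#) (+-cong (low q 1≤q (λ _ lt → lt))
        (trans (*-cong (trans (reflexive (≡.cong natC (nCn≡1 q))) (+-identityˡ 1#)) (*-congˡ (pow-1 (q ∸ q)))) (trans (*-identityˡ _) (*-identityʳ _))))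

-- The field L as an extension of 𝔽_q((z)).

module Embedding {q : ℕ} (𝔽 : FiniteField q) {a ℓ} (L : CommutativeRing a ℓ) (isField : RingOps.IsFieldRing L)
       (ι : Laurent.K∞ 𝔽 → CommutativeRing.Carrier L) (embedding : Laurent.Over.IsRingEmbedding 𝔽 L ι) where
  open FiniteField 𝔽 using (Fring; _≟F_; inv; inv-r) renaming (1≉0 to F-1≉0)
  open FormalSeries 𝔽 using (module F; module PF; module P; 𝔽[[t]]; least-index)
  open Laurent 𝔽
  open Laurent.Over.IsRingEmbedding embedding
  open CommutativeRing L hiding (zero)
  open RingOps L
  open IsFieldRing isField
  open IntegerSolver L
  open Sums L
  open SeriesInverse 𝔽
  open FiniteFieldLemmas 𝔽
  open Relation.Binary.Reasoning.Setoid setoid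
  private
    module FO = RingOps Fring
    module PO = RingOps 𝔽[[t]]

  coefAt⁺ : ∀ f k j → k ℤ.- v f ≡ + j → coefAt f k ≡ c f j
  coefAt⁺ f k j eq with k ℤ.- v f | eq
  ... | + j | ≡.refl = ≡.refl

  coefAt⁻ : ∀ f k j → k ℤ.- v f ≡ -[1+ j ] → coefAt f k ≡ F.0#
  coefAt⁻ f k j eq with k ℤ.- v f | eq
  ... | -[1+ _ ] | ≡.refl = ≡.refl

  laurent-cong : ∀ w {f g} → (∀ n → f n F.≈ g n) → laurent w f ≈∞ laurent w g
  laurent-cong w h k with k ℤ.- w
  ... | + j      = h j
  ... | -[1+ _ ] = F.refl

  shift-≈∞ : ∀ w m f → laurent w (PO.pow PF.var m P.* f) ≈∞ laurent (w ℤ.+ + m) f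
  shift-≈∞ w m f k = case (k ℤ.- w) ≡.refl
    where
    g = laurent w (PO.pow PF.var m P.* f)
    difference : k ℤ.- (w ℤ.+ + m) ≡ (k ℤ.- w) ℤ.- + m
    difference = ≡.trans (≡.cong (λ u → k ℤ.+ u) (ℤₚ.neg-distrib-+ w (+ m))) (≡.sym (ℤₚ.+-assoc k (ℤ.- w) (ℤ.- + m)))
    case : ∀ d → k ℤ.- w ≡ d → coefAt g k F.≈ coefAt (laurent (w ℤ.+ + m) f) k
    case (+ j) eq with j ℕ.<? m
    ... | yes j<m = F.trans (F.reflexive (coefAt⁺ g k j eq)) (F.trans (PF.var^-⊛-low m f j j<m)
        (F.sym (F.reflexive (coefAt⁻ (laurent (w ℤ.+ + m) f) k (m ∸ suc j) (≡.trans difference (≡.trans (≡.cong (λ u → u ℤ.- + m) eq) (≡.trans (ℤₚ.m-n≡m⊖n j m) (≡.trans (ℤₚ.⊖-< j<m) (≡.cong (λ e → ℤ.- (+ e)) (ℕₚ.+-∸-assoc 1 {m} {suc j} j<m))))))))))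
    ... | no j≮m  = F.trans (F.reflexive (≡.trans (coefAt⁺ g k j eq) (≡.cong (PO.pow PF.var m P.* f) (≡.sym (ℕₚ.m+[n∸m]≡n (ℕₚ.≮⇒≥ j≮m)))))) (F.trans (PF.var^-⊛-shift m f (j ∸ m))
        (F.sym (F.reflexive (coefAt⁺ (laurent (w ℤ.+ + m) f) k (j ∸ m) (≡.trans difference (≡.trans (≡.cong (λ u → u ℤ.- + m) eq) (≡.trans (ℤₚ.m-n≡m⊖n j m) (ℤₚ.⊖-≥ (ℕₚ.≮⇒≥ j≮m)))))))))
    case -[1+ j ] eq = F.trans (F.reflexive (coefAt⁻ g k j eq)) (F.sym (F.reflexive (negative m difference)))
      where
      negative : ∀ m → k ℤ.- (w ℤ.+ + m) ≡ (k ℤ.- w) ℤ.- + m → coefAt (laurent (w ℤ.+ + m) f) k ≡ F.0#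
      negative zero    dif = coefAt⁻ (laurent (w ℤ.+ + 0) f) k j (≡.trans dif (≡.trans (≡.cong (λ u → u ℤ.- + 0) eq) ≡.refl))
      negative (suc m) dif = coefAt⁻ (laurent (w ℤ.+ + suc m) f) k (suc (j ℕ.+ m)) (≡.trans dif (≡.cong (λ u → u ℤ.- + suc m) eq))

  ι₀ : P.Carrier → Carrier
  ι₀ f = ι (laurent (+ 0) f)

  ι₀-cong : ∀ {f g} → f P.≈ g → ι₀ f ≈ ι₀ g
  ι₀-cong h = cong-ι _ _ (laurent-cong (+ 0) h)

  ι₀-+ : ∀ f g → ι₀ (f P.+ g) ≈ ι₀ f + ι₀ g
  ι₀-+ f g = trans (cong-ι _ _ sums) (ι-+ _ _)
    where
    sums : laurent (+ 0) (f P.+ g) ≈∞ (laurent (+ 0) f +∞ laurent (+ 0) g)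
    sums (+ n)    = F.reflexive (≡.sym (≡.cong₂ F._+_ (≡.cong f (ℕₚ.+-identityʳ (n ℕ.+ 0))) (≡.cong g (ℕₚ.+-identityʳ (n ℕ.+ 0)))))
    sums -[1+ n ] = F.refl

  ι-product : ∀ w w′ f g → ι (laurent w f) * ι (laurent w′ g) ≈ ι (laurent (w ℤ.+ w′) (f P.* g))
  ι-product w w′ f g = trans (sym (ι-* _ _)) (cong-ι _ _ (laurent-cong (w ℤ.+ w′) (λ n → F.reflexive (≡.sym (PF.⊛-def f g n)))))

  ι₀-* : ∀ f g → ι₀ (f P.* g) ≈ ι₀ f * ι₀ g
  ι₀-* f g = sym (ι-product (+ 0) (+ 0) f g)

  ι₀-1 : ι₀ P.1# ≈ 1#
  ι₀-1 = trans (cong-ι _ _ (laurent-cong (+ 0) λ { zero → F.refl ; (suc _) → F.refl })) ι-1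

  ι₀-0 : ι₀ P.0# ≈ 0#
  ι₀-0 = begin
    ι₀ P.0#                          ≈⟨ solve 1 (λ u → u := (u :+ u) :- u) refl (ι₀ P.0#) ⟩
    (ι₀ P.0# + ι₀ P.0#) - ι₀ P.0#    ≈⟨ +-congʳ (trans (sym (ι₀-+ P.0# P.0#)) (ι₀-cong (P.+-identityˡ P.0#))) ⟩
    ι₀ P.0# - ι₀ P.0#                ≈⟨ -‿inverseʳ _ ⟩
    0#                               ∎

  ι₀-neg : ∀ f → ι₀ (P.- f) ≈ - ι₀ f
  ι₀-neg f = begin
    ι₀ (P.- f)                        ≈⟨ solve 2 (λ u w → u := (u :+ w) :- w) refl (ι₀ (P.- f)) (ι₀ f) ⟩
    (ι₀ (P.- f) + ι₀ f) - ι₀ f        ≈⟨ +-congʳ (trans (sym (ι₀-+ (P.- f) f)) (trans (ι₀-cong (P.-‿inverseˡ f)) ι₀-0)) ⟩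
    0# - ι₀ f                         ≈⟨ +-identityˡ _ ⟩
    - ι₀ f                            ∎

  seriesRel : FilteredRelation 𝔽[[t]] L ℓ
  seriesRel = record
    { T = λ _ f y → y ≈ ι₀ f
    ; T-cong = λ p p′ h → trans (sym p′) (trans h (ι₀-cong p))
    ; T-mono = λ _ h → h
    ; T-0 = sym ι₀-0
    ; T-1 = sym ι₀-1
    ; T-+ = λ h h′ → trans (+-cong h h′) (sym (ι₀-+ _ _))
    ; T-* = λ h h′ → trans (*-cong h h′) (sym (ι₀-* _ _))
    ; T-neg = λ h → trans (-‿cong h) (sym (ι₀-neg _)) }

  z θ : Carrier
  z = ι₀ PF.var
  θ = ι θ∞

  z^ : ∀ m → pow z m ≈ ι₀ (PO.pow PF.var m)
  z^ m = RelationLemmas.T-pow seriesRel m refl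

  ι-shift : ∀ w m f → ι (laurent w f) * pow z m ≈ ι (laurent (w ℤ.+ + m) f)
  ι-shift w m f = trans (*-congˡ (z^ m)) (trans (ι-product w (+ 0) f (PO.pow PF.var m))
    (trans (reflexive (≡.cong (λ u → ι (laurent u (f P.* PO.pow PF.var m))) (ℤₚ.+-identityʳ w)))
      (trans (cong-ι _ _ (laurent-cong w (P.*-comm f (PO.pow PF.var m)))) (cong-ι _ _ (shift-≈∞ w m f)))))

  zθ≈1 : z * θ ≈ 1#
  zθ≈1 = trans (*-comm z θ) (trans (*-congˡ (sym (*-identityˡ z))) (trans (ι-shift (ℤ.- ℤ.1ℤ) 1 (c θ∞)) (trans (ι₀-cong (λ { zero → F.refl ; (suc _) → F.refl })) ι₀-1)))

  [_] : F.Carrier → Carrier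
  [ u ] = ι (const∞ u)

  []≈ι₀ : ∀ u → [ u ] ≈ ι₀ (PF.const u)
  []≈ι₀ u = cong-ι _ _ (laurent-cong (+ 0) λ { zero → F.refl ; (suc _) → F.refl })

  constSeriesRel : FilteredRelation Fring L ℓ
  constSeriesRel = record
    { T = λ _ u y → y ≈ [ u ]
    ; T-cong = λ p p′ h → trans (sym p′) (trans h (trans ([]≈ι₀ _) (trans (ι₀-cong (λ { zero → p ; (suc _) → F.refl })) (sym ([]≈ι₀ _)))))
    ; T-mono = λ _ h → h
    ; T-0 = sym (trans ([]≈ι₀ _) (trans (ι₀-cong (λ { zero → F.refl ; (suc _) → F.refl })) ι₀-0))
    ; T-1 = sym (trans ([]≈ι₀ _) ι₀-1)
    ; T-+ = λ h h′ → trans (+-cong (trans h ([]≈ι₀ _)) (trans h′ ([]≈ι₀ _))) (sym (trans ([]≈ι₀ _) (trans (ι₀-cong (λ { zero → F.refl ; (suc _) → F.sym (F.+-identityˡ _) })) (ι₀-+ _ _))))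
    ; T-* = λ {_} {_} {u} {u′} h h′ → trans (*-cong (trans h ([]≈ι₀ _)) (trans h′ ([]≈ι₀ _))) (sym (trans ([]≈ι₀ _) (trans
        (ι₀-cong (λ { zero → F.sym (PF.const-⊛ u (PF.const u′) 0) ; (suc n) → F.sym (F.trans (PF.const-⊛ u (PF.const u′) (suc n)) (F.zeroʳ u)) })) (ι₀-* _ _))))
    ; T-neg = λ h → trans (-‿cong (trans h ([]≈ι₀ _))) (sym (trans ([]≈ι₀ _) (trans (ι₀-cong (λ { zero → F.refl ; (suc _) → F.sym (Algebra.Properties.Ring.-0#≈0# F.ring) })) (ι₀-neg _)))) }
  private module CR = FilteredRelation constSeriesRel

  z^≉0 : ∀ n → ¬ (pow z n ≈ 0#)
  z^≉0 n e = 1≉0 (trans (sym (trans (sym (pow-distrib z θ n)) (trans (pow-cong n zθ≈1) (pow-1 n)))) (trans (*-congʳ e) (zeroˡ _)))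

  series-unit : ∀ f → ¬ (f 0 F.≈ F.0#) → ι₀ f * ι₀ (invSeries f) ≈ 1#
  series-unit f ne = trans (sym (ι₀-* f (invSeries f))) (trans (ι₀-cong (invSeries-inverse f ne)) ι₀-1)

  series-factor : ∀ f k → ¬ (f k F.≈ F.0#) → ∃ λ m → ∃ λ g → ¬ (g 0 F.≈ F.0#) × ι₀ f ≈ pow z m * ι₀ g
  series-factor f k ne = let (m , fm≉0 , below) = least-index f k ne in
    m , (λ i → f (m ℕ.+ i)) , (λ e → fm≉0 (F.trans (F.reflexive (≡.cong f (≡.sym (ℕₚ.+-identityʳ m)))) e)) ,
    trans (ι₀-cong (λ n → factor-at m below n)) (trans (ι₀-* _ _) (*-congʳ (sym (z^ m))))
    where
    factor-at : ∀ m → (∀ i → i < m → f i F.≈ F.0#) → ∀ n → f n F.≈ (PO.pow PF.var m P.* (λ i → f (m ℕ.+ i))) n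
    factor-at m below n with n ℕ.<? m
    ... | yes n<m = F.trans (below n n<m) (F.sym (PF.var^-⊛-low m _ n n<m))
    ... | no n≮m  = F.trans (F.reflexive (≡.cong f (≡.sym (ℕₚ.m+[n∸m]≡n (ℕₚ.≮⇒≥ n≮m))))) (F.trans (F.sym (PF.var^-⊛-shift m (λ i → f (m ℕ.+ i)) (n ∸ m)))
        (F.reflexive (≡.cong (PO.pow PF.var m P.* (λ i → f (m ℕ.+ i))) (ℕₚ.m+[n∸m]≡n (ℕₚ.≮⇒≥ n≮m)))))

  unit≉0 : ∀ {u w} → u * w ≈ 1# → ¬ (u ≈ 0#)
  unit≉0 uw e = 1≉0 (trans (sym uw) (trans (*-congʳ e) (zeroˡ _)))

  -- A nonzero coefficient exhibits the series as z^m times an invertible series, and both have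
  -- nonzero image.
  ι₀-injective : ∀ f → ι₀ f ≈ 0# → ∀ n → f n F.≈ F.0#
  ι₀-injective f e n = decidable-stable (f n ≟F F.0#) λ ne →
    let (m , g , g≉0 , factored) = series-factor f n ne in
    z^≉0 m (begin
      pow z m                                    ≈⟨ *-identityʳ _ ⟨
      pow z m * 1#                               ≈⟨ *-congˡ (series-unit g g≉0) ⟨
      pow z m * (ι₀ g * ι₀ (invSeries g))        ≈⟨ *-assoc _ _ _ ⟨
      pow z m * ι₀ g * ι₀ (invSeries g)          ≈⟨ *-congʳ (trans (sym factored) e) ⟩
      0# * ι₀ (invSeries g)                      ≈⟨ zeroˡ _ ⟩
      0#                                         ∎)

  truncated : ℕ → (ℕ → F.Carrier) → P.Carrier
  truncated W e = PO.sumTo W (λ N → PF.const (e N) P.* PO.pow PF.var N)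

  truncated-at : ∀ W e N → N < W → truncated W e N F.≈ e N
  truncated-at W e N N<W = F.trans (F.reflexive (PF.sumTo-at W _ N)) (F.trans (Sums.Σ-single Fring W N _ N<W off) at)
    where
    swap : ∀ M → PF.const (e M) P.* PO.pow PF.var M P.≈ PO.pow PF.var M P.* PF.const (e M)
    swap M = P.*-comm (PF.const (e M)) (PO.pow PF.var M)
    at : (PF.const (e N) P.* PO.pow PF.var N) N F.≈ e N
    at = F.trans (swap N N) (F.trans (F.reflexive (≡.cong (PO.pow PF.var N P.* PF.const (e N)) (≡.sym (ℕₚ.+-identityʳ N)))) (PF.var^-⊛-shift N (PF.const (e N)) 0))
    off : ∀ M → M < W → ¬ (M ≡ N) → (PF.const (e M) P.* PO.pow PF.var M) N F.≈ F.0#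
    off M _ M≢N with N ℕ.<? M
    ... | yes N<M = F.trans (swap M N) (PF.var^-⊛-low M _ N N<M)
    ... | no N≮M  = F.trans (swap M N) (F.trans (F.reflexive (≡.cong (PO.pow PF.var M P.* PF.const (e M)) (≡.sym (≡.trans (ℕₚ.+-suc M (N ∸ suc M)) (ℕₚ.m+[n∸m]≡n M<N)))))
        (PF.var^-⊛-shift M (PF.const (e M)) (suc (N ∸ suc M))))
      where M<N = ℕₚ.≤∧≢⇒< (ℕₚ.≮⇒≥ N≮M) M≢N

  ι₀-truncated : ∀ W e → sumTo W (λ N → [ e N ] * pow z N) ≈ ι₀ (truncated W e)
  ι₀-truncated W e = RelationLemmas.T-sum seriesRel W {0} (λ N _ → trans (*-cong ([]≈ι₀ (e N)) (z^ N)) (sym (ι₀-* _ _)))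

  separate : ∀ W e B {y} → (∃ λ f → y ≈ ι₀ f) → sumTo W (λ N → [ e N ] * pow z N) ≈ pow z B * y → ∀ N → N < W → N < B → e N F.≈ F.0#
  separate W e B (f , y≈) eq N N<W N<B = F.trans (F.sym (truncated-at W e N N<W)) (F.trans (equal N) (PF.var^-⊛-low B f N N<B))
    where
    g = PO.pow PF.var B P.* f
    difference-zero : ι₀ (truncated W e P.- g) ≈ 0#
    difference-zero = trans (ι₀-+ _ _) (trans (+-cong (trans (sym (ι₀-truncated W e)) (trans eq (trans (*-cong (z^ B) y≈) (sym (ι₀-* _ _))))) (ι₀-neg g)) (-‿inverseʳ _))
    equal : ∀ N → truncated W e N F.≈ g N
    equal N = F.trans (IntegerSolver.solve Fring 2 (λ u w → IntegerSolver._:=_ Fring u (IntegerSolver._:+_ Fring (IntegerSolver._:-_ Fring u w) w)) F.refl (truncated W e N) (g N))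
      (F.trans (F.+-congʳ (ι₀-injective _ difference-zero N)) (F.+-identityˡ _))

  natC-[] : ∀ n → natC n ≈ [ FO.natC n ]
  natC-[] zero    = CR.T-0
  natC-[] (suc n) = CR.T-+ {0} (natC-[] n) CR.T-1

  binomial-zero-L : ∀ i → 0 < i → i < q → natC (q choose i) ≈ 0#
  binomial-zero-L i 0<i i<q = trans (natC-[] (q choose i)) (trans (CR.T-cong {0} (binomial-zero i 0<i i<q) refl refl) (sym CR.T-0))

  valued : ValuedExtension 𝔽 L ℓ
  valued = record
    { isField = isField
    ; 2≤q = q≥2
    ; [_] = [_]
    ; []-cong = λ p → CR.T-cong {0} p refl refl
    ; []-+ = λ u w → sym (CR.T-+ {0} refl refl)
    ; []-* = λ u w → sym (CR.T-* {0} {0} refl refl)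
    ; []-1 = sym CR.T-1
    ; z = z
    ; θ = θ
    ; zθ≈1 = zθ≈1
    ; 𝒪 = λ y → ∃ λ f → y ≈ ι₀ f
    ; 𝒪-cong = λ p (f , h) → f , trans (sym p) h
    ; 𝒪-+ = λ (f , h) (g , h′) → f P.+ g , trans (+-cong h h′) (sym (ι₀-+ f g))
    ; 𝒪-* = λ (f , h) (g , h′) → f P.* g , trans (*-cong h h′) (sym (ι₀-* f g))
    ; 𝒪-[] = λ u → PF.const u , []≈ι₀ u
    ; 𝒪-z = PF.var , refl
    ; 𝒪-geometric = λ e → ι₀ (invSeries (geometric e)) , (invSeries (geometric e) , refl) , trans (*-congʳ (sym (ι₀-geometric e))) (series-unit (geometric e) (geometric≉0 e))
    ; separation = λ W e B h → separate W e B h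
    ; frobenius = BinomialSums.frobenius-additive L q binomial-zero-L (ℕₚ.≤-trans (s≤s z≤n) q≥2) }
    where
    geometric : ℕ → P.Carrier
    geometric e = P.1# P.- PO.pow PF.var (suc e)
    geometric≉0 : ∀ e → ¬ (geometric e 0 F.≈ F.0#)
    geometric≉0 e h = F-1≉0 (F.trans (F.sym (F.trans (F.+-congˡ (F.trans (F.-‿cong low) (Algebra.Properties.Ring.-0#≈0# F.ring))) (F.+-identityʳ _))) h)
      where
      low : PO.pow PF.var (suc e) 0 F.≈ F.0#
      low = F.trans (P.sym (P.*-identityʳ (PO.pow PF.var (suc e))) 0) (PF.var^-⊛-low (suc e) P.1# 0 (s≤s z≤n))
    ι₀-geometric : ∀ e → ι₀ (geometric e) ≈ 1# - pow z (suc e)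
    ι₀-geometric e = trans (ι₀-+ _ _) (+-cong ι₀-1 (trans (ι₀-neg _) (-‿cong (sym (z^ (suc e))))))

-- Elements of K and polynomials over K inside L.

module Setting {q : ℕ} (𝔽 : FiniteField q) {a ℓ} (L : CommutativeRing a ℓ) (isField : RingOps.IsFieldRing L)
       (ι : Laurent.K∞ 𝔽 → CommutativeRing.Carrier L) (embedding : Laurent.Over.IsRingEmbedding 𝔽 L ι) where
  open FiniteField 𝔽 using (_≟F_) renaming (1≉0 to F-1≉0)
  open Laurent 𝔽
  open Laurent.Over 𝔽 L ι using (Poly; IsZeroPoly; evalPoly; carlitzPeriod; IsHigherDerivation; Extends)
  open Laurent.Over.IsRingEmbedding embedding
  module E = Embedding 𝔽 L isField ι embedding
  open E using (ι₀; ι₀-cong; ι₀-0; ι₀-1; ι₀-+; ι₀-*; ι₀-neg; ι₀-injective; laurent-cong; ι-product; ι-shift; series-unit; series-factor; coefAt⁺)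
  open ValuedLemmas E.valued hiding (isField)
  open FunctionalIndependence E.valued
  open FormalSeries 𝔽 using (module F; module PF; module P; 𝔽[[t]])
  open SeriesInverse 𝔽 using (invSeries-inverse)
  open CommutativeRing L hiding (zero)
  open RingOps L
  open IntegerSolver L
  open Sums L
  open Jets L q
  open PowerSeries L
  open Polynomials L
  open Representation L using (Fun; rep)
  open Vanishing L no-zero-divisors using (_◃_)
  open Roots L using (horner; roots⇒zero)
  open Relation.Binary.Reasoning.Setoid setoid
  module PO = RingOps 𝔽[[t]]
  module PI = IntegerSolver 𝔽[[t]]
  module FO = RingOps (FiniteField.Fring 𝔽)
  module SO = RingOps PS
  module S = CommutativeRing PS
  module SS = IntegerSolver PS

  ι₀-finite : ∀ W f → (∀ N → W ≤ N → f N F.≈ F.0#) → ι₀ f ≈ sumTo W (λ N → [ f N ] * pow z N)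
  ι₀-finite W f high = sym (trans (E.ι₀-truncated W f) (ι₀-cong same))
    where
    zero-term : ∀ N → W ≤ N → ∀ M → M < W → (PF.const (f M) P.* PO.pow PF.var M) N F.≈ F.0#
    zero-term N le M M<W = F.trans (P.*-comm (PF.const (f M)) (PO.pow PF.var M) N) (F.trans
      (F.reflexive (≡.cong (PO.pow PF.var M P.* PF.const (f M)) (≡.sym (≡.trans (ℕₚ.+-suc M (N ∸ suc M)) (ℕₚ.m+[n∸m]≡n (ℕₚ.<-≤-trans M<W le))))))
      (PF.var^-⊛-shift M (PF.const (f M)) (suc (N ∸ suc M))))
    same : ∀ N → E.truncated W f N F.≈ f N
    same N with N ℕ.<? W
    ... | yes N<W = E.truncated-at W f N N<W
    ... | no N≮W  = F.trans (F.trans (F.reflexive (PF.sumTo-at W _ N)) (Sums.Σ-zero (FiniteField.Fring 𝔽) W (zero-term N (ℕₚ.≮⇒≥ N≮W)))) (F.sym (high N (ℕₚ.≮⇒≥ N≮W)))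

  private
    leading : List F.Carrier → List F.Carrier
    leading l = dropWhile (λ u → u ≟F F.0#) l

    leading-head : ∀ l → All (F._≈ F.0#) l ⊎ ¬ (FO.getD (leading l) 0 F.≈ F.0#)
    leading-head [] = inj₁ []
    leading-head (u ∷ l) with u ≟F F.0#
    ... | no u≉0 = inj₂ u≉0
    ... | yes u≈0 with leading-head l
    ...   | inj₁ zeros = inj₁ (u≈0 ∷ zeros)
    ...   | inj₂ head≉0 = inj₂ head≉0

    getD-high : ∀ r N → length r ≤ N → FO.getD r N F.≈ F.0#
    getD-high []      N       _        = F.refl
    getD-high (u ∷ r) (suc N) (s≤s le) = getD-high r N le

  poly∞-head : ∀ l → All (F._≈ F.0#) l ⊎ ¬ (c (poly∞ l) 0 F.≈ F.0#)
  poly∞-head l with leading-head (reverse l)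
  ... | inj₁ zeros  = inj₁ (All-resp-↭ (↭-reverse l) zeros)
  ... | inj₂ head≉0 = inj₂ head≉0

  clear-θ : ∀ d f → pow z d * ι (laurent (ℤ.- + d) f) ≈ ι₀ f
  clear-θ d f = trans (*-comm _ _) (trans (ι-shift (ℤ.- + d) d f) (reflexive (≡.cong (λ w → ι (laurent w f)) (ℤₚ.+-inverseˡ (+ d)))))

  Laurent-poly : ∀ l → Laurent (ι (poly∞ l))
  Laurent-poly l = length r ∸ 1 , length r , bounded (FO.getD r) (λ N lt → getD-high r N (ℕₚ.<⇒≤ lt))
      (trans (clear-θ (length r ∸ 1) (FO.getD r)) (ι₀-finite (suc (length r)) (FO.getD r) (λ N lt → getD-high r N (ℕₚ.<⇒≤ lt))))
    where r = leading (reverse l)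

  poly∞-zero : ∀ l → ι (poly∞ l) ≈ 0# → All (F._≈ F.0#) l
  poly∞-zero l e with poly∞-head l
  ... | inj₁ zeros  = zeros
  ... | inj₂ head≉0 = ⊥-elim (head≉0 (E.ι₀-injective (c (poly∞ l)) (trans (sym (clear-θ _ (c (poly∞ l)))) (trans (*-congˡ e) (zeroʳ _))) 0))

  invNorm-inverse : ∀ f → ¬ (c f 0 F.≈ F.0#) → ι f * ι (invNorm f) ≈ 1#
  invNorm-inverse f ne = trans (ι-product (v f) (ℤ.- v f) (c f) (invSeries (c f)))
    (trans (reflexive (≡.cong (λ w → ι (laurent w (c f P.* invSeries (c f)))) (ℤₚ.+-inverseʳ (v f)))) (trans (ι₀-cong (invSeries-inverse (c f) ne)) ι₀-1))

  module _ (p : K) where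
    private
      num = ι (poly∞ (K.num p))
      den = ι (poly∞ (K.den p))
      inverse-den = ι (invNorm (poly∞ (K.den p)))
      den-unit : den * inverse-den ≈ 1#
      den-unit with poly∞-head (K.den p)
      ... | inj₁ zeros  = ⊥-elim (K.den≢0 p zeros)
      ... | inj₂ head≉0 = invNorm-inverse (poly∞ (K.den p)) head≉0

    denominator : ∃ λ δ → ¬ (δ ≈ 0#) × Laurent δ × Laurent (ι (K→K∞ p) * δ)
    denominator = den , E.unit≉0 den-unit , Laurent-poly (K.den p) , Laurent-cong (sym cleared) (Laurent-poly (K.num p))
      where
      cleared : ι (K→K∞ p) * den ≈ num
      cleared = begin
        ι (K→K∞ p) * den            ≈⟨ *-congʳ (ι-* _ _) ⟩
        num * inverse-den * den     ≈⟨ solve 3 (λ n i d → n :* i :* d := n :* (d :* i)) refl num inverse-den den ⟩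
        num * (den * inverse-den)   ≈⟨ trans (*-congˡ den-unit) (*-identityʳ num) ⟩
        num                         ∎

    K-zero : ι (K→K∞ p) ≈ 0# → IsZeroK p
    K-zero e = poly∞-zero (K.num p) (no-zero-divisors inverse-den num (trans (*-comm _ _) (trans (sym (ι-* _ _)) e)) (E.unit≉0 (trans (*-comm _ _) den-unit)))

  -- The recursion of evalPoly along the list of coefficients is local to its definition; see prefix.
  mutual
    evalFrom : ∀ n → List (Poly n) → (ℕ → Carrier) → List (Poly n) → ℕ → Carrier
    evalFrom = _

    evalFrom-found : ∀ n p ps x → evalPoly (suc n) (p ∷ ps) x ≡ evalPoly n p x * 1# + evalFrom n (p ∷ ps) x ps 1
    evalFrom-found n p ps x with p List.∷ ps | 1
    ... | _ | _ = ≡.refl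

  coefficients : ∀ n → List (Poly n) → (ℕ → Carrier) → List Carrier
  coefficients n ps x = map (λ p → evalPoly n p x) ps

  evalFrom-horner : ∀ n qs x ps k → evalFrom n qs x ps k ≈ pow (x n) k * horner (coefficients n ps x) (x n)
  evalFrom-horner n qs x []       k = sym (zeroʳ _)
  evalFrom-horner n qs x (p ∷ ps) k = trans (+-congˡ (evalFrom-horner n qs x ps (suc k)))
    (solve 4 (λ e y s h → e :* s :+ s :* y :* h := s :* (e :+ y :* h)) refl (evalPoly n p x) (x n) (pow (x n) k) _)

  evalPoly-horner : ∀ n ps x → evalPoly (suc n) ps x ≈ horner (coefficients n ps x) (x n)
  evalPoly-horner n ps x = trans (evalFrom-horner n ps x ps 0) (*-identityˡ _)

  mutual
    evalPoly-cong : ∀ n (P : Poly n) {x y} → (∀ i → i < n → x i ≈ y i) → evalPoly n P x ≈ evalPoly n P y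
    evalPoly-cong zero    p  h = refl
    evalPoly-cong (suc n) ps h = trans (evalPoly-horner n ps _) (trans (horner-cong n ps (λ i i<n → h i (ℕₚ.m<n⇒m<1+n i<n)) (h n ℕₚ.≤-refl)) (sym (evalPoly-horner n ps _)))

    horner-cong : ∀ n ps {x y u w} → (∀ i → i < n → x i ≈ y i) → u ≈ w → horner (coefficients n ps x) u ≈ horner (coefficients n ps y) w
    horner-cong n []       h e = refl
    horner-cong n (p ∷ ps) h e = +-cong (evalPoly-cong n p h) (*-cong e (horner-cong n ps h e))

  -- Powers of z provide enough points with nonzero coordinates. The restriction is what makes a
  -- prescribed jet Y invertible in the final argument.
  vanishing⇒IsZeroPoly : ∀ n (P : Poly n) → (∀ x → (∀ i → ¬ (x i ≈ 0#)) → evalPoly n P x ≈ 0#) → IsZeroPoly n P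
  vanishing⇒IsZeroPoly zero    p  h = K-zero p (h (λ _ → 1#) (λ _ → 1≉0))
  vanishing⇒IsZeroPoly (suc n) ps h = all-zero ps (λ x ne → roots⇒zero no-zero-divisors (length (coefficients n ps x)) (node 1) (λ i j i<j _ → node-distinct 1 ℕₚ.≤-refl i j i<j)
      (coefficients n ps x) ℕₚ.≤-refl (λ i _ → root x ne i))
    where
    replace : (ℕ → Carrier) → Carrier → ℕ → Carrier
    replace x u i with i ℕ.≟ n
    ... | yes _ = u
    ... | no _  = x i
    replace≉0 : ∀ x u → (∀ i → ¬ (x i ≈ 0#)) → ¬ (u ≈ 0#) → ∀ i → ¬ (replace x u i ≈ 0#)
    replace≉0 x u ne u≉0 i with i ℕ.≟ n
    ... | yes _ = u≉0
    ... | no _  = ne i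
    replace-below : ∀ x u i → i < n → replace x u i ≈ x i
    replace-below x u i i<n with i ℕ.≟ n
    ... | yes ≡.refl = ⊥-elim (ℕₚ.<-irrefl ≡.refl i<n)
    ... | no _       = refl
    replace-at : ∀ x u → replace x u n ≈ u
    replace-at x u with n ℕ.≟ n
    ... | yes _  = refl
    ... | no n≢n = ⊥-elim (n≢n ≡.refl)
    root : ∀ x → (∀ i → ¬ (x i ≈ 0#)) → ∀ i → horner (coefficients n ps x) (node 1 i) ≈ 0#
    root x ne i = trans (horner-cong n ps (λ j j<n → sym (replace-below x (node 1 i) j j<n)) (sym (replace-at x (node 1 i))))
      (trans (sym (evalPoly-horner n ps (replace x (node 1 i)))) (h (replace x (node 1 i)) (replace≉0 x (node 1 i) ne (pow-nonzero (i ℕ.* 1) z≉0))))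
    all-zero : ∀ ps → (∀ x → (∀ i → ¬ (x i ≈ 0#)) → ∀ l → getD (coefficients n ps x) l ≈ 0#) → All (IsZeroPoly n) ps
    all-zero []       _ = []
    all-zero (p ∷ ps) h = vanishing⇒IsZeroPoly n p (λ x ne → h x ne 0) ∷ all-zero ps (λ x ne l → h x ne (suc l))

  -- Linear independence of the powers of λ below q - 1.

  module RootIndependence (λθ : Carrier) (λθ-root : pow λθ (q ∸ 1) ≈ - θ) where
    pow-q : ∀ y → pow y q ≈ pow y (q ∸ 1) * y
    pow-q y = reflexive (≡.cong (pow y) (≡.sym (ℕₚ.m+[n∸m]≡n 1≤q)))

    λθ-frobenius : - z * pow λθ q ≈ λθ
    λθ-frobenius = begin
      - z * pow λθ q         ≈⟨ *-congˡ (trans (pow-q λθ) (*-congʳ λθ-root)) ⟩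
      - z * (- θ * λθ)       ≈⟨ solve 3 (λ z t l → :- z :* (:- t :* l) := z :* t :* l) refl z θ λθ ⟩
      z * θ * λθ             ≈⟨ trans (*-congʳ zθ≈1) (*-identityˡ _) ⟩
      λθ                     ∎

    λθ≉0 : ¬ (λθ ≈ 0#)
    λθ≉0 e = θ≉0 (begin
      θ                  ≈⟨ solve 1 (λ t → t := :- (:- t)) refl θ ⟩
      - (- θ)            ≈⟨ -‿cong λθ-root ⟨
      - pow λθ (q ∸ 1)   ≈⟨ -‿cong (trans (pow-cong (q ∸ 1) e) (pow-zero (ℕₚ.∸-monoˡ-≤ 1 2≤q))) ⟩
      - 0#               ≈⟨ Algebra.Properties.Ring.-0#≈0# ring ⟩
      0#                 ∎)

    Unit : Carrier → Set (a ⊔ ℓ)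
    Unit y = 𝒪 y × ∃ λ y′ → 𝒪 y′ × y * y′ ≈ 1#

    Unit-* : ∀ {y w} → Unit y → Unit w → Unit (y * w)
    Unit-* {y} {w} (h , y′ , h′ , e) (k , w′ , k′ , e′) = 𝒪-* h k , y′ * w′ , 𝒪-* h′ k′ ,
      trans (solve 4 (λ y w y′ w′ → (y :* w) :* (y′ :* w′) := (y :* y′) :* (w :* w′)) refl y w y′ w′) (trans (*-cong e e′) (*-identityˡ _))

    Unit-1 : Unit 1#
    Unit-1 = 𝒪-1 , 1# , 𝒪-1 , *-identityˡ _

    Unit-pow : ∀ {y} n → Unit y → Unit (pow y n)
    Unit-pow zero    h = Unit-1
    Unit-pow (suc n) h = Unit-* (Unit-pow n h) h

    Unit--1 : Unit (- 1#)
    Unit--1 = 𝒪-neg 𝒪-1 , - 1# , 𝒪-neg 𝒪-1 , solve 0 (:- :1 :* :- :1 := :1) refl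

    series-Unit : ∀ f → ¬ (f 0 F.≈ F.0#) → Unit (ι₀ f)
    series-Unit f ne = (f , refl) , ι₀ (invSeries f) , (_ , refl) , series-unit f ne

    -- Valuations are compared without a valuation function: if α < β, cancelling z^α would write a
    -- unit as a multiple of z, and hence 1 as well.
    exponent-≮ : ∀ {y y′} α β → Unit y → 𝒪 y′ → pow z α * y ≈ pow z β * y′ → ¬ (α < β)
    exponent-≮ {y} {y′} α β (_ , w , 𝒪w , yw) 𝒪y′ e α<β = 1≉0 (Bounded-small⇒≈0 (Bounded-z^ 0)
        (O-cong unit-small (O-scale (𝒪-* 𝒪y′ 𝒪w) (O-≤ (ℕₚ.m<n⇒0<n∸m α<β) (O-z^ (β ∸ α))))))
      where
      unit-small : y′ * w * pow z (β ∸ α) ≈ 1#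
      unit-small = begin
        y′ * w * pow z (β ∸ α)                ≈⟨ *-congˡ (θ^z^∸ (ℕₚ.<⇒≤ α<β)) ⟨
        y′ * w * (pow θ α * pow z β)          ≈⟨ solve 4 (λ y w t s → y :* w :* (t :* s) := t :* (s :* y) :* w) refl y′ w (pow θ α) (pow z β) ⟩
        pow θ α * (pow z β * y′) * w          ≈⟨ *-congʳ (*-congˡ e) ⟨
        pow θ α * (pow z α * y) * w           ≈⟨ *-congʳ (sym (*-assoc _ _ _)) ⟩
        pow θ α * pow z α * y * w             ≈⟨ *-congʳ (trans (*-congʳ (θ^z^ α)) (*-identityˡ y)) ⟩
        y * w                                 ≈⟨ yw ⟩
        1#                                    ∎

    exponent-unique : ∀ {y y′} α β → Unit y → Unit y′ → pow z α * y ≈ pow z β * y′ → α ≡ β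
    exponent-unique α β h h′ e with ℕₚ.<-cmp α β
    ... | tri< α<β _ _ = ⊥-elim (exponent-≮ α β h (proj₁ h′) e α<β)
    ... | tri≈ _ α≡β _ = α≡β
    ... | tri> _ _ β<α = ⊥-elim (exponent-≮ β α h′ (proj₁ h) (sym e) β<α)

    𝒪-coefficient : ∀ {y} (h : 𝒪 y) → (∀ n → ¬ ¬ (proj₁ h n F.≈ F.0#)) → y ≈ 0#
    𝒪-coefficient (f , y≈) zeros = trans y≈ (trans (ι₀-cong (λ n → decidable-stable (f n ≟F F.0#) (zeros n))) ι₀-0)

    𝒪-factored : ∀ {y} → 𝒪 y → ¬ (y ≈ 0#) → ¬ ¬ (∃ λ m → ∃ λ w → Unit w × y ≈ pow z m * w)
    𝒪-factored h@(f , y≈) y≉0 none = y≉0 (𝒪-coefficient h λ n ne →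
      let (m , g , g≉0 , e) = series-factor f n ne in none (m , ι₀ g , series-Unit g g≉0 , trans y≈ e))

    𝒪-stable : ∀ {y} → 𝒪 y → ¬ ¬ (y ≈ 0#) → y ≈ 0#
    𝒪-stable h@(f , y≈) nn = 𝒪-coefficient h λ n ne → nn λ y≈0 → ne (ι₀-injective f (trans (sym y≈) y≈0) n)

    residues : ∀ Q j m n → 0 < j → j < Q → ¬ (j ℕ.+ m ℕ.* Q ≡ n ℕ.* Q)
    residues Q@(suc _) j m n 0<j j<Q e = ℕₚ.<⇒≢ 0<j (≡.sym (≡.trans (≡.sym (DivMod.m<n⇒m%n≡m j<Q)) (≡.trans (≡.sym (DivMod.[m+kn]%n≡m%n j m Q)) (≡.trans (≡.cong (DivMod._% Q) e) (DivMod.m*n%n≡0 n Q)))))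

    -- the valuation of the left side is not divisible by q - 1
    no-root : ∀ j {y b} → 0 < j → j < q ∸ 1 → 𝒪 y → ¬ (y ≈ 0#) → 𝒪 b → ¬ (b ≈ 0#) → ¬ (pow (- z) j * pow y (q ∸ 1) ≈ pow b (q ∸ 1))
    no-root j {y} {b} 0<j j<Q 𝒪y y≉0 𝒪b b≉0 e = 𝒪-factored 𝒪y y≉0 λ (m , u , Uu , y≈) → 𝒪-factored 𝒪b b≉0 λ (n , w , Uw , b≈) →
      residues (q ∸ 1) j m n 0<j j<Q (exponent-unique _ _ (Unit-* (Unit-pow j Unit--1) (Unit-pow (q ∸ 1) Uu)) (Unit-pow (q ∸ 1) Uw) (begin
        pow z (j ℕ.+ m ℕ.* (q ∸ 1)) * (pow (- 1#) j * pow u (q ∸ 1))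
          ≈⟨ *-congʳ (trans (pow-+ z j _) (*-congˡ (power z m))) ⟩
        pow z j * pow (pow z m) (q ∸ 1) * (pow (- 1#) j * pow u (q ∸ 1))
          ≈⟨ solve 4 (λ s t n u → s :* t :* (n :* u) := (n :* s) :* (t :* u)) refl (pow z j) _ (pow (- 1#) j) _ ⟩
        pow (- 1#) j * pow z j * (pow (pow z m) (q ∸ 1) * pow u (q ∸ 1))
          ≈⟨ *-cong (trans (sym (pow-distrib (- 1#) z j)) (pow-cong j (solve 1 (λ z → :- :1 :* z := :- z) refl z))) (trans (sym (pow-distrib _ u (q ∸ 1))) (pow-cong (q ∸ 1) (sym y≈))) ⟩
        pow (- z) j * pow y (q ∸ 1)
          ≈⟨ e ⟩
        pow b (q ∸ 1)
          ≈⟨ trans (pow-cong (q ∸ 1) b≈) (pow-distrib _ w (q ∸ 1)) ⟩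
        pow (pow z n) (q ∸ 1) * pow w (q ∸ 1)
          ≈⟨ *-congʳ (power z n) ⟨
        pow z (n ℕ.* (q ∸ 1)) * pow w (q ∸ 1) ∎))
      where
      power : ∀ y m → pow y (m ℕ.* (q ∸ 1)) ≈ pow (pow y m) (q ∸ 1)
      power y m = trans (reflexive (≡.cong (pow y) (ℕₚ.*-comm m (q ∸ 1)))) (pow-* y (q ∸ 1) m)

    frobenius-Σ : ∀ n (f : ℕ → Carrier) → pow (sumTo n f) q ≈ sumTo n (λ i → pow (f i) q)
    frobenius-Σ zero    f = pow-zero 1≤q
    frobenius-Σ (suc n) f = trans (frobenius _ _) (+-congʳ (frobenius-Σ n f))

    mutual
      -- Combining a relation Σ λ^k a_k = 0 with its q-th power removes the top term.
      powers-independent : ∀ N → N ≤ q ∸ 1 → (α : ℕ → Carrier) → (∀ k → k < N → 𝒪 (α k)) → sumTo N (λ k → pow λθ k * α k) ≈ 0# → ∀ k → k < N → α k ≈ 0#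
      powers-independent (suc N) N<Q α 𝒪α e k k≤N with k ℕ.≟ N
      ... | no k≢N = powers-independent N (ℕₚ.<⇒≤ N<Q) α (λ i i<N → 𝒪α i (ℕₚ.m<n⇒m<1+n i<N)) (trans (sym (trans (+-congˡ (trans (*-congˡ top) (zeroʳ _))) (+-identityʳ _))) e) k (ℕₚ.≤∧≢⇒< (ℕₚ.≤-pred k≤N) k≢N)
        where
        top : α N ≈ 0#
        top = powers-independent-top N N<Q α 𝒪α e
      ... | yes ≡.refl = powers-independent-top N N<Q α 𝒪α e

      -- As -z λ^q = λ, the element (-z)^N Σ^q - b^{q-1} Σ has coefficients β in the same powers of
      -- λ, and β N = 0. By induction all β vanish. A nonzero lower α k would give (-z)^{N-k}
      -- α_k^{q-1} = b^{q-1}, which `no-root` excludes; so only λ^N b is left.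
      powers-independent-top : ∀ N → N < q ∸ 1 → (α : ℕ → Carrier) → (∀ k → k < suc N → 𝒪 (α k)) → sumTo (suc N) (λ k → pow λθ k * α k) ≈ 0# → α N ≈ 0#
      powers-independent-top N N<Q α 𝒪α e = 𝒪-stable (𝒪α N ℕₚ.≤-refl) λ b≉0 →
        *-nonzero (pow-nonzero N λθ≉0) b≉0 (trans (sym (+-identityˡ _)) (trans (+-congʳ (sym (Σ-zero N (λ k k<N → trans (*-congˡ (lower-zero b≉0 k k<N)) (zeroʳ _))))) e))
        where
        b = α N
        β : ℕ → Carrier
        β k = pow (- z) (N ∸ k) * pow (α k) q - pow b (q ∸ 1) * α k
        term : ∀ k → k ≤ N → pow (- z) N * pow (pow λθ k * α k) q - pow b (q ∸ 1) * (pow λθ k * α k) ≈ pow λθ k * β k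
        term k k≤N = begin
          pow (- z) N * pow (pow λθ k * α k) q - pow b (q ∸ 1) * (pow λθ k * α k)
            ≈⟨ +-congʳ (*-cong (trans (reflexive (≡.cong (pow (- z)) (≡.sym (ℕₚ.m∸n+n≡m k≤N)))) (pow-+ (- z) (N ∸ k) k)) (trans (pow-distrib _ _ q) (*-congʳ swap))) ⟩
          pow (- z) (N ∸ k) * pow (- z) k * (pow (pow λθ q) k * pow (α k) q) - pow b (q ∸ 1) * (pow λθ k * α k)
            ≈⟨ +-congʳ (solve 4 (λ s t l a → s :* t :* (l :* a) := (t :* l) :* (s :* a)) refl (pow (- z) (N ∸ k)) (pow (- z) k) (pow (pow λθ q) k) (pow (α k) q)) ⟩
          pow (- z) k * pow (pow λθ q) k * (pow (- z) (N ∸ k) * pow (α k) q) - pow b (q ∸ 1) * (pow λθ k * α k)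
            ≈⟨ +-congʳ (*-congʳ (trans (sym (pow-distrib (- z) (pow λθ q) k)) (pow-cong k λθ-frobenius))) ⟩
          pow λθ k * (pow (- z) (N ∸ k) * pow (α k) q) - pow b (q ∸ 1) * (pow λθ k * α k)
            ≈⟨ solve 4 (λ l s b a → l :* s :- b :* (l :* a) := l :* (s :- b :* a)) refl (pow λθ k) _ (pow b (q ∸ 1)) (α k) ⟩
          pow λθ k * β k ∎
          where
          swap : pow (pow λθ k) q ≈ pow (pow λθ q) k
          swap = trans (sym (pow-* λθ q k)) (trans (reflexive (≡.cong (pow λθ) (ℕₚ.*-comm q k))) (pow-* λθ k q))
        𝒪β : ∀ k → k < N → 𝒪 (β k)
        𝒪β k k<N = 𝒪-+ (𝒪-* (𝒪-pow (N ∸ k) (𝒪-neg 𝒪-z)) (𝒪-pow q (𝒪α k (ℕₚ.m<n⇒m<1+n k<N)))) (𝒪-neg (𝒪-* (𝒪-pow (q ∸ 1) (𝒪α N ℕₚ.≤-refl)) (𝒪α k (ℕₚ.m<n⇒m<1+n k<N))))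
        top-zero : β N ≈ 0#
        top-zero = trans (+-congʳ (trans (*-congʳ (reflexive (≡.cong (pow (- z)) (ℕₚ.n∸n≡0 N)))) (trans (*-identityˡ _) (pow-q b)))) (-‿inverseʳ _)
        combined : sumTo (suc N) (λ k → pow λθ k * β k) ≈ 0#
        combined = begin
          sumTo (suc N) (λ k → pow λθ k * β k)
            ≈⟨ Σ-cong (suc N) (λ k k≤N → term k (ℕₚ.≤-pred k≤N)) ⟨
          sumTo (suc N) (λ k → pow (- z) N * pow (pow λθ k * α k) q - pow b (q ∸ 1) * (pow λθ k * α k))
            ≈⟨ trans (Σ-+ (suc N) _ _) (+-cong (trans (sym (Σ-*ˡ (suc N) _ _)) (*-congˡ (sym (frobenius-Σ (suc N) _)))) (trans (sym (Σ-neg (suc N) _)) (-‿cong (sym (Σ-*ˡ (suc N) _ _))))) ⟩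
          pow (- z) N * pow (sumTo (suc N) (λ k → pow λθ k * α k)) q - pow b (q ∸ 1) * sumTo (suc N) (λ k → pow λθ k * α k)
            ≈⟨ +-cong (*-congˡ (trans (pow-cong q e) (pow-zero 1≤q))) (-‿cong (*-congˡ e)) ⟩
          pow (- z) N * 0# - pow b (q ∸ 1) * 0#
            ≈⟨ solve 2 (λ s b → s :* :0 :- b :* :0 := :0) refl _ _ ⟩
          0# ∎
        β-zero : ∀ k → k < N → β k ≈ 0#
        β-zero = powers-independent N (ℕₚ.<⇒≤ N<Q) β 𝒪β (trans (sym (trans (+-congˡ (trans (*-congˡ top-zero) (zeroʳ _))) (+-identityʳ _))) combined)
        lower-zero : ¬ (b ≈ 0#) → ∀ k → k < N → α k ≈ 0#
        lower-zero b≉0 k k<N = 𝒪-stable (𝒪α k (ℕₚ.m<n⇒m<1+n k<N)) λ α≉0 →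
          no-root (N ∸ k) (ℕₚ.m<n⇒0<n∸m k<N) (ℕₚ.≤-<-trans (ℕₚ.m∸n≤m N k) N<Q) (𝒪α k (ℕₚ.m<n⇒m<1+n k<N)) α≉0 (𝒪α N ℕₚ.≤-refl) b≉0 (cancel α≉0)
          where
          cancel : ¬ (α k ≈ 0#) → pow (- z) (N ∸ k) * pow (α k) (q ∸ 1) ≈ pow b (q ∸ 1)
          cancel α≉0 = begin
            w                                 ≈⟨ solve 2 (λ w v → w := (w :- v) :+ v) refl w (pow b (q ∸ 1)) ⟩
            (w - pow b (q ∸ 1)) + pow b (q ∸ 1) ≈⟨ +-congʳ (no-zero-divisors (α k) _ (trans product (β-zero k k<N)) α≉0) ⟩
            0# + pow b (q ∸ 1)                ≈⟨ +-identityˡ _ ⟩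
            pow b (q ∸ 1)                     ∎
            where
            w = pow (- z) (N ∸ k) * pow (α k) (q ∸ 1)
            product : α k * (w - pow b (q ∸ 1)) ≈ β k
            product = trans (solve 4 (λ a s p b → a :* (s :* p :- b) := s :* (p :* a) :- b :* a) refl (α k) (pow (- z) (N ∸ k)) (pow (α k) (q ∸ 1)) (pow b (q ∸ 1)))
              (+-congʳ (*-congˡ (sym (pow-q (α k)))))

  -- Hyperderivatives of the Carlitz period.

  module HyperDerivations (D : ℕ → Carrier → Carrier) (derivation : IsHigherDerivation D) (extends : Extends D) where
    open Laurent.Over.IsHigherDerivation derivation

    ι₀-low : ∀ B f → (∀ N → N < B → f N F.≈ F.0#) → O B (ι₀ f)
    ι₀-low B f low = small (ι₀ (λ N → f (B ℕ.+ N))) (_ , refl) (trans (ι₀-cong factored) (trans (ι₀-* _ _) (*-congʳ (sym (E.z^ B)))))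
      where
      factored : ∀ N → f N F.≈ (PO.pow PF.var B P.* (λ N → f (B ℕ.+ N))) N
      factored N with N ℕ.<? B
      ... | yes N<B = F.trans (low N N<B) (F.sym (PF.var^-⊛-low B _ N N<B))
      ... | no N≮B  = F.trans (F.reflexive (≡.cong f (≡.sym (ℕₚ.m+[n∸m]≡n (ℕₚ.≮⇒≥ N≮B))))) (F.trans (F.sym (PF.var^-⊛-shift B (λ N → f (B ℕ.+ N)) (N ∸ B)))
          (F.reflexive (≡.cong (PO.pow PF.var B P.* (λ N → f (B ℕ.+ N))) (ℕₚ.m+[n∸m]≡n (ℕₚ.≮⇒≥ N≮B)))))

    ι-zero : ∀ w f → (∀ n → f n F.≈ F.0#) → ι (laurent w f) ≈ 0#
    ι-zero w f h = trans (cong-ι (laurent w f) (laurent (+ 0) (λ _ → F.0#)) agree) ι₀-0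
      where
      agree : laurent w f ≈∞ laurent (+ 0) (λ _ → F.0#)
      agree k with k ℤ.- w | k ℤ.- (+ 0)
      ... | + j      | + _      = h j
      ... | + j      | -[1+ _ ] = h j
      ... | -[1+ _ ] | + _      = F.refl
      ... | -[1+ _ ] | -[1+ _ ] = F.refl

    𝒟 : Carrier → Ser
    𝒟 u i = D i u

    𝒟-* : ∀ u w → 𝒟 (u * w) ≋ 𝒟 u ⊛ 𝒟 w
    𝒟-* u w n = trans (D-Leibniz n u w) (reflexive (≡.sym (⊛-def (𝒟 u) (𝒟 w) n)))

    𝒟-0 : 𝒟 0# ≋ (λ _ → 0#)
    𝒟-0 n = begin
      D n 0#                     ≈⟨ solve 1 (λ u → u := (u :+ u) :- u) refl (D n 0#) ⟩
      (D n 0# + D n 0#) - D n 0# ≈⟨ +-congʳ (trans (sym (D-+ n 0# 0#)) (D-cong n _ _ (+-identityˡ 0#))) ⟩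
      D n 0# - D n 0#            ≈⟨ -‿inverseʳ _ ⟩
      0#                         ∎

    𝒟-neg : ∀ u → 𝒟 (- u) ≋ (λ n → - D n u)
    𝒟-neg u n = begin
      D n (- u)                       ≈⟨ solve 2 (λ u w → u := (u :+ w) :- w) refl (D n (- u)) (D n u) ⟩
      (D n (- u) + D n u) - D n u     ≈⟨ +-congʳ (trans (sym (D-+ n (- u) u)) (trans (D-cong n _ _ (-‿inverseˡ u)) (𝒟-0 n))) ⟩
      0# - D n u                      ≈⟨ +-identityˡ _ ⟩
      - D n u                         ∎

    𝒟-1 : 𝒟 1# ≋ const 1#
    𝒟-1 zero    = D0 1#
    𝒟-1 (suc n) = trans (D-cong (suc n) _ _ (sym ι-1)) (trans (extends (suc n) 1∞) (ι-zero _ _ λ { zero → F.zeroˡ _ ; (suc j) → F.zeroʳ _ }))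

    -- The Leibniz rule in all orders says that u ↦ Σ D_i(u) ε^i is a ring homomorphism into power
    -- series.
    derivRel : FilteredRelation L PS (a ⊔ ℓ)
    derivRel = record
      { T = λ _ u f → Level.Lift a (f ≋ 𝒟 u)
      ; T-cong = λ p p′ (Level.lift h) → Level.lift (λ n → trans (sym (p′ n)) (trans (h n) (D-cong n _ _ p)))
      ; T-mono = λ _ h → h
      ; T-0 = Level.lift (λ n → sym (𝒟-0 n))
      ; T-1 = Level.lift (λ n → sym (𝒟-1 n))
      ; T-+ = λ (Level.lift h) (Level.lift h′) → Level.lift (λ n → trans (+-cong (h n) (h′ n)) (sym (D-+ n _ _)))
      ; T-* = λ (Level.lift h) (Level.lift h′) → Level.lift (λ n → trans (⊛-cong h h′ n) (sym (𝒟-* _ _ n)))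
      ; T-neg = λ (Level.lift h) → Level.lift (λ n → trans (-‿cong (h n)) (sym (𝒟-neg _ n))) }

    𝒟-pow : ∀ u m → SO.pow (𝒟 u) m ≋ 𝒟 (pow u m)
    𝒟-pow u m = Level.lower (RelationLemmas.T-pow derivRel m {u} {𝒟 u} (Level.lift (λ _ → refl)))

    𝒟-θ : 𝒟 θ ≋ (λ { zero → θ ; (suc zero) → 1# ; (suc (suc _)) → 0# })
    𝒟-θ zero          = D0 θ
    𝒟-θ (suc zero)    = trans (extends 1 θ∞) (trans (ι₀-cong (λ { zero → F.trans (F.*-identityʳ _) (F.+-identityˡ _) ; (suc j) → F.zeroʳ _ })) ι₀-1)
    𝒟-θ (suc (suc n)) = trans (extends (suc (suc n)) θ∞) (ι-zero _ _ λ { zero → F.trans (F.*-congʳ (F.reflexive (≡.cong FO.natC (k>n⇒nCk≡0 {1} {suc (suc n)} (s≤s (s≤s z≤n)))))) (F.zeroˡ _) ; (suc j) → F.zeroʳ _ })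

    -- The jet of θ is θ + ε, so the Leibniz rule for θ z = 1 gives a recursion; no binomial
    -- coefficients with negative entries are evaluated.
    𝒟-z-suc : ∀ n → D (suc n) z ≈ - z * D n z
    𝒟-z-suc n = begin
      D (suc n) z                                          ≈⟨ *-identityˡ _ ⟨
      1# * D (suc n) z                                     ≈⟨ *-congʳ zθ≈1 ⟨
      z * θ * D (suc n) z                                  ≈⟨ solve 4 (λ z t d e → z :* t :* d := z :* (t :* d :+ e) :+ (:- z) :* e) refl z θ (D (suc n) z) (D n z) ⟩
      z * (θ * D (suc n) z + D n z) + - z * D n z          ≈⟨ +-congʳ (trans (*-congˡ relation) (zeroʳ z)) ⟩
      0# + - z * D n z                                     ≈⟨ +-identityˡ _ ⟩
      - z * D n z                                          ∎
      where
      tail-one : ∀ k → ((𝒟 θ ∘ suc) ⊛ 𝒟 z) k ≈ D k z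
      tail-one k = trans (⊛-cong {f′ = const 1#} (λ { zero → 𝒟-θ 1 ; (suc i) → 𝒟-θ (suc (suc i)) }) (λ _ → refl) k) (one-⊛ (𝒟 z) k)
      relation : θ * D (suc n) z + D n z ≈ 0#
      relation = begin
        θ * D (suc n) z + D n z                            ≈⟨ +-cong (*-congʳ (sym (D0 θ))) (sym (tail-one n)) ⟩
        D 0 θ * D (suc n) z + ((𝒟 θ ∘ suc) ⊛ 𝒟 z) n        ≈⟨ ⊛-suc (𝒟 θ) (𝒟 z) n ⟨
        (𝒟 θ ⊛ 𝒟 z) (suc n)                                ≈⟨ 𝒟-* θ z (suc n) ⟨
        D (suc n) (θ * z)                                  ≈⟨ D-cong (suc n) _ _ (trans (*-comm θ z) zθ≈1) ⟩
        D (suc n) 1#                                       ≈⟨ 𝒟-1 (suc n) ⟩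
        0#                                                 ∎

    DLaurent : Carrier → Set ℓ
    DLaurent u = ∀ i → Laurent (D i u)

    DLaurent-z : DLaurent z
    DLaurent-z zero    = Laurent-cong (sym (D0 z)) Laurent-z
    DLaurent-z (suc n) = Laurent-cong (sym (𝒟-z-suc n)) (Laurent-* (Laurent-neg Laurent-z) (DLaurent-z n))

    DLaurent-θ : DLaurent θ
    DLaurent-θ zero          = Laurent-cong (sym (𝒟-θ 0)) Laurent-θ
    DLaurent-θ (suc zero)    = Laurent-cong (sym (𝒟-θ 1)) Laurent-1
    DLaurent-θ (suc (suc n)) = Laurent-cong (sym (𝒟-θ (suc (suc n)))) Laurent-0

    DLaurent-1 : DLaurent 1#
    DLaurent-1 zero    = Laurent-cong (sym (𝒟-1 0)) Laurent-1
    DLaurent-1 (suc n) = Laurent-cong (sym (𝒟-1 (suc n))) Laurent-0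

    DLaurent-* : ∀ {u w} → DLaurent u → DLaurent w → DLaurent (u * w)
    DLaurent-* {u} {w} h h′ n = Laurent-cong (sym (𝒟-* u w n)) (RelationLemmas.T-⊛ laurentRel {0} {0} {f′ = λ _ → 0#} {g′ = λ _ → 0#} n h h′)

    DLaurent-neg : ∀ {u} → DLaurent u → DLaurent (- u)
    DLaurent-neg h n = Laurent-cong (sym (𝒟-neg _ n)) (Laurent-neg (h n))

    DLaurent-+ : ∀ {u w} → DLaurent u → DLaurent w → DLaurent (u + w)
    DLaurent-+ h h′ n = Laurent-cong (sym (D-+ n _ _)) (Laurent-+ (h n) (h′ n))

    DLaurent-pow : ∀ {u} m → DLaurent u → DLaurent (pow u m)
    DLaurent-pow zero    h = DLaurent-1
    DLaurent-pow (suc m) h = DLaurent-* (DLaurent-pow m h) h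

    natC-PS : ∀ n → SO.natC n ≋ const (natC n)
    natC-PS zero    = λ { zero → refl ; (suc _) → refl }
    natC-PS (suc n) = λ { zero → +-congʳ (natC-PS n 0) ; (suc i) → trans (+-identityʳ _) (natC-PS n (suc i)) }

    frobenius-PS : ∀ k f g → SO.pow (f S.+ g) (q ^ k) ≋ SO.pow f (q ^ k) S.+ SO.pow g (q ^ k)
    frobenius-PS zero    f g = S.trans (S.*-identityˡ _) (S.+-cong (S.sym (S.*-identityˡ f)) (S.sym (S.*-identityˡ g)))
    frobenius-PS (suc k) f g = S.trans (Sums.pow-* PS (f S.+ g) q (q ^ k)) (S.trans (Sums.pow-cong PS q (frobenius-PS k f g))
      (S.trans (BinomialSums.frobenius-additive PS q vanish (ℕₚ.≤-trans (s≤s z≤n) 2≤q) _ _)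
        (S.+-cong (S.sym (Sums.pow-* PS f q (q ^ k))) (S.sym (Sums.pow-* PS g q (q ^ k))))))
      where
      vanish : ∀ i → 0 < i → i < q → SO.natC (q choose i) ≋ (λ _ → 0#)
      vanish i 0<i i<q = S.trans (natC-PS (q choose i)) λ { zero → E.binomial-zero-L i 0<i i<q ; (suc _) → refl }

    const-pow : ∀ u m → SO.pow (const u) m ≋ const (pow u m)
    const-pow u zero    = λ _ → refl
    const-pow u (suc m) = S.trans (S.*-congʳ (const-pow u m)) λ { zero → const-⊛ _ (const u) 0 ; (suc n) → trans (const-⊛ _ (const u) (suc n)) (zeroʳ _) }

    -- Write f as its constant term plus ε g. Frobenius is additive, and (ε g)^{q^k} starts in order
    -- q^k.
    pow-q^ : ∀ k f i → i < q ^ k → SO.pow f (q ^ k) i ≈ const (pow (f 0) (q ^ k)) i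
    pow-q^ k f i lt = begin
      SO.pow f (q ^ k) i                                             ≈⟨ Sums.pow-cong PS (q ^ k) split i ⟩
      SO.pow (const (f 0) S.+ var ⊛ (f ∘ suc)) (q ^ k) i             ≈⟨ frobenius-PS k _ _ i ⟩
      SO.pow (const (f 0)) (q ^ k) i + SO.pow (var ⊛ (f ∘ suc)) (q ^ k) i
        ≈⟨ +-cong (const-pow (f 0) (q ^ k) i) (trans (Sums.pow-distrib PS var (f ∘ suc) (q ^ k) i) (var^-⊛-low (q ^ k) (SO.pow (f ∘ suc) (q ^ k)) i lt)) ⟩
      const (pow (f 0) (q ^ k)) i + 0#                               ≈⟨ +-identityʳ _ ⟩
      const (pow (f 0) (q ^ k)) i                                    ∎
      where
      split : f ≋ const (f 0) S.+ var ⊛ (f ∘ suc)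
      split zero    = sym (trans (+-congˡ (var-⊛-zero _)) (+-identityʳ _))
      split (suc n) = sym (trans (+-identityˡ _) (var-⊛-suc _ n))

    𝒟-q^ : ∀ k u i → i < q ^ k → D i (pow u (q ^ k)) ≈ const (pow u (q ^ k)) i
    𝒟-q^ k u i lt = trans (sym (𝒟-pow u (q ^ k) i)) (trans (pow-q^ k (𝒟 u) i lt) (const-cong i))
      where
      const-cong : ∀ i → const (pow (D 0 u) (q ^ k)) i ≈ const (pow u (q ^ k)) i
      const-cong zero    = pow-cong (q ^ k) (D0 u)
      const-cong (suc _) = refl

    D-O : ∀ i B u → O B u → O B (D i u)
    D-O i B u (small w (f , w≈) u≈) = O-cong (sym derived) (ι₀-scaled)
      where
      h = PO.pow PF.var B P.* f
      h′ : P.Carrier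
      h′ = c (∂ i (laurent (+ 0) h))
      u≈ι₀h : u ≈ ι₀ h
      u≈ι₀h = trans u≈ (trans (*-cong (E.z^ B) w≈) (sym (ι₀-* _ _)))
      derived : D i u ≈ ι₀ h′ * pow z i
      derived = trans (D-cong i _ _ u≈ι₀h) (trans (extends i (laurent (+ 0) h)) (sym (ι-shift (+ 0) i h′)))
      ι₀-scaled : O B (ι₀ h′ * pow z i)
      ι₀-scaled = O-cong (*-comm _ _) (O-scale (𝒪-pow i 𝒪-z) (ι₀-low B h′ (λ N N<B → F.trans (F.*-congˡ (PF.var^-⊛-low B f N N<B)) (F.zeroʳ _))))

    q^-mono : ∀ {m n} → m ≤ n → q ^ m ≤ q ^ n
    q^-mono = ℕₚ.^-monoʳ-≤ q {{ℕ.>-nonZero 1≤q}}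

    gap : ℕ → ℕ
    gap J = q ^ suc J ∸ 1

    <gap : ∀ J → J < gap J
    <gap J = ℕₚ.∸-monoˡ-≤ 1 (n<q^n (suc J))

    var^-at : ∀ e k → PO.pow PF.var e k F.≈ (if does (k ℕ.≟ e) then F.1# else F.0#)
    var^-at e k = case (k ℕ.≟ e)
      where
      case : (d : Dec (k ≡ e)) → PO.pow PF.var e k F.≈ (if does d then F.1# else F.0#)
      case (yes ≡.refl) = F.trans (P.sym (P.*-identityʳ (PO.pow PF.var e)) k) (F.trans (F.reflexive (≡.cong (PO.pow PF.var e P.* P.1#) (≡.sym (ℕₚ.+-identityʳ e)))) (PF.var^-⊛-shift e P.1# 0))
      case (no k≢e) with k ℕ.<? e
      ... | yes k<e = F.trans (P.sym (P.*-identityʳ (PO.pow PF.var e)) k) (PF.var^-⊛-low e P.1# k k<e)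
      ... | no k≮e  = F.trans (P.sym (P.*-identityʳ (PO.pow PF.var e)) k) (F.trans (F.reflexive (≡.cong (PO.pow PF.var e P.* P.1#)
          (≡.sym (≡.trans (ℕₚ.+-suc e (k ∸ suc e)) (ℕₚ.m+[n∸m]≡n (ℕₚ.≤∧≢⇒< (ℕₚ.≮⇒≥ k≮e) (k≢e ∘ ≡.sym))))))) (PF.var^-⊛-shift e P.1# (suc (k ∸ suc e))))

    oneMinus-series : ∀ J → c (oneMinus (suc J)) P.≈ P.1# P.- PO.pow PF.var (gap J)
    oneMinus-series J zero = F.sym (F.trans (F.+-congˡ (F.trans (F.-‿cong (F.trans (P.sym (P.*-identityʳ (PO.pow PF.var (gap J))) 0)
      (PF.var^-⊛-low (gap J) P.1# 0 (ℕₚ.≤-<-trans z≤n (<gap J))))) (Algebra.Properties.Ring.-0#≈0# F.ring))) (F.+-identityʳ _))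
    oneMinus-series J (suc k) = negate (does (suc k ℕ.≟ gap J)) (var^-at (gap J) (suc k))
      where
      negate : ∀ b {u} → u F.≈ (if b then F.1# else F.0#) → (if b then F.- F.1# else F.0#) F.≈ F.0# F.- u
      negate true  h = F.sym (F.trans (F.+-identityˡ _) (F.-‿cong h))
      negate false h = F.sym (F.trans (F.+-identityˡ _) (F.trans (F.-‿cong h) (Algebra.Properties.Ring.-0#≈0# F.ring)))

    partial : ℕ → P.Carrier
    partial J = c (prodUpTo J)

    -- Expressing the earlier product through the later one involves the polynomial factor rather
    -- than its inverse; since z^{gap J} has exponent above J, low coefficients are seen to be
    -- stable.
    partial-back : ∀ J → partial J P.≈ (P.1# P.- PO.pow PF.var (gap J)) P.* partial (suc J)
    partial-back J = P.sym (P.trans (P.*-cong (P.sym (oneMinus-series J)) (λ n → F.reflexive (≡.sym (PF.⊛-def (partial J) (invSeries om) n))))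
      (P.trans (PI.solve 3 (λ o p i → o PI.:* (p PI.:* i) PI.:= p PI.:* (o PI.:* i)) P.refl om (partial J) (invSeries om))
        (P.trans (P.*-congˡ (invSeries-inverse om F-1≉0)) (P.*-identityʳ (partial J)))))
      where om = c (oneMinus (suc J))

    partial-stable : ∀ J k → k ≤ J → partial (suc J) k F.≈ partial J k
    partial-stable J k k≤J = F.sym (F.trans (partial-back J k) (F.trans
      (PI.solve 2 (λ x p → (PI.:1 PI.:- x) PI.:* p PI.:= p PI.:- x PI.:* p) P.refl (PO.pow PF.var (gap J)) (partial (suc J)) k)
      (F.trans (F.+-congˡ (F.trans (F.-‿cong (PF.var^-⊛-low (gap J) (partial (suc J)) k (ℕₚ.≤-<-trans k≤J (<gap J)))) (Algebra.Properties.Ring.-0#≈0# F.ring))) (F.+-identityʳ _))))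

    partial-stable+ : ∀ i J k → k ≤ J → partial (i ℕ.+ J) k F.≈ partial J k
    partial-stable+ zero    J k k≤J = F.refl
    partial-stable+ (suc i) J k k≤J = F.trans (partial-stable (i ℕ.+ J) k (ℕₚ.≤-trans k≤J (ℕₚ.m≤n+m J i))) (partial-stable+ i J k k≤J)

    v-prodUpTo : ∀ J → v (prodUpTo J) ≡ + 0
    v-prodUpTo zero    = ≡.refl
    v-prodUpTo (suc J) = ≡.cong (λ u → u ℤ.+ + 0) (v-prodUpTo J)

    carlitzProd-at : ∀ J k → k < J → c carlitzProd k F.≈ partial J k
    carlitzProd-at J k k<J = F.trans (F.reflexive (coefAt⁺ (prodUpTo (suc k)) (+ k) k (≡.trans (≡.cong (λ u → + k ℤ.- u) (v-prodUpTo (suc k))) (ℤₚ.+-identityʳ (+ k)))))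
      (F.trans (F.sym (partial-stable+ (J ∸ suc k) (suc k) k (ℕₚ.n≤1+n k))) (F.reflexive (≡.cong (λ J → partial J k) (ℕₚ.m∸n+n≡m k<J))))

    θz^ : ∀ Q → 1 ≤ Q → θ * pow z Q ≈ pow z (Q ∸ 1)
    θz^ Q 1≤Q = trans (*-congʳ (sym (*-identityˡ θ))) (θ^z^∸ 1≤Q)

    product : ℕ → ℕ → Carrier
    product a cnt = jetProd θ z a cnt 0

    ι₀-partial : ∀ J → ι₀ (partial J) * product 0 J ≈ 1#
    ι₀-partial zero    = trans (*-identityʳ _) ι-1
    ι₀-partial (suc J) = begin
      ι₀ (partial (suc J)) * product 0 (suc J)                            ≈⟨ *-congˡ (⊛-zero (jetProd θ z 0 J) _) ⟩
      ι₀ (partial (suc J)) * (product 0 J * (1# - θ * pow z (q ^ suc J))) ≈⟨ solve 3 (λ p r m → p :* (r :* m) := m :* p :* r) refl _ _ _ ⟩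
      (1# - θ * pow z (q ^ suc J)) * ι₀ (partial (suc J)) * product 0 J   ≈⟨ *-congʳ (trans (*-congʳ (+-congˡ (-‿cong (θz^ _ (q^≥1 (suc J)))))) (sym back)) ⟩
      ι₀ (partial J) * product 0 J                                        ≈⟨ ι₀-partial J ⟩
      1#                                                                  ∎
      where
      back : ι₀ (partial J) ≈ (1# - pow z (gap J)) * ι₀ (partial (suc J))
      back = trans (ι₀-cong (partial-back J)) (trans (ι₀-* _ _) (*-congʳ (trans (ι₀-+ _ _) (+-cong ι₀-1 (trans (ι₀-neg _) (-‿cong (sym (E.z^ (gap J)))))))))

    -- The infinite product of the factors 1 - θ z^{q^j}, obtained by inverting `carlitzProd`.
    reciprocal : Carrier
    reciprocal = ι₀ (invSeries (c carlitzProd))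

    carlitzProd*reciprocal : ι carlitzProd * reciprocal ≈ 1#
    carlitzProd*reciprocal = series-unit (c carlitzProd) (λ e → F-1≉0 (F.trans (F.sym (F.trans (carlitzProd-at 1 0 (s≤s z≤n)) (partial-stable 0 0 z≤n))) e))

    O-⊛ : ∀ N {f g B} → (∀ i → i < N → 𝒪 (f i)) → (∀ i → i < N → O B (g i)) → ∀ i → i < N → O B ((f ⊛ g) i)
    O-⊛ N {f} {g} hf hg i i<N = O-cong (reflexive (≡.sym (⊛-def f g i))) (O-Σ (suc i) (λ j j≤i →
      O-scale (hf j (ℕₚ.≤-<-trans (ℕₚ.≤-pred j≤i) i<N)) (hg (i ∸ j) (ℕₚ.≤-<-trans (ℕₚ.m∸n≤m i j) i<N))))

    agree-⊛ : ∀ N {f f′ g g′} → (∀ i → i < N → f i ≈ f′ i) → (∀ i → i < N → g i ≈ g′ i) → ∀ i → i < N → (f ⊛ g) i ≈ (f′ ⊛ g′) i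
    agree-⊛ N {f} {f′} {g} {g′} hf hg i i<N = trans (reflexive (⊛-def f g i)) (trans (Σ-cong (suc i) (λ j j≤i →
      *-cong (hf j (ℕₚ.≤-<-trans (ℕₚ.≤-pred j≤i) i<N)) (hg (i ∸ j) (ℕₚ.≤-<-trans (ℕₚ.m∸n≤m i j) i<N)))) (reflexive (≡.sym (⊛-def f′ g′ i))))

    𝒪-jetProd : ∀ a cnt i → 𝒪 (jetProd θ z a cnt i)
    𝒪-jetProd a zero      zero    = 𝒪-1
    𝒪-jetProd a zero      (suc _) = 𝒪-0
    𝒪-jetProd a (suc cnt) i       = O⇒𝒪 (O-⊛ (suc i) (λ j _ → 𝒪-jetProd a cnt j) (λ j _ → 𝒪⇒O (𝒪-factor j)) i ℕₚ.≤-refl)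
      where
      𝒪-factor : ∀ j → 𝒪 (factorJet θ (pow z (q ^ (suc a ℕ.+ cnt))) j)
      𝒪-factor zero          = 𝒪-+ 𝒪-1 (𝒪-neg (𝒪-cong (sym (θz^ _ (q^≥1 (suc a ℕ.+ cnt)))) (𝒪-pow (q ^ (suc a ℕ.+ cnt) ∸ 1) 𝒪-z)))
      𝒪-factor (suc zero)    = 𝒪-neg (𝒪-pow (q ^ (suc a ℕ.+ cnt)) 𝒪-z)
      𝒪-factor (suc (suc _)) = 𝒪-0

    reciprocal-approximation : ∀ J → O J (reciprocal - product 0 J)
    reciprocal-approximation J = O-cong rearrange (O-scale (𝒪-* (_ , refl) (𝒪-jetProd 0 J 0))
        (ι₀-low J (partial J P.- c carlitzProd) (λ k k<J → F.trans (F.+-congˡ (F.-‿cong (carlitzProd-at J k k<J))) (F.-‿inverseʳ _))))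
      where
      rearrange : reciprocal * product 0 J * ι₀ (partial J P.- c carlitzProd) ≈ reciprocal - product 0 J
      rearrange = begin
        reciprocal * product 0 J * ι₀ (partial J P.- c carlitzProd)          ≈⟨ *-congˡ (trans (ι₀-+ _ _) (+-congˡ (ι₀-neg _))) ⟩
        reciprocal * product 0 J * (ι₀ (partial J) - ι carlitzProd)
          ≈⟨ solve 4 (λ g p f c → g :* p :* (f :- c) := g :* (f :* p) :- (c :* g) :* p) refl reciprocal (product 0 J) (ι₀ (partial J)) (ι carlitzProd) ⟩
        reciprocal * (ι₀ (partial J) * product 0 J) - (ι carlitzProd * reciprocal) * product 0 J
          ≈⟨ +-cong (trans (*-congˡ (ι₀-partial J)) (*-identityʳ _)) (-‿cong (trans (*-congʳ carlitzProd*reciprocal) (*-identityˡ _))) ⟩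
        reciprocal - product 0 J ∎

    𝒟-factor : ∀ k i → i < q ^ k → D i (1# - θ * pow z (q ^ k)) ≈ factorJet θ (pow z (q ^ k)) i
    𝒟-factor k i lt = trans (D-+ i _ _) (trans (+-cong (𝒟-1 i) (trans (𝒟-neg _ i) (-‿cong (trans (𝒟-* θ s i) (trans (agree-⊛ (q ^ k) (λ _ _ → refl) (𝒟-q^ k z) i lt)
        (trans (⊛-comm (𝒟 θ) (const s) i) (const-⊛ s (𝒟 θ) i))))))) (evaluate i))
      where
      s = pow z (q ^ k)
      evaluate : ∀ i → const 1# i - s * D i θ ≈ factorJet θ s i
      evaluate zero          = +-congˡ (-‿cong (trans (*-congˡ (D0 θ)) (*-comm s θ)))
      evaluate (suc zero)    = trans (+-identityˡ _) (-‿cong (trans (*-congˡ (𝒟-θ 1)) (*-identityʳ s)))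
      evaluate (suc (suc n)) = trans (+-congˡ (-‿cong (*-congˡ (𝒟-θ (suc (suc n)))))) (solve 1 (λ s → :0 :- s :* :0 := :0) refl s)

    -- The powers z^{q^k} with k > m are q^m-th powers, hence constants in orders below q^m. In
    -- these factors only θ moves, to θ + ε, which is the formal jet.
    𝒟-product : ∀ m J i → i < q ^ m → D i (product m J) ≈ jetProd θ z m J i
    𝒟-product m zero    i lt = 𝒟-1 i
    𝒟-product m (suc J) i lt = trans (D-cong i _ _ (⊛-zero (jetProd θ z m J) _)) (trans (𝒟-* (product m J) _ i)
      (agree-⊛ (q ^ m) (𝒟-product m J) (λ j j<N → 𝒟-factor (suc m ℕ.+ J) j (ℕₚ.<-≤-trans j<N (q^-mono (ℕₚ.≤-trans (ℕₚ.m≤m+n m J) (ℕₚ.n≤1+n _))))) i lt))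

    module Period (m : ℕ) where
      u : Carrier
      u = product 0 m

      -- In the first m factors z^{q^j} need not be constant in all orders below q^m, so their true
      -- jet A differs from the formal jet B. Exchanging A for B in the jet of `reciprocal` gives
      -- X₀, the limit of γ in orders below q^m; A and B have entries in 𝔽_q[z, θ].
      A B X₀ : Ser
      A  = 𝒟 u
      B  = jetProd θ z 0 m
      X₀ = 𝒟 (ι₀ (partial m)) ⊛ (B ⊛ 𝒟 reciprocal)

      A-inverse : A ⊛ 𝒟 (ι₀ (partial m)) ≋ const 1#
      A-inverse i = trans (sym (𝒟-* u _ i)) (trans (D-cong i _ _ (trans (*-comm u _) (ι₀-partial m))) (𝒟-1 i))

      X₀-approximation : ∀ J i → i < q ^ m → O J (X₀ i - γ (m ℕ.+ J) i)
      X₀-approximation J i lt = O-cong rearranged (O-⊛ (q ^ m) (λ j _ → O⇒𝒪 (D-O j 0 _ (𝒪⇒O (_ , refl))))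
          (O-⊛ (q ^ m) (λ j _ → 𝒪-jetProd 0 m j) (λ j j<N → O-cong (same j j<N) (D-O j J _ (O-≤ (ℕₚ.m≤n+m J m) (reciprocal-approximation (m ℕ.+ J)))))) i lt)
        where
        tail = jetProd θ z m J
        W = 𝒟 reciprocal S.- (A ⊛ tail)
        same : ∀ j → j < q ^ m → D j (reciprocal - product 0 (m ℕ.+ J)) ≈ W j
        same j j<N = trans (D-+ j _ _) (+-congˡ (trans (𝒟-neg _ j) (-‿cong (trans (D-cong j _ _ (trans (jetProd-+ θ z 0 m J 0) (⊛-zero B tail)))
          (trans (𝒟-* u (product m J) j) (agree-⊛ (q ^ m) (λ _ _ → refl) (𝒟-product m J) j j<N))))))
        rearranged : (𝒟 (ι₀ (partial m)) ⊛ (B ⊛ W)) i ≈ X₀ i - γ (m ℕ.+ J) i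
        rearranged = trans (SS.solve 5 (λ U B G A T → U SS.:* (B SS.:* (G SS.:- A SS.:* T)) SS.:= U SS.:* (B SS.:* G) SS.:- (A SS.:* U) SS.:* (B SS.:* T))
            S.refl (𝒟 (ι₀ (partial m))) B (𝒟 reciprocal) A tail i)
          (+-congˡ (-‿cong (trans (⊛-cong A-inverse (λ _ → refl) i) (trans (one-⊛ (B ⊛ tail) i) (sym (jetProd-+ θ z 0 m J i))))))

      A⊛X₀ : A ⊛ X₀ ≋ B ⊛ 𝒟 reciprocal
      A⊛X₀ = S.trans (S.sym (S.*-assoc A _ _)) (S.trans (S.*-congʳ A-inverse) (one-⊛ _))

      u≉0 : ¬ (u ≈ 0#)
      u≉0 = E.unit≉0 (trans (*-comm u _) (ι₀-partial m))

      DLaurent-u : DLaurent u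
      DLaurent-u = DLaurent-product m
        where
        DLaurent-product : ∀ J → DLaurent (product 0 J)
        DLaurent-product zero    = DLaurent-1
        DLaurent-product (suc J) i = Laurent-cong (D-cong i _ _ (sym (⊛-zero (jetProd θ z 0 J) _)))
          (DLaurent-* (DLaurent-product J) (DLaurent-+ DLaurent-1 (DLaurent-neg (DLaurent-* DLaurent-θ (DLaurent-pow (q ^ suc J) DLaurent-z)))) i)

      Laurent-B : ∀ i → Laurent (B i)
      Laurent-B i = RelationLemmas.T-jetProd₀ laurentRel q {τ′ = 0#} {ζ′ = 0#} Laurent-θ Laurent-z 0 m i

    module Root (λθ : Carrier) (λθ-root : pow λθ (q ∸ 1) ≈ - θ) where
      open RootIndependence λθ λθ-root

      -- The geometric sum (q^m - 1)/(q - 1).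
      exponent : ℕ → ℕ
      exponent zero    = 0
      exponent (suc m) = suc (q ℕ.* exponent m)

      λθ-q^ : ∀ m → λθ ≈ pow λθ (q ^ m) * pow (- z) (exponent m)
      λθ-q^ zero    = sym (trans (*-identityʳ _) (*-identityˡ _))
      λθ-q^ (suc m) = begin
        λθ                                                                ≈⟨ trans (sym λθ-frobenius) (*-comm _ _) ⟩
        pow λθ q * - z                                                    ≈⟨ *-congʳ (pow-cong q (λθ-q^ m)) ⟩
        pow (pow λθ (q ^ m) * pow (- z) (exponent m)) q * - z             ≈⟨ *-congʳ (pow-distrib _ _ q) ⟩
        pow (pow λθ (q ^ m)) q * pow (pow (- z) (exponent m)) q * - z     ≈⟨ *-congʳ (*-cong (sym (pow-* λθ q (q ^ m))) (sym (pow-* (- z) q (exponent m)))) ⟩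
        pow λθ (q ^ suc m) * pow (- z) (q ℕ.* exponent m) * - z           ≈⟨ *-assoc _ _ _ ⟩
        pow λθ (q ^ suc m) * pow (- z) (exponent (suc m))                 ∎

      -z≉0 : ¬ (- z ≈ 0#)
      -z≉0 e = z≉0 (trans (solve 1 (λ z → z := :- (:- z)) refl z) (trans (-‿cong e) (Algebra.Properties.Ring.-0#≈0# ring)))

      module PeriodRelation (m : ℕ) where
        open Period m

        r s : Ser
        r = 𝒟 (pow (- z) (exponent m) * θ)
        s = B ⊛ r

        Laurent-s : ∀ i → Laurent (s i)
        Laurent-s i = RelationLemmas.T-⊛ laurentRel {0} {0} {f′ = λ _ → 0#} {g′ = λ _ → 0#} i Laurent-B
          (DLaurent-* (DLaurent-pow (exponent m) (DLaurent-neg DLaurent-z)) DLaurent-θ)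

        s₀≉0 : ¬ (s 0 ≈ 0#)
        s₀≉0 e = *-nonzero u≉0 (*-nonzero (pow-nonzero (exponent m) -z≉0) θ≉0) (trans (*-congˡ (sym (D0 _))) (trans (sym (⊛-zero B r)) e))

        -- The period times `reciprocal` is λ θ = λ^{q^m} (-z)^e θ, and λ^{q^m} is constant in
        -- orders below q^m. Multiplying the jets by B brings in A and X₀.
        relation : ∀ i → i < q ^ m → (𝒟 (carlitzPeriod λθ) ⊛ (A ⊛ X₀)) i ≈ pow λθ (q ^ m) * s i
        relation i lt = begin
          (𝒟 (carlitzPeriod λθ) ⊛ (A ⊛ X₀)) i             ≈⟨ ⊛-cong (λ _ → refl) A⊛X₀ i ⟩
          (𝒟 (carlitzPeriod λθ) ⊛ (B ⊛ 𝒟 reciprocal)) i   ≈⟨ SS.solve 3 (λ p b g → p SS.:* (b SS.:* g) SS.:= b SS.:* (p SS.:* g)) S.refl (𝒟 (carlitzPeriod λθ)) B (𝒟 reciprocal) i ⟩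
          (B ⊛ (𝒟 (carlitzPeriod λθ) ⊛ 𝒟 reciprocal)) i   ≈⟨ ⊛-cong (λ _ → refl) (λ j → trans (sym (𝒟-* _ _ j)) (D-cong j _ _ cancelled)) i ⟩
          (B ⊛ 𝒟 (Λ * κθ)) i                              ≈⟨ agree-⊛ (q ^ m) (λ _ _ → refl) (λ j j<N → trans (𝒟-* Λ κθ j) (agree-⊛ (q ^ m) (𝒟-q^ m λθ) (λ _ _ → refl) j j<N)) i lt ⟩
          (B ⊛ (const Λ ⊛ r)) i                           ≈⟨ SS.solve 3 (λ b l r → b SS.:* (l SS.:* r) SS.:= l SS.:* (b SS.:* r)) S.refl B (const Λ) r i ⟩
          (const Λ ⊛ s) i                                 ≈⟨ const-⊛ Λ s i ⟩
          Λ * s i                                         ∎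
          where
          Λ = pow λθ (q ^ m)
          κθ = pow (- z) (exponent m) * θ
          cancelled : carlitzPeriod λθ * reciprocal ≈ Λ * κθ
          cancelled = begin
            λθ * ι (θ∞ *∞ carlitzProd) * reciprocal    ≈⟨ *-congʳ (*-congˡ (ι-* θ∞ carlitzProd)) ⟩
            λθ * (θ * ι carlitzProd) * reciprocal      ≈⟨ solve 4 (λ l t c g → l :* (t :* c) :* g := l :* t :* (c :* g)) refl λθ θ (ι carlitzProd) reciprocal ⟩
            λθ * θ * (ι carlitzProd * reciprocal)      ≈⟨ trans (*-congˡ carlitzProd*reciprocal) (*-identityʳ _) ⟩
            λθ * θ                                     ≈⟨ *-congʳ (λθ-q^ m) ⟩
            Λ * pow (- z) (exponent m) * θ             ≈⟨ *-assoc _ _ _ ⟩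
            Λ * κθ                                     ∎

      -- Transfer of algebraic relations from the period to the values.

      module Relations (n : ℕ) where
        -- The choice m = n suffices, because only orders below n < q^n occur.
        open Period n
        open PeriodRelation n

        -- Integrality of both sides is part of the relation, since congruences modulo z^b can only
        -- be multiplied among integral elements.
        congruence : ℕ → FilteredRelation L L (a ⊔ ℓ)
        congruence b = record
          { T = λ _ x y → 𝒪 x × 𝒪 y × O b (x - y)
          ; T-cong = λ p p′ (h , h′ , o) → 𝒪-cong p h , 𝒪-cong p′ h′ , O-cong (+-cong p (-‿cong p′)) o
          ; T-mono = λ _ h → h
          ; T-0 = 𝒪-0 , 𝒪-0 , O-cong (sym (-‿inverseʳ 0#)) O-0
          ; T-1 = 𝒪-1 , 𝒪-1 , O-cong (sym (-‿inverseʳ 1#)) O-0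
          ; T-+ = λ {_} {x} {x′} {y} {y′} (h , k , o) (h′ , k′ , o′) → 𝒪-+ h h′ , 𝒪-+ k k′ ,
              O-cong (solve 4 (λ x x′ y y′ → (x :- y) :+ (x′ :- y′) := (x :+ x′) :- (y :+ y′)) refl x x′ y y′) (O-+ o o′)
          ; T-* = λ {_} {_} {x} {x′} {y} {y′} (h , k , o) (h′ , k′ , o′) → 𝒪-* h h′ , 𝒪-* k k′ ,
              O-cong (solve 4 (λ x x′ y y′ → x′ :* (x :- y) :+ y :* (x′ :- y′) := x :* x′ :- y :* y′) refl x x′ y y′) (O-+ (O-scale h′ o) (O-scale k o′))
          ; T-neg = λ {_} {x} {y} (h , k , o) → 𝒪-neg h , 𝒪-neg k , O-cong (solve 2 (λ x y → :- (x :- y) := (:- x) :- (:- y)) refl x y) (O-neg o) }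

        i<n⇒i<q^n : ∀ {i} → i < n → i < q ^ n
        i<n⇒i<q^n i<n = ℕₚ.<-trans i<n (n<q^n n)

        𝒪-X₀ : ∀ i → 𝒪 (X₀ i)
        𝒪-X₀ i = O⇒𝒪 (O-⊛ (suc i) (λ j _ → O⇒𝒪 (D-O j 0 _ (𝒪⇒O (_ , refl)))) (O-⊛ (suc i) (λ j _ → 𝒪-jetProd 0 n j) (λ j _ → D-O j 0 _ (𝒪⇒O (_ , refl)))) i ℕₚ.≤-refl)

        X₀-congruent : ∀ b J → n ℕ.+ b ≤ J → ∀ i → i < n → FilteredRelation.T (congruence b) 0 (X₀ i) (γ J i)
        X₀-congruent b J le i i<n = 𝒪-X₀ i , 𝒪-jetProd 0 J i , O-≤ (ℕₚ.m+n≤o⇒m≤o∸n b (ℕₚ.≤-trans (ℕₚ.≤-reflexive (ℕₚ.+-comm b n)) le))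
          (≡.subst (λ J′ → O (J ∸ n) (X₀ i - γ J′ i)) (ℕₚ.m+[n∸m]≡n (ℕₚ.≤-trans (ℕₚ.m≤m+n n b) le)) (X₀-approximation (J ∸ n) i (i<n⇒i<q^n i<n)))

        polyFun-congruent : ∀ {f} → PolyFun n f → ∃ λ k → ∀ b {x y} → (∀ i → i < n → FilteredRelation.T (congruence b) 0 (x i) (y i)) →
          FilteredRelation.T (congruence b) 0 (pow z k * f x) (pow z k * f y)
        polyFun-congruent {f} (d , rep c Lc agree) = k , λ b {x} {y} h → FilteredRelation.T-cong (congruence b) {0} (values x) (values y)
            (RelationLemmas.T-ev₀ (congruence b) n d (λ μ → 𝒪-c′ μ , 𝒪-c′ μ , O-cong (sym (-‿inverseʳ _)) O-0) h)
          where
          cleared = clear-denominators n d c Lc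
          k = proj₁ cleared
          c′ : Mon n d → Carrier
          c′ μ = pow z k * c μ
          𝒪-c′ : ∀ μ → 𝒪 (c′ μ)
          𝒪-c′ μ = Bounded⇒𝒪 (proj₂ (proj₂ cleared) μ)
          values : ∀ x → ev n d c′ x ≈ pow z k * f x
          values x = trans (ev-scale n d (pow z k) c x) (*-congˡ (sym (agree x)))

        -- By continuity, a polynomial that vanishes at the limit X₀ tends to 0 along γ, and
        -- independence of the values applies.
        polyFun-X₀ : ∀ {f} → PolyFun n f → f X₀ ≈ 0# → ∀ x → f x ≈ 0#
        polyFun-X₀ {f} h e = polyFun-vanishes (ValueStep.value-independence E.valued n) h (Null-cong (λ J → cancel J) (Null-θ^ k null))
          where
          k = proj₁ (polyFun-congruent h)
          null : Null (λ J → pow z k * f (γ J))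
          null b = n ℕ.+ b , λ J le → O-cong (solve 2 (λ x y → (:- (x :- y)) :+ x := y) refl _ _)
            (O-+ (O-neg (proj₂ (proj₂ (proj₂ (polyFun-congruent h) b (X₀-congruent b J le))))) (O-cong (sym (trans (*-congˡ e) (zeroʳ _))) O-0))
          cancel : ∀ J → pow θ k * (pow z k * f (γ J)) ≈ f (γ J)
          cancel J = trans (sym (*-assoc _ _ _)) (trans (*-congʳ (θ^z^ k)) (*-identityˡ _))

        Split : (Carrier → Fun) → Set (a ⊔ ℓ)
        Split Φ = ∃ λ M → ∃ λ (G : ℕ → Fun) → (∀ k → PolyFun n (G k)) × (∀ k → M ≤ k → ∀ x → G k x ≈ 0#) × (∀ l x → Φ l x ≈ sumTo M (λ k → pow l k * G k x))

        split-X₀ : ∀ {Φ} → PolyFun (suc n) Φ → Split (λ l x → Φ (l ◃ x))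
        split-X₀ (d , rep c Lc agree) = let (M , G , hG , high , law) = go d c Lc in M , G , hG , high , λ l x → trans (agree (l ◃ x)) (law l x)
          where
          go : ∀ d (c : Mon (suc n) d → Carrier) → (∀ μ → Laurent (c μ)) → Split (λ l x → ev (suc n) d c (l ◃ x))
          go zero c Lc = 1 , G , (λ { zero → PolyFun-const (Lc tt) ; (suc _) → PolyFun-const Laurent-0 }) , (λ { zero () _ ; (suc _) _ _ → refl }) ,
              λ l x → solve 1 (λ c → c := :0 :+ :1 :* c) refl (c tt)
            where
            G : ℕ → Fun
            G zero    _ = c tt
            G (suc _) _ = 0#
          go (suc d) c Lc = let (M , G , hG , high , law) = go d (c ∘ inj₂) (Lc ∘ inj₂) in
            suc M , cons G , (λ { zero → suc d , rep (c ∘ inj₁) (Lc ∘ inj₁) (λ _ → refl) ; (suc k) → hG k }) , (λ { zero () ; (suc k) (s≤s le) → high k le }) ,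
              λ l x → trans (+-cong (sym (*-identityˡ _)) (trans (*-congˡ (law l x)) (trans (Σ-*ˡ M l _) (Σ-cong′ M (λ k → solve 3 (λ l p g → l :* (p :* g) := p :* l :* g) refl l (pow l k) (G k x))))))
                (sym (Σ-head M (λ k → pow l k * cons G k x)))
            where
            cons : (ℕ → Fun) → ℕ → Fun
            cons G zero    = ev n (suc d) (c ∘ inj₁)
            cons G (suc k) = G k

        common-denominator : ∀ (f : ℕ → Fun) → (∀ k → PolyFun n (f k)) → ∀ N → ∃ λ w → ∀ k → k < N → 𝒪 (pow z w * f k X₀)
        common-denominator f h N = w , λ k k<N → 𝒪-cong (raise k (w-max k k<N)) (𝒪-* (𝒪-pow (w ∸ e k) 𝒪-z)
            (proj₁ (proj₂ (polyFun-congruent (h k)) 0 {X₀} {X₀} (λ i _ → 𝒪-X₀ i , 𝒪-X₀ i , O-cong (sym (-‿inverseʳ _)) O-0))))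
          where
          e : ℕ → ℕ
          e k = proj₁ (polyFun-congruent (h k))
          w = proj₁ (maxBelow N e)
          w-max = proj₂ (maxBelow N e)
          raise : ∀ k → e k ≤ w → pow z (w ∸ e k) * (pow z (e k) * f k X₀) ≈ pow z w * f k X₀
          raise k le = trans (sym (*-assoc _ _ _)) (*-congʳ (trans (sym (pow-+ z (w ∸ e k) (e k))) (reflexive (≡.cong (pow z) (ℕₚ.m∸n+n≡m le)))))

        combination-vanishes : ∀ (H : ℕ → Fun) → (∀ k → PolyFun n (H k)) → sumTo (q ∸ 1) (λ k → pow λθ k * H k X₀) ≈ 0# → ∀ k → k < q ∸ 1 → H k X₀ ≈ 0#
        combination-vanishes H h e k k<Q = let (w , 𝒪-H) = common-denominator H h (q ∸ 1) in
          no-zero-divisors (pow z w) (H k X₀) (powers-independent (q ∸ 1) ℕₚ.≤-refl (λ k → pow z w * H k X₀) 𝒪-H (scaled w) k k<Q) (pow-nonzero w z≉0)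
          where
          scaled : ∀ w → sumTo (q ∸ 1) (λ k → pow λθ k * (pow z w * H k X₀)) ≈ 0#
          scaled w = trans (trans (Σ-cong′ (q ∸ 1) (λ k → solve 3 (λ l s h → l :* (s :* h) := s :* (l :* h)) refl (pow λθ k) (pow z w) (H k X₀))) (sym (Σ-*ˡ (q ∸ 1) _ _)))
            (trans (*-congˡ e) (zeroʳ _))

        -- Exponents of λ are reduced modulo q - 1 by λ^{q-1} = -θ; the coefficients stay
        -- polynomials over 𝔽_q[z, θ].
        fold : ℕ → (ℕ → Fun) → ℕ → Fun
        fold M G k x = sumTo M (λ N → pow (- θ) N * G (N ℕ.* (q ∸ 1) ℕ.+ k) x)

        fold-law : ∀ M (G : ℕ → Fun) → (∀ k → M ≤ k → ∀ x → G k x ≈ 0#) → ∀ x → sumTo M (λ k → pow λθ k * G k x) ≈ sumTo (q ∸ 1) (λ k → pow λθ k * fold M G k x)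
        fold-law M G high x = begin
          sumTo M (λ k → pow λθ k * G k x)                                                     ≈⟨ Σ-extend _ M≤MQ (λ k le → trans (*-congˡ (high k le x)) (zeroʳ _)) ⟨
          sumTo (M ℕ.* Q) (λ k → pow λθ k * G k x)                                             ≈⟨ Σ-block M Q _ ⟩
          sumTo M (λ N → sumTo Q (λ k → pow λθ (N ℕ.* Q ℕ.+ k) * G (N ℕ.* Q ℕ.+ k) x))         ≈⟨ Σ-swap M Q _ ⟩
          sumTo Q (λ k → sumTo M (λ N → pow λθ (N ℕ.* Q ℕ.+ k) * G (N ℕ.* Q ℕ.+ k) x))         ≈⟨ Σ-cong′ Q (λ k → trans (Σ-cong′ M (λ N → reduce N k)) (sym (Σ-*ˡ M _ _))) ⟩
          sumTo Q (λ k → pow λθ k * fold M G k x)                                              ∎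
          where
          Q = q ∸ 1
          M≤MQ : M ≤ M ℕ.* Q
          M≤MQ = ℕₚ.≤-trans (ℕₚ.≤-reflexive (≡.sym (ℕₚ.*-identityʳ M))) (ℕₚ.*-monoʳ-≤ M (ℕₚ.∸-monoˡ-≤ 1 2≤q))
          reduce : ∀ N k → pow λθ (N ℕ.* Q ℕ.+ k) * G (N ℕ.* Q ℕ.+ k) x ≈ pow λθ k * (pow (- θ) N * G (N ℕ.* Q ℕ.+ k) x)
          reduce N k = trans (*-congʳ (trans (pow-+ λθ (N ℕ.* Q) k) (*-congʳ (trans (pow-* λθ N Q) (pow-cong N λθ-root)))))
            (solve 3 (λ t l g → t :* l :* g := l :* (t :* g)) refl (pow (- θ) N) (pow λθ k) (G (N ℕ.* Q ℕ.+ k) x))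

        PolyFun-fold : ∀ M (G : ℕ → Fun) → (∀ k → PolyFun n (G k)) → ∀ k → PolyFun n (fold M G k)
        PolyFun-fold M G h k = PolyFun-Σ M (λ N _ → PolyFun-scale (Laurent-pow N (Laurent-neg Laurent-θ)) (h (N ℕ.* (q ∸ 1) ℕ.+ k)))

        -- After folding, Φ is a combination of 1, λ, ..., λ^{q-2} whose coefficients are
        -- polynomials in the other variables. At X₀ each coefficient vanishes by linear
        -- independence over 𝔽_q((z)), and then it vanishes identically.
        vanishing-at-period : ∀ {Φ} → PolyFun (suc n) Φ → Φ (λθ ◃ X₀) ≈ 0# → ∀ x → Φ (λθ ◃ x) ≈ 0#
        vanishing-at-period {Φ} h e x = conclude (split-X₀ h)
          where
          conclude : Split (λ l x → Φ (l ◃ x)) → Φ (λθ ◃ x) ≈ 0#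
          conclude (M , G , hG , high , law) = trans (law λθ x) (trans (fold-law M G high x) (Σ-zero (q ∸ 1) (λ k k<Q → trans (*-congˡ (polyFun-X₀ (PolyFun-fold M G hG k)
            (combination-vanishes (fold M G) (PolyFun-fold M G hG) (trans (sym (fold-law M G high X₀)) (trans (sym (law λθ X₀)) e)) k k<Q) x)) (zeroʳ _))))

        V : (ℕ → Carrier) → Ser
        V y = A ⊛ (y ∘ suc)

        -- Abstracts the identity `relation`: besides y = `λθ ◃ X₀` with the jet of the period there
        -- are further pairs, which carry the final specialisation.
        Admissible : (ℕ → Carrier) → (ℕ → Carrier) → Set ℓ
        Admissible y Y = ∀ i → i < n → (Y ⊛ V y) i ≈ pow (y 0) (q ^ n) * s i

        PolyFun-V : ∀ i → i < n → PolyFun (suc n) (λ y → V y i)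
        PolyFun-V i i<n = PolyFun-cong (λ y → reflexive (≡.sym (⊛-def A (y ∘ suc) i)))
          (PolyFun-Σ (suc i) (λ j _ → PolyFun-scale (DLaurent-u j) (PolyFun-var (s≤s (ℕₚ.≤-<-trans (ℕₚ.m∸n≤m i j) i<n)))))

        PolyFun-neg : ∀ {f} → PolyFun (suc n) f → PolyFun (suc n) (λ y → - f y)
        PolyFun-neg {f} h = PolyFun-cong (λ y → solve 1 (λ f → :- :1 :* f := :- f) refl (f y)) (PolyFun-scale (Laurent-neg Laurent-1) h)

        -- the convolution equations solve for the entries of Y after multiplication by a power of V₀
        entries : ∀ k → k ≤ n → ∃ λ e → ∃ λ (Z : ℕ → Fun) → ∀ i → i < k → PolyFun (suc n) (Z i) × (∀ y Y → Admissible y Y → Y i * pow (V y 0) e ≈ Z i y)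
        entries zero    _   = 0 , (λ _ _ → 0#) , λ _ ()
        entries (suc k) k<n = suc e , Z′ , all
          where
          previous = entries k (ℕₚ.<⇒≤ k<n)
          e = proj₁ previous
          Z = proj₁ (proj₂ previous)
          hZ = proj₂ (proj₂ previous)
          new : Fun
          new y = pow (V y 0) e * (s k * pow (y 0) (q ^ n)) - sumTo k (λ j → Z j y * V y (k ∸ j))
          Z′ : ℕ → Fun
          Z′ i with i ℕ.≟ k
          ... | yes _ = new
          ... | no _  = λ y → Z i y * V y 0
          PolyFun-V₀ : PolyFun (suc n) (λ y → V y 0)
          PolyFun-V₀ = PolyFun-V 0 (ℕₚ.≤-<-trans z≤n k<n)
          PolyFun-new : PolyFun (suc n) new
          PolyFun-new = PolyFun-+ (PolyFun-* (PolyFun-pow e PolyFun-V₀) (PolyFun-scale (Laurent-s k) (PolyFun-pow (q ^ n) (PolyFun-var (s≤s z≤n)))))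
            (PolyFun-neg (PolyFun-Σ k (λ j j<k → PolyFun-* (proj₁ (hZ j j<k)) (PolyFun-V (k ∸ j) (ℕₚ.≤-<-trans (ℕₚ.m∸n≤m k j) k<n)))))
          new-law : ∀ y Y → Admissible y Y → Y k * pow (V y 0) (suc e) ≈ new y
          new-law y Y adm = begin
            Y k * (p * V y 0)                                               ≈⟨ solve 4 (λ Y p v r → Y :* (p :* v) := p :* (r :+ Y :* v) :- r :* p) refl (Y k) p (V y 0) rest ⟩
            p * (rest + Y k * V y 0) - rest * p                             ≈⟨ +-cong (*-congˡ (trans convolution (trans (adm k k<n) (*-comm _ _)))) (-‿cong cleared) ⟩
            new y                                                           ∎
            where
            p = pow (V y 0) e
            rest = sumTo k (λ j → Y j * V y (k ∸ j))
            convolution : rest + Y k * V y 0 ≈ (Y ⊛ V y) k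
            convolution = trans (+-congˡ (*-congˡ (reflexive (≡.cong (V y) (≡.sym (ℕₚ.n∸n≡0 k)))))) (reflexive (≡.sym (⊛-def Y (V y) k)))
            cleared : rest * p ≈ sumTo k (λ j → Z j y * V y (k ∸ j))
            cleared = trans (Σ-*ʳ k _ _) (Σ-cong k (λ j j<k → trans (solve 3 (λ Y v p → Y :* v :* p := Y :* p :* v) refl (Y j) (V y (k ∸ j)) p) (*-congʳ (proj₂ (hZ j j<k) y Y adm))))
          all : ∀ i → i < suc k → PolyFun (suc n) (Z′ i) × (∀ y Y → Admissible y Y → Y i * pow (V y 0) (suc e) ≈ Z′ i y)
          all i i≤k with i ℕ.≟ k
          ... | yes ≡.refl = PolyFun-new , new-law
          ... | no i≢k     = PolyFun-* (proj₁ (hZ i i<k)) PolyFun-V₀ , λ y Y adm → trans (sym (*-assoc _ _ _)) (*-congʳ (proj₂ (hZ i i<k) y Y adm))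
            where i<k = ℕₚ.≤∧≢⇒< (ℕₚ.≤-pred i≤k) i≢k

        -- A function of the jet of the period, rewritten rationally in λ and X₀. The rewriting is
        -- demanded for every admissible pair, so that an identity in y can be brought back to other
        -- jets Y.
        record Quotient (h : Fun) : Set (a ⊔ ℓ) where
          constructor quotient
          field
            numerator denominator′ : Fun
            numerator-polynomial   : PolyFun (suc n) numerator
            denominator-polynomial : PolyFun (suc n) denominator′
            denominator≉0          : ∀ y → ¬ (V y 0 ≈ 0#) → ¬ (denominator′ y ≈ 0#)
            equation               : ∀ y Y → Admissible y Y → h Y * denominator′ y ≈ numerator y

        Quotient-+ : ∀ {h h′} → Quotient h → Quotient h′ → Quotient (λ Y → h Y + h′ Y)
        Quotient-+ (quotient N Δ pN pΔ ne e) (quotient N′ Δ′ pN′ pΔ′ ne′ e′) = quotient (λ y → N y * Δ′ y + N′ y * Δ y) (λ y → Δ y * Δ′ y)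
          (PolyFun-+ (PolyFun-* pN pΔ′) (PolyFun-* pN′ pΔ)) (PolyFun-* pΔ pΔ′) (λ y V≉0 → *-nonzero (ne y V≉0) (ne′ y V≉0))
          (λ y Y adm → trans (solve 4 (λ h h′ d d′ → (h :+ h′) :* (d :* d′) := h :* d :* d′ :+ h′ :* d′ :* d) refl _ _ (Δ y) (Δ′ y)) (+-cong (*-congʳ (e y Y adm)) (*-congʳ (e′ y Y adm))))

        Quotient-* : ∀ {h h′} → Quotient h → Quotient h′ → Quotient (λ Y → h Y * h′ Y)
        Quotient-* (quotient N Δ pN pΔ ne e) (quotient N′ Δ′ pN′ pΔ′ ne′ e′) = quotient (λ y → N y * N′ y) (λ y → Δ y * Δ′ y)
          (PolyFun-* pN pN′) (PolyFun-* pΔ pΔ′) (λ y V≉0 → *-nonzero (ne y V≉0) (ne′ y V≉0))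
          (λ y Y adm → trans (solve 4 (λ h h′ d d′ → (h :* h′) :* (d :* d′) := (h :* d) :* (h′ :* d′)) refl _ _ (Δ y) (Δ′ y)) (*-cong (e y Y adm) (e′ y Y adm)))

        Quotient-const : ∀ {u δ} → ¬ (δ ≈ 0#) → Laurent δ → Laurent (u * δ) → Quotient (λ _ → u)
        Quotient-const δ≉0 Lδ Luδ = quotient _ _ (PolyFun-const Luδ) (PolyFun-const Lδ) (λ _ _ → δ≉0) (λ _ _ _ → refl)

        Quotient-entry : ∀ i → i < n → Quotient (λ Y → Y i)
        Quotient-entry i i<n = let (e , Z , h) = entries n ℕₚ.≤-refl in
          quotient (Z i) (λ y → pow (V y 0) e) (proj₁ (h i i<n)) (PolyFun-pow e (PolyFun-V 0 (ℕₚ.≤-<-trans z≤n i<n))) (λ y V≉0 → pow-nonzero e V≉0) (proj₂ (h i i<n))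

        mutual
          Quotient-eval : ∀ k → k ≤ n → (P : Poly k) → Quotient (evalPoly k P)
          Quotient-eval zero    _   p  = let (δ , δ≉0 , Lδ , Lpδ) = denominator p in Quotient-const δ≉0 Lδ Lpδ
          Quotient-eval (suc k) k<n ps = let (quotient N Δ pN pΔ ne e) = Quotient-horner k k<n ps in
            quotient N Δ pN pΔ ne (λ y Y adm → trans (*-congʳ (evalPoly-horner k ps Y)) (e y Y adm))

          Quotient-horner : ∀ k → k < n → (ps : List (Poly k)) → Quotient (λ Y → horner (coefficients k ps Y) (Y k))
          Quotient-horner k k<n []       = Quotient-const 1≉0 Laurent-1 (Laurent-cong (sym (zeroˡ 1#)) Laurent-0)
          Quotient-horner k k<n (p ∷ ps) = Quotient-+ (Quotient-eval k (ℕₚ.<⇒≤ k<n) p) (Quotient-* (Quotient-entry k k<n) (Quotient-horner k k<n ps))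

        -- The numerator of P vanishes at (λ, X₀), hence at (λ, x) for all x. Every Y with nonzero
        -- entries forms an admissible pair with some x, found by dividing by the jet A Y, so P
        -- vanishes at Y too.
        relation⇒IsZeroPoly : ∀ (P : Poly n) → evalPoly n P (𝒟 (carlitzPeriod λθ)) ≈ 0# → IsZeroPoly n P
        relation⇒IsZeroPoly P e = vanishing⇒IsZeroPoly n P everywhere
          where
          open Quotient (Quotient-eval n ℕₚ.≤-refl P)
          numerator-zero : ∀ x → numerator (λθ ◃ x) ≈ 0#
          numerator-zero = vanishing-at-period numerator-polynomial (trans (sym (equation (λθ ◃ X₀) (𝒟 (carlitzPeriod λθ)) (λ i i<n → relation i (i<n⇒i<q^n i<n))))
            (trans (*-congʳ e) (zeroˡ _)))
          everywhere : ∀ Y → (∀ i → ¬ (Y i ≈ 0#)) → evalPoly n P Y ≈ 0#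
          everywhere Y Y≉0 = no-zero-divisors (denominator′ (λθ ◃ x)) _ (trans (*-comm _ _) (trans (equation (λθ ◃ x) Y (λ i i<n → solved′ i (ℕₚ.m<n⇒m<1+n i<n))) (numerator-zero x)))
              (denominator≉0 (λθ ◃ x) V≉0)
            where
            target : ℕ → Carrier
            target i = pow λθ (q ^ n) * s i
            -- Order `suc n` makes the constant term available even for n = 0; it shows that the
            -- denominators do not vanish.
            solution = solve-⊛ (A ⊛ Y) (λ e → *-nonzero A₀≉0 (Y≉0 0) (trans (sym (⊛-zero A Y)) e)) (suc n) target
              where
              A₀≉0 : ¬ (A 0 ≈ 0#)
              A₀≉0 e = u≉0 (trans (sym (D0 u)) e)
            x = proj₁ solution
            solved′ : ∀ i → i < suc n → (Y ⊛ (A ⊛ x)) i ≈ target i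
            solved′ i lt = trans (SS.solve 3 (λ Y A x → Y SS.:* (A SS.:* x) SS.:= (A SS.:* Y) SS.:* x) S.refl Y A x i) (proj₂ solution i lt)
            V≉0 : ¬ (V (λθ ◃ x) 0 ≈ 0#)
            V≉0 e = *-nonzero (pow-nonzero (q ^ n) λθ≉0) s₀≉0 (trans (sym (solved′ 0 (s≤s z≤n))) (trans (⊛-zero Y (A ⊛ x)) (trans (*-congˡ e) (zeroʳ _))))

theorem2p1 : ∀ {q : ℕ} (𝔽 : FiniteField q) {a ℓ} (L : CommutativeRing a ℓ)
    → RingOps.IsFieldRing L
    → (ι : Laurent.K∞ 𝔽 → CommutativeRing.Carrier L)
    → Laurent.Over.IsRingEmbedding 𝔽 L ι
    → (λθ : CommutativeRing.Carrier L)
    → CommutativeRing._≈_ L (RingOps.pow L λθ (q ∸ 1))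
        (CommutativeRing.-_ L (ι (Laurent.θ∞ 𝔽)))
    → (D : ℕ → CommutativeRing.Carrier L → CommutativeRing.Carrier L)
    → Laurent.Over.IsHigherDerivation 𝔽 L ι D
    → Laurent.Over.Extends 𝔽 L ι D
    → Laurent.Over.AlgebraicallyIndependent 𝔽 L ι
        (λ n → D n (Laurent.Over.carlitzPeriod 𝔽 L ι λθ))
theorem2p1 𝔽 L isField ι embedding λθ λθ-root D derivation extends n P P≢0 e =
  P≢0 (Setting.HyperDerivations.Root.Relations.relation⇒IsZeroPoly 𝔽 L isField ι embedding D derivation extends λθ λθ-root n P e)
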